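{- Let $K$ be a field of characteristic zero, let $\phi(z)=\sum_{k\ge 0}\phi_k z^k\in K[[z]]$ with $\phi_0=1$, let $F(z)=\sum_{i\ge 0} f_i z^i\in K[[z]]$, and let $L_{bin},L_{div}:K[y]\to K[y]$ be the binomial and divided power 1-cocycle operators determined by $F$ (see context). For $L\in\{L_{bin},L_{div}\}$, extended to $K[y][[x]]$ coefficientwise in $x$, consider the functional equation $$G(x,y)=x\,L(\phi(G(x,y)))$$ for $G\in K[y][[x]]$ (with zero constant term in $x$). It is uniquely solved by $$G(x,y)=\sum_{C\in\mathcal C} f_C\,\phi_C\,x^{|C|}\,\frac{L_{bin}(y^{t_1(C)-1})}{(t_1(C)-1)!}\quad\text{if } L=L_{bin},$$ and by $$G(x,y)=\sum_{C\in\mathcal C_{top}} f_C\,\phi_C\,x^{|C|}\,L_{div}(y^{t_1(C)-1})\quad\text{if } L=L_{div},$$ where $\mathcal C$ is the set of (nonempty) connected chord diagrams, $\mathcal C_{top}\subseteq\mathcal C$ is the set of connected top-cycle-free chord diagrams, $\phi_C=\prod_{c\in C}\phi_{\mathrm{val}(c)}$, and, for a diagram $C$ with exactly $k$ terminal chords, $$f_C=f_0^{|C|-k}\,f_{t_2(C)-t_1(C)}\,f_{t_3(C)-t_2(C)}\cdots f_{t_k(C)-t_{k-1}(C)}.$$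
   Context: Operators: $L_{bin}(y^n)=\int_0^y F\left(\frac{d}{dt}\right)t^n\,dt=n!\sum_{i=1}^{n+1} f_{n+1-i}\frac{y^i}{i!}$ and $L_{div}(y^n)=yF\left(\frac{\delta}{\delta y}\right)y^n=\sum_{i=1}^{n+1} f_{n+1-i}y^i$, where $\frac{\delta}{\delta y}y^n=y^{n-1}$ for $n>0$ and $\frac{\delta}{\delta y}1=0$. (These are the forms of the Hochschild 1-cocycle operators of the binomial coalgebra $\Delta(y^n)=\sum_k\binom nk y^k\otimes y^{n-k}$ and the divided power coalgebra $\Delta(y^n)=\sum_k y^k\otimes y^{n-k}$ on $K[y]$.) Chord diagrams: a chord diagram (diagram) $C$ of size $|C|=n$ is a perfect matching of $\{1,\dots,2n\}$. Its chords are ordered pairs $(a,b)$ with $a<b$; $a$ is the source, $b$ the sink. The chord containing $1$ is the root. A subset $D\subseteq C$ is a subdiagram, viewed as a diagram by order-preserving relabelling of its endpoints. For chords $c_1=(a_1,b_1)$, $c_2=(a_2,b_2)$ with $a_1<a_2$: they cross if $a_2<b_1<b_2$, and then $c_2$ is a right neighbor of $c_1$ and $c_1$ is a left neighbor of $c_2$. The intersection graph has the chords as vertices and crossings as edges; $C$ is connected if this graph is connected, and connected components of a diagram are those of its intersection graph. A diagram is indecomposable if it is not the concatenation of two smaller nonempty diagrams; indecomposable components are the maximal nonempty indecomposable subdiagrams (into whose concatenation the diagram factors). The standard order on chords is the order of their sources. Intersection order on a connected diagram: starting with label 1, label the root with the next available label, remove it, and then label the resulting connected components recursively, one after another, in the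 standard order of their roots. Terminal chords: a chord is terminal if it has no right neighbors. $t_j(C)$ denotes the index (label) in the intersection order of the $j$th terminal chord of $C$ in that order. Top cycles: for $m\ge 3$, the top cycle diagram of size $m$ is $T_m=\{(2i-1,2i+2):1\le i\le m-1\}\cup\{(2,2m-1)\}$. A diagram is top-cycle-free if it has no subdiagram equal (after relabelling) to some $T_m$, $m\ge3$. Valency: $\mathrm{val}(c)=k+\ell$, where $k$ is the number of left neighbors of $c$ which do not cross any chord $c'>c$ (standard order), and $\ell$ is the number of indecomposable components immediately following the source of $c$ after the left neighbors of $c$ have been removed, i.e. in the diagram obtained by deleting all left neighbors of $c$, $\ell$ is the maximal number of consecutive intervals of endpoints, beginning directly after the source of $c$, each of which is the set of endpoints of an indecomposable subdiagram. -}

module Defs where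

open import Algebra.Apartness.Bundles using (HeytingField; HeytingCommutativeRing)
open import Algebra.Bundles using (CommutativeRing; Semiring)
import Algebra.Definitions.RawSemiring as RawSemiringDefs
open import Data.List.Base
  using (List; []; _∷_; _++_; length; map; concatMap; foldr; filter; zip; zipWith;
         take; drop; head; upTo; applyUpTo; cartesianProduct)
open import Data.List.Extrema.Nat using (max)
open import Data.List.Membership.Propositional using (_∈_)
open import Data.List.Properties using (≡-dec; length-applyUpTo; length-map)
open import Data.List.Relation.Unary.All as All using (All; all?)
open import Data.List.Relation.Unary.Any as Any using (Any; any?; here; there)
open import Data.Maybe.Base using (fromMaybe)
open import Data.Nat.Base
  using (ℕ; zero; suc; _+_; _*_; _∸_; _≤_; _<_; s≤s; NonZero; _!)
open import Data.Nat.GeneralisedArithmetic using (iterate)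
open import Data.Nat.Properties using (_≟_; _≤?_; _<?_; allUpTo?; _!≢0)
open import Data.Product.Base using (_×_; _,_; proj₁; proj₂)
open import Data.Product.Properties using () renaming (≡-dec to ×-≡-dec)
open import Data.Sum.Base using (_⊎_; inj₁; inj₂)
open import Data.Unit.Base using (⊤; tt)
open import Level using (Level; _⊔_)
open import Relation.Binary.Construct.Closure.ReflexiveTransitive
  using (Star; ε; _◅_; _◅◅_)
open import Relation.Binary.Definitions using (DecidableEquality)
open import Relation.Binary.PropositionalEquality
  using (_≡_; _≢_; refl; sym; trans; cong)
open import Relation.Nullary.Decidable
  using (Dec; yes; no; ¬?; map′; _×-dec_; _⊎-dec_; _→-dec_)
open import Relation.Nullary.Negation using (¬_)

------------------------------------------------------------------------
-- Diagrams

Chord : Set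
Chord = ℕ × ℕ

source sink : Chord → ℕ
source = proj₁
sink   = proj₂

-- A finite set of chords, listed in the standard order (increasing
-- sources).  Endpoints are arbitrary distinct naturals, so a subdiagram
-- keeps the endpoints it has in the ambient diagram; every notion below
-- except `relabel` and `topCycle` depends only on their relative order.

Diagram : Set
Diagram = List Chord

endpoints : Diagram → List ℕ
endpoints = concatMap (λ c → source c ∷ sink c ∷ [])

-- All subsets of the set of chords, each in the standard order.

subdiagrams : Diagram → List Diagram
subdiagrams []      = [] ∷ []
subdiagrams (c ∷ C) = map (c ∷_) (subdiagrams C) ++ subdiagrams C

points : ℕ → List ℕ
points n = applyUpTo suc (2 * n)

-- All pairs a < b of points in lexicographic order.

possibleChords : ℕ → Diagram
possibleChords n =
  filter (λ c → source c <? sink c) (cartesianProduct (points n) (points n))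

PerfectMatching : ℕ → Diagram → Set
PerfectMatching n C =
  All (λ p → length (filter (p ≟_) (endpoints C)) ≡ 1) (points n)

perfectMatching? : ∀ n C → Dec (PerfectMatching n C)
perfectMatching? n C = all? (λ _ → _ ≟ _) (points n)

-- The chord diagrams of size n, each exactly once: the perfect matchings
-- of {1,…,2n} among the sets of pairs a < b.

chordDiagrams : ℕ → List Diagram
chordDiagrams n = filter (perfectMatching? n) (subdiagrams (possibleChords n))

------------------------------------------------------------------------
-- Crossings and connectedness

-- c ⌒ d : c and d cross, c is a left neighbour of d and d is a right
-- neighbour of c.

infix 4 _⌒_ _⌒?_

_⌒_ : Chord → Chord → Set
c ⌒ d = source c < source d × source d < sink c × sink c < sink d

_⌒?_ : ∀ c d → Dec (c ⌒ d)
c ⌒? d = source c <? source d ×-dec source d <? sink c ×-dec sink c <? sink d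

Cross : Chord → Chord → Set
Cross c d = c ⌒ d ⊎ d ⌒ c

cross? : ∀ c d → Dec (Cross c d)
cross? c d = c ⌒? d ⊎-dec d ⌒? c

_≟ᶜ_ : DecidableEquality Chord
_≟ᶜ_ = ×-≡-dec _≟_ _≟_

infix 4 _∈?_ _∈ᶜ?_

_∈?_ : ∀ (p : ℕ) ps → Dec (p ∈ ps)
p ∈? ps = any? (p ≟_) ps

_∈ᶜ?_ : ∀ (c : Chord) C → Dec (c ∈ C)
c ∈ᶜ? C = any? (c ≟ᶜ_) C

-- The edges of the intersection graph of C, and the paths in it.

Edge : Diagram → Chord → Chord → Set
Edge C c d = c ∈ C × d ∈ C × Cross c d

Path : Diagram → Chord → Chord → Set
Path C = Star (Edge C)

Connected : Diagram → Set
Connected C = C ≢ [] × (∀ {c} → c ∈ C → ∀ {d} → d ∈ C → Path C c d)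

-- Deciding `Path` as in the Floyd–Warshall algorithm: `Via C vs c d` says
-- that some path from c to d has all its inner vertices in vs.

private
  Via : Diagram → List Chord → Chord → Chord → Set
  Via C []       c d = c ≡ d ⊎ Edge C c d
  Via C (v ∷ vs) c d = Via C vs c d ⊎ (Via C vs c v × Via C vs v d)

  via? : ∀ C vs c d → Dec (Via C vs c d)
  via? C []       c d =
    c ≟ᶜ d ⊎-dec (c ∈ᶜ? C ×-dec d ∈ᶜ? C ×-dec cross? c d)
  via? C (v ∷ vs) c d =
    via? C vs c d ⊎-dec (via? C vs c v ×-dec via? C vs v d)

  via⇒path : ∀ C vs {c d} → Via C vs c d → Path C c d
  via⇒path C []       (inj₁ refl)    = ε
  via⇒path C []       (inj₂ e)       = e ◅ ε
  via⇒path C (v ∷ vs) (inj₁ p)       = via⇒path C vs p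
  via⇒path C (v ∷ vs) (inj₂ (p , q)) = via⇒path C vs p ◅◅ via⇒path C vs q

  via-base : ∀ C vs {c d} → c ≡ d ⊎ Edge C c d → Via C vs c d
  via-base C []       p = p
  via-base C (v ∷ vs) p = inj₁ (via-base C vs p)

  via-trans : ∀ C vs {c e d} → e ∈ vs → Via C vs c e → Via C vs e d → Via C vs c d
  via-trans C (v ∷ vs) (here refl) (inj₁ p)       (inj₁ q)       = inj₂ (p , q)
  via-trans C (v ∷ vs) (here refl) (inj₁ p)       (inj₂ (_ , q)) = inj₂ (p , q)
  via-trans C (v ∷ vs) (here refl) (inj₂ (p , _)) (inj₁ q)       = inj₂ (p , q)
  via-trans C (v ∷ vs) (here refl) (inj₂ (p , _)) (inj₂ (_ , q)) = inj₂ (p , q)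
  via-trans C (v ∷ vs) (there e∈)  (inj₁ p)       (inj₁ q)       =
    inj₁ (via-trans C vs e∈ p q)
  via-trans C (v ∷ vs) (there e∈)  (inj₁ p)       (inj₂ (q , r)) =
    inj₂ (via-trans C vs e∈ p q , r)
  via-trans C (v ∷ vs) (there e∈)  (inj₂ (p , q)) (inj₁ r)       =
    inj₂ (p , via-trans C vs e∈ q r)
  via-trans C (v ∷ vs) (there e∈)  (inj₂ (p , _)) (inj₂ (_ , r)) = inj₂ (p , r)

  path⇒via : ∀ C {c d} → Path C c d → Via C C c d
  path⇒via C ε                      = via-base C C (inj₁ refl)
  path⇒via C (e@(_ , d∈C , _) ◅ es) =
    via-trans C C d∈C (via-base C C (inj₂ e)) (path⇒via C es)

path? : ∀ C c d → Dec (Path C c d)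
path? C c d = map′ (via⇒path C C) (path⇒via C) (via? C C c d)

connected? : ∀ C → Dec (Connected C)
connected? C =
  ¬? (≡-dec _≟ᶜ_ C [])
  ×-dec map′ (λ ps c∈ d∈ → All.lookup (All.lookup ps c∈) d∈)
             (λ ps → All.tabulate (λ c∈ → All.tabulate (λ d∈ → ps c∈ d∈)))
             (all? (λ c → all? (path? C c) C) C)

------------------------------------------------------------------------
-- Intersection order and terminal chords

component : Diagram → Chord → Diagram
component C r = filter (path? C r) C

-- r has the least source in its connected component.

IsRoot : Diagram → Chord → Set
IsRoot C r = All (λ c → Path C r c → source r ≤ source c) C

isRoot? : ∀ C r → Dec (IsRoot C r)
isRoot? C r = all? (λ c → path? C r c →-dec source r ≤? source c) C

-- The connected components, in the standard order of their roots.

components : Diagram → List Diagram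
components C = map (component C) (filter (isRoot? C) C)

-- The chords of a connected diagram listed by increasing label.  The
-- first argument bounds the number of chords and only serves termination.

label : ℕ → Diagram → List Chord
label zero    _       = []
label (suc k) []      = []
label (suc k) (r ∷ C) = r ∷ concatMap (label k) (components C)

intersectionOrder : Diagram → List Chord
intersectionOrder C = label (length C) C

Terminal : Diagram → Chord → Set
Terminal C c = All (λ d → ¬ c ⌒ d) C

terminal? : ∀ C c → Dec (Terminal C c)
terminal? C c = all? (λ d → ¬? (c ⌒? d)) C

-- The list t₁(C), t₂(C), …, t_k(C).

terminalLabels : Diagram → List ℕ
terminalLabels C =
  map proj₁ (filter (λ lc → terminal? C (proj₂ lc))
                    (zip (applyUpTo suc (length C)) (intersectionOrder C)))

-- The default 0 is never used: a nonempty diagram has a terminal chord.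

t₁ : Diagram → ℕ
t₁ C = fromMaybe 0 (head (terminalLabels C))

------------------------------------------------------------------------
-- Top cycles

relabel : Diagram → Diagram
relabel D = map (λ c → rank (source c) , rank (sink c)) D
  where
  rank : ℕ → ℕ
  rank p = length (filter (_≤? p) (endpoints D))

-- T_m for m ≥ 3 in the standard order: the chord (1 , 4), then
-- (2 , 2m - 1), then the chords (2i - 1 , 2i + 2) for i = j + 2,
-- 2 ≤ i ≤ m - 1.

topCycle : ℕ → Diagram
topCycle m =
  (1 , 4) ∷ (2 , 2 * m ∸ 1) ∷ applyUpTo (λ j → 2 * j + 3 , 2 * j + 6) (m ∸ 2)

TopCycleFree : Diagram → Set
TopCycleFree C =
  All (λ D → ∀ m → 3 ≤ m → relabel D ≢ topCycle m) (subdiagrams C)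

private
  length-topCycle : ∀ {m} → 3 ≤ m → length (topCycle m) ≡ m
  length-topCycle {suc (suc m)} (s≤s (s≤s _)) =
    cong (λ k → suc (suc k)) (length-applyUpTo _ m)

  size : ∀ D {m} → 3 ≤ m → relabel D ≡ topCycle m → length D ≡ m
  size D 3≤m eq =
    trans (sym (length-map _ D)) (trans (cong length eq) (length-topCycle 3≤m))

  notTopCycle? : ∀ D → Dec (∀ m → 3 ≤ m → relabel D ≢ topCycle m)
  notTopCycle? D =
    map′ (λ h m 3≤m eq → lemma h m 3≤m eq (size D 3≤m eq)) (λ h → h (length D))
         (3 ≤? length D →-dec ¬? (≡-dec _≟ᶜ_ (relabel D) (topCycle (length D))))
    where
    lemma : (3 ≤ length D → relabel D ≢ topCycle (length D)) →
            ∀ m → 3 ≤ m → relabel D ≡ topCycle m → ¬ (length D ≡ m)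
    lemma h _ 3≤m eq refl = h 3≤m eq

topCycleFree? : ∀ C → Dec (TopCycleFree C)
topCycleFree? C = all? notTopCycle? (subdiagrams C)

------------------------------------------------------------------------
-- Valency

Before : Diagram → Diagram → Set
Before D E = All (λ p → All (p <_) (endpoints E)) (endpoints D)

before? : ∀ D E → Dec (Before D E)
before? D E = all? (λ p → all? (p <?_) (endpoints E)) (endpoints D)

-- E is nonempty and is not the concatenation of two nonempty diagrams.

Indecomposable : Diagram → Set
Indecomposable E =
  E ≢ [] × (∀ {i} → i < length E → 0 < i → ¬ Before (take i E) (drop i E))

indecomposable? : ∀ E → Dec (Indecomposable E)
indecomposable? E =
  ¬? (≡-dec _≟ᶜ_ E [])
  ×-dec allUpTo? (λ i → 0 <? i →-dec ¬? (before? (take i E) (drop i E))) (length E)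

-- For a subdiagram E of D: the endpoints of E form an interval among the
-- endpoints of D, and this interval begins directly after the point a.

Follows : Diagram → ℕ → Diagram → Set
Follows D a E =
  All (a <_) (endpoints E) ×
  All (λ p → a < p → Any (p ≤_) (endpoints E) → p ∈ endpoints E) (endpoints D)

follows? : ∀ D a E → Dec (Follows D a E)
follows? D a E =
  all? (a <?_) (endpoints E)
  ×-dec all? (λ p → a <? p →-dec any? (p ≤?_) (endpoints E) →-dec p ∈? endpoints E)
             (endpoints D)

-- Directly after the point a there are j consecutive intervals, each the
-- set of endpoints of an indecomposable subdiagram of D.

Blocks : Diagram → ℕ → ℕ → Set
Blocks D a zero    = ⊤
Blocks D a (suc j) =
  Any (λ E → Indecomposable E × Follows D a E × Blocks D (max 0 (endpoints E)) j)
      (subdiagrams D)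

blocks? : ∀ D a j → Dec (Blocks D a j)
blocks? D a zero    = yes tt
blocks? D a (suc j) =
  any? (λ E → indecomposable? E ×-dec follows? D a E
              ×-dec blocks? D (max 0 (endpoints E)) j)
       (subdiagrams D)

-- The greatest such j; the blocks are disjoint, so j ≤ |D|.

maxBlocks : Diagram → ℕ → ℕ
maxBlocks D a = max 0 (filter (blocks? D a) (upTo (suc (length D))))

valency : Diagram → Chord → ℕ
valency C c = length (filter crossesNoLater? (filter (_⌒? c) C))
            + maxBlocks (filter (λ d → ¬? (d ⌒? c)) C) (source c)
  where
  crossesNoLater? : ∀ d → Dec (All (λ e → source c < source e → ¬ Cross d e) C)
  crossesNoLater? d =
    all? (λ e → source c <? source e →-dec ¬? (cross? d e)) C

------------------------------------------------------------------------
-- The functional equation over a field of characteristic zero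

module _ {c ℓ₁ ℓ₂ : Level} (K : HeytingField c ℓ₁ ℓ₂) where

  private
    ring : CommutativeRing c ℓ₁
    ring = HeytingCommutativeRing.commutativeRing
             (HeytingField.heytingCommutativeRing K)

  open HeytingField K using (Carrier; _#_; 0#; 1#)
  open RawSemiringDefs (Semiring.rawSemiring (CommutativeRing.semiring ring))
    using () renaming (_×_ to _·_)

  CharacteristicZero : Set ℓ₂
  CharacteristicZero = ∀ n → .{{NonZero n}} → (n · 1#) # 0#

module ChordExpansion {c ℓ₁ ℓ₂ : Level}
  (K : HeytingField c ℓ₁ ℓ₂) (char0 : CharacteristicZero K) where

  private
    ring : CommutativeRing c ℓ₁
    ring = HeytingCommutativeRing.commutativeRing
             (HeytingField.heytingCommutativeRing K)

  open HeytingField K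
    using (Carrier; _≈_; 0#; 1#; #⇒invertible)
    renaming (_+_ to _+ᴷ_; _*_ to _*ᴷ_)
  open RawSemiringDefs (Semiring.rawSemiring (CommutativeRing.semiring ring))
    using (_^_) renaming (_×_ to _·_)

  -- 1/n in K.

  1/_ : (n : ℕ) → .{{NonZero n}} → Carrier
  1/ n = proj₁ (#⇒invertible (char0 n))

  -- K[y]: lists of coefficients, lowest degree first, up to trailing zeros.

  Poly : Set c
  Poly = List Carrier

  coeff : Poly → ℕ → Carrier
  coeff []      _       = 0#
  coeff (a ∷ _) zero    = a
  coeff (_ ∷ p) (suc n) = coeff p n

  infix 4 _≈ₚ_ _≈ₛ_
  infixl 6 _+ₚ_
  infixl 7 _*ₚ_ _*ₛ_
  infixr 8 _•_

  _≈ₚ_ : Poly → Poly → Set ℓ₁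
  p ≈ₚ q = ∀ n → coeff p n ≈ coeff q n

  _+ₚ_ : Poly → Poly → Poly
  []      +ₚ q       = q
  (a ∷ p) +ₚ []      = a ∷ p
  (a ∷ p) +ₚ (b ∷ q) = a +ᴷ b ∷ p +ₚ q

  _•_ : Carrier → Poly → Poly
  a • p = map (a *ᴷ_) p

  _*ₚ_ : Poly → Poly → Poly
  []      *ₚ q = []
  (a ∷ p) *ₚ q = a • q +ₚ (0# ∷ p *ₚ q)

  sumₚ : List Poly → Poly
  sumₚ = foldr _+ₚ_ []

  y^_ : ℕ → Poly
  y^ zero  = 1# ∷ []
  y^ suc n = 0# ∷ y^ n

  -- K[y][[x]]: the sequence of coefficients of the powers of x.

  Series : Set c
  Series = ℕ → Poly

  _≈ₛ_ : Series → Series → Set ℓ₁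
  G ≈ₛ H = ∀ n → G n ≈ₚ H n

  1ₛ : Series
  1ₛ zero    = y^ 0
  1ₛ (suc _) = []

  x·_ : Series → Series
  (x· G) zero    = []
  (x· G) (suc n) = G n

  _*ₛ_ : Series → Series → Series
  (G *ₛ H) n = sumₚ (map (λ k → G k *ₚ H (n ∸ k)) (upTo (suc n)))

  _^ₛ_ : Series → ℕ → Series
  G ^ₛ zero  = 1ₛ
  G ^ₛ suc k = G *ₛ (G ^ₛ k)

  -- φ(G) for G with zero constant term in x: G ^ₛ k is divisible by x^k,
  -- so only the terms with k ≤ n contribute to the coefficient of x^n.

  _⟨_⟩ : (ℕ → Carrier) → Series → Series
  (φ ⟨ G ⟩) n = sumₚ (map (λ k → φ k • (G ^ₛ k) n) (upTo (suc n)))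

  -- F(D) p for an operator D on K[y] that lowers the degree.

  applySeries : (ℕ → Carrier) → (Poly → Poly) → Poly → Poly
  applySeries f D p = sumₚ (map (λ k → f k • iterate D p k) (upTo (length p)))

  d/dy ∫₀ʸ δ/δy y·_ : Poly → Poly

  d/dy []      = []
  d/dy (_ ∷ p) = zipWith _·_ (applyUpTo suc (length p)) p

  ∫₀ʸ p = 0# ∷ zipWith (λ i a → (1/ suc i) *ᴷ a) (upTo (length p)) p

  δ/δy []      = []
  δ/δy (_ ∷ p) = p

  y· p = 0# ∷ p

  Lbin Ldiv : (ℕ → Carrier) → Poly → Poly
  Lbin f p = ∫₀ʸ (applySeries f d/dy p)
  Ldiv f p = y· (applySeries f δ/δy p)

  -- G = x L(φ(G)), with L applied to each coefficient in x.

  Solves : (Poly → Poly) → (ℕ → Carrier) → Series → Set ℓ₁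
  Solves L φ G = G 0 ≈ₚ [] × G ≈ₛ x· (λ n → L ((φ ⟨ G ⟩) n))

  UniqueSolution : (Poly → Poly) → (ℕ → Carrier) → Series → Set (c ⊔ ℓ₁)
  UniqueSolution L φ G =
    Solves L φ G × (∀ H → Solves L φ H → H ≈ₛ G)

  product : List Carrier → Carrier
  product = foldr _*ᴷ_ 1#

  φ-weight : (ℕ → Carrier) → Diagram → Carrier
  φ-weight φ C = product (map (λ d → φ (valency C d)) C)

  f-weight : (ℕ → Carrier) → Diagram → Carrier
  f-weight f C = f 0 ^ (length C ∸ length ts)
              *ᴷ product (map f (zipWith _∸_ (drop 1 ts) ts))
    where
    ts : List ℕ
    ts = terminalLabels C

  Gbin Gdiv : (f φ : ℕ → Carrier) → Series
  Gbin f φ n = sumₚ (map term (filter connected? (chordDiagrams n)))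
    where
    term : Diagram → Poly
    term C = (f-weight f C *ᴷ φ-weight φ C)
             • (1/ ((t₁ C ∸ 1) !)) {{(t₁ C ∸ 1) !≢0}}
             • Lbin f (y^ (t₁ C ∸ 1))
  Gdiv f φ n =
    sumₚ (map term (filter topCycleFree? (filter connected? (chordDiagrams n))))
    where
    term : Diagram → Poly
    term C = (f-weight f C *ᴷ φ-weight φ C) • Ldiv f (y^ (t₁ C ∸ 1))

module Submission where

-- Removing the root r = (1 , b) of a connected diagram C leaves components
-- D¹, D², …, Dᵐ, where Dʲ⁺¹, …, Dᵐ and b all lie in one gap of Dʲ.  So C is a
-- tree: the list of the pairs (Dʲ , gap).  Say that a gap is owned by the last
-- chord that is open there.  A chord of valency v owns v + 1 gaps, and r raises
-- by one the valencies of the owners of the m gaps used.  Weighting a chord of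
-- valency v with φ⁽ᵛ⁾(z) / v!, the sum of the weights over the gaps of Dʲ is
-- therefore the z-derivative of the weight of Dʲ.  As the terminal chords of C
-- are those of the Dʲ (if m > 0), the series U_t of the diagrams with t₁ = t
-- satisfy U_1 = x φ(z) and
--   U_{t+1} = k ∂U_t/∂z,   k = x f₀ φ(z) / (1 − ∂/∂z Σ_t f_t U_t).
-- Hence H = Σ_t U_t yᵗ⁻¹ / (t−1)! and G = L(H) satisfy ∂H/∂y = k ∂H/∂z and
-- ∂G/∂y = k (1 + ∂G/∂z).  Then x φ(z + G) solves the transport equation of H,
-- with the same value at y = 0, so H = x φ(z + G); now put z = 0.
--
-- C is top-cycle-free if and only if each Dʲ is and the gap used in it is
-- admissible: every chord open there owns this gap or a later one.  Attaching at
-- a gap makes the earlier ones inadmissible.  The same argument applies, with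
-- divided differences instead of derivatives: the loss of the earlier gaps is
-- the factor b(0) in δ(a b) = a δb + δa b(0).

-- For G(x,y) alone there is no recursion: attaching a root changes a valency in D¹, so the weight
-- of the new diagram is not a product of old weights. The variable z stores all values that a
-- factor can still take, and at z = 0 the factor of a chord of valency v is φ_v again. In the
-- binomial case φ(z + G) is Taylor's series in G. Its counterpart for divided differences is Σ ψ_n
-- G ε(G)^(n-1), where ψ_n is the n-th iterated divided difference of φ and ε(G) is G at z = 0; both
-- specialise to φ(G) at z = 0. As these sums are infinite, only truncations are formed. Their
-- defect in the transport equation telescopes to a single remainder of high order in x. Since k is
-- divisible by x, the transport equation fixes the y-derivative of each coefficient in x by the
-- preceding ones, so an induction on the degree in x compares H with the truncation. The
-- combinatorics needs two views of one tree: `slots` lists gaps from left to right, as the geometry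
-- does; `states` lists chords, as the weights do. `Σslots` reconciles them.

module Series where

  open import Algebra.Bundles using (CommutativeRing)
  open import Data.Nat.Base as ℕ using (ℕ; zero; suc; z≤n; s≤s)
  import Data.Nat.Properties as ℕₚ
  open import Data.Product.Base using (_,_)
  open import Level using (Level; _⊔_)
  open import Relation.Binary.PropositionalEquality as ≡ using (_≡_)
  import Relation.Binary.Reasoning.Setoid as SetoidReasoning

  -- Formal power series over a commutative ring.

  module PowerSeries {c ℓ : Level} (R : CommutativeRing c ℓ) where

    open CommutativeRing R
    open import Algebra.Solver.Ring.NaturalCoefficients.Default commutativeSemiring
      using (solve; _:+_; _:*_; _:=_)
    open SetoidReasoning setoid

    Ser : Set c
    Ser = ℕ → Carrier

    infix 4 _≋_
    -- A record rather than a function type, so that both series can be inferred from a proof of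
    -- equality.
    record _≋_ (a b : Ser) : Set ℓ where
      constructor mk≋
      field at : ∀ n → a n ≈ b n
    open _≋_ public

    tail : Ser → Ser
    tail a n = a (suc n)

    infixl 7 _⊛_
    infixl 6 _⊞_

    -- The Cauchy product in the form a b = a₀ b + z (tail a) b: the ring laws then follow by
    -- induction on the degree, without finite sums.
    _⊞_ _⊛_ : Ser → Ser → Ser
    (a ⊞ b) n = a n + b n
    (a ⊛ b) zero    = a 0 * b 0
    (a ⊛ b) (suc n) = a 0 * b (suc n) + (tail a ⊛ b) n

    const : Carrier → Ser
    const k zero    = k
    const k (suc _) = 0#

    𝟎 : Ser
    𝟎 _ = 0#

    -- A coefficient of a product depends only on coefficients of the factors up to the same degree.
    -- The inductions on the degree in x rest on this.
    ⊛-cong-≤ : ∀ {a a′ b b′} n → (∀ m → m ℕ.≤ n → a m ≈ a′ m) →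
               (∀ m → m ℕ.≤ n → b m ≈ b′ m) → (a ⊛ b) n ≈ (a′ ⊛ b′) n
    ⊛-cong-≤ zero    p q = *-cong (p 0 z≤n) (q 0 z≤n)
    ⊛-cong-≤ (suc n) p q =
      +-cong (*-cong (p 0 z≤n) (q (suc n) ℕₚ.≤-refl))
             (⊛-cong-≤ n (λ m m≤n → p (suc m) (s≤s m≤n))
                         (λ m m≤n → q m (ℕₚ.m≤n⇒m≤1+n m≤n)))

    ⊛-cong : ∀ {a a′ b b′} → a ≋ a′ → b ≋ b′ → a ⊛ b ≋ a′ ⊛ b′
    ⊛-cong p q = mk≋ λ n → ⊛-cong-≤ n (λ m _ → at p m) (λ m _ → at q m)

    ⊛-zeroˡ : ∀ b n → (𝟎 ⊛ b) n ≈ 0#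
    ⊛-zeroˡ b zero    = zeroˡ _
    ⊛-zeroˡ b (suc n) = trans (+-cong (zeroˡ _) (⊛-zeroˡ b n)) (+-identityˡ 0#)

    const-⊛ : ∀ k b n → (const k ⊛ b) n ≈ k * b n
    const-⊛ k b zero    = refl
    const-⊛ k b (suc n) = trans (+-congˡ (⊛-zeroˡ b n)) (+-identityʳ _)

    ⊛-distribʳ : ∀ b a a′ n → ((a ⊞ a′) ⊛ b) n ≈ (a ⊛ b) n + (a′ ⊛ b) n
    ⊛-distribʳ b a a′ zero    = distribʳ _ _ _
    ⊛-distribʳ b a a′ (suc n) = trans (+-cong (distribʳ _ _ _) (⊛-distribʳ b (tail a) (tail a′) n))
      (solve 4 (λ w x y z → (w :+ x) :+ (y :+ z) := (w :+ y) :+ (x :+ z)) refl _ _ _ _)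

    -- The definition peels off the left factor; this mirror image peels off the right one, and
    -- commutativity follows by comparing the two.
    ⊛-sucʳ : ∀ a b n → (a ⊛ b) (suc n) ≈ (a ⊛ tail b) n + a (suc n) * b 0
    ⊛-sucʳ a b zero    = refl
    ⊛-sucʳ a b (suc n) = trans (+-congˡ (⊛-sucʳ (tail a) b n)) (sym (+-assoc _ _ _))

    ⊛-comm : ∀ a b n → (a ⊛ b) n ≈ (b ⊛ a) n
    ⊛-comm a b zero    = *-comm _ _
    ⊛-comm a b (suc n) = begin
      (a ⊛ b) (suc n)                    ≈⟨ ⊛-sucʳ a b n ⟩
      (a ⊛ tail b) n + a (suc n) * b 0   ≈⟨ +-cong (⊛-comm a (tail b) n) (*-comm _ _) ⟩
      (tail b ⊛ a) n + b 0 * a (suc n)   ≈⟨ +-comm _ _ ⟩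
      (b ⊛ a) (suc n)                    ∎

    ⊛-scaleˡ : ∀ k a b n → ((λ m → k * a m) ⊛ b) n ≈ k * (a ⊛ b) n
    ⊛-scaleˡ k a b zero    = *-assoc _ _ _
    ⊛-scaleˡ k a b (suc n) =
      trans (+-cong (*-assoc _ _ _) (⊛-scaleˡ k (tail a) b n)) (sym (distribˡ _ _ _))

    ⊛-assoc : ∀ a b d n → ((a ⊛ b) ⊛ d) n ≈ (a ⊛ (b ⊛ d)) n
    ⊛-assoc a b d zero    = *-assoc _ _ _
    ⊛-assoc a b d (suc n) = begin
      a 0 * b 0 * d (suc n) + (((λ m → a 0 * tail b m) ⊞ (tail a ⊛ b)) ⊛ d) n
        ≈⟨ +-congˡ (⊛-distribʳ d (λ m → a 0 * tail b m) (tail a ⊛ b) n) ⟩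
      a 0 * b 0 * d (suc n) + (((λ m → a 0 * tail b m) ⊛ d) n + ((tail a ⊛ b) ⊛ d) n)
        ≈⟨ +-congˡ (+-cong (⊛-scaleˡ _ (tail b) d n) (⊛-assoc (tail a) b d n)) ⟩
      a 0 * b 0 * d (suc n) + (a 0 * (tail b ⊛ d) n + (tail a ⊛ (b ⊛ d)) n)
        ≈⟨ solve 5 (λ w x y z u → w :* x :* y :+ (w :* z :+ u) := w :* (x :* y :+ z) :+ u)
             refl _ _ _ _ _ ⟩
      a 0 * (b ⊛ d) (suc n) + (tail a ⊛ (b ⊛ d)) n ∎

    ⊛-distribˡ : ∀ b a a′ n → (b ⊛ (a ⊞ a′)) n ≈ (b ⊛ a) n + (b ⊛ a′) n
    ⊛-distribˡ b a a′ n = begin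
      (b ⊛ (a ⊞ a′)) n        ≈⟨ ⊛-comm b _ n ⟩
      ((a ⊞ a′) ⊛ b) n        ≈⟨ ⊛-distribʳ b a a′ n ⟩
      (a ⊛ b) n + (a′ ⊛ b) n  ≈⟨ +-cong (⊛-comm a b n) (⊛-comm a′ b n) ⟩
      (b ⊛ a) n + (b ⊛ a′) n  ∎

    ⊛-identityˡ : ∀ a n → (const 1# ⊛ a) n ≈ a n
    ⊛-identityˡ a n = trans (const-⊛ 1# a n) (*-identityˡ _)

    powerSeriesRing : CommutativeRing c ℓ
    powerSeriesRing = record
      { Carrier = Ser
      ; _≈_     = _≋_
      ; _+_     = _⊞_
      ; _*_     = _⊛_
      ; -_      = λ a n → - a n
      ; 0#      = 𝟎
      ; 1#      = const 1#
      ; isCommutativeRing = record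
        { isRing = record
          { +-isAbelianGroup = record
            { isGroup = record
              { isMonoid = record
                { isSemigroup = record
                  { isMagma = record
                    { isEquivalence = record
                      { refl  = mk≋ λ _ → refl
                      ; sym   = λ p → mk≋ λ n → sym (at p n)
                      ; trans = λ p q → mk≋ λ n → trans (at p n) (at q n)
                      }
                    ; ∙-cong = λ p q → mk≋ λ n → +-cong (at p n) (at q n)
                    }
                  ; assoc = λ a b d → mk≋ λ n → +-assoc (a n) (b n) (d n)
                  }
                ; identity = (λ a → mk≋ λ n → +-identityˡ (a n))
                           , (λ a → mk≋ λ n → +-identityʳ (a n))
                }
              ; inverse = (λ a → mk≋ λ n → -‿inverseˡ (a n))
                        , (λ a → mk≋ λ n → -‿inverseʳ (a n))
              ; ⁻¹-cong = λ p → mk≋ λ n → -‿cong (at p n)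
              }
            ; comm = λ a b → mk≋ λ n → +-comm (a n) (b n)
            }
          ; *-cong     = ⊛-cong
          ; *-assoc    = λ a b d → mk≋ (⊛-assoc a b d)
          ; *-identity = (λ a → mk≋ (⊛-identityˡ a))
                       , (λ a → mk≋ λ n → trans (⊛-comm a _ n) (⊛-identityˡ a n))
          ; distrib    = (λ b a a′ → mk≋ (⊛-distribˡ b a a′))
                       , (λ b a a′ → mk≋ (⊛-distribʳ b a a′))
          }
        ; *-comm = λ a b → mk≋ (⊛-comm a b)
        }
      }

  module Coefficientwise {c ℓ c′ ℓ′ : Level} (R : CommutativeRing c ℓ) (R′ : CommutativeRing c′ ℓ′) where

    private
      module R  = CommutativeRing R
      module R′ = CommutativeRing R′
      module P  = PowerSeries R
      module P′ = PowerSeries R′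

    -- Applied twice, this makes evaluation at z = 0 multiplicative below two layers of power
    -- series.
    homo-⊛ : (e : R.Carrier → R′.Carrier) → (∀ a b → e (a R.+ b) R′.≈ e a R′.+ e b) →
             (∀ a b → e (a R.* b) R′.≈ e a R′.* e b) → ∀ a b n →
             e ((a P.⊛ b) n) R′.≈ ((λ m → e (a m)) P′.⊛ (λ m → e (b m))) n
    homo-⊛ e e-+ e-* a b zero    = e-* _ _
    homo-⊛ e e-+ e-* a b (suc n) =
      R′.trans (e-+ _ _) (R′.+-cong (e-* _ _) (homo-⊛ e e-+ e-* (P.tail a) b n))

  -- Twisted derivations.

  data Kind : Set where
    binomial divided : Kind

  -- The coefficient that appears when zⁿ, n > 0, is lowered to zⁿ⁻¹: by differentiation or by the
  -- divided difference.
  multiplicity : Kind → ℕ → ℕ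
  multiplicity binomial n = n
  multiplicity divided  _ = 1

  module _ {c ℓ : Level} (R : CommutativeRing c ℓ) where

    open CommutativeRing R

    -- What the two kinds do not share. In the divided power case ε is evaluation at 0, so its
    -- values are free of the variable.
    Law : Kind → (D ε : Carrier → Carrier) → Set (c ⊔ ℓ)
    Law binomial D ε = ∀ a → ε a ≈ a
    Law divided  D ε = ∀ a → D (ε a) ≈ 0#

    -- An (ε , id)-derivation: an ordinary derivation in the binomial case, a
    -- divided difference (a − ε a) / z in the divided power case.

    record TwistedDerivation (κ : Kind) : Set (c ⊔ ℓ) where
      field
        D ε    : Carrier → Carrier
        D-cong : ∀ {a b} → a ≈ b → D a ≈ D b
        ε-cong : ∀ {a b} → a ≈ b → ε a ≈ ε b
        D-+    : ∀ a b → D (a + b) ≈ D a + D b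
        D-*    : ∀ a b → D (a * b) ≈ ε a * D b + D a * b
        ε-+    : ∀ a b → ε (a + b) ≈ ε a + ε b
        ε-*    : ∀ a b → ε (a * b) ≈ ε a * ε b
        ε-1    : ε 1# ≈ 1#
        ε-ε    : ∀ a → ε (ε a) ≈ ε a
        law    : Law κ D ε

  module TwistedProperties {c ℓ : Level} (R : CommutativeRing c ℓ) {κ : Kind}
                           (T : TwistedDerivation R κ) where

    open CommutativeRing R
    open TwistedDerivation T
    open import Algebra.Properties.Group +-group using (identityˡ-unique)
    open import Algebra.Properties.Semiring.Exp semiring using (_^_)
    open import Algebra.Properties.Semiring.Mult semiring
      using (_×_; ×-congʳ; ×-comm-*)
    open SetoidReasoning setoid

    D-0 : D 0# ≈ 0#
    D-0 = identityˡ-unique _ _ (trans (sym (D-+ 0# 0#)) (D-cong (+-identityˡ 0#)))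

    ε-0 : ε 0# ≈ 0#
    ε-0 = identityˡ-unique _ _ (trans (sym (ε-+ 0# 0#)) (ε-cong (+-identityˡ 0#)))

    D-1 : D 1# ≈ 0#
    D-1 = identityˡ-unique _ _ (begin
      D 1# + D 1#              ≈⟨ +-cong (*-identityˡ _) (*-identityʳ _) ⟨
      1# * D 1# + D 1# * 1#    ≈⟨ +-congʳ (*-congʳ ε-1) ⟨
      ε 1# * D 1# + D 1# * 1#  ≈⟨ D-* 1# 1# ⟨
      D (1# * 1#)              ≈⟨ D-cong (*-identityˡ 1#) ⟩
      D 1#                     ∎)

    -- Commutativity moves ε to the right factor. In a product over a list, ε then hits the factors
    -- after the differentiated one.
    D-*′ : ∀ a b → D (a * b) ≈ a * D b + D a * ε b
    D-*′ a b = begin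
      D (a * b)              ≈⟨ D-cong (*-comm a b) ⟩
      D (b * a)              ≈⟨ D-* b a ⟩
      ε b * D a + D b * a    ≈⟨ +-comm _ _ ⟩
      D b * a + ε b * D a    ≈⟨ +-cong (*-comm _ _) (*-comm _ _) ⟩
      a * D b + D a * ε b    ∎

    ε-^ : ∀ a n → ε (a ^ n) ≈ ε a ^ n
    ε-^ a zero    = ε-1
    ε-^ a (suc n) = trans (ε-* _ _) (*-congˡ (ε-^ a n))

    D-× : ∀ n a → D (n × a) ≈ n × D a
    D-× zero    a = D-0
    D-× (suc n) a = trans (D-+ _ _) (+-congˡ (D-× n a))

    -- Both equations are required to pull a factor out of D, because the Leibniz rule puts ε on it.
    record Constant (a : Carrier) : Set ℓ where
      field
        D-const : D a ≈ 0#
        ε-const : ε a ≈ a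

    open Constant public

    1-const : Constant 1#
    1-const = record { D-const = D-1 ; ε-const = ε-1 }

    *-const : ∀ {a b} → Constant a → Constant b → Constant (a * b)
    *-const {a} {b} p q = record
      { D-const = trans (D-* a b) (trans (+-cong (trans (*-congˡ (D-const q)) (zeroʳ _))
                                                 (trans (*-congʳ (D-const p)) (zeroˡ _)))
                                         (+-identityˡ 0#))
      ; ε-const = trans (ε-* a b) (*-cong (ε-const p) (ε-const q))
      }

    D-const-* : ∀ {a} → Constant a → ∀ b → D (a * b) ≈ a * D b
    D-const-* {a} k b = begin
      D (a * b)            ≈⟨ D-* a b ⟩
      ε a * D b + D a * b  ≈⟨ +-cong (*-congʳ (ε-const k)) (*-congʳ (D-const k)) ⟩
      a * D b + 0# * b     ≈⟨ +-congˡ (zeroˡ b) ⟩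
      a * D b + 0#         ≈⟨ +-identityʳ _ ⟩
      a * D b              ∎

    -- The power rule for g^(k+1) with all factors but one replaced by ε g. These are equal to g in
    -- the binomial case; in the divided power case D annihilates their product.
    D-^ : ∀ g k → D (g * ε g ^ k) ≈ multiplicity κ (suc k) × (ε g ^ k * D g)
    D-^ g = go κ law
      where
      w = ε g
      go : ∀ κ′ → Law R κ′ D ε → ∀ k →
           D (g * w ^ k) ≈ multiplicity κ′ (suc k) × (w ^ k * D g)
      go binomial id≈ zero    = begin
        D (g * 1#)    ≈⟨ D-cong (*-identityʳ g) ⟩
        D g           ≈⟨ *-identityˡ _ ⟨
        1# * D g      ≈⟨ +-identityʳ _ ⟨
        1 × (1# * D g) ∎
      go binomial id≈ (suc k) = begin
        D (g * (w * w ^ k))                      ≈⟨ D-* g _ ⟩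
        w * D (w * w ^ k) + D g * (w * w ^ k)    ≈⟨ +-cong (*-congˡ (D-cong (*-congʳ (id≈ g)))) (*-comm _ _) ⟩
        w * D (g * w ^ k) + w ^ suc k * D g      ≈⟨ +-congʳ (*-congˡ (go binomial id≈ k)) ⟩
        w * (suc k × (w ^ k * D g)) + w ^ suc k * D g
          ≈⟨ +-congʳ (×-comm-* (suc k) w (w ^ k * D g)) ⟩
        suc k × (w * (w ^ k * D g)) + w ^ suc k * D g
          ≈⟨ +-congʳ (×-congʳ (suc k) (sym (*-assoc _ _ _))) ⟩
        suc k × (w ^ suc k * D g) + w ^ suc k * D g  ≈⟨ +-comm _ _ ⟩
        suc (suc k) × (w ^ suc k * D g)          ∎
      go divided Dε≈0 k = begin
        D (g * w ^ k)                   ≈⟨ D-* g _ ⟩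
        w * D (w ^ k) + D g * w ^ k     ≈⟨ +-congʳ (*-congˡ (D-cong (ε-^ g k))) ⟨
        w * D (ε (g ^ k)) + D g * w ^ k ≈⟨ +-congʳ (*-congˡ (Dε≈0 _)) ⟩
        w * 0# + D g * w ^ k            ≈⟨ +-congʳ (zeroʳ w) ⟩
        0# + D g * w ^ k                ≈⟨ +-comm _ _ ⟩
        D g * w ^ k + 0#                ≈⟨ +-congʳ (*-comm _ _) ⟩
        1 × (w ^ k * D g)               ∎

  module _ {c ℓ : Level} (R : CommutativeRing c ℓ) where

    open CommutativeRing R
    open PowerSeries R
    open import Algebra.Properties.Semiring.Mult semiring
      using (_×_; ×-congʳ; ×-comm-*)
    open import Algebra.Properties.CommutativeMonoid.Mult +-commutativeMonoid
      using (×-distrib-+)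
    open import Algebra.Solver.Ring.NaturalCoefficients.Default commutativeSemiring
      using (solve; _:+_; _:*_; _:=_)
    open SetoidReasoning setoid

    -- Acts on coefficients and leaves the new variable alone, whereas `derivation` acts on the new
    -- variable.
    lift : ∀ {κ} → TwistedDerivation R κ → TwistedDerivation powerSeriesRing κ
    lift {κ} T = record
      { D      = λ a n → D (a n)
      ; ε      = λ a n → ε (a n)
      ; D-cong = λ p → mk≋ λ n → D-cong (at p n)
      ; ε-cong = λ p → mk≋ λ n → ε-cong (at p n)
      ; D-+    = λ a b → mk≋ λ n → D-+ (a n) (b n)
      ; D-*    = λ a b → mk≋ (lift-D-* a b)
      ; ε-+    = λ a b → mk≋ λ n → ε-+ (a n) (b n)
      ; ε-*    = λ a b → mk≋ (lift-ε-* a b)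
      ; ε-1    = mk≋ λ { zero → ε-1 ; (suc _) → ε-0 }
      ; ε-ε    = λ a → mk≋ λ n → ε-ε (a n)
      ; law    = lift-law κ law
      }
      where
      open TwistedDerivation T
      open TwistedProperties R T
      lift-D-* : ∀ a b n → D ((a ⊛ b) n) ≈
                 ((λ m → ε (a m)) ⊛ (λ m → D (b m))) n + ((λ m → D (a m)) ⊛ b) n
      lift-D-* a b zero    = D-* _ _
      lift-D-* a b (suc n) =
        trans (D-+ _ _) (trans (+-cong (D-* _ _) (lift-D-* (tail a) b n))
          (solve 4 (λ w x y z → (w :+ x) :+ (y :+ z) := (w :+ y) :+ (x :+ z)) refl _ _ _ _))
      lift-ε-* : ∀ a b n → ε ((a ⊛ b) n) ≈ ((λ m → ε (a m)) ⊛ (λ m → ε (b m))) n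
      lift-ε-* a b zero    = ε-* _ _
      lift-ε-* a b (suc n) = trans (ε-+ _ _) (+-cong (ε-* _ _) (lift-ε-* (tail a) b n))
      lift-law : ∀ κ → Law R κ D ε →
                 Law powerSeriesRing κ (λ a n → D (a n)) (λ a n → ε (a n))
      lift-law binomial p a = mk≋ λ n → p (a n)
      lift-law divided  p a = mk≋ λ n → p (a n)

    ∂ : Kind → Ser → Ser
    ∂ κ a n = multiplicity κ (suc n) × a (suc n)

    ∂-binomial-* : ∀ a b n →
      ∂ binomial (a ⊛ b) n ≈ (a ⊛ ∂ binomial b) n + (∂ binomial a ⊛ b) n
    ∂-binomial-* a b zero =
      solve 4 (λ a₀ b₁ a₁ b₀ → (a₀ :* b₁ :+ a₁ :* b₀) := a₀ :* b₁ :+ a₁ :* b₀) refl _ _ _ _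
      ⟨trans⟩ +-cong (*-congˡ (sym (+-identityʳ _))) (*-congʳ (sym (+-identityʳ _)))
      where
      _⟨trans⟩_ : ∀ {x y z} → x ≈ y → y ≈ z → x + 0# ≈ z
      p ⟨trans⟩ q = trans (+-identityʳ _) (trans p q)
    ∂-binomial-* a b (suc n) = begin
      suc (suc n) × (a 0 * b (suc (suc n)) + a′b (suc n))
        ≈⟨ ×-distrib-+ _ _ (suc (suc n)) ⟩
      suc (suc n) × (a 0 * b (suc (suc n))) + (a′b (suc n) + suc n × a′b (suc n))
        ≈⟨ +-cong (sym (×-comm-* (suc (suc n)) _ _)) (+-congˡ (∂-binomial-* (tail a) b n)) ⟩
      a₀b″ + (a 1 * b (suc n) + (tail (tail a) ⊛ b) n + (∂b + ∂a′))
        ≈⟨ solve 5 (λ x y z u v → x :+ ((y :+ z) :+ (u :+ v)) := (x :+ u) :+ (y :+ (z :+ v)))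
             refl _ _ _ _ _ ⟩
      (a₀b″ + ∂b) + (a 1 * b (suc n) + ((tail (tail a) ⊛ b) n + ∂a′))
        -- The tail of ∂ a is the sum of tail (tail a) and ∂ (tail a), since (n + 2) a = a + (n + 1)
        -- a for the coefficient a of degree n + 2.
        ≈⟨ +-congˡ (+-cong (*-congʳ (sym (+-identityʳ _)))
                           (sym (⊛-distribʳ b (tail (tail a)) (∂ binomial (tail a)) n))) ⟩
      (a ⊛ ∂ binomial b) (suc n) + (∂ binomial a ⊛ b) (suc n) ∎
      where
      a′b  = tail a ⊛ b
      a₀b″ = a 0 * ∂ binomial b (suc n)
      ∂b   = (tail a ⊛ ∂ binomial b) n
      ∂a′  = (∂ binomial (tail a) ⊛ b) n

    ∂-divided : ∀ a → ∂ divided a ≋ tail a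
    ∂-divided a = mk≋ λ n → +-identityʳ _

    -- The ε of `derivation`; the binomial kind requires the identity here.
    constantTerm : Kind → Ser → Ser
    constantTerm binomial a = a
    constantTerm divided  a = const (a 0)

    private module S = CommutativeRing powerSeriesRing

    derivation : ∀ κ → TwistedDerivation powerSeriesRing κ
    derivation κ = record
      { D      = ∂ κ
      ; ε      = constantTerm κ
      ; D-cong = λ p → mk≋ λ n → ×-congʳ (multiplicity κ (suc n)) (at p (suc n))
      ; ε-cong = ε-cong κ
      ; D-+    = λ a b → mk≋ λ n → ×-distrib-+ _ _ (multiplicity κ (suc n))
      ; D-*    = D-* κ
      ; ε-+    = ε-+ κ
      ; ε-*    = ε-* κ
      ; ε-1    = ε-1 κ
      ; ε-ε    = ε-ε κ
      ; law    = law κ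
      }
      where
      ε-cong : ∀ κ {a b} → a ≋ b → constantTerm κ a ≋ constantTerm κ b
      ε-cong binomial p = p
      ε-cong divided  p = mk≋ λ { zero → at p 0 ; (suc _) → refl }
      D-* : ∀ κ a b → ∂ κ (a ⊛ b) ≋ (constantTerm κ a ⊛ ∂ κ b) ⊞ (∂ κ a ⊛ b)
      D-* binomial a b = mk≋ (∂-binomial-* a b)
      D-* divided  a b = mk≋ λ n → trans (+-identityʳ _)
        (+-cong (sym (trans (const-⊛ (a 0) _ n) (*-congˡ (+-identityʳ _))))
                (at (S.*-congʳ {b} (S.sym (∂-divided a))) n))
      ε-+ : ∀ κ a b → constantTerm κ (a ⊞ b) ≋ constantTerm κ a ⊞ constantTerm κ b
      ε-+ binomial a b = S.refl
      ε-+ divided  a b = mk≋ λ { zero → refl ; (suc _) → sym (+-identityˡ 0#) }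
      ε-* : ∀ κ a b → constantTerm κ (a ⊛ b) ≋ constantTerm κ a ⊛ constantTerm κ b
      ε-* binomial a b = S.refl
      ε-* divided  a b = mk≋ λ where
        zero    → refl
        (suc n) → sym (trans (const-⊛ (a 0) (const (b 0)) (suc n)) (zeroʳ _))
      ε-1 : ∀ κ → constantTerm κ (const 1#) ≋ const 1#
      ε-1 binomial = S.refl
      ε-1 divided  = S.refl
      ε-ε : ∀ κ a → constantTerm κ (constantTerm κ a) ≋ constantTerm κ a
      ε-ε binomial a = S.refl
      ε-ε divided  a = mk≋ λ { zero → refl ; (suc _) → refl }
      law : ∀ κ → Law powerSeriesRing κ (∂ κ) (constantTerm κ)
      law binomial a = S.refl
      law divided  a = mk≋ λ n → +-identityʳ _

    open import Algebra.Properties.Semiring.Mult S.semiring using () renaming (_×_ to _×ˢ_)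

    const-cong : ∀ {a b} → a ≈ b → const a ≋ const b
    const-cong p = mk≋ λ { zero → p ; (suc _) → refl }

    const-0 : const 0# ≋ 𝟎
    const-0 = mk≋ λ { zero → refl ; (suc _) → refl }

    ×ˢ-at : ∀ n a j → (n ×ˢ a) j ≡ n × a j
    ×ˢ-at zero    a j = ≡.refl
    ×ˢ-at (suc n) a j = ≡.cong (a j +_) (×ˢ-at n a j)

    ×-0 : ∀ n → n × 0# ≈ 0#
    ×-0 zero    = refl
    ×-0 (suc n) = trans (+-identityˡ _) (×-0 n)

    const-× : ∀ n a → const (n × a) ≋ n ×ˢ const a
    const-× n a = mk≋ λ where
      zero    → sym (reflexive (×ˢ-at n (const a) 0))
      (suc j) → sym (trans (reflexive (×ˢ-at n (const a) (suc j))) (×-0 n))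

    module _ {κ} (T : TwistedDerivation R κ) where

      open TwistedDerivation T
      open TwistedProperties R T
      private module L = TwistedDerivation (lift T)

      lift-D-const : ∀ a → L.D (const a) ≋ const (D a)
      lift-D-const a = mk≋ λ { zero → refl ; (suc _) → D-0 }

      lift-constant : ∀ {a} → Constant a → TwistedProperties.Constant powerSeriesRing (lift T) (const a)
      lift-constant p = record
        { D-const = mk≋ λ { zero → D-const p ; (suc _) → D-0 }
        ; ε-const = mk≋ λ { zero → ε-const p ; (suc _) → ε-0 }
        }

    derivation-constant : ∀ κ a → TwistedProperties.Constant powerSeriesRing (derivation κ) (const a)
    derivation-constant κ a = record
      { D-const = mk≋ λ n → ×-0 (multiplicity κ (suc n))
      ; ε-const = go κ
      }
      where
      go : ∀ κ → constantTerm κ (const a) ≋ const a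
      go binomial = S.refl
      go divided  = S.refl

  -- Taylor polynomials of φ(z + G) and the transport equation.

  module TransportEquation {c ℓ : Level} (X : CommutativeRing c ℓ) {κ : Kind}
                           (Z Y : TwistedDerivation X κ) where

    open CommutativeRing X
    open TwistedDerivation Z using (D; ε; D-cong; D-+)
    open TwistedDerivation Y using () renaming (D to ∂y; ε to εy; D-+ to ∂y-+)
    module Zₚ = TwistedProperties X Z
    module Yₚ = TwistedProperties X Y
    open import Algebra.Properties.Semiring.Exp semiring using (_^_; ^-congˡ)
    open import Algebra.Properties.Semiring.Mult semiring
      using (_×_; ×-congʳ; ×-assoc-*; ×-comm-*)
    open import Algebra.Solver.Ring.NaturalCoefficients.Default commutativeSemiring
      using (solve; _:+_; _:*_; _:=_; con)
    open SetoidReasoning setoid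

    module Truncation (ψ : ℕ → Carrier) (ψ-const : ∀ k → Yₚ.Constant (ψ k))
             (D-ψ : ∀ k → D (ψ k) ≈ multiplicity κ (suc k) × ψ (suc k))
             (k G : Carrier) (∂y-G : ∂y G ≈ k * (1# + D G))
             (εy-G : κ ≡ divided → εy G ≈ 0#) where

      -- The substitute for Gⁿ in Taylor's formula: one factor G suffices for D and ∂y to act as on
      -- a power, and at z = 0 it is Gⁿ.
      power : ℕ → Carrier
      power zero    = 1#
      power (suc n) = G * ε G ^ n

      -- In the divided power case the Leibniz rule in y leaves ∂y of (ε G)ⁿ, but with the
      -- coefficient εy G, and G is a multiple of y.
      ∂y-power : ∀ n → ∂y (power (suc n)) ≈ multiplicity κ (suc n) × (ε G ^ n * ∂y G)
      ∂y-power n = go κ Z Y εy-G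
        where
        module T = TwistedDerivation
        go : ∀ κ (Z Y : TwistedDerivation X κ) → (κ ≡ divided → T.ε Y G ≈ 0#) →
             T.D Y (G * T.ε Z G ^ n) ≈ multiplicity κ (suc n) × (T.ε Z G ^ n * T.D Y G)
        go binomial Z Y _ = begin
          T.D Y (G * T.ε Z G ^ n)             ≈⟨ T.D-cong Y (*-congˡ (^-congˡ n Z≈Y)) ⟩
          T.D Y (G * T.ε Y G ^ n)             ≈⟨ TwistedProperties.D-^ X Y G n ⟩
          suc n × (T.ε Y G ^ n * T.D Y G)     ≈⟨ ×-congʳ (suc n) (*-congʳ (^-congˡ n Z≈Y)) ⟨
          suc n × (T.ε Z G ^ n * T.D Y G)     ∎
          where
          Z≈Y : T.ε Z G ≈ T.ε Y G
          Z≈Y = trans (T.law Z G) (sym (T.law Y G))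
        go divided Z Y van = begin
          T.D Y (G * wⁿ)                   ≈⟨ T.D-* Y G wⁿ ⟩
          T.ε Y G * T.D Y wⁿ + T.D Y G * wⁿ ≈⟨ +-congʳ (*-congʳ (van ≡.refl)) ⟩
          0# * T.D Y wⁿ + T.D Y G * wⁿ     ≈⟨ +-cong (zeroˡ _) (*-comm _ _) ⟩
          0# + wⁿ * T.D Y G                ≈⟨ +-comm _ _ ⟩
          1 × (wⁿ * T.D Y G)               ∎
          where
          wⁿ = T.ε Z G ^ n

      ε-power : ∀ n → ε (power n) ≈ ε G ^ n
      ε-power zero    = TwistedDerivation.ε-1 Z
      ε-power (suc n) = trans (TwistedDerivation.ε-* Z _ _)
        (*-congˡ (trans (Zₚ.ε-^ _ n) (^-congˡ n (TwistedDerivation.ε-ε Z G))))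

      -- The Taylor polynomial of φ(z + G) of degree n in G, and the term by which it misses the
      -- transport equation, up to the factor k.
      truncation remainder : ℕ → Carrier
      truncation zero    = ψ 0 * power 0
      truncation (suc n) = truncation n + ψ (suc n) * power (suc n)
      remainder n = multiplicity κ (suc n) × ψ (suc n) * ε G ^ n

      D-ψ-* : ∀ n a → D (ψ n * a) ≈ ψ n * D a + multiplicity κ (suc n) × ψ (suc n) * ε a
      D-ψ-* n a = trans (Zₚ.D-*′ (ψ n) a) (+-congˡ (*-congʳ (D-ψ n)))

      -- D of the n-th term has two parts. The part ψₙ D(power n) is matched by ∂y of the same term,
      -- through the summand D G of ∂y G = k (1 + D G). The part from D ψₙ is matched by the summand
      -- 1 in ∂y of the next term. The sum telescopes, and only the last part of the second type is
      -- left over.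
      transport : ∀ n → ∂y (truncation n) + k * remainder n ≈ k * D (truncation n)
      transport zero = begin
        ∂y (ψ 0 * 1#) + k * remainder 0
          ≈⟨ +-congʳ (trans (Yₚ.D-const-* (ψ-const 0) 1#) (trans (*-congˡ Yₚ.D-1) (zeroʳ _))) ⟩
        0# + k * remainder 0
          ≈⟨ +-identityˡ _ ⟩
        k * remainder 0
          ≈⟨ *-congˡ (+-identityˡ _) ⟨
        k * (0# + remainder 0)
          ≈⟨ *-congˡ (+-cong (trans (*-congˡ Zₚ.D-1) (zeroʳ _)) (*-congˡ (TwistedDerivation.ε-1 Z))) ⟨
        k * (ψ 0 * D 1# + multiplicity κ 1 × ψ 1 * ε 1#)
          ≈⟨ *-congˡ (D-ψ-* 0 1#) ⟨
        k * D (ψ 0 * 1#) ∎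
      transport (suc n) = begin
        ∂y (truncation n + ψ′ * power (suc n)) + k * remainder (suc n)
          ≈⟨ +-congʳ (∂y-+ _ _) ⟩
        (∂y (truncation n) + ∂y (ψ′ * power (suc n))) + k * remainder (suc n)
          ≈⟨ +-congʳ (+-congˡ (trans (Yₚ.D-const-* (ψ-const (suc n)) _) (*-congˡ (∂y-power n)))) ⟩
        (∂y (truncation n) + ψ′ * (m × (wⁿ * ∂y G))) + k * remainder (suc n)
          ≈⟨ +-congʳ (+-congˡ (*-congˡ (×-congʳ m (*-congˡ ∂y-G)))) ⟩
        (∂y (truncation n) + ψ′ * (m × (wⁿ * (k * (1# + D G))))) + k * remainder (suc n)
          ≈⟨ +-congʳ (+-congˡ (pull _ _)) ⟩
        (∂y (truncation n) + (m × ψ′) * (wⁿ * (k * (1# + D G)))) + k * remainder (suc n)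
          -- The summand 1 of 1 + D G gives k times `remainder n`, which the induction hypothesis
          -- absorbs.
          ≈⟨ solve 6 (λ a p w q d r → (a :+ p :* (w :* (q :* (con 1 :+ d)))) :+ q :* r
                       := (a :+ q :* (p :* w)) :+ q :* (p :* (w :* d) :+ r))
               refl _ _ _ _ _ _ ⟩
        (∂y (truncation n) + k * remainder n) + k * ((m × ψ′) * (wⁿ * D G) + remainder (suc n))
          ≈⟨ +-cong (transport n) (*-congˡ (+-congʳ (sym (pull _ _)))) ⟩
        k * D (truncation n) + k * (ψ′ * (m × (wⁿ * D G)) + remainder (suc n))
          ≈⟨ distribˡ _ _ _ ⟨
        k * (D (truncation n) + (ψ′ * (m × (wⁿ * D G)) + remainder (suc n)))
          ≈⟨ *-congˡ (+-congˡ (+-cong (*-congˡ (sym (Zₚ.D-^ G n))) (*-congˡ (sym (ε-power (suc n)))))) ⟩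
        k * (D (truncation n) + (ψ′ * D (power (suc n)) + m′ × ψ (suc (suc n)) * ε (power (suc n))))
          ≈⟨ *-congˡ (+-congˡ (D-ψ-* (suc n) _)) ⟨
        k * (D (truncation n) + D (ψ′ * power (suc n)))
          ≈⟨ *-congˡ (D-+ _ _) ⟨
        k * D (truncation (suc n)) ∎
        where
        ψ′ = ψ (suc n)
        wⁿ = ε G ^ n
        m  = multiplicity κ (suc n)
        m′ = multiplicity κ (suc (suc n))
        pull : ∀ p a → p * (m × a) ≈ (m × p) * a
        pull p a = trans (×-comm-* m p a) (sym (×-assoc-* m p a))

-- Trees of connected diagrams, their gaps and their valencies.

module Forests where

  open import Algebra.Bundles using (CommutativeMonoid)
  open import Data.Bool.Base using (Bool; true; false; _∧_)
  open import Data.Empty using (⊥)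
  open import Data.List.Base
    using (List; []; _∷_; _++_; length; map; take; drop; concatMap; upTo)
  open import Data.List.Membership.Propositional using (_∈_; find)
  open import Data.List.Membership.Propositional.Properties
    using (∈-++⁺ˡ; ∈-++⁺ʳ; ∈-++⁻; ∈-map⁺; ∈-map⁻; ∈-concatMap⁺; ∈-concatMap⁻;
           ∈-applyUpTo⁺; ∈-applyUpTo⁻)
  open import Data.List.Properties using (length-map; length-++; length-take; length-drop)
  open import Data.List.Relation.Unary.All as All using (All; []; _∷_)
  import Data.List.Relation.Unary.All.Properties as Allₚ
  open import Data.List.Relation.Unary.AllPairs as AllPairs using (AllPairs; []; _∷_)
  import Data.List.Relation.Unary.AllPairs.Properties as AllPairsₚ
  open import Data.List.Relation.Unary.Any as Any using (here; there)
  open import Data.List.Relation.Unary.Unique.Propositional using (Unique)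
  import Data.List.Relation.Unary.Unique.Propositional.Properties as Uniqueₚ
  open import Data.Nat.Base using (ℕ; zero; suc; _+_; _*_; _∸_; _≤_; _<_; z≤n; s≤s)
  import Data.Nat.Properties as ℕₚ
  open import Data.Product.Base using (_×_; _,_; proj₁; proj₂; ∃)
  open import Data.Sum.Base using (inj₁; inj₂)
  open import Data.Unit.Base using (⊤; tt)
  open import Function.Base using (_∘_)
  open import Level using (Level)
  open import Relation.Binary.PropositionalEquality as ≡
    using (_≡_; refl; cong; subst; cong₂)
  open Series

  -- The tree C = node F of a connected diagram with root chord r: the forest F
  -- lists the components D¹, D², … of C ∖ r, each with the gap of Dʲ (counted
  -- from 0) that holds the sink of r; fork F₁ g F₂ has D¹ = node F₁.

  data Forest : Set where
    leaf : Forest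
    fork : (F₁ : Forest) (g : ℕ) (F₂ : Forest) → Forest

  -- The root is not counted, so the diagram has one chord more.
  size : Forest → ℕ
  size leaf            = 0
  size (fork F₁ g F₂)  = suc (size F₁) + size F₂

  -- This is t₁: the root has label 1, D¹ is labelled next, and a root that crosses D¹ is not
  -- terminal.
  firstLabel : Forest → ℕ
  firstLabel leaf           = 1
  firstLabel (fork F₁ g F₂) = suc (firstLabel F₁)

  nth : ∀ {a} {A : Set a} → A → List A → ℕ → A
  nth d []       _       = d
  nth d (x ∷ xs) zero    = x
  nth d (x ∷ xs) (suc n) = nth d xs n

  -- One slot per gap: the index (in postorder: D¹, D², …, r) of the last chord
  -- that is open there, and whether attaching a root there creates no top cycle.

  Slot : Set
  Slot = ℕ × Bool

  block : Slot → Slot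
  block (k , _) = k , false

  shift : ℕ → Slot → Slot
  shift n (k , b) = n + k , b

  -- The sink b of the root and the points of D², D³, ... are inserted into gap g of D¹ and split it
  -- in two; hence slot g occurs both in `take (suc g)` and in `drop g`. The gaps of D¹ before b
  -- become blocked, because up to b the root is covered by later chords. The position after the
  -- last point is not a gap.
  slotsᶠ slots : Forest → List Slot
  slotsᶠ leaf           = []
  slotsᶠ (fork F₁ g F₂) =
    let o = (size F₁ , true) ∷ slotsᶠ F₁ in
    map block (take (suc g) o) ++ map (shift (suc (size F₁))) (slotsᶠ F₂) ++ drop g o
  slots F = (size F , true) ∷ slotsᶠ F

  slot : Forest → ℕ → Slot
  slot F = nth (0 , false) (slots F)

  Valid : Forest → Set
  Valid leaf           = ⊤
  Valid (fork F₁ g F₂) = Valid F₁ × g < length (slots F₁) × Valid F₂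

  isFree : Forest → Bool
  isFree leaf           = true
  isFree (fork F₁ g F₂) = isFree F₁ ∧ (proj₂ (slot F₁ g) ∧ isFree F₂)

  -- The valencies in postorder; a chord is alive if it is the owner of an
  -- admissible slot.

  State : Set
  State = ℕ × Bool

  kill : State → State
  kill (v , _) = v , false

  -- The chords after k in postorder lose their admissible slots: by `slots-descending` these slots
  -- precede the one that is used. The slot of k itself survives behind the new sink.
  attach : ℕ → List State → List State
  attach _       []            = []
  attach zero    ((v , a) ∷ σ) = (suc v , a) ∷ map kill σ
  attach (suc k) (s ∷ σ)       = s ∷ attach k σ

  statesᶠ states : Forest → List State
  statesᶠ leaf           = []
  statesᶠ (fork F₁ g F₂) =
    attach (proj₁ (slot F₁ g)) (statesᶠ F₁ ++ (0 , true) ∷ []) ++ statesᶠ F₂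
  states F = statesᶠ F ++ (0 , true) ∷ []

  length-attach : ∀ k σ → length (attach k σ) ≡ length σ
  length-attach k       []            = refl
  length-attach zero    ((v , a) ∷ σ) = cong suc (length-map kill σ)
  length-attach (suc k) (s ∷ σ)       = cong suc (length-attach k σ)

  length-statesᶠ : ∀ F → length (statesᶠ F) ≡ size F
  length-states  : ∀ F → length (states F) ≡ suc (size F)
  length-statesᶠ leaf           = refl
  length-statesᶠ (fork F₁ g F₂) = ≡.trans (length-++ (attach _ (states F₁)))
    (≡.cong₂ _+_ (≡.trans (length-attach _ (states F₁)) (length-states F₁)) (length-statesᶠ F₂))
  length-states F = ≡.trans (length-++ (statesᶠ F))
    (≡.trans (ℕₚ.+-comm _ 1) (cong suc (length-statesᶠ F)))

  -- The 2n + 2 endpoints of n + 1 chords have 2n + 1 gaps between them; `slots` adds the first of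
  -- these, behind the source of the root.
  length-slotsᶠ : ∀ F → Valid F → length (slotsᶠ F) ≡ 2 * size F
  length-slotsᶠ leaf           _            = refl
  length-slotsᶠ (fork F₁ g F₂) (v₁ , g< , v₂) = begin
    length (map block (take (suc g) o) ++ map (shift s) (slotsᶠ F₂) ++ drop g o)
      ≡⟨ length-++ (map block (take (suc g) o)) ⟩
    length (map block (take (suc g) o)) + length (map (shift s) (slotsᶠ F₂) ++ drop g o)
      ≡⟨ ≡.cong₂ _+_ (≡.trans (length-map block (take (suc g) o)) (length-take (suc g) o))
                     (length-++ (map (shift s) (slotsᶠ F₂))) ⟩
    (suc g) ⊓ length o + (length (map (shift s) (slotsᶠ F₂)) + length (drop g o))
      ≡⟨ ≡.cong₂ _+_ (ℕₚ.m≤n⇒m⊓n≡m g<) (≡.cong₂ _+_ (≡.trans (length-map (shift s) (slotsᶠ F₂)) (length-slotsᶠ F₂ v₂)) (length-drop g o)) ⟩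
    suc g + (2 * size F₂ + (length o ∸ g))
      ≡⟨ cong suc (lemma g (2 * size F₂) (length o ∸ g)) ⟩
    suc (length o ∸ g + g + 2 * size F₂)
      ≡⟨ cong (λ x → suc (x + 2 * size F₂)) (ℕₚ.m∸n+n≡m (ℕₚ.<⇒≤ g<)) ⟩
    suc (length o + 2 * size F₂)
      ≡⟨ cong (λ x → suc (suc (x + 2 * size F₂))) (length-slotsᶠ F₁ v₁) ⟩
    2 + 2 * size F₁ + 2 * size F₂
      ≡⟨ cong (_+ 2 * size F₂) (≡.sym (ℕₚ.*-suc 2 (size F₁))) ⟩
    2 * s + 2 * size F₂
      ≡⟨ ℕₚ.*-distribˡ-+ 2 s (size F₂) ⟨
    2 * (s + size F₂) ∎
    where
    open ≡.≡-Reasoning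
    open import Data.Nat.Base using (_⊓_)
    o = slots F₁
    s = suc (size F₁)
    lemma : ∀ a b c → a + (b + c) ≡ c + a + b
    lemma a b c = ≡.trans (ℕₚ.+-comm a (b + c)) (≡.trans (cong (_+ a) (ℕₚ.+-comm b c))
      (≡.trans (ℕₚ.+-assoc c b a) (≡.trans (cong (c +_) (ℕₚ.+-comm b a)) (≡.sym (ℕₚ.+-assoc c a b)))))

  Below : ℕ → Slot → Set
  Below n e = proj₁ e < n

  slotsᶠ-below : ∀ F → All (Below (size F)) (slotsᶠ F)
  slots-below  : ∀ F → All (Below (suc (size F))) (slots F)
  slotsᶠ-below leaf           = []
  slotsᶠ-below (fork F₁ g F₂) =
    Allₚ.++⁺ (Allₚ.map⁺ (All.map weaken (Allₚ.take⁺ (suc g) (slots-below F₁))))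
    (Allₚ.++⁺ (Allₚ.map⁺ (All.map (ℕₚ.+-monoʳ-< (suc (size F₁))) (slotsᶠ-below F₂)))
              (All.map weaken (Allₚ.drop⁺ g (slots-below F₁))))
    where
    weaken : ∀ {k} → k < suc (size F₁) → k < suc (size F₁) + size F₂
    weaken p = ℕₚ.<-≤-trans p (ℕₚ.m≤m+n _ (size F₂))
  slots-below F = ℕₚ.≤-refl ∷ All.map ℕₚ.m≤n⇒m≤1+n (slotsᶠ-below F)

  Descending : List Slot → Set
  Descending = AllPairs (λ d e → proj₂ d ≡ true → proj₂ e ≡ true → proj₁ e < proj₁ d)

  -- The slots of D¹ before b are blocked, and those behind it come after the slots of D², D³, ...,
  -- whose owners are later in postorder.
  slotsᶠ-descending : ∀ F → Descending (slotsᶠ F)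
  slots-descending  : ∀ F → Descending (slots F)
  slotsᶠ-descending leaf           = []
  slotsᶠ-descending (fork F₁ g F₂) =
    AllPairsₚ.++⁺ (blocked (take (suc g) (slots F₁)))
      (AllPairsₚ.++⁺ (AllPairsₚ.map⁺ (AllPairs.map (λ lt p q → ℕₚ.+-monoʳ-< (suc (size F₁)) (lt p q))
                                                   (slotsᶠ-descending F₂)))
                     (AllPairsₚ.drop⁺ g (slots-descending F₁))
                     (Allₚ.map⁺ (All.universal (λ e → All.map (λ {d} d< _ _ → ℕₚ.<-≤-trans d< (ℕₚ.m≤m+n _ _))
                                                       (Allₚ.drop⁺ g (slots-below F₁))) (slotsᶠ F₂))))
      (apart (take (suc g) (slots F₁)) _)
    where
    blocked : ∀ es → Descending (map block es)
    blocked []       = []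
    blocked (_ ∷ es) = Allₚ.map⁺ (All.universal (λ _ ()) es) ∷ blocked es
    apart : ∀ ds es → All (λ d → All (λ e → proj₂ d ≡ true → proj₂ e ≡ true → proj₁ e < proj₁ d) es)
                          (map block ds)
    apart []       es = []
    apart (d ∷ ds) es = All.universal (λ _ ()) es ∷ apart ds es
  slots-descending F = All.map (λ lt _ _ → lt) (slotsᶠ-below F) ∷ slotsᶠ-descending F

  slotWeight : Kind → Bool → ℕ
  slotWeight binomial _     = 1
  slotWeight divided  true  = 1
  slotWeight divided  false = 0

  -- The number of usable slots of a chord: all of its v + 1 gaps, or only the admissible ones, of
  -- which an alive chord has exactly one.
  stateWeight : Kind → State → ℕ
  stateWeight binomial (v , _) = suc v
  stateWeight divided  (_ , a) = slotWeight divided a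

  admissible : Kind → Forest → Bool
  admissible binomial _ = true
  admissible divided  F = isFree F

  ∧-projˡ : ∀ {x y} → x ∧ y ≡ true → x ≡ true
  ∧-projˡ {true} _ = refl

  ∧-projʳ : ∀ {x y} → x ∧ y ≡ true → y ≡ true
  ∧-projʳ {true} p = p

  nth-All : ∀ {a p} {A : Set a} {P : A → Set p} {d xs} n → n < length xs → All P xs → P (nth d xs n)
  nth-All zero    _        (p ∷ _)  = p
  nth-All (suc n) (s≤s n<) (_ ∷ ps) = nth-All n n< ps

  -- A commutative monoid is the common ground of the two applications: weights in a ring, and
  -- counting in ℕ.
  module SlotSums {c ℓ : Level} (M : CommutativeMonoid c ℓ) where

    open CommutativeMonoid M
      using (Carrier; _≈_; setoid; ε; identityˡ; identityʳ; ∙-cong; ∙-congˡ; ∙-congʳ; assoc; comm)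
      renaming (_∙_ to _⊹_; refl to ≈-refl; sym to ≈-sym; trans to ≈-trans; reflexive to ≈-reflexive)
    open import Algebra.Properties.CommutativeMonoid.Mult M using (×-congʳ) renaming (_×_ to _·_)
    open import Relation.Binary.Reasoning.Setoid setoid

    Σslot : Kind → (ℕ → Carrier) → List Slot → Carrier
    Σslot κ h []       = ε
    Σslot κ h (e ∷ es) = (slotWeight κ (proj₂ e) · h (proj₁ e)) ⊹ Σslot κ h es

    Σstate : Kind → (ℕ → Carrier) → List State → Carrier
    Σstate κ h []      = ε
    Σstate κ h (s ∷ σ) = (stateWeight κ s · h 0) ⊹ Σstate κ (h ∘ suc) σ

    ·-ε : ∀ n → n · ε ≈ ε
    ·-ε zero    = ≈-refl
    ·-ε (suc n) = ≈-trans (identityˡ _) (·-ε n)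

    Σslot-++ : ∀ κ h ds es → Σslot κ h (ds ++ es) ≈ Σslot κ h ds ⊹ Σslot κ h es
    Σslot-++ κ h []       es = ≈-sym (identityˡ _)
    Σslot-++ κ h (d ∷ ds) es = ≈-trans (∙-congˡ (Σslot-++ κ h ds es)) (≈-sym (assoc _ _ _))

    Σslot-shift : ∀ κ h n es → Σslot κ h (map (shift n) es) ≈ Σslot κ (h ∘ (n +_)) es
    Σslot-shift κ h n []       = ≈-refl
    Σslot-shift κ h n (e ∷ es) = ∙-congˡ (Σslot-shift κ h n es)

    Σslot-block-binomial : ∀ h es → Σslot binomial h (map block es) ≈ Σslot binomial h es
    Σslot-block-binomial h []       = ≈-refl
    Σslot-block-binomial h (e ∷ es) = ∙-congˡ (Σslot-block-binomial h es)

    Σslot-block-divided : ∀ h es → Σslot divided h (map block es) ≈ ε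
    Σslot-block-divided h []       = ≈-refl
    Σslot-block-divided h (e ∷ es) = ≈-trans (identityˡ _) (Σslot-block-divided h es)

    -- Slot g lies in both parts, so its owner is counted once more: its valency grows by one.
    Σslot-take-drop : ∀ h es g {d} → g < length es →
      Σslot binomial h (take (suc g) es) ⊹ Σslot binomial h (drop g es) ≈
      Σslot binomial h es ⊹ h (proj₁ (nth d es g))
    Σslot-take-drop h (e ∷ es) zero    _        = begin
      ((h _ ⊹ ε) ⊹ ε) ⊹ Σslot binomial h (e ∷ es) ≈⟨ ∙-congʳ (≈-trans (identityʳ _) (identityʳ _)) ⟩
      h _ ⊹ Σslot binomial h (e ∷ es)             ≈⟨ comm _ _ ⟩
      Σslot binomial h (e ∷ es) ⊹ h _             ∎
    Σslot-take-drop h (e ∷ es) (suc g) (s≤s g<) =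
      ≈-trans (assoc _ _ _) (≈-trans (∙-congˡ (Σslot-take-drop h es g g<)) (≈-sym (assoc _ _ _)))

    Σstate-++ : ∀ κ h σ τ → Σstate κ h (σ ++ τ) ≈ Σstate κ h σ ⊹ Σstate κ (h ∘ (length σ +_)) τ
    Σstate-++ κ h []      τ = ≈-sym (identityˡ _)
    Σstate-++ κ h (s ∷ σ) τ = ≈-trans (∙-congˡ (Σstate-++ κ (h ∘ suc) σ τ)) (≈-sym (assoc _ _ _))

    Σstate-kill-binomial : ∀ h σ → Σstate binomial h (map kill σ) ≈ Σstate binomial h σ
    Σstate-kill-binomial h []      = ≈-refl
    Σstate-kill-binomial h (s ∷ σ) = ∙-congˡ (Σstate-kill-binomial (h ∘ suc) σ)

    Σstate-kill-divided : ∀ h σ → Σstate divided h (map kill σ) ≈ ε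
    Σstate-kill-divided h []      = ≈-refl
    Σstate-kill-divided h (s ∷ σ) = ≈-trans (identityˡ _) (Σstate-kill-divided (h ∘ suc) σ)

    Σstate-attach-binomial : ∀ h k σ → k < length σ →
      Σstate binomial h (attach k σ) ≈ Σstate binomial h σ ⊹ h k
    Σstate-attach-binomial h zero    ((v , a) ∷ σ) _ = begin
      (h 0 ⊹ (suc v · h 0)) ⊹ Σstate binomial (h ∘ suc) (map kill σ)
        ≈⟨ ∙-congˡ (Σstate-kill-binomial (h ∘ suc) σ) ⟩
      (h 0 ⊹ (suc v · h 0)) ⊹ Σstate binomial (h ∘ suc) σ
        ≈⟨ ≈-trans (assoc _ _ _) (comm _ _) ⟩
      ((suc v · h 0) ⊹ Σstate binomial (h ∘ suc) σ) ⊹ h 0 ∎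
    Σstate-attach-binomial h (suc k) (s ∷ σ) (s≤s k<) =
      ≈-trans (∙-congˡ (Σstate-attach-binomial (h ∘ suc) k σ k<)) (≈-sym (assoc _ _ _))

    -- Killing the chords after k amounts to replacing h by 0 beyond k. The induction hypothesis can
    -- thus be applied to the same tree with another h.
    upTo≤ : ℕ → (ℕ → Carrier) → ℕ → Carrier
    upTo≤ _       h zero    = h 0
    upTo≤ zero    h (suc j) = ε
    upTo≤ (suc k) h (suc j) = upTo≤ k (h ∘ suc) j

    upTo≤-≤ : ∀ {k j} h → j ≤ k → upTo≤ k h j ≡ h j
    upTo≤-≤         h z≤n     = refl
    upTo≤-≤ {suc k} h (s≤s p) = upTo≤-≤ (h ∘ suc) p

    upTo≤-> : ∀ {k j} h → k < j → upTo≤ k h j ≡ ε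
    upTo≤-> {zero}  {suc j} h p       = refl
    upTo≤-> {suc k} {suc j} h (s≤s p) = upTo≤-> (h ∘ suc) p

    Σstate-ε : ∀ κ σ → Σstate κ (λ _ → ε) σ ≈ ε
    Σstate-ε κ []      = ≈-refl
    Σstate-ε κ (s ∷ σ) = ≈-trans (∙-cong (·-ε (stateWeight κ s)) (Σstate-ε κ σ)) (identityˡ ε)

    Σstate-attach-divided : ∀ h k σ → Σstate divided h (attach k σ) ≈ Σstate divided (upTo≤ k h) σ
    Σstate-attach-divided h k       []            = ≈-refl
    Σstate-attach-divided h zero    ((v , a) ∷ σ) =
      ∙-congˡ (≈-trans (Σstate-kill-divided (h ∘ suc) σ) (≈-sym (Σstate-ε divided σ)))
    Σstate-attach-divided h (suc k) (s ∷ σ)       = ∙-congˡ (Σstate-attach-divided (h ∘ suc) k σ)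

    -- Owners of admissible slots decrease, so the slots before g are those with owners beyond k:
    -- dropping positions becomes cutting off h.
    Σslot-drop-divided : ∀ h es g {d k} → Descending es → g < length es → nth d es g ≡ (k , true) →
      Σslot divided h (drop g es) ≈ Σslot divided (upTo≤ k h) es
    Σslot-drop-divided h ((k , .true) ∷ es) zero {k = k} (lts ∷ _) _ refl =
      ∙-cong (×-congʳ 1 (≈-reflexive (≡.sym (upTo≤-≤ h ℕₚ.≤-refl)))) (below es lts)
      where
      below : ∀ es → All (λ e → true ≡ true → proj₂ e ≡ true → proj₁ e < k) es →
              Σslot divided h es ≈ Σslot divided (upTo≤ k h) es
      below []                _          = ≈-refl
      below ((j , true) ∷ es) (lt ∷ lts) =
        ∙-cong (×-congʳ 1 (≈-reflexive (≡.sym (upTo≤-≤ h (ℕₚ.<⇒≤ (lt refl refl)))))) (below es lts)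
      below ((j , false) ∷ es) (_ ∷ lts) = ∙-congˡ (below es lts)
    Σslot-drop-divided h ((j , false) ∷ es) (suc g) (_ ∷ desc) (s≤s g<) eq =
      ≈-trans (Σslot-drop-divided h es g desc g< eq) (≈-sym (identityˡ _))
    Σslot-drop-divided h ((j , true) ∷ es) (suc g) {d} {k} (lts ∷ desc) (s≤s g<) eq = begin
      Σslot divided h (drop g es)             ≈⟨ Σslot-drop-divided h es g desc g< eq ⟩
      Σslot divided (upTo≤ k h) es            ≈⟨ identityˡ _ ⟨
      ε ⊹ Σslot divided (upTo≤ k h) es        ≈⟨ ∙-congʳ (≈-trans (×-congʳ 1 (≈-reflexive (upTo≤-> h k<j))) (·-ε 1)) ⟨
      Σslot divided (upTo≤ k h) ((j , true) ∷ es) ∎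
      where
      k<j : k < j
      k<j = subst (λ e → proj₁ e < j) eq (nth-All g g< lts refl (cong proj₂ eq))

    -- The gaps are grouped by their owners. Both lists follow the recursion of the tree: using gap
    -- g doubles a slot of its owner and blocks the slots before it, while `attach` raises that
    -- owner and kills the chords after it.
    Σslotsᶠ : ∀ κ h F → Valid F → admissible κ F ≡ true →
              Σslot κ h (slotsᶠ F) ≈ Σstate κ h (statesᶠ F)
    Σslots  : ∀ κ h F → Valid F → admissible κ F ≡ true →
              Σslot κ h (slots F) ≈ Σstate κ h (states F)
    Σslots κ h F v ok = begin
      (slotWeight κ true · h (size F)) ⊹ Σslot κ h (slotsᶠ F)
        ≈⟨ ∙-cong (≈-reflexive (≡.cong₂ (λ m n → m · h n) (weight-new κ) (≡.sym size≡)))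
                  (Σslotsᶠ κ h F v ok) ⟩
      (stateWeight κ (0 , true) · h (length (statesᶠ F) + 0)) ⊹ Σstate κ h (statesᶠ F)
        ≈⟨ ∙-congʳ (identityʳ _) ⟨
      Σstate κ (h ∘ (length (statesᶠ F) +_)) ((0 , true) ∷ []) ⊹ Σstate κ h (statesᶠ F)
        ≈⟨ comm _ _ ⟩
      Σstate κ h (statesᶠ F) ⊹ Σstate κ (h ∘ (length (statesᶠ F) +_)) ((0 , true) ∷ [])
        ≈⟨ Σstate-++ κ h (statesᶠ F) _ ⟨
      Σstate κ h (states F) ∎
      where
      size≡ : length (statesᶠ F) + 0 ≡ size F
      size≡ = ≡.trans (ℕₚ.+-identityʳ _) (length-statesᶠ F)
      weight-new : ∀ κ → slotWeight κ true ≡ stateWeight κ (0 , true)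
      weight-new binomial = refl
      weight-new divided  = refl
    Σslotsᶠ κ h leaf _ _ = ≈-refl
    Σslotsᶠ κ h (fork F₁ g F₂) (v₁ , g< , v₂) ok = begin
      Σslot κ h (map block (take (suc g) o) ++ map (shift s) (slotsᶠ F₂) ++ drop g o)
        ≈⟨ Σslot-++ κ h (map block (take (suc g) o)) _ ⟩
      Σslot κ h (map block (take (suc g) o)) ⊹ Σslot κ h (map (shift s) (slotsᶠ F₂) ++ drop g o)
        ≈⟨ ∙-congˡ (≈-trans (Σslot-++ κ h (map (shift s) (slotsᶠ F₂)) _) (comm _ _)) ⟩
      Σslot κ h (map block (take (suc g) o)) ⊹ (Σslot κ h (drop g o) ⊹ Σslot κ h (map (shift s) (slotsᶠ F₂)))
        ≈⟨ assoc _ _ _ ⟨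
      (Σslot κ h (map block (take (suc g) o)) ⊹ Σslot κ h (drop g o)) ⊹ Σslot κ h (map (shift s) (slotsᶠ F₂))
        ≈⟨ ∙-cong (around κ ok) (≈-trans (Σslot-shift κ h s (slotsᶠ F₂)) (Σslotsᶠ κ _ F₂ v₂ (ok₂ κ ok))) ⟩
      Σstate κ h (attach k (states F₁)) ⊹ Σstate κ (h ∘ (s +_)) (statesᶠ F₂)
        ≈⟨ ∙-congˡ (≈-reflexive (cong (λ n → Σstate κ (h ∘ (n +_)) (statesᶠ F₂)) s≡)) ⟩
      Σstate κ h (attach k (states F₁)) ⊹ Σstate κ (h ∘ (length (attach k (states F₁)) +_)) (statesᶠ F₂)
        ≈⟨ Σstate-++ κ h (attach k (states F₁)) (statesᶠ F₂) ⟨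
      Σstate κ h (statesᶠ (fork F₁ g F₂)) ∎
      where
      o = slots F₁
      s = suc (size F₁)
      k = proj₁ (slot F₁ g)
      s≡ : s ≡ length (attach k (states F₁))
      s≡ = ≡.sym (≡.trans (length-attach k (states F₁)) (length-states F₁))
      k< : k < length (states F₁)
      k< = subst (k <_) (≡.sym (length-states F₁)) (nth-All g g< (slots-below F₁))
      ok₂ : ∀ κ → admissible κ (fork F₁ g F₂) ≡ true → admissible κ F₂ ≡ true
      ok₂ binomial _  = refl
      ok₂ divided  ok = ∧-projʳ {proj₂ (slot F₁ g)} (∧-projʳ {isFree F₁} ok)
      around : ∀ κ → admissible κ (fork F₁ g F₂) ≡ true →
               Σslot κ h (map block (take (suc g) o)) ⊹ Σslot κ h (drop g o) ≈
               Σstate κ h (attach k (states F₁))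
      around binomial _ = begin
        Σslot binomial h (map block (take (suc g) o)) ⊹ Σslot binomial h (drop g o)
          ≈⟨ ∙-congʳ (Σslot-block-binomial h (take (suc g) o)) ⟩
        Σslot binomial h (take (suc g) o) ⊹ Σslot binomial h (drop g o)
          ≈⟨ Σslot-take-drop h o g g< ⟩
        Σslot binomial h o ⊹ h k
          ≈⟨ ∙-congʳ (Σslots binomial h F₁ v₁ refl) ⟩
        Σstate binomial h (states F₁) ⊹ h k
          ≈⟨ Σstate-attach-binomial h k (states F₁) k< ⟨
        Σstate binomial h (attach k (states F₁)) ∎
      around divided ok = begin
        Σslot divided h (map block (take (suc g) o)) ⊹ Σslot divided h (drop g o)
          ≈⟨ ∙-congʳ (Σslot-block-divided h (take (suc g) o)) ⟩
        ε ⊹ Σslot divided h (drop g o)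
          ≈⟨ identityˡ _ ⟩
        Σslot divided h (drop g o)
          ≈⟨ Σslot-drop-divided h o g (slots-descending F₁) g<
               (cong (k ,_) (∧-projˡ {proj₂ (slot F₁ g)} (∧-projʳ {isFree F₁} ok))) ⟩
        Σslot divided (upTo≤ k h) o
          ≈⟨ Σslots divided (upTo≤ k h) F₁ v₁ (∧-projˡ {isFree F₁} ok) ⟩
        Σstate divided (upTo≤ k h) (states F₁)
          ≈⟨ Σstate-attach-divided h k (states F₁) ⟨
        Σstate divided h (attach k (states F₁)) ∎

  -- Enumeration of the trees by size.

  forks : List Forest → List Forest → List Forest
  forks as bs = concatMap (λ F₁ → concatMap (λ g → map (fork F₁ g) bs) (upTo (length (slots F₁)))) as

  -- Follows the recursion of `⊛`, so that a sum over this list becomes a coefficient of a product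
  -- of series.
  convolve : (ℕ → List Forest) → (ℕ → List Forest) → ℕ → List Forest
  convolve a b zero    = forks (a 0) (b 0)
  convolve a b (suc n) = forks (a 0) (b (suc n)) ++ convolve (a ∘ suc) b n

  -- The first argument bounds the depth and only serves termination.

  forestsUpTo : ℕ → ℕ → List Forest
  forestsUpTo _       zero    = leaf ∷ []
  forestsUpTo zero    (suc n) = []
  forestsUpTo (suc k) (suc n) = convolve (forestsUpTo k) (forestsUpTo k) n

  forests : ℕ → List Forest
  forests n = forestsUpTo n n

  convolve-cong : ∀ {a a′ b b′} n → (∀ m → m ≤ n → a m ≡ a′ m) → (∀ m → m ≤ n → b m ≡ b′ m) →
                  convolve a b n ≡ convolve a′ b′ n
  convolve-cong zero    p q = cong₂ forks (p 0 z≤n) (q 0 z≤n)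
  convolve-cong (suc n) p q =
    cong₂ _++_ (cong₂ forks (p 0 z≤n) (q (suc n) ℕₚ.≤-refl))
               (convolve-cong n (λ m m≤n → p (suc m) (s≤s m≤n)) (λ m m≤n → q m (ℕₚ.m≤n⇒m≤1+n m≤n)))

  forestsUpTo-stable : ∀ {k l} n → n ≤ k → n ≤ l → forestsUpTo k n ≡ forestsUpTo l n
  forestsUpTo-stable zero    _ _ = refl
  forestsUpTo-stable {suc k} {suc l} (suc n) (s≤s n≤k) (s≤s n≤l) = convolve-cong n stable stable
    where
    stable : ∀ m → m ≤ n → forestsUpTo k m ≡ forestsUpTo l m
    stable m m≤n = forestsUpTo-stable m (ℕₚ.≤-trans m≤n n≤k) (ℕₚ.≤-trans m≤n n≤l)

  forests-suc : ∀ n → forests (suc n) ≡ convolve forests forests n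
  forests-suc n = convolve-cong n stable stable
    where
    stable : ∀ m → m ≤ n → forestsUpTo n m ≡ forests m
    stable m m≤n = forestsUpTo-stable m m≤n ℕₚ.≤-refl

  ∈-forks⁺ : ∀ {F₁ g F₂ as bs} → F₁ ∈ as → g < length (slots F₁) → F₂ ∈ bs → fork F₁ g F₂ ∈ forks as bs
  ∈-forks⁺ {F₁} {g} {as = as} p g< q =
    ∈-concatMap⁺ _ (Any.map (λ { refl → ∈-concatMap⁺ _ (Any.map (λ { refl → ∈-map⁺ (fork F₁ g) q })
                                                           (∈-applyUpTo⁺ (λ n → n) g<)) }) p)

  ∈-forks⁻ : ∀ {F} as bs → F ∈ forks as bs → ∃ λ F₁ → ∃ λ g → ∃ λ F₂ →
             F ≡ fork F₁ g F₂ × F₁ ∈ as × g < length (slots F₁) × F₂ ∈ bs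
  ∈-forks⁻ (F₁ ∷ as) bs p with ∈-++⁻ (concatMap (λ g → map (fork F₁ g) bs) (upTo (length (slots F₁)))) p
  ... | inj₂ q with ∈-forks⁻ as bs q
  ...   | F₁′ , g , F₂ , eq , F₁∈ , g< , F₂∈ = F₁′ , g , F₂ , eq , there F₁∈ , g< , F₂∈
  ∈-forks⁻ (F₁ ∷ as) bs p | inj₁ q
    with find (∈-concatMap⁻ (λ g → map (fork F₁ g) bs) {xs = upTo (length (slots F₁))} q)
  ... | g , g∈ , q′ with ∈-applyUpTo⁻ (λ n → n) g∈ | ∈-map⁻ (fork F₁ g) q′
  ...   | _ , g< , refl | F₂ , F₂∈ , eq = F₁ , g , F₂ , eq , here refl , g< , F₂∈

  ∈-convolve⁺ : ∀ {F₁ g F₂ a b} i j → F₁ ∈ a i → g < length (slots F₁) → F₂ ∈ b j →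
                fork F₁ g F₂ ∈ convolve a b (i + j)
  ∈-convolve⁺         zero    zero    p g< q = ∈-forks⁺ p g< q
  ∈-convolve⁺         zero    (suc j) p g< q = ∈-++⁺ˡ (∈-forks⁺ p g< q)
  ∈-convolve⁺ {a = a} {b} (suc i) j p g< q = ∈-++⁺ʳ (forks (a 0) (b (suc (i + j)))) (∈-convolve⁺ i j p g< q)

  ∈-convolve⁻ : ∀ {F} a b n → F ∈ convolve a b n → ∃ λ i → ∃ λ j → ∃ λ F₁ → ∃ λ g → ∃ λ F₂ →
                i + j ≡ n × F ≡ fork F₁ g F₂ × F₁ ∈ a i × g < length (slots F₁) × F₂ ∈ b j
  ∈-convolve⁻ a b zero p with ∈-forks⁻ (a 0) (b 0) p
  ... | F₁ , g , F₂ , r = 0 , 0 , F₁ , g , F₂ , refl , r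
  ∈-convolve⁻ a b (suc n) p with ∈-++⁻ (forks (a 0) (b (suc n))) p
  ... | inj₁ q with ∈-forks⁻ (a 0) (b (suc n)) q
  ...   | F₁ , g , F₂ , r = 0 , suc n , F₁ , g , F₂ , refl , r
  ∈-convolve⁻ a b (suc n) p | inj₂ q with ∈-convolve⁻ (a ∘ suc) b n q
  ... | i , j , F₁ , g , F₂ , eq , r = suc i , j , F₁ , g , F₂ , cong suc eq , r

  forestsUpTo-sound : ∀ k n {F} → F ∈ forestsUpTo k n → Valid F × size F ≡ n
  forestsUpTo-sound k       zero    (here refl) = tt , refl
  forestsUpTo-sound (suc k) (suc n) p with ∈-convolve⁻ (forestsUpTo k) (forestsUpTo k) n p
  ... | i , j , F₁ , g , F₂ , refl , refl , F₁∈ , g< , F₂∈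
    with forestsUpTo-sound k i F₁∈ | forestsUpTo-sound k j F₂∈
  ...   | v₁ , refl | v₂ , refl = (v₁ , g< , v₂) , refl

  forests-valid : ∀ n {F} → F ∈ forests n → Valid F
  forests-valid n p = proj₁ (forestsUpTo-sound n n p)

  forests-size : ∀ n {F} → F ∈ forests n → size F ≡ n
  forests-size n p = proj₂ (forestsUpTo-sound n n p)

  forests-complete : ∀ F → Valid F → F ∈ forests (size F)
  forests-complete leaf _ = here refl
  forests-complete (fork F₁ g F₂) (v₁ , g< , v₂) =
    subst (fork F₁ g F₂ ∈_) (≡.sym (forests-suc (size F₁ + size F₂)))
      (∈-convolve⁺ (size F₁) (size F₂) (forests-complete F₁ v₁) g< (forests-complete F₂ v₂))

  fork-injective : ∀ {F₁ g F₂ F₁′ g′ F₂′} → fork F₁ g F₂ ≡ fork F₁′ g′ F₂′ → F₁ ≡ F₁′ × g ≡ g′ × F₂ ≡ F₂′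
  fork-injective refl = refl , refl , refl

  forks-unique : ∀ {as bs} → Unique as → Unique bs → Unique (forks as bs)
  forks-unique {as} {bs} uas ubs = go uas
    where
    over-gaps : ∀ F₁ {gs} → Unique gs → Unique (concatMap (λ g → map (fork F₁ g) bs) gs)
    over-gaps F₁ []                  = []
    over-gaps F₁ {g ∷ gs} (g∉ ∷ ugs) = Uniqueₚ.++⁺ (Uniqueₚ.map⁺ (λ eq → proj₂ (proj₂ (fork-injective eq))) ubs)
      (over-gaps F₁ ugs) λ (p , q) → disjoint p q
      where
      disjoint : ∀ {F} → F ∈ map (fork F₁ g) bs → F ∈ concatMap (λ g → map (fork F₁ g) bs) gs → ⊥
      disjoint p q with find (∈-concatMap⁻ (λ g → map (fork F₁ g) bs) {xs = gs} q)
      ... | g′ , g′∈ , q′ with ∈-map⁻ (fork F₁ g) p | ∈-map⁻ (fork F₁ g′) q′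
      ...   | _ , _ , refl | _ , _ , refl = All.lookup g∉ g′∈ refl
    go : ∀ {as} → Unique as → Unique (forks as bs)
    go []                    = []
    go {F₁ ∷ as} (F₁∉ ∷ uas) = Uniqueₚ.++⁺ (over-gaps F₁ (Uniqueₚ.upTo⁺ (length (slots F₁)))) (go uas)
      λ (p , q) → disjoint p q
      where
      disjoint : ∀ {F} → F ∈ concatMap (λ g → map (fork F₁ g) bs) (upTo (length (slots F₁))) →
                 F ∈ forks as bs → ⊥
      disjoint p q with find (∈-concatMap⁻ (λ g → map (fork F₁ g) bs) {xs = upTo (length (slots F₁))} p)
                      | ∈-forks⁻ as bs q
      ... | g , _ , p′ | F₁′ , g′ , _ , eq , F₁′∈ , _ with ∈-map⁻ (fork F₁ g) p′
      ...   | _ , _ , eq′ with ≡.trans (≡.sym eq′) eq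
      ...     | refl = All.lookup F₁∉ F₁′∈ refl

  convolve-unique : ∀ {a b} n → (∀ i → Unique (a i)) → (∀ i → Unique (b i)) →
                    (∀ i j {F} → F ∈ a i → F ∈ a j → i ≡ j) → Unique (convolve a b n)
  convolve-unique         zero    ua ub d = forks-unique (ua 0) (ub 0)
  convolve-unique {a} {b} (suc n) ua ub d = Uniqueₚ.++⁺ (forks-unique (ua 0) (ub (suc n)))
    (convolve-unique n (ua ∘ suc) ub (λ i j p q → ℕₚ.suc-injective (d (suc i) (suc j) p q)))
    λ (p , q) → disjoint p q
    where
    disjoint : ∀ {F} → F ∈ forks (a 0) (b (suc n)) → F ∈ convolve (a ∘ suc) b n → ⊥
    disjoint p q with ∈-forks⁻ (a 0) (b (suc n)) p | ∈-convolve⁻ (a ∘ suc) b n q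
    ... | _ , _ , _ , refl , F₁∈ , _ | i , _ , _ , _ , _ , _ , refl , F₁∈′ , _ with d 0 (suc i) F₁∈ F₁∈′
    ...   | ()

  forestsUpTo-unique : ∀ k n → Unique (forestsUpTo k n)
  forestsUpTo-unique k       zero    = [] ∷ []
  forestsUpTo-unique zero    (suc n) = []
  forestsUpTo-unique (suc k) (suc n) = convolve-unique n (forestsUpTo-unique k) (forestsUpTo-unique k)
    λ i j p q → ≡.trans (≡.sym (proj₂ (forestsUpTo-sound k i p))) (proj₂ (forestsUpTo-sound k j q))

-- Generating functions of trees.

module TreeSeries where

  open import Algebra.Bundles using (CommutativeRing)
  open import Data.Bool.Base using (Bool; true; false; _∧_; if_then_else_)
  open import Data.List.Base
    using (List; []; _∷_; _++_; length; map; concatMap; upTo; applyUpTo)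
  open import Data.List.Membership.Propositional using (_∈_)
  open import Data.List.Relation.Unary.Any using (here; there)
  open import Data.Nat.Base as ℕ using (ℕ; zero; suc; _≤_; _<_; s≤s)
  import Data.Nat.Properties as ℕₚ
  open import Data.Product.Base using (_×_; _,_; proj₁; proj₂)
  open import Data.Sum.Base using (inj₁; inj₂)
  open import Function.Base using (_∘_)
  open import Level using (Level)
  open import Relation.Binary.PropositionalEquality as ≡ using (_≡_; cong; cong₂)
  import Relation.Binary.Reasoning.Setoid as SetoidReasoning
  open Series
  open Forests

  module ListSums {c ℓ : Level} (R : CommutativeRing c ℓ) where

    open CommutativeRing R
    open PowerSeries R
    open import Algebra.Properties.CommutativeSemigroup +-commutativeSemigroup using (interchange)
    open SetoidReasoning setoid

    Σ : ∀ {a} {A : Set a} → List A → (A → Carrier) → Carrier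
    Σ []       h = 0#
    Σ (x ∷ xs) h = h x + Σ xs h

    module _ {a} {A : Set a} where

      Σ-cong : ∀ (xs : List A) {h k} → (∀ {x} → x ∈ xs → h x ≈ k x) → Σ xs h ≈ Σ xs k
      Σ-cong []       eq = refl
      Σ-cong (x ∷ xs) eq = +-cong (eq (here ≡.refl)) (Σ-cong xs (eq ∘ there))

      Σ-++ : ∀ (xs ys : List A) h → Σ (xs ++ ys) h ≈ Σ xs h + Σ ys h
      Σ-++ []       ys h = sym (+-identityˡ _)
      Σ-++ (x ∷ xs) ys h = trans (+-congˡ (Σ-++ xs ys h)) (sym (+-assoc _ _ _))

      Σ-+ : ∀ (xs : List A) h k → Σ xs (λ x → h x + k x) ≈ Σ xs h + Σ xs k
      Σ-+ []       h k = sym (+-identityˡ 0#)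
      Σ-+ (x ∷ xs) h k = trans (+-congˡ (Σ-+ xs h k)) (interchange _ _ _ _)

      Σ-distribˡ : ∀ (xs : List A) h r → Σ xs (λ x → r * h x) ≈ r * Σ xs h
      Σ-distribˡ []       h r = sym (zeroʳ r)
      Σ-distribˡ (x ∷ xs) h r = trans (+-congˡ (Σ-distribˡ xs h r)) (sym (distribˡ _ _ _))

      Σ-distribʳ : ∀ (xs : List A) h r → Σ xs (λ x → h x * r) ≈ Σ xs h * r
      Σ-distribʳ []       h r = sym (zeroˡ r)
      Σ-distribʳ (x ∷ xs) h r = trans (+-congˡ (Σ-distribʳ xs h r)) (sym (distribʳ _ _ _))

      Σ-0 : ∀ (xs : List A) {h} → (∀ {x} → x ∈ xs → h x ≈ 0#) → Σ xs h ≈ 0#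
      Σ-0 []       eq = refl
      Σ-0 (x ∷ xs) eq = trans (+-cong (eq (here ≡.refl)) (Σ-0 xs (eq ∘ there))) (+-identityˡ 0#)

      Σ-concatMap : ∀ {b} {B : Set b} (xs : List B) (k : B → List A) h →
                    Σ (concatMap k xs) h ≈ Σ xs (λ x → Σ (k x) h)
      Σ-concatMap []       k h = refl
      Σ-concatMap (x ∷ xs) k h = trans (Σ-++ (k x) _ h) (+-congˡ (Σ-concatMap xs k h))

      Σ-map : ∀ {b} {B : Set b} (k : B → A) (xs : List B) h → Σ (map k xs) h ≡ Σ xs (h ∘ k)
      Σ-map k []       h = ≡.refl
      Σ-map k (x ∷ xs) h = cong (h (k x) +_) (Σ-map k xs h)

    Σ-applyUpTo : ∀ (k : ℕ → Carrier) (p : ℕ → ℕ) n → Σ (applyUpTo p n) k ≡ Σ (upTo n) (k ∘ p)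
    Σ-applyUpTo k p zero    = ≡.refl
    Σ-applyUpTo k p (suc n) = cong (k (p 0) +_)
      (≡.trans (Σ-applyUpTo k (p ∘ suc) n) (≡.sym (Σ-applyUpTo (k ∘ p) suc n)))

    Σgaps : (Forest → ℕ → Carrier) → Forest → Carrier
    Σgaps X F = Σ (upTo (length (slots F))) (X F)

    module _ (X : Forest → ℕ → Carrier) (Y v : Forest → Carrier) where

      Σ-forks : ∀ as bs → (∀ F₁ g F₂ → v (fork F₁ g F₂) ≈ X F₁ g * Y F₂) →
                Σ (forks as bs) v ≈ Σ as (Σgaps X) * Σ bs Y
      Σ-forks as bs eq = begin
        Σ (forks as bs) v
          ≈⟨ Σ-concatMap as byGap v ⟩
        Σ as (λ F₁ → Σ (byGap F₁) v)
          ≈⟨ Σ-cong as (λ {F₁} _ → inner F₁) ⟩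
        Σ as (λ F₁ → Σgaps X F₁ * Σ bs Y)
          ≈⟨ Σ-distribʳ as _ (Σ bs Y) ⟩
        Σ as (Σgaps X) * Σ bs Y ∎
        where
        gaps : Forest → List ℕ
        gaps F = upTo (length (slots F))
        byGap : Forest → List Forest
        byGap F₁ = concatMap (λ g → map (fork F₁ g) bs) (gaps F₁)
        inner : ∀ F₁ → Σ (byGap F₁) v ≈ Σgaps X F₁ * Σ bs Y
        inner F₁ = begin
          Σ (byGap F₁) v
            ≈⟨ Σ-concatMap (gaps F₁) (λ g → map (fork F₁ g) bs) v ⟩
          Σ (gaps F₁) (λ g → Σ (map (fork F₁ g) bs) v)
            ≈⟨ Σ-cong (gaps F₁) (λ {g} _ → reflexive (Σ-map (fork F₁ g) bs v)) ⟩
          Σ (gaps F₁) (λ g → Σ bs (v ∘ fork F₁ g))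
            ≈⟨ Σ-cong (gaps F₁) (λ {g} _ → trans (Σ-cong bs (λ {F₂} _ → eq F₁ g F₂))
                                                 (Σ-distribˡ bs Y (X F₁ g))) ⟩
          Σ (gaps F₁) (λ g → X F₁ g * Σ bs Y)
            ≈⟨ Σ-distribʳ (gaps F₁) (X F₁) (Σ bs Y) ⟩
          Σgaps X F₁ * Σ bs Y ∎

      Σ-convolve : ∀ a b n → (∀ F₁ g F₂ → v (fork F₁ g F₂) ≈ X F₁ g * Y F₂) →
                   Σ (convolve a b n) v ≈ ((λ i → Σ (a i) (Σgaps X)) ⊛ (λ j → Σ (b j) Y)) n
      Σ-convolve a b zero    eq = Σ-forks (a 0) (b 0) eq
      Σ-convolve a b (suc n) eq = trans (Σ-++ (forks (a 0) (b (suc n))) _ _)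
        (+-cong (Σ-forks (a 0) (b (suc n)) eq) (Σ-convolve (a ∘ suc) b n eq))

  module _ {c ℓ : Level} (A : CommutativeRing c ℓ) {κ : Kind} (Z : TwistedDerivation A κ) where

    open CommutativeRing A
    open TwistedDerivation Z using (D)
    open TwistedProperties A Z using (Constant)
    open import Algebra.Properties.Semiring.Mult semiring using () renaming (_×_ to _·_)

    -- Here ψ k is the weight of a chord of valency k: φ⁽ᵏ⁾(z)/k!, or the k-th iterated divided
    -- difference of φ.
    record Coefficients : Set (c Level.⊔ ℓ) where
      field
        ψ f     : ℕ → Carrier
        D-ψ     : ∀ k → D (ψ k) ≈ multiplicity κ (suc k) · ψ (suc k)
        f-const : ∀ k → Constant (f k)

  module TreeWeights {c ℓ : Level} (A : CommutativeRing c ℓ) {κ : Kind} (Z : TwistedDerivation A κ)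
                     (coefficients : Coefficients A Z) where

    open CommutativeRing A
    open TwistedDerivation Z
    open TwistedProperties A Z
    open Coefficients coefficients
    open PowerSeries A
    open ListSums A
    open SlotSums +-commutativeMonoid using (Σslot; Σstate; Σslots)
    open import Algebra.Properties.Semiring.Mult semiring
      using (×-assoc-*; ×-comm-*) renaming (_×_ to _·_)
    open import Algebra.Solver.Ring.NaturalCoefficients.Default commutativeSemiring
      using (solve; _:*_; _:=_)
    open SetoidReasoning setoid

    -- A dead chord has no admissible slot, so its valency is final; ε freezes its factor to a
    -- constant on which D vanishes.
    factorOf : Kind → State → Carrier
    factorOf binomial (v , _)     = ψ v
    factorOf divided  (v , true)  = ψ v
    factorOf divided  (v , false) = ε (ψ v)

    factor : State → Carrier
    factor = factorOf κ

    weight : List State → Carrier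
    weight []      = 1#
    weight (s ∷ σ) = factor s * weight σ

    weight-++ : ∀ σ τ → weight (σ ++ τ) ≈ weight σ * weight τ
    weight-++ []      τ = sym (*-identityˡ _)
    weight-++ (s ∷ σ) τ = trans (*-congˡ (weight-++ σ τ)) (sym (*-assoc _ _ _))

    ε-factor : ∀ s → ε (factor s) ≈ factor (kill s)
    ε-factor = go κ law
      where
      go : ∀ κ → Law A κ D ε → ∀ s → ε (factorOf κ s) ≈ factorOf κ (kill s)
      go binomial id≈ s           = id≈ _
      go divided  _   (v , true)  = refl
      go divided  _   (v , false) = ε-ε _

    D-factor : ∀ v a → D (factor (v , a)) ≈ stateWeight κ (v , a) · factor (suc v , a)
    D-factor = go κ law D-ψ
      where
      go : ∀ κ → Law A κ D ε → (∀ k → D (ψ k) ≈ multiplicity κ (suc k) · ψ (suc k)) →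
           ∀ v a → D (factorOf κ (v , a)) ≈ stateWeight κ (v , a) · factorOf κ (suc v , a)
      go binomial _    Dψ v a     = Dψ v
      go divided  _    Dψ v true  = Dψ v
      go divided  Dε≈0 Dψ v false = Dε≈0 _

    ε-weight : ∀ σ → ε (weight σ) ≈ weight (map kill σ)
    ε-weight []      = ε-1
    ε-weight (s ∷ σ) = trans (ε-* _ _) (*-cong (ε-factor s) (ε-weight σ))

    Σstate-*ˡ : ∀ r h σ → Σstate κ (λ k → r * h k) σ ≈ r * Σstate κ h σ
    Σstate-*ˡ r h []      = sym (zeroʳ r)
    Σstate-*ˡ r h (s ∷ σ) =
      trans (+-cong (sym (×-comm-* (stateWeight κ s) r _)) (Σstate-*ˡ r (h ∘ suc) σ)) (sym (distribˡ _ _ _))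

    -- By the rule `D-*′`, the term that differentiates one factor applies ε to all later factors,
    -- just as `attach` kills the later chords.
    D-weight : ∀ σ → D (weight σ) ≈ Σstate κ (λ k → weight (attach k σ)) σ
    D-weight []            = D-1
    D-weight ((v , a) ∷ σ) = begin
      D (factor (v , a) * weight σ)
        ≈⟨ D-*′ _ _ ⟩
      factor (v , a) * D (weight σ) + D (factor (v , a)) * ε (weight σ)
        ≈⟨ +-comm _ _ ⟩
      D (factor (v , a)) * ε (weight σ) + factor (v , a) * D (weight σ)
        ≈⟨ +-cong (*-cong (D-factor v a) (ε-weight σ)) (*-congˡ (D-weight σ)) ⟩
      (stateWeight κ (v , a) · factor (suc v , a)) * weight (map kill σ)
        + factor (v , a) * Σstate κ (λ k → weight (attach k σ)) σ
        ≈⟨ +-cong (×-assoc-* (stateWeight κ (v , a)) _ _) (sym (Σstate-*ˡ _ _ σ)) ⟩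
      Σstate κ (λ k → weight (attach k ((v , a) ∷ σ))) ((v , a) ∷ σ) ∎

    -- f_C read off the tree. The last label in a component belongs to a terminal chord, so the
    -- difference to the next component's first terminal label is the `firstLabel` of that
    -- component. The root contributes f₀ if there is a component; D¹ then starts the list of
    -- terminal chords and enters without such a difference.
    treeFactor forestFactor : Forest → Carrier
    treeFactor leaf           = 1#
    treeFactor (fork F₁ g F₂) = f 0 * (treeFactor F₁ * forestFactor F₂)
    forestFactor leaf           = 1#
    forestFactor (fork F₁ g F₂) = f (firstLabel F₁) * (treeFactor F₁ * forestFactor F₂)

    guard : Bool → Carrier → Carrier
    guard b a = if b then a else 0#

    guard-∧ : ∀ b b′ {x y} → guard (b ∧ b′) (x * y) ≈ guard b x * guard b′ y
    guard-∧ true  true  = refl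
    guard-∧ true  false = sym (zeroʳ _)
    guard-∧ false b′    = sym (zeroˡ _)

    guard-cong : ∀ b {x y} → x ≈ y → guard b x ≈ guard b y
    guard-cong true  eq = eq
    guard-cong false eq = refl

    guard-≡ : ∀ {b b′ x} → b ≡ b′ → guard b x ≈ guard b′ x
    guard-≡ ≡.refl = refl

    guard-*ˡ : ∀ b {x y} → guard b (x * y) ≈ x * guard b y
    guard-*ˡ true  = refl
    guard-*ˡ false = sym (zeroʳ _)

    treeWeight forestWeight : Forest → Carrier
    treeWeight   F = guard (admissible κ F) (treeFactor F * weight (states F))
    forestWeight F = guard (admissible κ F) (forestFactor F * weight (statesᶠ F))

    open? : Kind → Slot → Bool
    open? binomial _       = true
    open? divided  (_ , b) = b

    attachedWeight : Forest → ℕ → Carrier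
    attachedWeight F g =
      guard (admissible κ F ∧ open? κ (slot F g)) (treeFactor F * weight (attach (proj₁ (slot F g)) (states F)))

    admissible-fork : ∀ κ F₁ g F₂ → admissible κ (fork F₁ g F₂) ≡
                      (admissible κ F₁ ∧ open? κ (slot F₁ g)) ∧ admissible κ F₂
    admissible-fork binomial F₁ g F₂ = ≡.refl
    admissible-fork divided  F₁ g F₂ with isFree F₁
    ... | true  = ≡.refl
    ... | false = ≡.refl

    weight-root : ∀ σ → weight (σ ++ (0 , true) ∷ []) ≈ ψ 0 * weight σ
    weight-root σ = trans (weight-++ σ _) (trans (*-congˡ (trans (*-identityʳ _) (root κ))) (*-comm _ _))
      where
      root : ∀ κ → factorOf κ (0 , true) ≈ ψ 0
      root binomial = refl
      root divided  = refl

    treeWeight-leaf : treeWeight leaf ≈ ψ 0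
    treeWeight-leaf = trans (admit κ) (trans (*-identityˡ _) (trans (weight-root []) (*-identityʳ _)))
      where
      admit : ∀ κ {x} → guard (admissible κ leaf) x ≈ x
      admit binomial = refl
      admit divided  = refl

    forestWeight-leaf : forestWeight leaf ≈ 1#
    forestWeight-leaf = trans (admit κ) (*-identityˡ _)
      where
      admit : ∀ κ {x} → guard (admissible κ leaf) x ≈ x
      admit binomial = refl
      admit divided  = refl

    forestWeight-fork : ∀ F₁ g F₂ → forestWeight (fork F₁ g F₂) ≈
                        f (firstLabel F₁) * attachedWeight F₁ g * forestWeight F₂
    forestWeight-fork F₁ g F₂ = begin
      guard (admissible κ (fork F₁ g F₂)) (fl * (tf * ff) * weight (attached ++ statesᶠ F₂))
        ≈⟨ guard-≡ (admissible-fork κ F₁ g F₂) ⟩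
      guard (a₁ ∧ a₂) (fl * (tf * ff) * weight (attached ++ statesᶠ F₂))
        ≈⟨ guard-cong (a₁ ∧ a₂) (*-congˡ (weight-++ attached (statesᶠ F₂))) ⟩
      guard (a₁ ∧ a₂) (fl * (tf * ff) * (weight attached * weight (statesᶠ F₂)))
        ≈⟨ guard-cong (a₁ ∧ a₂) (solve 5 (λ l t q x y → l :* (t :* q) :* (x :* y) := l :* (t :* x) :* (q :* y)) refl _ _ _ _ _) ⟩
      guard (a₁ ∧ a₂) (fl * (tf * weight attached) * (ff * weight (statesᶠ F₂)))
        ≈⟨ guard-∧ a₁ a₂ ⟩
      guard a₁ (fl * (tf * weight attached)) * forestWeight F₂
        ≈⟨ *-congʳ (guard-*ˡ a₁) ⟩
      fl * attachedWeight F₁ g * forestWeight F₂ ∎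
      where
      attached = attach (proj₁ (slot F₁ g)) (states F₁)
      a₁ = admissible κ F₁ ∧ open? κ (slot F₁ g)
      a₂ = admissible κ F₂
      fl = f (firstLabel F₁)
      tf = treeFactor F₁
      ff = forestFactor F₂

    treeWeight-fork : ∀ F₁ g F₂ → treeWeight (fork F₁ g F₂) ≈
                      f 0 * ψ 0 * (attachedWeight F₁ g * forestWeight F₂)
    treeWeight-fork F₁ g F₂ = begin
      guard (admissible κ (fork F₁ g F₂)) (f 0 * (tf * ff) * weight ((attached ++ statesᶠ F₂) ++ (0 , true) ∷ []))
        ≈⟨ guard-≡ (admissible-fork κ F₁ g F₂) ⟩
      guard (a₁ ∧ a₂) (f 0 * (tf * ff) * weight ((attached ++ statesᶠ F₂) ++ (0 , true) ∷ []))
        ≈⟨ guard-cong (a₁ ∧ a₂) (*-congˡ (trans (weight-root (attached ++ statesᶠ F₂)) (*-congˡ (weight-++ attached (statesᶠ F₂))))) ⟩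
      guard (a₁ ∧ a₂) (f 0 * (tf * ff) * (ψ 0 * (weight attached * weight (statesᶠ F₂))))
        ≈⟨ guard-cong (a₁ ∧ a₂) (solve 6 (λ l t q p x y → l :* (t :* q) :* (p :* (x :* y)) := (l :* p) :* ((t :* x) :* (q :* y))) refl _ _ _ _ _ _) ⟩
      guard (a₁ ∧ a₂) (f 0 * ψ 0 * ((tf * weight attached) * (ff * weight (statesᶠ F₂))))
        ≈⟨ guard-*ˡ (a₁ ∧ a₂) ⟩
      f 0 * ψ 0 * guard (a₁ ∧ a₂) ((tf * weight attached) * (ff * weight (statesᶠ F₂)))
        ≈⟨ *-congˡ (guard-∧ a₁ a₂) ⟩
      f 0 * ψ 0 * (attachedWeight F₁ g * forestWeight F₂) ∎
      where
      attached = attach (proj₁ (slot F₁ g)) (states F₁)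
      a₁ = admissible κ F₁ ∧ open? κ (slot F₁ g)
      a₂ = admissible κ F₂
      tf = treeFactor F₁
      ff = forestFactor F₂

    treeFactor-const   : ∀ F → Constant (treeFactor F)
    forestFactor-const : ∀ F → Constant (forestFactor F)
    treeFactor-const leaf           = 1-const
    treeFactor-const (fork F₁ g F₂) =
      *-const (f-const 0) (*-const (treeFactor-const F₁) (forestFactor-const F₂))
    forestFactor-const leaf           = 1-const
    forestFactor-const (fork F₁ g F₂) =
      *-const (f-const (firstLabel F₁)) (*-const (treeFactor-const F₁) (forestFactor-const F₂))

    Σ-slots : ∀ (es : List Slot) (h : ℕ → Carrier) →
              Σ (upTo (length es)) (λ g → guard (open? κ (nth (0 , false) es g)) (h (proj₁ (nth (0 , false) es g))))
              ≈ Σslot κ h es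
    Σ-slots []       h = refl
    Σ-slots (e ∷ es) h = +-cong (first κ e)
      (trans (reflexive (Σ-applyUpTo _ suc (length es))) (Σ-slots es h))
      where
      first : ∀ κ e → guard (open? κ e) (h (proj₁ e)) ≈ slotWeight κ (proj₂ e) · h (proj₁ e)
      first binomial e           = sym (+-identityʳ _)
      first divided  (k , true)  = sym (+-identityʳ _)
      first divided  (k , false) = refl

    -- `Σslots` turns the sum over gaps into a sum over chords, which `D-weight` recognises as the
    -- Leibniz expansion of the derivative.
    Σ-attachedWeight : ∀ F → Valid F →
                       Σ (upTo (length (slots F))) (attachedWeight F) ≈ D (treeWeight F)
    Σ-attachedWeight F v with admissible κ F in eq
    ... | false = trans (Σ-0 (upTo (length (slots F))) (λ _ → refl)) (sym D-0)
    ... | true  = begin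
      Σ gs (λ g → guard (open? κ (slot F g)) (treeFactor F * weight (attach (proj₁ (slot F g)) (states F))))
        ≈⟨ Σ-cong gs (λ {g} _ → guard-*ˡ (open? κ (slot F g))) ⟩
      Σ gs (λ g → treeFactor F * guard (open? κ (slot F g)) (weight (attach (proj₁ (slot F g)) (states F))))
        ≈⟨ Σ-distribˡ gs _ _ ⟩
      treeFactor F * Σ gs (λ g → guard (open? κ (slot F g)) (weight (attach (proj₁ (slot F g)) (states F))))
        ≈⟨ *-congˡ (Σ-slots (slots F) (λ k → weight (attach k (states F)))) ⟩
      treeFactor F * Σslot κ (λ k → weight (attach k (states F))) (slots F)
        ≈⟨ *-congˡ (Σslots κ _ F v eq) ⟩
      treeFactor F * Σstate κ (λ k → weight (attach k (states F))) (states F)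
        ≈⟨ *-congˡ (D-weight (states F)) ⟨
      treeFactor F * D (weight (states F))
        ≈⟨ D-const-* (treeFactor-const F) _ ⟨
      D (treeFactor F * weight (states F)) ∎
      where
      gs = upTo (length (slots F))

    -- The generating functions Σ_C x^|C| b(t₁) f_C W_C over connected diagrams,
    -- for a constant sequence b, and of the forests following D¹.

    treeSeries : (ℕ → Carrier) → Ser
    treeSeries b zero    = 0#
    treeSeries b (suc n) = Σ (forests n) (λ F → b (firstLabel F) * treeWeight F)

    forestSeries : Ser
    forestSeries n = Σ (forests n) forestWeight

    attachedSeries : (ℕ → Carrier) → Forest → ℕ → Carrier
    attachedSeries b F g = b (firstLabel F) * attachedWeight F g

    D-Σ : ∀ {h : Forest → Carrier} xs → D (Σ xs h) ≈ Σ xs (D ∘ h)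
    D-Σ []       = D-0
    D-Σ (x ∷ xs) = trans (D-+ _ _) (+-congˡ (D-Σ xs))

    Σ-D-treeSeries : ∀ b → (∀ k → Constant (b k)) → ∀ n →
                     Σ (forests n) (Σgaps (attachedSeries b)) ≈ D (treeSeries b (suc n))
    Σ-D-treeSeries b bc n = trans (Σ-cong (forests n) each) (sym (D-Σ (forests n)))
      where
      each : ∀ {F} → F ∈ forests n → Σgaps (attachedSeries b) F ≈ D (b (firstLabel F) * treeWeight F)
      each {F} F∈ = begin
        Σ (upTo (length (slots F))) (λ g → b (firstLabel F) * attachedWeight F g)
          ≈⟨ Σ-distribˡ (upTo (length (slots F))) _ _ ⟩
        b (firstLabel F) * Σ (upTo (length (slots F))) (attachedWeight F)
          ≈⟨ *-congˡ (Σ-attachedWeight F (forests-valid n F∈)) ⟩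
        b (firstLabel F) * D (treeWeight F)
          ≈⟨ D-const-* (bc (firstLabel F)) _ ⟨
        D (b (firstLabel F) * treeWeight F) ∎

    -- Splitting off D¹ gives the recursion of the geometric series 1 / (1 - D (Σ_t f_t U_t)),
    -- without forming an inverse.
    forestSeries-suc : ∀ n → forestSeries (suc n) ≈
                       ((λ i → D (treeSeries f (suc i))) ⊛ forestSeries) n
    forestSeries-suc n = begin
      Σ (forests (suc n)) forestWeight
        ≡⟨ cong (λ xs → Σ xs forestWeight) (forests-suc n) ⟩
      Σ (convolve forests forests n) forestWeight
        ≈⟨ Σ-convolve (attachedSeries f) forestWeight forestWeight forests forests n forestWeight-fork ⟩
      ((λ i → Σ (forests i) (Σgaps (attachedSeries f))) ⊛ forestSeries) n
        ≈⟨ ⊛-cong-≤ n (λ m _ → Σ-D-treeSeries f f-const m) (λ _ _ → refl) ⟩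
      ((λ i → D (treeSeries f (suc i))) ⊛ forestSeries) n ∎

    module _ (b : ℕ → Carrier) (b-const : ∀ k → Constant (b k)) where

      treeSeries-one : treeSeries b 1 ≈ b 1 * ψ 0
      treeSeries-one = trans (+-identityʳ _) (*-congˡ treeWeight-leaf)

      -- If b is 1 at t + 1 and 0 elsewhere, this is U_{t+1} = k ∂U_t/∂z. The shift b ∘ suc
      -- expresses that t₁ grows by one with the root, for all t at once.
      treeSeries-suc : ∀ n → treeSeries b (suc (suc n)) ≈
                       f 0 * ψ 0 * ((λ i → D (treeSeries (b ∘ suc) (suc i))) ⊛ forestSeries) n
      treeSeries-suc n = begin
        Σ (forests (suc n)) bw
          ≡⟨ cong (λ xs → Σ xs bw) (forests-suc n) ⟩
        Σ (convolve forests forests n) bw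
          ≈⟨ Σ-convolve scaled forestWeight bw forests forests n fork-eq ⟩
        ((λ i → Σ (forests i) (Σgaps scaled)) ⊛ forestSeries) n
          ≈⟨ ⊛-cong-≤ n (λ m _ → factor-out m) (λ _ _ → refl) ⟩
        ((λ i → f 0 * ψ 0 * D (treeSeries (b ∘ suc) (suc i))) ⊛ forestSeries) n
          ≈⟨ ⊛-scaleˡ (f 0 * ψ 0) _ forestSeries n ⟩
        f 0 * ψ 0 * ((λ i → D (treeSeries (b ∘ suc) (suc i))) ⊛ forestSeries) n ∎
        where
        bw : Forest → Carrier
        bw F = b (firstLabel F) * treeWeight F
        scaled : Forest → ℕ → Carrier
        scaled F g = f 0 * ψ 0 * attachedSeries (b ∘ suc) F g
        fork-eq : ∀ F₁ g F₂ → bw (fork F₁ g F₂) ≈ scaled F₁ g * forestWeight F₂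
        fork-eq F₁ g F₂ = trans (*-congˡ (treeWeight-fork F₁ g F₂))
          (solve 4 (λ x y z w → x :* (y :* (z :* w)) := y :* (x :* z) :* w) refl _ _ _ _)
        factor-out : ∀ i → Σ (forests i) (Σgaps scaled) ≈ f 0 * ψ 0 * D (treeSeries (b ∘ suc) (suc i))
        factor-out i = trans (Σ-cong (forests i) (λ {F} _ → Σ-distribˡ (upTo (length (slots F))) _ _))
          (trans (Σ-distribˡ (forests i) _ _) (*-congˡ (Σ-D-treeSeries (b ∘ suc) (b-const ∘ suc) i)))

  module TreeSeriesProperties {c ℓ : Level} (A : CommutativeRing c ℓ) {κ : Kind} (Z : TwistedDerivation A κ)
                              (coefficients : Coefficients A Z) where

    open CommutativeRing A
    open TwistedDerivation Z
    open TwistedProperties A Z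
    open Coefficients coefficients
    open PowerSeries A
    open ListSums A
    open TreeWeights A Z coefficients
    open import Algebra.Properties.Semiring.Mult semiring using () renaming (_×_ to _·_)
    open SetoidReasoning setoid
    private module S = CommutativeRing powerSeriesRing

    D∘ : Ser → Ser
    D∘ a n = D (a n)

    -- The coefficient k of the transport equation is x times this series.
    slope : Ser
    slope n = f 0 * ψ 0 * forestSeries n

    slope-⊛ : ∀ a n → a 0 ≈ 0# → (slope ⊛ a) (suc n) ≈ f 0 * ψ 0 * (tail a ⊛ forestSeries) n
    slope-⊛ a n a₀≈0 = begin
      (slope ⊛ a) (suc n)                         ≈⟨ ⊛-scaleˡ (f 0 * ψ 0) forestSeries a (suc n) ⟩
      f 0 * ψ 0 * (forestSeries ⊛ a) (suc n)      ≈⟨ *-congˡ (⊛-comm forestSeries a (suc n)) ⟩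
      f 0 * ψ 0 * (a ⊛ forestSeries) (suc n)      ≈⟨ *-congˡ (trans (+-congʳ (trans (*-congʳ a₀≈0) (zeroˡ _))) (+-identityˡ _)) ⟩
      f 0 * ψ 0 * (tail a ⊛ forestSeries) n       ∎

    -- First labels start at 1, so agreement from 1 on suffices.
    treeSeries-cong : ∀ {b b′} → (∀ t → b (suc t) ≈ b′ (suc t)) → treeSeries b ≋ treeSeries b′
    treeSeries-cong eq = mk≋ λ where
      zero    → refl
      (suc n) → Σ-cong (forests n) λ { {leaf} _ → *-congʳ (eq _) ; {fork _ _ _} _ → *-congʳ (eq _) }

    treeSeries-+ : ∀ b b′ → treeSeries (λ t → b t + b′ t) ≋ treeSeries b ⊞ treeSeries b′
    treeSeries-+ b b′ = mk≋ λ where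
      zero    → sym (+-identityˡ 0#)
      (suc n) → trans (Σ-cong (forests n) (λ _ → distribʳ _ _ _)) (Σ-+ (forests n) _ _)

    treeSeries-0 : treeSeries (λ _ → 0#) ≋ 𝟎
    treeSeries-0 = mk≋ λ where
      zero    → refl
      (suc n) → Σ-0 (forests n) (λ _ → zeroˡ _)

    treeSeries-· : ∀ m b n → treeSeries (λ t → m · b t) n ≈ m · treeSeries b n
    treeSeries-· zero    b n = at treeSeries-0 n
    treeSeries-· (suc m) b n =
      trans (at (treeSeries-+ b (λ t → m · b t)) n) (+-congˡ (treeSeries-· m b n))

    treeSeries-unfold : ∀ b → (∀ k → Constant (b k)) → ∀ n → treeSeries b (suc n) ≈
                        const (b 1 * ψ 0) n + (slope ⊛ D∘ (treeSeries (b ∘ suc))) n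
    treeSeries-unfold b bc zero    = trans (treeSeries-one b bc)
      (sym (trans (+-congˡ (trans (*-congˡ D-0) (zeroʳ _))) (+-identityʳ _)))
    treeSeries-unfold b bc (suc n) = trans (treeSeries-suc b bc n)
      (sym (trans (+-identityˡ _) (slope-⊛ (D∘ (treeSeries (b ∘ suc))) n D-0)))

    slope-unfold : ∀ n → slope n ≈ const (f 0 * ψ 0) n + (slope ⊛ D∘ (treeSeries f)) n
    slope-unfold zero    = begin
      f 0 * ψ 0 * (forestWeight leaf + 0#)         ≈⟨ *-congˡ (trans (+-identityʳ _) forestWeight-leaf) ⟩
      f 0 * ψ 0 * 1#                               ≈⟨ *-identityʳ _ ⟩
      f 0 * ψ 0                                    ≈⟨ +-identityʳ _ ⟨
      f 0 * ψ 0 + 0#                               ≈⟨ +-congˡ (trans (*-congˡ D-0) (zeroʳ _)) ⟨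
      f 0 * ψ 0 + slope 0 * D 0#                   ∎
    slope-unfold (suc n) = trans (*-congˡ (forestSeries-suc n))
      (sym (trans (+-identityˡ _) (slope-⊛ (D∘ (treeSeries f)) n D-0)))

  -- The binomial coefficient C(k + j, k), by Pascal's rule. Multiplied by φ_{k+j}, it is the
  -- coefficient of zʲ in φ⁽ᵏ⁾(z)/k!.
  polynomialNumber : ℕ → ℕ → ℕ
  polynomialNumber k       zero    = 1
  polynomialNumber zero    (suc j) = 1
  polynomialNumber (suc k) (suc j) = polynomialNumber k (suc j) ℕ.+ polynomialNumber (suc k) j

  -- Both sides are (k + j + 1)! / (k! j!).
  polynomialNumber-suc : ∀ k j → suc j ℕ.* polynomialNumber k (suc j) ≡ suc k ℕ.* polynomialNumber (suc k) j
  polynomialNumber-suc zero zero    = ≡.refl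
  polynomialNumber-suc zero (suc j) = cong suc (≡.trans (polynomialNumber-suc zero j) (≡.refl))
  polynomialNumber-suc (suc k) zero = ≡.trans (ℕₚ.+-identityʳ _) (≡.trans (ℕₚ.+-comm (polynomialNumber k 1) 1)
    (cong suc (≡.trans (≡.sym (ℕₚ.+-identityʳ _)) (polynomialNumber-suc k zero))))
  polynomialNumber-suc (suc k) (suc j) = begin
    suc (suc j) ℕ.* (p ℕ.+ q)                                 ≡⟨ ℕₚ.*-distribˡ-+ (suc (suc j)) p q ⟩
    suc (suc j) ℕ.* p ℕ.+ suc (suc j) ℕ.* q                   ≡⟨ cong (ℕ._+ suc (suc j) ℕ.* q) (polynomialNumber-suc k (suc j)) ⟩
    suc k ℕ.* q ℕ.+ suc (suc j) ℕ.* q                         ≡⟨ solve 3 (λ a b c → (con 1 :+ a) :* c :+ (con 2 :+ b) :* c := (con 2 :+ a) :* c :+ (con 1 :+ b) :* c) ≡.refl k j q ⟩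
    suc (suc k) ℕ.* q ℕ.+ suc j ℕ.* q                         ≡⟨ cong (suc (suc k) ℕ.* q ℕ.+_) (polynomialNumber-suc (suc k) j) ⟩
    suc (suc k) ℕ.* q ℕ.+ suc (suc k) ℕ.* r                   ≡⟨ ℕₚ.*-distribˡ-+ (suc (suc k)) q r ⟨
    suc (suc k) ℕ.* (q ℕ.+ r)                                 ∎
    where
    open ≡.≡-Reasoning
    open import Data.Nat.Solver using (module +-*-Solver)
    open +-*-Solver
    p = polynomialNumber k (suc (suc j))
    q = polynomialNumber (suc k) (suc j)
    r = polynomialNumber (suc (suc k)) j

  -- The expansion H = x φ(z + G).

  module ExpansionEquation {c ℓ : Level} (K : CommutativeRing c ℓ) (κ : Kind)
                           (φ f : ℕ → CommutativeRing.Carrier K) where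

    private
      module K = CommutativeRing K
      module PK = PowerSeries K

    open import Algebra.Properties.Semiring.Mult K.semiring as KMult using () renaming (_×_ to _·_)

    A : CommutativeRing c ℓ
    A = PK.powerSeriesRing

    Z : TwistedDerivation A κ
    Z = derivation K κ

    shifted : Kind → ℕ → ℕ → K.Carrier
    shifted binomial k j = polynomialNumber k j · φ (k ℕ.+ j)
    shifted divided  k j = φ (k ℕ.+ j)

    ∂-shifted : ∀ κ k j → multiplicity κ (suc j) · shifted κ k (suc j) K.≈ multiplicity κ (suc k) · shifted κ (suc k) j
    ∂-shifted divided  k j = KMult.×-congʳ 1 (K.reflexive (cong φ (ℕₚ.+-suc k j)))
    ∂-shifted binomial k j = begin
      suc j · (polynomialNumber k (suc j) · φ (k ℕ.+ suc j))
        ≈⟨ KMult.×-assocˡ _ (suc j) (polynomialNumber k (suc j)) ⟩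
      (suc j ℕ.* polynomialNumber k (suc j)) · φ (k ℕ.+ suc j)
        ≈⟨ K.reflexive (cong₂ (λ m n → m · φ n) (polynomialNumber-suc k j) (ℕₚ.+-suc k j)) ⟩
      (suc k ℕ.* polynomialNumber (suc k) j) · φ (suc k ℕ.+ j)
        ≈⟨ KMult.×-assocˡ _ (suc k) (polynomialNumber (suc k) j) ⟨
      suc k · (polynomialNumber (suc k) j · φ (suc k ℕ.+ j)) ∎
      where open SetoidReasoning K.setoid

    shifted-0 : ∀ k → shifted κ k 0 K.≈ φ k
    shifted-0 k = go κ
      where
      go : ∀ κ → shifted κ k 0 K.≈ φ k
      go binomial = K.trans (K.+-identityʳ _) (K.reflexive (cong φ (ℕₚ.+-identityʳ k)))
      go divided  = K.reflexive (cong φ (ℕₚ.+-identityʳ k))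

    module A where
      open CommutativeRing A public
      open import Algebra.Properties.Semiring.Mult semiring public using () renaming (_×_ to _·_)

    open TwistedProperties A Z using (Constant; D-const; ε-const)

    embed : K.Carrier → A.Carrier
    embed = PK.const

    embed-const : ∀ k → Constant (embed k)
    embed-const = derivation-constant K κ

    coefficients : Coefficients A Z
    coefficients = record
      { ψ       = shifted κ
      ; f       = λ n → embed (f n)
      ; D-ψ     = λ k → PK.mk≋ λ j → K.trans (∂-shifted κ k j)
                    (K.reflexive (≡.sym (×ˢ-at K (multiplicity κ (suc k)) (shifted κ (suc k)) j)))
      ; f-const = λ n → embed-const (f n)
      }

    open PowerSeries A using (_≋_; mk≋; at; _⊛_; _⊞_; 𝟎; tail; const; const-⊛; ⊛-cong-≤; ⊛-zeroˡ)
    open TreeWeights A Z coefficients using (treeSeries)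
    open TreeSeriesProperties A Z coefficients
    open TwistedDerivation Z using (D; ε; D-cong; D-+)
    open TwistedProperties A Z using (D-0)

    -- A is K[[z]], B is A[[y]] and X is B[[x]], with x outermost for the inductions on its degree.
    -- The tree series live in A[[x]], which is the same ring as B with the variable renamed.
    B X : CommutativeRing c ℓ
    B = PowerSeries.powerSeriesRing A
    X = PowerSeries.powerSeriesRing B

    private
      module PB = PowerSeries B
      module X  = CommutativeRing X

    ZX YX : TwistedDerivation X κ
    ZX = lift B (lift A Z)
    YX = lift B (derivation A κ)

    ι : A.Carrier → X.Carrier
    ι a = PB.const (const a)

    ψX : ℕ → X.Carrier
    ψX k = ι (shifted κ k)

    -- The shift of the index is the factor x in k.
    slopeX : X.Carrier
    slopeX zero    = 𝟎
    slopeX (suc n) = const (slope n)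

    const-⊛X : ∀ s a n j → ((λ m → const (s m)) PB.⊛ a) n j A.≈ (s ⊛ (λ m → a m j)) n
    const-⊛X s a zero    j = const-⊛ (s 0) (a 0) j
    const-⊛X s a (suc n) j = A.+-cong (const-⊛ (s 0) (a (suc n)) j) (const-⊛X (s ∘ suc) a n j)

    slopeX-⊛ : ∀ a n j → (slopeX PB.⊛ a) (suc n) j A.≈ (slope ⊛ (λ m → a m j)) n
    slopeX-⊛ a n j = A.trans (A.+-congʳ (⊛-zeroˡ (a (suc n)) j))
      (A.trans (A.+-identityˡ _) (const-⊛X slope a n j))

    embed-cong : ∀ {a b} → a K.≈ b → embed a A.≈ embed b
    embed-cong = const-cong K

    embed-· : ∀ m a → m A.· embed a A.≈ embed (m · a)
    embed-· m a = A.sym (const-× K m a)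

    ·-constant : ∀ m {a} → Constant a → Constant (m A.· a)
    ·-constant m {a} p = record
      { D-const = A.trans (TwistedProperties.D-× A Z m a) (A.trans (·-cong m (D-const p)) (×-0 A m))
      ; ε-const = go m
      }
      where
      open import Algebra.Properties.Semiring.Mult A.semiring using () renaming (×-congʳ to ·-cong)
      go : ∀ m → ε (m A.· a) A.≈ m A.· a
      go zero    = TwistedProperties.ε-0 A Z
      go (suc m) = A.trans (TwistedDerivation.ε-+ Z _ _) (A.+-cong (ε-const p) (go m))

    -- With e_s = yˢ/s! or yˢ, the rows are h t = e_{t-1} and l t = L(e_{t-1}), read as coefficients
    -- in y, and row 0 vanishes. For `l-suc`: the y-derivative of L(e_t) is F(∂) e_t, and L(e_{t-1})
    -- is F(∂) e_t without its constant term f_t.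
    record Kernels : Set (c Level.⊔ ℓ) where
      field
        l h    : ℕ → ℕ → K.Carrier
        l-0    : ∀ j → l 0 j K.≈ K.0#
        l-y⁰   : ∀ t → l t 0 K.≈ K.0#
        l-suc  : ∀ t j → multiplicity κ (suc j) · l (suc t) (suc j) K.≈ l t j K.+ PK.const (f t) j
        h-0    : ∀ j → h 0 j K.≈ K.0#
        h-1-y⁰ : h 1 0 K.≈ K.1#
        h-y⁰   : ∀ t → h (suc (suc t)) 0 K.≈ K.0#
        h-suc  : ∀ t j → multiplicity κ (suc j) · h (suc t) (suc j) K.≈ h t j
        cancel : ∀ m {a b} → multiplicity κ (suc m) · a K.≈ multiplicity κ (suc m) · b → a K.≈ b

    open import Algebra.Properties.Semiring.Exp X.semiring using () renaming (_^_ to _X^_)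
    open import Algebra.Properties.Semiring.Exp (CommutativeRing.semiring B) using () renaming (_^_ to _B^_)
    import Algebra.Properties.Semiring.Mult X.semiring as XMult

    module Solve (kernels : Kernels) where

      open Kernels kernels

      series : (ℕ → ℕ → K.Carrier) → X.Carrier
      series b n j = treeSeries (λ t → embed (b t j)) n

      G H : X.Carrier
      G = series l
      H = series h

      -- ∂y lowers the index of the kernels, while attaching a root raises t₁; the two shifts meet
      -- in `treeSeries-unfold`. The first summand comes from the single chord.
      ∂y-series : ∀ (b b′ : ℕ → ℕ → K.Carrier) → (∀ t j → multiplicity κ (suc j) · b (suc t) (suc j) K.≈ b′ t j) → ∀ n j →
                  multiplicity κ (suc j) A.· series b (suc n) (suc j) A.≈
                  const (embed (b′ 0 j) A.* shifted κ 0) n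
                    A.+ (slope ⊛ D∘ (treeSeries (λ t → embed (b′ t j)))) n
      ∂y-series b b′ eq n j = begin
        m A.· treeSeries (λ t → embed (b t (suc j))) (suc n)
          ≈⟨ treeSeries-· m (λ t → embed (b t (suc j))) (suc n) ⟨
        treeSeries (λ t → m A.· embed (b t (suc j))) (suc n)
          ≈⟨ treeSeries-unfold (λ t → m A.· embed (b t (suc j))) (λ t → ·-constant m (embed-const (b t (suc j)))) n ⟩
        const ((m A.· embed (b 1 (suc j))) A.* shifted κ 0) n
          A.+ (slope ⊛ D∘ (treeSeries (λ t → m A.· embed (b (suc t) (suc j))))) n
          ≈⟨ A.+-cong (at (const-cong A (A.*-congʳ {shifted κ 0} (each 0))) n)
               (⊛-cong-≤ n (λ _ _ → A.refl) (λ k _ → D-cong (at (treeSeries-cong {λ t → m A.· embed (b (suc t) (suc j))} {λ t → embed (b′ t j)} (λ t → each (suc t))) k))) ⟩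
        const (embed (b′ 0 j) A.* shifted κ 0) n A.+ (slope ⊛ D∘ (treeSeries (λ t → embed (b′ t j)))) n ∎
        where
        open SetoidReasoning A.setoid
        m = multiplicity κ (suc j)
        each : ∀ t → m A.· embed (b (suc t) (suc j)) A.≈ embed (b′ t j)
        each t = A.trans (embed-· m (b (suc t) (suc j))) (embed-cong {multiplicity κ (suc j) · b (suc t) (suc j)} {b′ t j} (eq t j))

      D-series : X.Carrier → X.Carrier
      D-series = TwistedDerivation.D ZX

      unit : ∀ n j → X.1# n j A.≈ const (const A.1# j) n
      unit zero    j       = A.refl
      unit (suc n) j       = A.refl

      -- By `l-suc`, ∂y splits G into the part k ∂G/∂z and a part independent of y. The latter is f₀
      -- φ(z) + slope ∂(Σ_t f_t U_t)/∂z up to the factor x, which is `slope` by `slope-unfold` and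
      -- yields the summand 1.
      ∂y-G : TwistedDerivation.D YX G X.≈ slopeX PB.⊛ (X.1# PB.⊞ D-series G)
      ∂y-G = PB.mk≋ λ n → mk≋ (go n)
        where
        open SetoidReasoning A.setoid
        f₀ = embed (f 0)
        ψ₀ = shifted κ 0
        Gⱼ : ℕ → ℕ → A.Carrier
        Gⱼ j n = G n j
        split : ∀ j k → treeSeries (λ t → embed (l t j K.+ PK.const (f t) j)) k A.≈
                G k j A.+ treeSeries (λ t → embed (PK.const (f t) j)) k
        split j k = A.trans (at (treeSeries-cong λ t → embed-+ (l (suc t) j) (PK.const (f (suc t)) j)) k)
                            (at (treeSeries-+ (λ t → embed (l t j)) (λ t → embed (PK.const (f t) j))) k)
          where
          embed-+ : ∀ a b → embed (a K.+ b) A.≈ embed a A.+ embed b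
          embed-+ a b = PK.mk≋ λ { zero → K.refl ; (suc _) → K.sym (K.+-identityˡ K.0#) }
        source : ∀ j n → const (embed (l 0 j K.+ PK.const (f 0) j) A.* ψ₀) n
                   A.+ (slope ⊛ D∘ (treeSeries (λ t → embed (PK.const (f t) j)))) n
                 A.≈ (slope ⊛ const (const A.1# j)) n
        source zero n = begin
          const (embed (l 0 0 K.+ f 0) A.* ψ₀) n A.+ (slope ⊛ D∘ (treeSeries (λ t → embed (f t)))) n
            ≈⟨ A.+-congʳ (at (const-cong A (A.*-congʳ (embed-cong (K.trans (K.+-congʳ (l-0 0)) (K.+-identityˡ _))))) n) ⟩
          const (f₀ A.* ψ₀) n A.+ (slope ⊛ D∘ (treeSeries (λ t → embed (f t)))) n
            ≈⟨ slope-unfold n ⟨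
          slope n
            ≈⟨ A.trans (at (CommutativeRing.*-identityʳ B slope) n) A.refl ⟨
          (slope ⊛ const A.1#) n ∎
        source (suc j) n = begin
          const (embed (l 0 (suc j) K.+ K.0#) A.* ψ₀) n
            A.+ (slope ⊛ D∘ (treeSeries (λ t → embed K.0#))) n
            ≈⟨ A.+-cong (at vanish n) (A.trans (⊛-cong-≤ n (λ _ _ → A.refl) (λ k _ → A.trans (D-cong (zero-series k)) D-0))
                 (at (CommutativeRing.zeroʳ B slope) n)) ⟩
          A.0# A.+ A.0#
            ≈⟨ A.+-identityˡ _ ⟩
          A.0#
            ≈⟨ at (CommutativeRing.zeroʳ B slope) n ⟨
          (slope ⊛ 𝟎) n
            ≈⟨ ⊛-cong-≤ n (λ _ _ → A.refl) (λ k _ → at (const-0 A) k) ⟨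
          (slope ⊛ const A.0#) n ∎
          where
          vanish : const (embed (l 0 (suc j) K.+ K.0#) A.* ψ₀) ≋ 𝟎
          vanish = CommutativeRing.trans B (const-cong A (A.trans (A.*-congʳ (A.trans
            (embed-cong (K.trans (K.+-identityʳ _) (l-0 (suc j)))) (const-0 K))) (A.zeroˡ _))) (const-0 A)
          zero-series : ∀ k → treeSeries (λ t → embed K.0#) k A.≈ A.0#
          zero-series k = A.trans (at (treeSeries-cong (λ _ → const-0 K)) k) (at treeSeries-0 k)
        go : ∀ n j → TwistedDerivation.D YX G n j A.≈ (slopeX PB.⊛ (X.1# PB.⊞ D-series G)) n j
        go zero    j = A.trans (×-0 A (multiplicity κ (suc j))) (A.sym (⊛-zeroˡ _ j))
        go (suc n) j = begin
          multiplicity κ (suc j) A.· G (suc n) (suc j)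
            ≈⟨ ∂y-series l (λ t j → l t j K.+ PK.const (f t) j) l-suc n j ⟩
          const (embed (l 0 j K.+ PK.const (f 0) j) A.* ψ₀) n
            A.+ (slope ⊛ D∘ (treeSeries (λ t → embed (l t j K.+ PK.const (f t) j)))) n
            ≈⟨ A.+-congˡ (⊛-cong-≤ n (λ _ _ → A.refl) (λ k _ → A.trans (D-cong (split j k)) (D-+ (G k j) (Fⱼ k)))) ⟩
          const (embed (l 0 j K.+ PK.const (f 0) j) A.* ψ₀) n A.+ (slope ⊛ (D∘ (Gⱼ j) ⊞ D∘ Fⱼ)) n
            ≈⟨ A.+-congˡ (at (CommutativeRing.distribˡ B slope (D∘ (Gⱼ j)) (D∘ Fⱼ)) n) ⟩
          const (embed (l 0 j K.+ PK.const (f 0) j) A.* ψ₀) n A.+ ((slope ⊛ D∘ (Gⱼ j)) n A.+ (slope ⊛ D∘ Fⱼ) n)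
            ≈⟨ A.+-congˡ (A.+-comm _ _) ⟩
          const (embed (l 0 j K.+ PK.const (f 0) j) A.* ψ₀) n A.+ ((slope ⊛ D∘ Fⱼ) n A.+ (slope ⊛ D∘ (Gⱼ j)) n)
            ≈⟨ A.+-assoc _ _ _ ⟨
          (const (embed (l 0 j K.+ PK.const (f 0) j) A.* ψ₀) n A.+ (slope ⊛ D∘ Fⱼ) n) A.+ (slope ⊛ D∘ (Gⱼ j)) n
            ≈⟨ A.+-congʳ (source j n) ⟩
          (slope ⊛ const (const A.1# j)) n A.+ (slope ⊛ D∘ (Gⱼ j)) n
            ≈⟨ at (CommutativeRing.distribˡ B slope _ _) n ⟨
          (slope ⊛ (const (const A.1# j) ⊞ D∘ (Gⱼ j))) n
            ≈⟨ ⊛-cong-≤ n (λ _ _ → A.refl) (λ k _ → A.+-congʳ (unit k j)) ⟨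
          (slope ⊛ (λ m → X.1# m j A.+ D (G m j))) n
            ≈⟨ slopeX-⊛ _ n j ⟨
          (slopeX PB.⊛ (X.1# PB.⊞ D-series G)) (suc n) j ∎
          where
          Fⱼ : ℕ → A.Carrier
          Fⱼ = treeSeries (λ t → embed (PK.const (f t) j))

      ∂y-H : ∀ n j → multiplicity κ (suc j) A.· H (suc n) (suc j) A.≈ (slopeX PB.⊛ D-series H) (suc n) j
      ∂y-H n j = begin
        multiplicity κ (suc j) A.· H (suc n) (suc j)
          ≈⟨ ∂y-series h h h-suc n j ⟩
        const (embed (h 0 j) A.* shifted κ 0) n A.+ (slope ⊛ (λ m → D (H m j))) n
          ≈⟨ A.+-congʳ (at (CommutativeRing.trans B (const-cong A (A.trans (A.*-congʳ (A.trans (embed-cong (h-0 j)) (const-0 K))) (A.zeroˡ _))) (const-0 A)) n) ⟩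
        A.0# A.+ (slope ⊛ (λ m → D (H m j))) n
          ≈⟨ A.+-identityˡ _ ⟩
        (slope ⊛ (λ m → D (H m j))) n
          ≈⟨ slopeX-⊛ _ n j ⟨
        (slopeX PB.⊛ D-series H) (suc n) j ∎
        where open SetoidReasoning A.setoid

      -- At y = 0 only t₁ = 1 is left, which holds for the single chord alone.
      H-y⁰ : ∀ n → H (suc n) 0 A.≈ const (shifted κ 0) n
      H-y⁰ n = begin
        treeSeries (λ t → embed (h t 0)) (suc n)
          ≈⟨ treeSeries-unfold (λ t → embed (h t 0)) (λ t → embed-const (h t 0)) n ⟩
        const (embed (h 1 0) A.* shifted κ 0) n A.+ (slope ⊛ D∘ (treeSeries (λ t → embed (h (suc t) 0)))) n
          ≈⟨ A.+-cong (at (const-cong A (A.trans (A.*-congʳ (embed-cong h-1-y⁰)) (A.*-identityˡ _))) n)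
               (A.trans (⊛-cong-≤ n (λ _ _ → A.refl) (λ k _ → A.trans (D-cong (A.trans (at (treeSeries-cong (λ t → A.trans (embed-cong (h-y⁰ t)) (const-0 K))) k) (at treeSeries-0 k))) D-0))
                 (at (CommutativeRing.zeroʳ B slope) n)) ⟩
        const (shifted κ 0) n A.+ A.0#
          ≈⟨ A.+-identityʳ _ ⟩
        const (shifted κ 0) n ∎
        where open SetoidReasoning A.setoid

      G-y⁰ : ∀ n → G n 0 A.≈ A.0#
      G-y⁰ n = A.trans (at (treeSeries-cong (λ t → A.trans (embed-cong (l-y⁰ (suc t))) (const-0 K))) n) (at treeSeries-0 n)

      εy-G : κ ≡ divided → TwistedDerivation.ε YX G X.≈ X.0#
      εy-G ≡.refl = PB.mk≋ λ n → mk≋ λ { zero → G-y⁰ n ; (suc _) → A.refl }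

      ψX-const : ∀ k → TwistedProperties.Constant X YX (ψX k)
      ψX-const k = lift-constant B (derivation A κ) (derivation-constant A κ (shifted κ k))

      D-ψX : ∀ k → D-series (ψX k) X.≈ XMult._×_ (multiplicity κ (suc k)) (ψX (suc k))
      D-ψX k = X.trans (lift-D-const B (lift A Z) (const (shifted κ k)))
        (X.trans (const-cong B (CommutativeRing.trans B (lift-D-const A Z (shifted κ k))
           (CommutativeRing.trans B (const-cong A (Coefficients.D-ψ coefficients k)) (const-× A (multiplicity κ (suc k)) _))))
          (const-× B (multiplicity κ (suc k)) (const (shifted κ (suc k)))))

      open TransportEquation.Truncation X ZX YX ψX ψX-const D-ψX slopeX G ∂y-G εy-G

      w : X.Carrier
      w = TwistedDerivation.ε ZX G

      ⊛X-zeroˡ : ∀ (a b : X.Carrier) n → (∀ m → m ≤ n → a m ≋ 𝟎) → (a PB.⊛ b) n ≋ 𝟎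
      ⊛X-zeroˡ a b n a≈0 = CommutativeRing.trans B
        (PB.⊛-cong-≤ n a≈0 (λ _ _ → CommutativeRing.refl B)) (PB.⊛-zeroˡ b n)

      ⊛X-zeroʳ : ∀ (a b : X.Carrier) n → (∀ m → m ≤ n → b m ≋ 𝟎) → (a PB.⊛ b) n ≋ 𝟎
      ⊛X-zeroʳ a b n b≈0 = CommutativeRing.trans B (PB.⊛-comm a b n) (⊛X-zeroˡ b a n b≈0)

      w-0 : w 0 ≋ 𝟎
      w-0 = TwistedProperties.ε-0 B (lift A Z)

      -- G has no constant term in x, hence neither has ε G, and its N-th power is divisible by x^N.
      w^-order : ∀ N m → m < N → (w X^ N) m ≋ 𝟎
      w^-order (suc N) zero    _        =
        CommutativeRing.trans B (CommutativeRing.*-congʳ B w-0) (CommutativeRing.zeroˡ B _)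
      w^-order (suc N) (suc m) (s≤s m<) = CommutativeRing.trans B
        (CommutativeRing.+-cong B (CommutativeRing.trans B (CommutativeRing.*-congʳ B w-0) (CommutativeRing.zeroˡ B _))
          (⊛X-zeroʳ (PB.tail w) (w X^ N) m (λ k k≤m → w^-order N k (ℕₚ.≤-<-trans k≤m m<))))
        (CommutativeRing.+-identityˡ B _)

      remainder-order : ∀ N m → m < N → remainder N m ≋ 𝟎
      remainder-order N m m<N =
        ⊛X-zeroʳ _ (w X^ N) m (λ k k≤m → w^-order N k (ℕₚ.≤-<-trans k≤m m<N))

      ⊛X-y⁰ˡ : ∀ (a b : X.Carrier) n → (∀ m → a m 0 A.≈ A.0#) → (a PB.⊛ b) n 0 A.≈ A.0#
      ⊛X-y⁰ˡ a b zero    a≈0 = A.trans (A.*-congʳ (a≈0 0)) (A.zeroˡ _)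
      ⊛X-y⁰ˡ a b (suc n) a≈0 = A.trans (A.+-cong (A.trans (A.*-congʳ (a≈0 0)) (A.zeroˡ _)) (⊛X-y⁰ˡ (a ∘ suc) b n (a≈0 ∘ suc)))
        (A.+-identityˡ _)

      -- G vanishes at y = 0, so of the Taylor polynomial only φ(z) remains.
      truncation-y⁰ : ∀ N n → truncation N n 0 A.≈ const (shifted κ 0) n
      truncation-y⁰ zero    n = A.trans (at (PB.at (X.*-identityʳ (ψX 0)) n) 0) (first n)
        where
        first : ∀ n → ψX 0 n 0 A.≈ const (shifted κ 0) n
        first zero    = A.refl
        first (suc _) = A.refl
      truncation-y⁰ (suc N) n = A.trans (A.+-cong (truncation-y⁰ N n)
          (A.trans (at (PB.at (X.*-comm (ψX (suc N)) (power (suc N))) n) 0)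
            (⊛X-y⁰ˡ (power (suc N)) (ψX (suc N)) n (λ m → ⊛X-y⁰ˡ G (w X^ N) m G-y⁰))))
        (A.+-identityʳ _)

      cancelA : ∀ m {a b} → multiplicity κ (suc m) A.· a A.≈ multiplicity κ (suc m) A.· b → a A.≈ b
      cancelA m {a} {b} eq = PK.mk≋ λ j → cancel m (K.trans (K.reflexive (≡.sym (×ˢ-at K (multiplicity κ (suc m)) a j)))
        (K.trans (PK.at eq j) (K.reflexive (×ˢ-at K (multiplicity κ (suc m)) b j))))

      module _ (N : ℕ) where

        -- In degree n ≤ N the term k · `remainder N` vanishes, since k contributes one further
        -- power of x. In k D(truncation) only degrees below n of the truncation occur, where the
        -- hypothesis replaces it by H.
        ∂y-truncation : ∀ n j → n ≤ N → (∀ m → m < n → H (suc m) ≋ truncation N m) →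
          multiplicity κ (suc j) A.· truncation N n (suc j) A.≈ (slope ⊛ (λ m → D (H m j))) n
        ∂y-truncation n j n≤N ih = begin
          TwistedDerivation.D YX (truncation N) n j
            ≈⟨ A.+-identityʳ _ ⟨
          TwistedDerivation.D YX (truncation N) n j A.+ A.0#
            ≈⟨ A.+-congˡ (at (remainder-vanishes n n≤N) j) ⟨
          TwistedDerivation.D YX (truncation N) n j A.+ (slopeX PB.⊛ remainder N) n j
            ≈⟨ at (PB.at (transport N) n) j ⟩
          (slopeX PB.⊛ D-series (truncation N)) n j
            ≈⟨ flow n ih ⟩
          (slope ⊛ (λ m → D (H m j))) n ∎
          where
          open SetoidReasoning A.setoid
          remainder-vanishes : ∀ n → n ≤ N → (slopeX PB.⊛ remainder N) n ≋ 𝟎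
          remainder-vanishes zero    _   = CommutativeRing.zeroˡ B _
          remainder-vanishes (suc n) n<N = CommutativeRing.trans B
            (CommutativeRing.+-congʳ B (CommutativeRing.zeroˡ B _))
            (CommutativeRing.trans B (CommutativeRing.+-identityˡ B _)
              (⊛X-zeroʳ (PB.tail slopeX) (remainder N) n
                (λ m m≤n → remainder-order N m (ℕₚ.≤-<-trans m≤n n<N))))
          flow : ∀ n → (∀ m → m < n → H (suc m) ≋ truncation N m) →
                 (slopeX PB.⊛ D-series (truncation N)) n j A.≈ (slope ⊛ (λ m → D (H m j))) n
          -- The left side vanishes because of the factor x in k, the right side because H has no
          -- constant term in x.
          flow zero    ih = A.trans (⊛-zeroˡ _ j) (A.sym (A.trans (A.*-congˡ D-0) (A.zeroʳ _)))
          flow (suc n) ih = begin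
            (slopeX PB.⊛ D-series (truncation N)) (suc n) j
              ≈⟨ slopeX-⊛ _ n j ⟩
            (slope ⊛ (λ m → D (truncation N m j))) n
              ≈⟨ ⊛-cong-≤ n (λ _ _ → A.refl) (λ m m≤n → D-cong (at (ih m (s≤s m≤n)) j)) ⟨
            (slope ⊛ (λ m → D (H (suc m) j))) n
              ≈⟨ A.+-identityʳ _ ⟨
            (slope ⊛ (λ m → D (H (suc m) j))) n A.+ A.0#
              ≈⟨ A.+-congˡ (A.trans (A.*-congˡ D-0) (A.zeroʳ _)) ⟨
            (slope ⊛ (λ m → D (H (suc m) j))) n A.+ slope (suc n) A.* D A.0#
              ≈⟨ PowerSeries.⊛-sucʳ A slope (λ m → D (H m j)) n ⟨
            (slope ⊛ (λ m → D (H m j))) (suc n) ∎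

        -- A series in y is determined by its value at 0 and its derivative, because the
        -- multiplicities can be cancelled.
        H≈truncation-step : ∀ n → n ≤ N → (∀ m → m < n → H (suc m) ≋ truncation N m) → H (suc n) ≋ truncation N n
        H≈truncation-step n n≤N ih = mk≋ λ where
          zero    → A.trans (H-y⁰ n) (A.sym (truncation-y⁰ N n))
          (suc j) → cancelA j (A.trans (∂y-H n j) (A.trans (slopeX-⊛ _ n j) (A.sym (∂y-truncation n j n≤N ih))))

        H≈truncation-below : ∀ n → n ≤ suc N → ∀ m → m < n → H (suc m) ≋ truncation N m
        H≈truncation-below (suc n) (s≤s n≤N) m (s≤s m≤n) with ℕₚ.m≤n⇒m<n∨m≡n m≤n
        ... | inj₁ m<n    = H≈truncation-below n (ℕₚ.m≤n⇒m≤1+n n≤N) m m<n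
        ... | inj₂ ≡.refl = H≈truncation-step n n≤N (H≈truncation-below n (ℕₚ.m≤n⇒m≤1+n n≤N))

        H≈truncation : H (suc N) ≋ truncation N N
        H≈truncation = H≈truncation-below (suc N) ℕₚ.≤-refl N ℕₚ.≤-refl

      -- Evaluation at z = 0; its target is B read as K[[y]][[x]].

      ev : X.Carrier → ℕ → ℕ → K.Carrier
      ev a n j = a n j 0

      private module BX = CommutativeRing B

      ev-⊛ : ∀ a b → ev (a PB.⊛ b) BX.≈ ev a ⊛ ev b
      ev-⊛ a b = mk≋ λ n → PK.mk≋ λ j → PK.at (Coefficientwise.homo-⊛ B A (λ b j → b j 0) (λ _ _ → A.refl)
        (λ a b → PK.mk≋ (Coefficientwise.homo-⊛ A K (λ a → a 0) (λ _ _ → K.refl) (λ _ _ → K.refl) a b)) a b n) j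

      ev-1 : ev X.1# BX.≈ BX.1#
      ev-1 = mk≋ λ { zero → PK.mk≋ (λ { zero → K.refl ; (suc _) → K.refl }) ; (suc _) → A.refl }

      ev-ε : ∀ a → ev (TwistedDerivation.ε ZX a) BX.≈ ev a
      ev-ε a = mk≋ λ n → PK.mk≋ λ j → K.reflexive (go κ (a n j))
        where
        go : ∀ κ (a : A.Carrier) → constantTerm K κ a 0 ≡ a 0
        go binomial a = ≡.refl
        go divided  a = ≡.refl

      composition : (ℕ → ℕ → K.Carrier) → ℕ → ℕ → ℕ → K.Carrier
      composition g zero    = const (PK.const (φ 0)) ⊛ BX.1#
      composition g (suc N) = composition g N ⊞ (const (PK.const (φ (suc N))) ⊛ (g B^ suc N))

      ev-ψX : ∀ k → ev (ψX k) BX.≈ const (PK.const (φ k))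
      ev-ψX k = mk≋ λ where
        zero    → PK.mk≋ λ { zero → shifted-0 k ; (suc _) → K.refl }
        (suc _) → A.refl

      ev-w^ : ∀ N → ev (w X^ N) BX.≈ ev G B^ N
      ev-w^ zero    = ev-1
      ev-w^ (suc N) = BX.trans (ev-⊛ w (w X^ N)) (BX.*-cong (ev-ε G) (ev-w^ N))

      -- At z = 0 the weight ψₙ becomes φₙ and ε G becomes G, so the Taylor polynomial of φ(z + G)
      -- becomes that of φ(G).
      ev-truncation : ∀ N → ev (truncation N) BX.≈ composition (ev G) N
      ev-truncation zero    = BX.trans (ev-⊛ (ψX 0) X.1#) (BX.*-cong (ev-ψX 0) ev-1)
      ev-truncation (suc N) = BX.+-cong (ev-truncation N) (BX.trans (ev-⊛ (ψX (suc N)) (power (suc N)))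
        (BX.*-cong (ev-ψX (suc N)) (BX.trans (ev-⊛ G (w X^ N)) (BX.*-congˡ (ev-w^ N)))))

      expansion : ∀ N → ev H (suc N) A.≈ composition (ev G) N N
      expansion N = A.trans (PK.mk≋ λ j → PK.at (at (H≈truncation N) j) 0) (at (ev-truncation N) N)

-- Connected chord diagrams and their trees.

module Diagrams where

  open import Defs
  open import Data.Bool.Base using (Bool; true; false; _∧_)
  open import Data.Empty using (⊥)
  open import Data.List.Base
    using (List; []; _∷_; map; filter; _++_; length; concatMap; zip; zipWith; applyUpTo;
           head; take; drop; upTo; cartesianProduct)
  open import Data.List.Extrema.Nat using (max; max≤v⁺; v≤max⁺; xs≤max)
  open import Data.List.Membership.Propositional using (_∈_; find; lose)
  open import Data.List.Membership.Propositional.Properties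
    using (∈-filter⁻; ∈-++⁺ˡ; ∈-++⁺ʳ; ∈-++⁻; ∈-map⁺; ∈-map⁻; ∈-filter⁺; ∈-upTo⁺;
           ∈-cartesianProduct⁺; ∈-cartesianProduct⁻; ∈-∃++)
  open import Data.List.Properties
    using (filter-accept; filter-reject; length-++; length-filter; ∷-injective;
           filter-++; filter-all; ++-identityʳ; length-map; take++drop≡id; ++-assoc;
           map-++; length-applyUpTo)
  open import Data.List.Relation.Binary.Permutation.Propositional
    using (_↭_; ↭-refl; ↭-sym; ↭-prep; ↭-trans; module PermutationReasoning; ↭⇒↭ₛ;
           ↭-swap)
  import Data.List.Relation.Binary.Permutation.Propositional.Properties as ↭ₚ
  import Data.List.Relation.Binary.Permutation.Setoid.Properties as ↭ₛ
  open import Data.List.Relation.Ternary.Interleaving.Propositional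
    using (Interleaving; []; consˡ; consʳ; toPermutation)
  open import Data.List.Relation.Unary.All as All using (All; []; _∷_; all?)
  import Data.List.Relation.Unary.All.Properties as Allₚ
  open import Data.List.Relation.Unary.AllPairs as AllPairs using (AllPairs; []; _∷_)
  import Data.List.Relation.Unary.AllPairs.Properties as AllPairsₚ
  open import Data.List.Relation.Unary.Any as Any using (here; there; Any)
  open import Data.List.Relation.Unary.Unique.Propositional using (Unique)
  import Data.List.Relation.Unary.Unique.Propositional.Properties as Uniqueₚ
  open import Data.Maybe.Base using (fromMaybe)
  open import Data.Nat.Base using (ℕ; _≤_; _<_; suc; _+_; _*_; zero; z≤n; s≤s; _∸_)
  import Data.Nat.Properties as ℕₚ
  open import Data.Product.Base using (_×_; _,_; proj₁; proj₂; ∃)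
  open import Data.Product.Properties using (,-injective)
  open import Data.Sum.Base as Sum using (_⊎_; inj₁; inj₂; [_,_]′)
  open import Data.Unit.Base using (tt)
  open import Function.Base using (_∘_; id)
  open import Relation.Binary.Construct.Closure.ReflexiveTransitive as Star
    using (Star; ε; _◅_; _◅◅_)
  open import Relation.Binary.Definitions using (tri<; tri≈; tri>)
  open import Relation.Binary.PropositionalEquality as ≡
    using (_≡_; refl; sym; trans; cong; cong₂; subst; _≢_; subst₂)
  open import Relation.Nullary.Decidable using (yes; no; ¬?; Dec; _×-dec_; _→-dec_)
  open import Relation.Nullary.Negation using (¬_; contradiction)
  open import Relation.Unary using (Decidable; Pred)
  open Series
  open Forests
  open TreeSeries

  -- Paths and components

  Sorted : Diagram → Set
  Sorted = AllPairs (λ c d → source c < source d)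

  Increasing : List ℕ → Set
  Increasing = AllPairs _<_

  module _ {a} {A : Set a} where

    ∈-interleaveˡ : ∀ {x : A} {L R X} → Interleaving L R X → x ∈ L → x ∈ X
    ∈-interleaveˡ (consˡ i) (here refl) = here refl
    ∈-interleaveˡ (consˡ i) (there p)   = there (∈-interleaveˡ i p)
    ∈-interleaveˡ (consʳ i) p           = there (∈-interleaveˡ i p)

    ∈-interleaveʳ : ∀ {x : A} {L R X} → Interleaving L R X → x ∈ R → x ∈ X
    ∈-interleaveʳ (consˡ i) p           = there (∈-interleaveʳ i p)
    ∈-interleaveʳ (consʳ i) (here refl) = here refl
    ∈-interleaveʳ (consʳ i) (there p)   = there (∈-interleaveʳ i p)

    ∈-interleave⁻ : ∀ {x : A} {L R X} → Interleaving L R X → x ∈ X → x ∈ L ⊎ x ∈ R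
    ∈-interleave⁻ (consˡ i) (here refl) = inj₁ (here refl)
    ∈-interleave⁻ (consˡ i) (there p)   = Sum.map there id (∈-interleave⁻ i p)
    ∈-interleave⁻ (consʳ i) (here refl) = inj₂ (here refl)
    ∈-interleave⁻ (consʳ i) (there p)   = Sum.map id there (∈-interleave⁻ i p)

    module _ {r} {R : A → A → Set r} where

      AllPairs-interleaveˡ : ∀ {L M X} → Interleaving L M X → AllPairs R X → AllPairs R L
      AllPairs-interleaveˡ []        _        = []
      AllPairs-interleaveˡ (consˡ i) (p ∷ ps) =
        All.tabulate (All.lookup p ∘ ∈-interleaveˡ i) ∷ AllPairs-interleaveˡ i ps
      AllPairs-interleaveˡ (consʳ i) (_ ∷ ps) = AllPairs-interleaveˡ i ps

      AllPairs-interleaveʳ : ∀ {L M X} → Interleaving L M X → AllPairs R X → AllPairs R M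
      AllPairs-interleaveʳ []        _        = []
      AllPairs-interleaveʳ (consˡ i) (_ ∷ ps) = AllPairs-interleaveʳ i ps
      AllPairs-interleaveʳ (consʳ i) (p ∷ ps) =
        All.tabulate (All.lookup p ∘ ∈-interleaveʳ i) ∷ AllPairs-interleaveʳ i ps

    module _ {p} {P : Pred A p} (P? : Decidable P) where

      filter-interleaveˡ : ∀ {L R X} → Interleaving L R X → All P L → All (¬_ ∘ P) R → filter P? X ≡ L
      filter-interleaveˡ []        _        _        = refl
      filter-interleaveˡ (consˡ i) (p ∷ ps) qs       = trans (filter-accept P? p) (cong (_ ∷_) (filter-interleaveˡ i ps qs))
      filter-interleaveˡ (consʳ i) ps       (q ∷ qs) = trans (filter-reject P? q) (filter-interleaveˡ i ps qs)

      filter-interleave : ∀ {L R X} → Interleaving L R X → Interleaving (filter P? L) (filter P? R) (filter P? X)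
      filter-interleave []                 = []
      filter-interleave {x ∷ _} (consˡ i) with P? x
      ... | yes _ = consˡ (filter-interleave i)
      ... | no  _ = filter-interleave i
      filter-interleave {_} {x ∷ _} (consʳ i) with P? x
      ... | yes _ = consʳ (filter-interleave i)
      ... | no  _ = filter-interleave i

      partition-interleave : ∀ X → Interleaving (filter P? X) (filter (¬? ∘ P?) X) X
      partition-interleave []       = []
      partition-interleave (x ∷ X) with P? x
      ... | yes _ = consˡ (partition-interleave X)
      ... | no  _ = consʳ (partition-interleave X)

    interleave-[]ˡ : ∀ {R X : List A} → Interleaving [] R X → X ≡ R
    interleave-[]ˡ []        = refl
    interleave-[]ˡ (consʳ i) = cong (_ ∷_) (interleave-[]ˡ i)

    filter-cong : ∀ {p q} {P : Pred A p} {Q : Pred A q} (P? : Decidable P) (Q? : Decidable Q) xs →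
                  (∀ {x} → x ∈ xs → P x → Q x) → (∀ {x} → x ∈ xs → Q x → P x) → filter P? xs ≡ filter Q? xs
    filter-cong P? Q? []       f g = refl
    filter-cong P? Q? (x ∷ xs) f g with P? x | Q? x
    ... | yes _ | yes _ = cong (x ∷_) (filter-cong P? Q? xs (f ∘ there) (g ∘ there))
    ... | yes p | no ¬q = contradiction (f (here refl) p) ¬q
    ... | no ¬p | yes q = contradiction (g (here refl) q) ¬p
    ... | no _  | no _  = filter-cong P? Q? xs (f ∘ there) (g ∘ there)

  cross-sym : ∀ {c d} → Cross c d → Cross d c
  cross-sym = Sum.swap

  edge-sym : ∀ {C c d} → Edge C c d → Edge C d c
  edge-sym (p , q , x) = q , p , cross-sym x

  path-sym : ∀ {C c d} → Path C c d → Path C d c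
  path-sym = Star.reverse edge-sym

  path-mono : ∀ {C C′ c d} → (∀ {x} → x ∈ C → x ∈ C′) → Path C c d → Path C′ c d
  path-mono f = Star.map (λ (p , q , x) → f p , f q , x)

  NonCrossing : Diagram → Diagram → Set
  NonCrossing D E = ∀ {d e} → d ∈ D → e ∈ E → ¬ Cross d e

  module _ {D E X : Diagram} (i : Interleaving D E X) (nc : NonCrossing D E) where

    path-restrictˡ : ∀ {c d} → Path X c d → c ∈ D → Path D c d × d ∈ D
    path-restrictˡ ε                   c∈ = ε , c∈
    path-restrictˡ ((_ , d∈ , x) ◅ es) c∈ with ∈-interleave⁻ i d∈
    ... | inj₁ d∈D = let (p , q) = path-restrictˡ es d∈D in (c∈ , d∈D , x) ◅ p , q
    ... | inj₂ d∈E = contradiction x (nc c∈ d∈E)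

    path-restrictʳ : ∀ {c d} → Path X c d → c ∈ E → Path E c d × d ∈ E
    path-restrictʳ ε                   c∈ = ε , c∈
    path-restrictʳ ((_ , d∈ , x) ◅ es) c∈ with ∈-interleave⁻ i d∈
    ... | inj₂ d∈E = let (p , q) = path-restrictʳ es d∈E in (c∈ , d∈E , x) ◅ p , q
    ... | inj₁ d∈D = contradiction (cross-sym x) (nc d∈D c∈)

  sorted-injective : ∀ {C} → Sorted C → ∀ {c d} → c ∈ C → d ∈ C → source c ≡ source d → c ≡ d
  sorted-injective (_ ∷ _)  (here refl) (here refl) _  = refl
  sorted-injective (p ∷ _)  (here refl) (there q)   eq = contradiction eq (ℕₚ.<⇒≢ (All.lookup p q))
  sorted-injective (p ∷ _)  (there q)   (here refl) eq = contradiction (sym eq) (ℕₚ.<⇒≢ (All.lookup p q))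
  sorted-injective (_ ∷ ps) (there p)   (there q)   eq = sorted-injective ps p q eq

  interleave-disjoint : ∀ {L R X} → Interleaving L R X → Sorted X → ∀ {x} → x ∈ L → x ∈ R → ⊥
  interleave-disjoint (consˡ i) (p ∷ ps) (here refl) q = ℕₚ.<-irrefl refl (All.lookup p (∈-interleaveʳ i q))
  interleave-disjoint (consˡ i) (p ∷ ps) (there r)   q = interleave-disjoint i ps r q
  interleave-disjoint (consʳ i) (p ∷ ps) r (here refl) = ℕₚ.<-irrefl refl (All.lookup p (∈-interleaveˡ i r))
  interleave-disjoint (consʳ i) (p ∷ ps) r (there q)   = interleave-disjoint i ps r q

  filter-none : ∀ {a p} {A : Set a} {P : Pred A p} (P? : Decidable P) {xs} → All (¬_ ∘ P) xs → filter P? xs ≡ []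
  filter-none P? []       = refl
  filter-none P? (q ∷ qs) = trans (filter-reject P? q) (filter-none P? qs)

  module _ {h X₁ E X} (i : Interleaving (h ∷ X₁) E X) (nc : NonCrossing (h ∷ X₁) E) (sorted : Sorted X)
           (connected : ∀ {c} → c ∈ h ∷ X₁ → Path (h ∷ X₁) h c)
           (first : ∀ {c} → c ∈ X → source h ≤ source c) where

    private
      D = h ∷ X₁
      disjoint : ∀ {x} → x ∈ D → x ∈ E → ⊥
      disjoint = interleave-disjoint i sorted

    component-first : component X h ≡ D
    component-first = filter-interleaveˡ (path? X h) i
      (All.tabulate (path-mono (∈-interleaveˡ i) ∘ connected))
      (All.tabulate λ e∈ p → disjoint (proj₂ (path-restrictˡ i nc p (here refl))) e∈)

    component-rest : ∀ {r} → r ∈ E → component X r ≡ component E r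
    component-rest {r} r∈ = trans
      (interleave-[]ˡ (subst (λ Y → Interleaving Y (filter (path? X r) E) (component X r)) none
        (filter-interleave (path? X r) i)))
      (filter-cong (path? X r) (path? E r) E (λ _ p → proj₁ (path-restrictʳ i nc p r∈))
                                             (λ _ → path-mono (∈-interleaveʳ i)))
      where
      none : filter (path? X r) D ≡ []
      none = filter-none (path? X r) (All.tabulate λ d∈ p → disjoint d∈ (proj₂ (path-restrictʳ i nc p r∈)))

    roots : filter (isRoot? X) X ≡ h ∷ filter (isRoot? E) E
    roots = go i sorted first
      where
      others : filter (isRoot? X) X₁ ≡ []
      others = filter-none (isRoot? X) (All.tabulate λ c∈ root →
        ℕₚ.<⇒≱ (All.lookup (AllPairs.head (AllPairs-interleaveˡ i sorted)) c∈)
               (All.lookup root (∈-interleaveˡ i (here refl))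
                 (path-mono (∈-interleaveˡ i) (path-sym (connected (there c∈))))))
      rootsE : filter (isRoot? X) E ≡ filter (isRoot? E) E
      rootsE = filter-cong (isRoot? X) (isRoot? E) E
        (λ e∈ root → All.tabulate λ c∈ p → All.lookup root (∈-interleaveʳ i c∈) (path-mono (∈-interleaveʳ i) p))
        (λ e∈ root → All.tabulate λ c∈ p → let (p′ , c∈E) = path-restrictʳ i nc p e∈ in All.lookup root c∈E p′)
      go : ∀ {Y} → Interleaving D E Y → Sorted Y → (∀ {c} → c ∈ Y → source h ≤ source c) →
           filter (isRoot? X) Y ≡ h ∷ filter (isRoot? E) E
      go (consˡ j) _ _ = trans (filter-accept (isRoot? X) (All.tabulate λ c∈ _ → first c∈))
        (cong (h ∷_) (trans (interleave-[]ˡ (subst (λ Z → Interleaving Z _ _) others (filter-interleave (isRoot? X) j))) rootsE))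
      go (consʳ j) (p ∷ _) fst = contradiction (All.lookup p (∈-interleaveˡ j (here refl))) (ℕₚ.≤⇒≯ (fst (here refl)))

    -- No path leaves D or E, so the components of X are D and those of E; D comes first because its
    -- root has the least source.
    components-split : components X ≡ D ∷ components E
    components-split = trans (cong (map (component X)) roots)
      (cong₂ _∷_ component-first (map-cong-∈ (filter (isRoot? E) E) (component-rest ∘ proj₁ ∘ ∈-filter⁻ (isRoot? E))))
      where
      map-cong-∈ : ∀ {b} {B : Set b} {f g : Chord → B} xs → (∀ {x} → x ∈ xs → f x ≡ g x) → map f xs ≡ map g xs
      map-cong-∈ []       eq = refl
      map-cong-∈ (x ∷ xs) eq = cong₂ _∷_ (eq (here refl)) (map-cong-∈ xs (eq ∘ there))

  -- Nested components

  -- Nest F b ps X: the components of X form the forest F around the point b,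
  -- and ps lists b and the endpoints of X in increasing order.

  data Nest : Forest → ℕ → List ℕ → Diagram → Set where
    nil  : ∀ {b} → Nest leaf b (b ∷ []) []
    -- D¹ has the root (a′ , b′) and the points a′ ∷ us ++ v ∷ vs; the points ms of the rest, among
    -- them b, fill its gap `length us`. A point v exists because D¹ is crossed by the root that
    -- ends in b.
    cons : ∀ {F₁ F₂ a′ b′ b us v vs ms X₁ X₂ X} →
           Nest F₁ b′ (us ++ v ∷ vs) X₁ → Nest F₂ b ms X₂ →
           Interleaving ((a′ , b′) ∷ X₁) X₂ X →
           Nest (fork F₁ (length us) F₂) b ((a′ ∷ us) ++ ms ++ v ∷ vs) X

  -- A point stands for the gap that directly follows it, hence the half-open interval.
  Open : Chord → ℕ → Set
  Open c p = source c ≤ p × p < sink c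

  AllPairs-++⁻ : ∀ {a r} {A : Set a} {R : A → A → Set r} xs {ys} → AllPairs R (xs ++ ys) →
                 AllPairs R xs × AllPairs R ys × (∀ {x y} → x ∈ xs → y ∈ ys → R x y)
  AllPairs-++⁻ []       ps       = [] , ps , λ ()
  AllPairs-++⁻ (x ∷ xs) (p ∷ ps) = let (qs , rs , f) = AllPairs-++⁻ xs ps in
    Allₚ.++⁻ˡ xs p ∷ qs , rs , λ { (here refl) y∈ → All.lookup (Allₚ.++⁻ʳ xs p) y∈ ; (there x∈) y∈ → f x∈ y∈ }

  AllPairs-++⁺ : ∀ {a r} {A : Set a} {R : A → A → Set r} {xs ys} → AllPairs R xs → AllPairs R ys →
                 (∀ {x y} → x ∈ xs → y ∈ ys → R x y) → AllPairs R (xs ++ ys)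
  AllPairs-++⁺ ps qs f = AllPairsₚ.++⁺ ps qs (All.tabulate λ x∈ → All.tabulate λ y∈ → f x∈ y∈)

  module Layers (us ms vs : List ℕ) (inc : Increasing (us ++ ms ++ vs)) where

    private
      outer = AllPairs-++⁻ us inc
      inner = AllPairs-++⁻ ms (proj₁ (proj₂ outer))

    ms-increasing : Increasing ms
    ms-increasing = proj₁ inner

    us<ms : ∀ {u m} → u ∈ us → m ∈ ms → u < m
    us<ms u∈ m∈ = proj₂ (proj₂ outer) u∈ (∈-++⁺ˡ m∈)

    ms<vs : ∀ {m v} → m ∈ ms → v ∈ vs → m < v
    ms<vs = proj₂ (proj₂ inner)

    us<vs : ∀ {u v} → u ∈ us → v ∈ vs → u < v
    us<vs u∈ v∈ = proj₂ (proj₂ outer) u∈ (∈-++⁺ʳ ms v∈)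

    us++vs-increasing : Increasing (us ++ vs)
    us++vs-increasing = AllPairs-++⁺ (proj₁ outer) (proj₁ (proj₂ inner)) us<vs

  ∈-endpoints : ∀ {c C} → c ∈ C → source c ∈ endpoints C × sink c ∈ endpoints C
  ∈-endpoints (here refl) = here refl , there (here refl)
  ∈-endpoints (there p)   = let (q , r) = ∈-endpoints p in there (there q) , there (there r)

  ∈-endpoints⁻ : ∀ {p} C → p ∈ endpoints C → ∃ λ c → c ∈ C × (p ≡ source c ⊎ p ≡ sink c)
  ∈-endpoints⁻ (c ∷ C) (here eq)           = c , here refl , inj₁ eq
  ∈-endpoints⁻ (c ∷ C) (there (here eq))   = c , here refl , inj₂ eq
  ∈-endpoints⁻ (c ∷ C) (there (there p)) = let (d , d∈ , eq) = ∈-endpoints⁻ C p in d , there d∈ , eq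

  endpoints-interleaving : ∀ {L R X} → Interleaving L R X →
                           Interleaving (endpoints L) (endpoints R) (endpoints X)
  endpoints-interleaving []        = []
  endpoints-interleaving (consˡ i) = consˡ (consˡ (endpoints-interleaving i))
  endpoints-interleaving (consʳ i) = consʳ (consʳ (endpoints-interleaving i))

  endpoints-interleave : ∀ {L R X} → Interleaving L R X → endpoints X ↭ endpoints L ++ endpoints R
  endpoints-interleave i = toPermutation (endpoints-interleaving i)

  length-endpoints : ∀ C → length (endpoints C) ≡ 2 * length C
  length-endpoints []      = refl
  length-endpoints (c ∷ C) = trans (cong (suc ∘ suc) (length-endpoints C)) (sym (ℕₚ.*-suc 2 (length C)))

  nest-↭ : ∀ {F b ps X} → Nest F b ps X → ps ↭ b ∷ endpoints X
  nest-↭ nil = ↭-refl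
  nest-↭ (cons {a′ = a′} {b′} {b} {us} {v} {vs} {ms} {X₁} {X₂} {X} n₁ n₂ i) = begin
    (a′ ∷ us) ++ ms ++ v ∷ vs               ↭⟨ ↭ₚ.shifts (a′ ∷ us) ms ⟩
    ms ++ a′ ∷ us ++ v ∷ vs                 ↭⟨ ↭ₚ.++⁺ (nest-↭ n₂) (↭-prep a′ (nest-↭ n₁)) ⟩
    b ∷ endpoints X₂ ++ endpoints ((a′ , b′) ∷ X₁)
                                            ↭⟨ ↭-prep b (↭ₚ.++-comm (endpoints X₂) _) ⟩
    b ∷ endpoints ((a′ , b′) ∷ X₁) ++ endpoints X₂
                                            ↭⟨ ↭-prep b (endpoints-interleave i) ⟨
    b ∷ endpoints X                         ∎
    where open import Data.List.Relation.Binary.Permutation.Propositional using (module PermutationReasoning)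
          open PermutationReasoning

  nest-∈ : ∀ {F b ps X} → Nest F b ps X → ∀ {c} → c ∈ X → source c ∈ ps × sink c ∈ ps
  nest-∈ n c∈ = let (p , q) = ∈-endpoints c∈ in
    ↭ₚ.∈-resp-↭ (↭-sym (nest-↭ n)) (there p) , ↭ₚ.∈-resp-↭ (↭-sym (nest-↭ n)) (there q)

  nest-sink∈ : ∀ {F b ps X} → Nest F b ps X → b ∈ ps
  nest-sink∈ n = ↭ₚ.∈-resp-↭ (↭-sym (nest-↭ n)) (here refl)

  tree-∈ : ∀ {F a b ps X} → Nest F b ps X → ∀ {c} → c ∈ (a , b) ∷ X → source c ∈ a ∷ ps × sink c ∈ a ∷ ps
  tree-∈ n (here refl) = here refl , there (nest-sink∈ n)
  tree-∈ n (there c∈)  = let (p , q) = nest-∈ n c∈ in there p , there q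

  nest-length : ∀ {F b ps X} → Nest F b ps X → length X ≡ size F
  nest-length nil            = refl
  nest-length (cons {X₁ = X₁} {X₂} n₁ n₂ i) = trans (↭ₚ.↭-length (toPermutation i))
    (trans (length-++ ((0 , 0) ∷ X₁)) (cong₂ _+_ (cong suc (nest-length n₁)) (nest-length n₂)))

  nest-points : ∀ {F b ps X} → Nest F b ps X → length ps ≡ suc (2 * size F)
  nest-points {F} {X = X} n = trans (↭ₚ.↭-length (nest-↭ n))
    (cong suc (trans (length-endpoints X) (cong (2 *_) (nest-length n))))

  module Geometry {F₁ F₂ a′ b′ b us v vs ms X₁ X₂}
                  (n₁ : Nest F₁ b′ (us ++ v ∷ vs) X₁) (n₂ : Nest F₂ b ms X₂)
                  (inc : Increasing ((a′ ∷ us) ++ ms ++ v ∷ vs)) where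

    open Layers (a′ ∷ us) ms (v ∷ vs) inc public

    Outside : ℕ → Set
    Outside p = (∀ {m} → m ∈ ms → p < m) ⊎ (∀ {m} → m ∈ ms → m < p)

    outside : ∀ {p} → p ∈ (a′ ∷ us) ++ v ∷ vs → Outside p
    outside p∈ with ∈-++⁻ (a′ ∷ us) p∈
    ... | inj₁ u∈ = inj₁ (us<ms u∈)
    ... | inj₂ v∈ = inj₂ (λ m∈ → ms<vs m∈ v∈)

    -- Each endpoint of D lies on one side of all points of ms, whereas a crossing would place an
    -- endpoint of D between two of them.
    nonCrossing : NonCrossing ((a′ , b′) ∷ X₁) X₂
    nonCrossing d∈ e∈ x with tree-∈ n₁ d∈ | nest-∈ n₂ e∈
    ... | s∈ , t∈ | p∈ , q∈ with outside s∈ | outside t∈ | x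
    ... | _      | inj₁ t< | inj₁ (_ , p<t , t<q) = ℕₚ.<-asym p<t (t< p∈)
    ... | _      | inj₂ >t | inj₁ (_ , p<t , t<q) = ℕₚ.<-asym t<q (>t q∈)
    ... | inj₁ s< | _      | inj₂ (p<s , s<q , _) = ℕₚ.<-asym p<s (s< p∈)
    ... | inj₂ >s | _      | inj₂ (p<s , s<q , _) = ℕₚ.<-asym s<q (>s q∈)

    least : ∀ {p} → p ∈ (a′ ∷ us) ++ ms ++ v ∷ vs → a′ ≤ p
    least (here refl) = ℕₚ.≤-refl
    least (there p∈)  = ℕₚ.<⇒≤ (All.lookup (AllPairs.head inc) p∈)

    a′<b : a′ < b
    a′<b = us<ms (here refl) (nest-sink∈ n₂)

    b<v : b < v
    b<v = ms<vs (nest-sink∈ n₂) (here refl)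

  nest-valid : ∀ {F b ps X} → Nest F b ps X → Increasing ps → ∀ {c} → c ∈ X → source c < sink c
  nest-valid (cons {us = us} n₁ n₂ i) inc c∈ with ∈-interleave⁻ i c∈
  ... | inj₁ (here refl) = All.lookup (AllPairs.head us++vs-increasing) (nest-sink∈ n₁)
    where open Geometry n₁ n₂ inc
  ... | inj₁ (there c∈)  = nest-valid n₁ (AllPairs.tail us++vs-increasing) c∈
    where open Geometry n₁ n₂ inc
  ... | inj₂ c∈          = nest-valid n₂ ms-increasing c∈
    where open Geometry n₁ n₂ inc

  -- A connected diagram covers its span without a hole. Before b the root is open; from b on D¹
  -- takes over, as it starts before b and extends beyond all of ms.
  covered : ∀ {F a b ps X} → Nest F b ps X → Increasing ps → ∀ {p q} → a ≤ q → q < p → p ∈ ps →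
            ∃ λ y → y ∈ (a , b) ∷ X × Open y q
  covered nil inc a≤q q<p (here refl) = _ , here refl , a≤q , q<p
  covered {b = b} (cons {a′ = a′} {us = us} {v} {ms = ms} n₁ n₂ i) inc {p} {q} a≤q q<p p∈ with q ℕₚ.<? b
  ... | yes q<b = _ , here refl , a≤q , q<b
  ... | no  q≮b = let (y , y∈ , o) = inD (∈-++⁻ (a′ ∷ us) p∈) in y , there (∈-interleaveˡ i y∈) , o
    where
    open Geometry n₁ n₂ inc
    b≤q : b ≤ q
    b≤q = ℕₚ.≮⇒≥ q≮b
    a′≤q : a′ ≤ q
    a′≤q = ℕₚ.≤-trans (ℕₚ.<⇒≤ a′<b) b≤q
    inD : p ∈ a′ ∷ us ⊎ p ∈ ms ++ v ∷ _ → _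
    inD (inj₁ u∈) = contradiction (us<ms u∈ (nest-sink∈ n₂)) (ℕₚ.<⇒≯ (ℕₚ.≤-<-trans b≤q q<p))
    inD (inj₂ r) with ∈-++⁻ ms r
    ... | inj₁ m∈ = covered n₁ (AllPairs.tail us++vs-increasing) a′≤q (ℕₚ.<-trans q<p (ms<vs m∈ (here refl)))
                      (∈-++⁺ʳ us (here refl))
    ... | inj₂ v∈ = covered n₁ (AllPairs.tail us++vs-increasing) a′≤q q<p (∈-++⁺ʳ us v∈)

  -- The root has the least source, so a chord crosses it exactly if it spans its sink b. The
  -- condition thus says that the root connects X.
  Linked : ℕ → Diagram → Set
  Linked b X = ∀ {x} → x ∈ X → ∃ λ y → y ∈ X × Path X x y × source y < b × b < sink y

  -- Each component surrounds b, so by `covered` one of its chords spans b, and all of its chords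
  -- are connected with that one.
  nest-linked   : ∀ {F b ps X} → Nest F b ps X → Increasing ps → Linked b X
  tree-linked   : ∀ {F a b ps X} → Nest F b ps X → Increasing (a ∷ ps) →
                  ∀ {c} → c ∈ (a , b) ∷ X → Path ((a , b) ∷ X) (a , b) c
  nest-linked {b = b} (cons {a′ = a′} {b′} {us = us} {v} {X₁ = X₁} n₁ n₂ i) inc x∈ with ∈-interleave⁻ i x∈
  ... | inj₂ x∈E = let (y , y∈ , p , o) = nest-linked n₂ ms-increasing x∈E in
                   y , ∈-interleaveʳ i y∈ , path-mono (∈-interleaveʳ i) p , o
    where open Geometry n₁ n₂ inc
  ... | inj₁ x∈D =
    let (y , y∈ , s≤b , b<t) = covered n₁ (AllPairs.tail us++vs-increasing) (ℕₚ.<⇒≤ a′<b) b<v (∈-++⁺ʳ us (here refl))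
    in y , ∈-interleaveˡ i y∈
       , path-mono (∈-interleaveˡ i) (path-sym (tree-linked n₁ us++vs-increasing x∈D) ◅◅ tree-linked n₁ us++vs-increasing y∈)
       , ℕₚ.≤∧≢⇒< s≤b (source≢b y∈) , b<t
    where
    open Geometry n₁ n₂ inc
    source≢b : ∀ {y} → y ∈ (a′ , b′) ∷ X₁ → source y ≢ b
    source≢b y∈ eq with outside (proj₁ (tree-∈ n₁ y∈))
    ... | inj₁ < = ℕₚ.<⇒≢ (< (nest-sink∈ n₂)) eq
    ... | inj₂ > = ℕₚ.<⇒≢ (> (nest-sink∈ n₂)) (sym eq)
  tree-linked n inc (here refl) = ε
  tree-linked n (a< ∷ inc) (there c∈) =
    let (y , y∈ , p , s<b , b<t) = nest-linked n inc c∈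
    in (here refl , there y∈ , inj₁ (All.lookup a< (proj₁ (nest-∈ n y∈)) , s<b , b<t)) ◅ path-mono there (path-sym p)

  tree-connected : ∀ {F a b ps X} → Nest F b ps X → Increasing (a ∷ ps) → Connected ((a , b) ∷ X)
  tree-connected n inc = (λ ()) , λ c∈ d∈ → path-sym (tree-linked n inc c∈) ◅◅ tree-linked n inc d∈

  nest-components : ∀ {F₁ F₂ a′ b′ b us v vs ms X₁ X₂ X}
    (n₁ : Nest F₁ b′ (us ++ v ∷ vs) X₁) (n₂ : Nest F₂ b ms X₂) (i : Interleaving ((a′ , b′) ∷ X₁) X₂ X) →
    Increasing ((a′ ∷ us) ++ ms ++ v ∷ vs) → Sorted X → components X ≡ ((a′ , b′) ∷ X₁) ∷ components X₂
  nest-components n₁ n₂ i inc sorted =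
    components-split i nonCrossing sorted (tree-linked n₁ us++vs-increasing) (λ c∈ → least (proj₁ (nest-∈ (cons n₁ n₂ i) c∈)))
    where open Geometry n₁ n₂ inc

  -- The bijection between connected diagrams and forests

  module _ {a r} {A : Set a} {R : A → A → Set r} (asym : ∀ {x y} → R x y → ¬ R y x) where

    sorted-unique : ∀ {xs ys} → AllPairs R xs → AllPairs R ys → xs ↭ ys → xs ≡ ys
    sorted-unique {[]}     {ys}     _        _        p = sym (↭ₚ.↭-empty-inv (↭-sym p))
    sorted-unique {x ∷ xs} {[]}     _        _        p with () ← ↭ₚ.↭-length p
    sorted-unique {x ∷ xs} {y ∷ ys} (p ∷ ps) (q ∷ qs) perm
      with ↭ₚ.∈-resp-↭ perm (here refl) | ↭ₚ.∈-resp-↭ (↭-sym perm) (here refl)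
    ... | here refl | _         = cong (x ∷_) (sorted-unique ps qs (↭ₚ.drop-∷ perm))
    ... | there _   | here refl = cong (x ∷_) (sorted-unique ps qs (↭ₚ.drop-∷ perm))
    ... | there x∈  | there y∈  = contradiction (All.lookup q x∈) (asym (All.lookup p y∈))

  increasing-unique : ∀ {xs ys} → Increasing xs → Increasing ys → xs ↭ ys → xs ≡ ys
  increasing-unique = sorted-unique ℕₚ.<-asym

  sorted-diagram-unique : ∀ {C E} → Sorted C → Sorted E → C ↭ E → C ≡ E
  sorted-diagram-unique = sorted-unique (λ {c} {d} → ℕₚ.<-asym {source c} {source d})

  ++-injective : ∀ {a} {A : Set a} (xs ys : List A) {xs′ ys′} → length xs ≡ length ys →
                 xs ++ xs′ ≡ ys ++ ys′ → xs ≡ ys × xs′ ≡ ys′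
  ++-injective []       []       _  eq = refl , eq
  ++-injective (x ∷ xs) (y ∷ ys) l eq with ∷-injective eq
  ... | refl , eq′ = let (p , q) = ++-injective xs ys (ℕₚ.suc-injective l) eq′ in cong (x ∷_) p , q

  -- F prescribes how the points are cut: g is the length of us, and `size F₂` fixes that of ms.
  nest-functional : ∀ {F F′ b b̂ ps p̂s X X̂} → Nest F b ps X → Nest F′ b̂ p̂s X̂ → F ≡ F′ → ps ≡ p̂s →
                    Sorted X → Sorted X̂ → b ≡ b̂ × X ≡ X̂
  nest-functional nil nil refl refl _ _ = refl , refl
  nest-functional (cons {a′ = a} {us = us} {v} {vs} {ms} n₁ n₂ i) (cons {a′ = a₀} {us = us′} {v′} {vs′} {ms′} n₁′ n₂′ i′) eqF eqP s s′
    with forkEq eqF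
    where
    forkEq : ∀ {F₁ g F₂ F₁′ g′ F₂′} → fork F₁ g F₂ ≡ fork F₁′ g′ F₂′ → F₁ ≡ F₁′ × g ≡ g′ × F₂ ≡ F₂′
    forkEq refl = refl , refl , refl
  ... | refl , g≡ , refl with ++-injective (a ∷ us) (a₀ ∷ us′) (cong suc g≡) eqP
  ... | refl , rest with ++-injective ms ms′ (trans (nest-points n₂) (sym (nest-points n₂′))) rest
  ... | refl , refl with nest-functional n₁ n₁′ refl refl (AllPairs.tail (AllPairs-interleaveˡ i s)) (AllPairs.tail (AllPairs-interleaveˡ i′ s′))
                       | nest-functional n₂ n₂′ refl refl (AllPairs-interleaveʳ i s) (AllPairs-interleaveʳ i′ s′)
  ... | refl , refl | refl , refl = refl , sorted-diagram-unique s s′ (↭-trans (toPermutation i) (↭-sym (toPermutation i′)))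

  ↭-++-cancelˡ : ∀ {a} {A : Set a} (xs : List A) {ys zs} → xs ++ ys ↭ xs ++ zs → ys ↭ zs
  ↭-++-cancelˡ []       p = p
  ↭-++-cancelˡ (x ∷ xs) p = ↭-++-cancelˡ xs (↭ₚ.drop-∷ p)

  length-below : ∀ b us {vs} → (∀ {u} → u ∈ us → u < b) → (∀ {v} → v ∈ vs → b < v) →
                 length (filter (ℕₚ._<? b) (us ++ vs)) ≡ length us
  length-below b us {vs} us<b b<vs = trans (cong length (filter-++ (ℕₚ._<? b) us vs))
    (cong length (trans (cong₂ _++_ (filter-all (ℕₚ._<? b) (All.tabulate us<b))
                                    (filter-none (ℕₚ._<? b) (All.tabulate (ℕₚ.<⇒≯ ∘ b<vs))))
                        (++-identityʳ us)))

  -- D¹ is recovered as the first entry of `components X`, and g as the number of points of D¹ below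
  -- b, apart from its first point.
  nest-injective : ∀ {F F′ b ps p̂s X} → Nest F b ps X → Nest F′ b p̂s X → Increasing ps → Increasing p̂s →
                   Sorted X → F ≡ F′
  nest-injective nil nil _ _ _ = refl
  nest-injective nil (cons _ _ ()) _ _ _
  nest-injective (cons _ _ ()) nil _ _ _
  nest-injective {b = b} (cons {a′ = a} {us = us} {v} {vs} {ms} n₁ n₂ i) (cons {us = us′} {v′} {vs′} {ms′} n₁′ n₂′ i′) inc inc′ s
    with components-injective (trans (sym (nest-components n₁ n₂ i inc s)) (nest-components n₁′ n₂′ i′ inc′ s))
    where
    components-injective : ∀ {c : Chord} {C E c′ C′ E′} → _≡_ {A = List Diagram} ((c ∷ C) ∷ E) ((c′ ∷ C′) ∷ E′) → c ≡ c′ × C ≡ C′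
    components-injective refl = refl , refl
  ... | refl , refl with sorted-diagram-unique (AllPairs-interleaveʳ i s) (AllPairs-interleaveʳ i′ s)
                           (↭-++-cancelˡ (_ ∷ _) (↭-trans (↭-sym (toPermutation i)) (toPermutation i′)))
  ... | refl = cong₃ (nest-injective n₁ n₁′ (AllPairs.tail G.us++vs-increasing) (AllPairs.tail G′.us++vs-increasing)
                       (AllPairs.tail (AllPairs-interleaveˡ i s)))
                     lengths
                     (nest-injective n₂ n₂′ G.ms-increasing G′.ms-increasing (AllPairs-interleaveʳ i s))
    where
    module G  = Geometry n₁ n₂ inc
    module G′ = Geometry n₁′ n₂′ inc′
    cong₃ : ∀ {F₁ g F₂ F₁′ g′ F₂′} → F₁ ≡ F₁′ → g ≡ g′ → F₂ ≡ F₂′ → fork F₁ g F₂ ≡ fork F₁′ g′ F₂′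
    cong₃ refl refl refl = refl
    samePoints : us ++ v ∷ vs ≡ us′ ++ v′ ∷ vs′
    samePoints = increasing-unique (AllPairs.tail G.us++vs-increasing) (AllPairs.tail G′.us++vs-increasing)
               (↭-trans (nest-↭ n₁) (↭-sym (nest-↭ n₁′)))
    lengths : length us ≡ length us′
    lengths = trans (sym (length-below b us (λ u∈ → G.us<ms (there u∈) (nest-sink∈ n₂)) (G.ms<vs (nest-sink∈ n₂))))
      (trans (cong (length ∘ filter (ℕₚ._<? b)) samePoints)
             (length-below b us′ (λ u∈ → G′.us<ms (there u∈) (nest-sink∈ n₂′)) (G′.ms<vs (nest-sink∈ n₂′))))

  merge : ∀ L R → Sorted L → Sorted R → (∀ {c d} → c ∈ L → d ∈ R → source c ≢ source d) →
          ∃ λ X → Interleaving L R X × Sorted X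
  merge []      []      _        _        _ = [] , [] , []
  merge []      (d ∷ R) _        (q ∷ qs) _ =
    let (X , i , s) = merge [] R [] qs (λ ()) in
    d ∷ X , consʳ i , All.tabulate (λ x∈ → [ (λ ()) , All.lookup q ]′ (∈-interleave⁻ i x∈)) ∷ s
  merge (c ∷ L) R       (p ∷ ps) qs       f = go R qs f
    where
    go : ∀ R → Sorted R → (∀ {c′ d} → c′ ∈ c ∷ L → d ∈ R → source c′ ≢ source d) →
         ∃ λ X → Interleaving (c ∷ L) R X × Sorted X
    go [] _ _ =
      let (X , i , s) = merge L [] ps [] (λ _ ()) in
      c ∷ X , consˡ i , All.tabulate (λ x∈ → [ All.lookup p , (λ ()) ]′ (∈-interleave⁻ i x∈)) ∷ s
    go (d ∷ R) (q ∷ qs) f = compare (ℕₚ.<-cmp (source c) (source d))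
      where
      compare : _ → _
      compare (tri≈ _ eq _) = contradiction eq (f (here refl) (here refl))
      compare (tri< c<d _ _) =
        let (X , i , s) = merge L (d ∷ R) ps (q ∷ qs) (f ∘ there) in
        c ∷ X , consˡ i , All.tabulate (λ x∈ → [ All.lookup p , All.lookup (c<d ∷ All.map (ℕₚ.<-trans c<d) q) ]′ (∈-interleave⁻ i x∈)) ∷ s
      compare (tri> _ _ d<c) =
        let (X , i , s) = go R qs (λ c∈ d∈ → f c∈ (there d∈)) in
        d ∷ X , consʳ i , All.tabulate (λ x∈ → [ All.lookup (d<c ∷ All.map (ℕₚ.<-trans d<c) p) , All.lookup q ]′ (∈-interleave⁻ i x∈)) ∷ s

  split-length : ∀ {a} {A : Set a} k m (xs : List A) → length xs ≡ k + m →
                 ∃ λ us → ∃ λ vs → xs ≡ us ++ vs × length us ≡ k × length vs ≡ m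
  split-length zero    m xs       l = [] , xs , refl , refl , l
  split-length (suc k) m (x ∷ xs) l = let (us , vs , eq , p , q) = split-length k m xs (ℕₚ.suc-injective l) in
    x ∷ us , vs , cong (x ∷_) eq , cong suc p , q

  points-split : ∀ s₁ s₂ g r → g + r ≡ 2 * s₁ → 2 * (suc s₁ + s₂) ≡ g + (suc (2 * s₂) + suc r)
  points-split s₁ s₂ g r eq = trans
    (solve 2 (λ x y → con 2 :* (con 1 :+ x :+ y) := con 2 :* x :+ (con 2 :+ con 2 :* y)) refl s₁ s₂)
    (trans (cong (_+ (2 + 2 * s₂)) (sym eq))
      (solve 3 (λ g r y → g :+ r :+ (con 2 :+ y) := g :+ (con 1 :+ y :+ (con 1 :+ r))) refl g r (2 * s₂)))
    where
    open import Data.Nat.Solver using (module +-*-Solver)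
    open +-*-Solver

  nest-exists : ∀ F → Valid F → ∀ ps → Increasing ps → length ps ≡ suc (2 * size F) →
                ∃ λ b → ∃ λ X → Nest F b ps X × Sorted X
  nest-exists leaf _ (b ∷ []) _ _ = b , [] , nil , []
  nest-exists (fork F₁ g F₂) (v₁ , g< , v₂) (a ∷ ps) inc len
    -- The bound on g leaves a rest r, the length of vs, so that at least the point v follows the
    -- gap.
    with ℕₚ.m≤n⇒∃[o]m+o≡n (ℕₚ.≤-pred (subst (g <_) (cong suc (length-slotsᶠ F₁ v₁)) g<))
  ... | r , g+r≡ with split-length g _ ps (trans (ℕₚ.suc-injective len) (points-split (size F₁) (size F₂) g r g+r≡))
  ... | us , rest , refl , refl , lrest with split-length (suc (2 * size F₂)) (suc r) rest lrest
  ... | ms , v ∷ vs , refl , lms , lvs =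
    let module L = Layers (a ∷ us) ms (v ∷ vs) inc
        (b′ , X₁ , n₁ , s₁) = nest-exists F₁ v₁ (us ++ v ∷ vs) (AllPairs.tail L.us++vs-increasing)
                                (trans (length-++ us) (trans (cong (length us +_) lvs) (trans (ℕₚ.+-suc _ r) (cong suc g+r≡))))
        (b , X₂ , n₂ , s₂)  = nest-exists F₂ v₂ ms L.ms-increasing lms
        (X , i , s) = merge ((a , b′) ∷ X₁) X₂
                        (All.tabulate (λ c∈ → All.lookup (AllPairs.head L.us++vs-increasing) (proj₁ (nest-∈ n₁ c∈))) ∷ s₁) s₂
                        (λ c∈ d∈ eq → apart L.us<ms L.ms<vs (proj₁ (tree-∈ n₁ c∈)) (proj₁ (nest-∈ n₂ d∈)) eq)
    in b , X , cons n₁ n₂ i , s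
    where
    apart : ∀ {us ms vs : List ℕ} → (∀ {u m} → u ∈ us → m ∈ ms → u < m) → (∀ {m v} → m ∈ ms → v ∈ vs → m < v) →
            ∀ {p q} → p ∈ us ++ vs → q ∈ ms → p ≢ q
    apart {us} f g p∈ q∈ eq with ∈-++⁻ us p∈
    ... | inj₁ u∈ = ℕₚ.<⇒≢ (f u∈ q∈) eq
    ... | inj₂ v∈ = ℕₚ.<⇒≢ (g q∈ v∈) (sym eq)

  -- The path is cut before it first meets h; the last chord reached crosses h.
  path-until : ∀ {h X x} → Path (h ∷ X) x h → x ∈ X → h ≢ x → ∃ λ y → y ∈ X × Path X x y × Cross y h
  path-until ε x∈ h≢x = contradiction refl h≢x
  path-until {h} {X} ((_ , here refl , c) ◅ _)  x∈ _ = _ , x∈ , ε , c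
  path-until {h} {X} (_◅_ {j = z} (_ , there z∈ , c) es) x∈ _ with h ≟ᶜ z
  ... | yes refl = _ , x∈ , ε , c
  ... | no h≢z = let (y , y∈ , p , c′) = path-until es z∈ h≢z in y , y∈ , (x∈ , z∈ , c) ◅ p , c′

  root-linked : ∀ {h X} → Sorted (h ∷ X) → (∀ {c} → c ∈ X → Path (h ∷ X) h c) → Linked (sink h) X
  root-linked (h< ∷ _) conn x∈ with path-until (path-sym (conn x∈)) x∈ (λ { refl → ℕₚ.<-irrefl refl (All.lookup h< x∈) })
  ... | y , y∈ , p , inj₁ (y<h , _ , _)     = contradiction y<h (ℕₚ.<-asym (All.lookup h< y∈))
  ... | y , y∈ , p , inj₂ (_ , y<t , t<y)   = y , y∈ , p , y<t , t<y

  Distinct : Diagram → Set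
  Distinct C = Unique (endpoints C)

  source≢sink : ∀ {C} → Distinct C → ∀ {c d} → c ∈ C → d ∈ C → source c ≢ sink d
  source≢sink ((p ∷ _) ∷ _ ∷ _) (here refl) (here refl) = p
  source≢sink (p ∷ _ ∷ _)       (here refl) (there d∈)  = All.lookup p (there (proj₂ (∈-endpoints d∈)))
  source≢sink (_ ∷ p ∷ _)       (there c∈)  (here refl) = λ eq → All.lookup p (proj₁ (∈-endpoints c∈)) (sym eq)
  source≢sink (_ ∷ _ ∷ ps)      (there c∈)  (there d∈)  = source≢sink ps c∈ d∈

  distinct-sink : ∀ {C} → Distinct C → ∀ {c d} → c ∈ C → d ∈ C → sink c ≡ sink d → c ≡ d
  distinct-sink _            (here refl) (here refl) _  = refl
  distinct-sink (_ ∷ p ∷ _)  (here refl) (there d∈)  eq = contradiction eq (All.lookup p (proj₂ (∈-endpoints d∈)))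
  distinct-sink (_ ∷ p ∷ _)  (there c∈)  (here refl) eq = contradiction (sym eq) (All.lookup p (proj₂ (∈-endpoints c∈)))
  distinct-sink (_ ∷ _ ∷ ps) (there c∈)  (there d∈)  eq = distinct-sink ps c∈ d∈ eq

  split-at : ∀ {xs} b → Increasing xs → ¬ b ∈ xs →
             ∃ λ us → ∃ λ vs → xs ≡ us ++ vs × All (_< b) us × All (b <_) vs
  split-at {[]}     b _        _  = [] , [] , refl , [] , []
  split-at {x ∷ xs} b (p ∷ ps) b∉ with ℕₚ.<-cmp x b
  ... | tri≈ _ refl _ = contradiction (here refl) b∉
  ... | tri> _ _ b<x  = [] , x ∷ xs , refl , [] , b<x ∷ All.map (ℕₚ.<-trans b<x) p
  ... | tri< x<b _ _  = let (us , vs , eq , us< , <vs) = split-at b ps (b∉ ∘ there) in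
    x ∷ us , vs , cong (x ∷_) eq , x<b ∷ us< , <vs

  Proper : Diagram → Set
  Proper C = ∀ {c} → c ∈ C → source c < sink c

  Inside : Chord → Chord → Set
  Inside e d = source e < source d × sink d < sink e

  module _ {X} (distinct : Distinct X) (proper : Proper X) where

    private
      ≢→<⊎> : ∀ {m n} → m ≢ n → m < n ⊎ n < m
      ≢→<⊎> {m} {n} m≢n with ℕₚ.<-cmp m n
      ... | tri< lt _ _ = inj₁ lt
      ... | tri≈ _ eq _ = contradiction eq m≢n
      ... | tri> _ _ gt = inj₂ gt

      ss : ∀ {d e} → d ∈ X → e ∈ X → source d ≢ sink e
      ss = source≢sink distinct

      sinks : ∀ {d e} → d ∈ X → e ∈ X → d ≢ e → sink d < sink e ⊎ sink e < sink d
      sinks d∈ e∈ d≢e = ≢→<⊎> (d≢e ∘ distinct-sink distinct d∈ e∈)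

    -- By its crossing with d, the chord d′ has an endpoint inside e, and it could leave e only by
    -- crossing it.
    inside-step : Sorted X → ∀ {d d′ e} → d ∈ X → d′ ∈ X → e ∈ X → d′ ≢ e → Inside e d → Cross d d′ → ¬ Cross d′ e → Inside e d′
    inside-step sorted d∈ d′∈ e∈ d′≢e (e<d , d<e) (inj₁ (d<d′ , d′<t , t<t′)) nc with sinks d′∈ e∈ d′≢e
    ... | inj₁ lt = ℕₚ.<-trans e<d d<d′ , lt
    ... | inj₂ gt = contradiction (inj₂ (ℕₚ.<-trans e<d d<d′ , ℕₚ.<-trans d′<t d<e , gt)) nc
    inside-step sorted d∈ d′∈ e∈ d′≢e (e<d , d<e) (inj₂ (d′<d , d<t′ , t′<t)) nc
      with ≢→<⊎> (d′≢e ∘ sorted-injective sorted d′∈ e∈)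
    ... | inj₂ gt = gt , ℕₚ.<-trans t′<t d<e
    ... | inj₁ lt = contradiction (inj₁ (lt , ℕₚ.<-trans e<d d<t′ , ℕₚ.<-trans t′<t d<e)) nc

    -- No chord spans p, so a crossing cannot lead from one side of p to the other.
    right-of : ∀ {E y x p} → (∀ {e} → e ∈ E → ¬ (source e < p × p < sink e)) → (∀ {e} → e ∈ E → source e ≢ p × sink e ≢ p) →
               Path E y x → p < source y → p < source x
    right-of gap ≢p ε p< = p<
    right-of {x = x} gap ≢p (_◅_ {i = y} {j = z} (y∈ , z∈ , c) es) p<y = right-of gap ≢p es (step c)
      where
      step : Cross y z → _ < source z
      step (inj₁ (y<z , _ , _)) = ℕₚ.<-trans p<y y<z
      step (inj₂ (z<y , y<t , _)) with ≢→<⊎> (proj₁ (≢p z∈))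
      ... | inj₂ gt = gt
      ... | inj₁ lt = contradiction (lt , ℕₚ.<-trans p<y y<t) (gap z∈)

    left-of : ∀ {E y x p} → (∀ {e} → e ∈ E → ¬ (source e < p × p < sink e)) → (∀ {e} → e ∈ E → source e ≢ p × sink e ≢ p) →
              Path E y x → sink y < p → sink x < p
    left-of gap ≢p ε <p = <p
    left-of {x = x} gap ≢p (_◅_ {i = y} {j = z} (y∈ , z∈ , c) es) y<p = left-of gap ≢p es (step c)
      where
      step : Cross y z → sink z < _
      step (inj₂ (_ , _ , z<y)) = ℕₚ.<-trans z<y y<p
      step (inj₁ (_ , z<y , _)) with ≢→<⊎> (proj₂ (≢p z∈))
      ... | inj₁ lt = lt
      ... | inj₂ gt = contradiction (ℕₚ.<-trans z<y y<p , gt) (gap z∈)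

    module _ {h X₁ E} (i : Interleaving (h ∷ X₁) E X) (nc : NonCrossing (h ∷ X₁) E) (sorted : Sorted X)
             (connected : ∀ {c} → c ∈ h ∷ X₁ → Path (h ∷ X₁) h c)
             (first : ∀ {c} → c ∈ X → source h ≤ source c) where

      private
        D = h ∷ X₁
        disjoint : ∀ {x} → x ∈ D → x ∈ E → ⊥
        disjoint = interleave-disjoint i sorted
        ∈ˡ : ∀ {x} → x ∈ D → x ∈ X
        ∈ˡ = ∈-interleaveˡ i
        ∈ʳ : ∀ {x} → x ∈ E → x ∈ X
        ∈ʳ = ∈-interleaveʳ i

      -- Along the paths of D, `inside-step` would carry h into the inside of e as well, but h has
      -- the least source.
      never-inside : ∀ {d e} → d ∈ D → e ∈ E → ¬ Inside e d
      never-inside {e = e} d∈ e∈ ins = ℕₚ.<⇒≱ (proj₁ (walk (path-sym (connected d∈)) d∈ ins)) (first (∈ʳ e∈))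
        where
        walk : ∀ {d d′} → Path D d d′ → d ∈ D → Inside e d → Inside e d′
        walk ε                    _  ins = ins
        walk ((d∈ , z∈ , c) ◅ es) _ ins = walk es z∈
          (inside-step sorted (∈ˡ d∈) (∈ˡ z∈) (∈ʳ e∈) (λ { refl → disjoint z∈ e∈ }) ins c (nc z∈ e∈))

      -- A chord over an endpoint of d either crosses d or contains it. Hence each chord of E stays
      -- within one gap of D.
      gap : ∀ {p} → p ∈ endpoints D → ∀ {e} → e ∈ E → ¬ (source e < p × p < sink e)
      gap p∈ {e} e∈ (s< , <t) with ∈-endpoints⁻ D p∈
      ... | d , d∈ , inj₁ refl with sinks (∈ˡ d∈) (∈ʳ e∈) (λ { refl → disjoint d∈ e∈ })
      ...   | inj₁ lt = never-inside d∈ e∈ (s< , lt)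
      ...   | inj₂ gt = nc d∈ e∈ (inj₂ (s< , <t , gt))
      gap p∈ {e} e∈ (s< , <t) | d , d∈ , inj₂ refl with ≢→<⊎> (λ eq → disjoint d∈ (subst (_∈ E) (sorted-injective sorted (∈ʳ e∈) (∈ˡ d∈) (sym eq)) e∈))
      ...   | inj₁ lt = nc d∈ e∈ (inj₁ (lt , s< , <t))
      ...   | inj₂ gt = never-inside d∈ e∈ (gt , <t)

      apart : ∀ {p} → p ∈ endpoints D → ∀ {e} → e ∈ E → source e ≢ p × sink e ≢ p
      apart p∈ {e} e∈ with ∈-endpoints⁻ D p∈
      ... | d , d∈ , inj₁ refl =
        (λ eq → disjoint d∈ (subst (_∈ E) (sorted-injective sorted (∈ʳ e∈) (∈ˡ d∈) eq) e∈)) ,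
        (λ eq → ss (∈ˡ d∈) (∈ʳ e∈) (sym eq))
      ... | d , d∈ , inj₂ refl =
        (λ eq → ss (∈ʳ e∈) (∈ˡ d∈) eq) ,
        (λ eq → disjoint d∈ (subst (_∈ E) (distinct-sink distinct (∈ʳ e∈) (∈ˡ d∈) eq) e∈))

      -- Every chord of E is joined within E to one that spans b, and no path of E passes an
      -- endpoint of D. So E lies in the gap of D that contains b.
      rest-right : ∀ {b} → Linked b E → ∀ {p} → p ∈ endpoints D → p < b → ∀ {x} → x ∈ E → p < source x × p < sink x
      rest-right linked p∈ p<b x∈ with linked x∈
      ... | y , y∈ , path , y<b , b<t with ≢→<⊎> (proj₁ (apart p∈ y∈))
      ...   | inj₁ lt = contradiction (lt , ℕₚ.<-trans p<b b<t) (gap p∈ y∈)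
      ...   | inj₂ gt = let q = right-of (gap p∈) (apart p∈) (path-sym path) gt in q , ℕₚ.<-trans q (proper (∈ʳ x∈))

      rest-left : ∀ {b} → Linked b E → ∀ {p} → p ∈ endpoints D → b < p → ∀ {x} → x ∈ E → source x < p × sink x < p
      rest-left linked p∈ b<p x∈ with linked x∈
      ... | y , y∈ , path , y<b , b<t with ≢→<⊎> (proj₂ (apart p∈ y∈))
      ...   | inj₂ gt = contradiction (ℕₚ.<-trans y<b b<p , gt) (gap p∈ y∈)
      ...   | inj₁ lt = let q = left-of (gap p∈) (apart p∈) (path-sym path) lt in ℕₚ.<-trans (proper (∈ʳ x∈)) q , q

  -- The recursion splits X into the component of its first chord h and the rest E. Without h, that
  -- component is linked around the sink of h, while E stays linked around b; the invariant is thus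
  -- inherited. The bound k serves termination.
  decompose : ∀ k X → length X ≤ k → ∀ b → Sorted X → Unique (b ∷ endpoints X) → Proper X → Linked b X →
              ∃ λ F → ∃ λ ps → Nest F b ps X × Increasing ps × Valid F
  decompose k [] _ b _ _ _ _ = leaf , b ∷ [] , nil , [] ∷ [] , tt
  decompose (suc k) (h ∷ X) (s≤s len) b sorted (b∉ ∷ distinct) proper linked =
    assemble (decompose k X₁ (ℕₚ.≤-trans (length-filter P? X) len) (sink h) (AllPairs.tail sortedD) (proj₂ (AllPairs-++⁻ (source h ∷ []) distinctD) .proj₁)
               (proper ∘ ∈ˡ ∘ there) (root-linked sortedD (connected ∘ there)))
             (decompose k E (ℕₚ.≤-trans (ℕₚ.≤-reflexive (cong length E≡)) (ℕₚ.≤-trans (length-filter (¬? ∘ P?) X) len)) b (AllPairs-interleaveʳ i sorted)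
               (All.tabulate (All.lookup b∉ ∘ ∈-interleaveʳ (endpoints-interleaving i)) ∷ AllPairs-interleaveʳ (endpoints-interleaving i) distinct)
               (proper ∘ ∈-interleaveʳ i) linkedE)
    where
    P? : ∀ x → Dec (Path (h ∷ X) h x)
    P? = path? (h ∷ X) h
    X₁ E : Diagram
    X₁ = filter P? X
    E  = filter (¬? ∘ P?) (h ∷ X)
    E≡ : E ≡ filter (¬? ∘ P?) X
    E≡ = filter-reject (¬? ∘ P?) (λ ¬p → ¬p ε)
    i : Interleaving (h ∷ X₁) E (h ∷ X)
    i = subst (λ D → Interleaving D E (h ∷ X)) (filter-accept P? ε) (partition-interleave P? (h ∷ X))
    ∈ˡ : ∀ {x} → x ∈ h ∷ X₁ → x ∈ h ∷ X
    ∈ˡ = ∈-interleaveˡ i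
    reach : ∀ {d} → d ∈ h ∷ X₁ → Path (h ∷ X) h d
    reach (here refl) = ε
    reach (there d∈)  = proj₂ (∈-filter⁻ P? {xs = X} d∈)
    unreached : ∀ {e} → e ∈ E → ¬ Path (h ∷ X) h e
    unreached e∈ = proj₂ (∈-filter⁻ (¬? ∘ P?) {xs = h ∷ X} e∈)
    nc : NonCrossing (h ∷ X₁) E
    nc d∈ e∈ c = unreached e∈ (reach d∈ ◅◅ (∈ˡ d∈ , ∈-interleaveʳ i e∈ , c) ◅ ε)
    connected : ∀ {c} → c ∈ h ∷ X₁ → Path (h ∷ X₁) h c
    connected c∈ = proj₁ (path-restrictˡ i nc (reach c∈) (here refl))
    sortedD : Sorted (h ∷ X₁)
    sortedD = AllPairs-interleaveˡ i sorted
    distinctD : Distinct (h ∷ X₁)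
    distinctD = AllPairs-interleaveˡ (endpoints-interleaving i) distinct
    first : ∀ {c} → c ∈ h ∷ X → source h ≤ source c
    first (here refl) = ℕₚ.≤-refl
    first (there c∈)  = ℕₚ.<⇒≤ (All.lookup (AllPairs.head sorted) c∈)
    linkedE : Linked b E
    linkedE x∈ = let (y , y∈ , p , o) = linked (∈-interleaveʳ i x∈)
                     (p′ , y∈E) = path-restrictʳ i nc p x∈
                 in y , y∈E , p′ , o
    b≢D : ∀ {p} → p ∈ endpoints (h ∷ X₁) → b ≢ p
    b≢D p∈ = All.lookup b∉ (∈-interleaveˡ (endpoints-interleaving i) p∈)
    assemble : (∃ λ F → ∃ λ ps → Nest F (sink h) ps X₁ × Increasing ps × Valid F) →
               (∃ λ F → ∃ λ ps → Nest F b ps E × Increasing ps × Valid F) →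
               ∃ λ F → ∃ λ ps → Nest F b ps (h ∷ X) × Increasing ps × Valid F
    assemble (F₁ , qs , n₁ , inc₁ , v₁) (F₂ , ms , n₂ , inc₂ , v₂)
      with split-at b inc₁ (λ b∈ → b≢D (there (↭ₚ.∈-resp-↭ (nest-↭ n₁) b∈)) refl)
    ... | us , vs , refl , us< , <vs = finish vs refl
      where
      ∈D : ∀ {p} → p ∈ source h ∷ us ++ vs → p ∈ endpoints (h ∷ X₁)
      ∈D (here refl) = here refl
      ∈D (there p∈)  = there (↭ₚ.∈-resp-↭ (nest-↭ n₁) p∈)
      h<qs : ∀ {q} → q ∈ us ++ vs → source h < q
      h<qs q∈ with ↭ₚ.∈-resp-↭ (nest-↭ n₁) q∈
      ... | here refl = proper (here refl)
      ... | there q∈′ with ∈-endpoints⁻ X₁ q∈′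
      ...   | d , d∈ , inj₁ refl = All.lookup (AllPairs.head sortedD) d∈
      ...   | d , d∈ , inj₂ refl = ℕₚ.<-trans (All.lookup (AllPairs.head sortedD) d∈) (proper (∈ˡ (there d∈)))
      across : ∃ λ y → y ∈ h ∷ X₁ × source y < b × b < sink y
      across = let (y , _ , p , o) = linked (here refl)
                   (_ , y∈D) = path-restrictˡ i nc p (here refl)
               in y , y∈D , o
      h<b : source h < b
      h<b = let (y , y∈ , y<b , _) = across in ℕₚ.≤-<-trans (first (∈ˡ y∈)) y<b
      u<b : ∀ {u} → u ∈ source h ∷ us → u < b
      u<b (here refl) = h<b
      u<b (there u∈)  = All.lookup us< u∈
      ms-from : ∀ {m} → m ∈ ms → m ≡ b ⊎ ∃ λ e → e ∈ E × (m ≡ source e ⊎ m ≡ sink e)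
      ms-from m∈ with ↭ₚ.∈-resp-↭ (nest-↭ n₂) m∈
      ... | here eq  = inj₁ eq
      ... | there m∈′ = inj₂ (∈-endpoints⁻ E m∈′)
      us<ms : ∀ {u m} → u ∈ source h ∷ us → m ∈ ms → u < m
      us<ms u∈ m∈ with ms-from m∈ | rest-right distinct proper i nc sorted connected first linkedE (∈D (∈-++⁺ˡ u∈)) (u<b u∈)
      ... | inj₁ refl                  | _ = u<b u∈
      ... | inj₂ (e , e∈ , inj₁ refl) | f = proj₁ (f e∈)
      ... | inj₂ (e , e∈ , inj₂ refl) | f = proj₂ (f e∈)
      ms<vs : ∀ {m v} → m ∈ ms → v ∈ vs → m < v
      ms<vs m∈ v∈ with ms-from m∈ | rest-left distinct proper i nc sorted connected first linkedE (∈D (∈-++⁺ʳ (source h ∷ us) v∈)) (All.lookup <vs v∈)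
      ... | inj₁ refl                  | _ = All.lookup <vs v∈
      ... | inj₂ (e , e∈ , inj₁ refl) | f = proj₁ (f e∈)
      ... | inj₂ (e , e∈ , inj₂ refl) | f = proj₂ (f e∈)
      increasing : Increasing ((source h ∷ us) ++ ms ++ vs)
      increasing = let (p , q , r) = AllPairs-++⁻ (source h ∷ us) (All.tabulate h<qs ∷ inc₁) in
        AllPairs-++⁺ p (AllPairs-++⁺ inc₂ q ms<vs)
          λ u∈ x∈ → [ us<ms u∈ , r u∈ ]′ (∈-++⁻ ms x∈)
      finish : ∀ vs′ → vs ≡ vs′ → ∃ λ F → ∃ λ ps → Nest F b ps (h ∷ X) × Increasing ps × Valid F
      -- Some chord of D spans b, so a point of D follows b.
      finish [] refl = contradiction (proj₂ (proj₂ (proj₂ across)))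
        (ℕₚ.<⇒≯ (u<b (subst (sink (proj₁ across) ∈_) (++-identityʳ (source h ∷ us)) (proj₂ (tree-∈ n₁ (proj₁ (proj₂ across)))))))
      finish (v ∷ vs′) refl = _ , _ , cons n₁ n₂ i , increasing , v₁ , g< , v₂
        where
        g< : length us < length (slots F₁)
        g< = ℕₚ.<-≤-trans (ℕₚ.m<m+n (length us) (s≤s z≤n))
          (ℕₚ.≤-reflexive (trans (sym (length-++ us)) (trans (nest-points n₁) (cong suc (sym (length-slotsᶠ F₁ v₁))))))

  -- The intersection order

  -- The components receive consecutive blocks of labels, after label 1 of the root.
  terminals terminalsᶠ : Forest → List ℕ
  terminals leaf             = 1 ∷ []
  terminals (fork F₁ g F₂)  = map suc (terminals F₁ ++ map (suc (size F₁) +_) (terminalsᶠ F₂))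
  terminalsᶠ leaf            = []
  terminalsᶠ (fork F₁ g F₂) = terminals F₁ ++ map (suc (size F₁) +_) (terminalsᶠ F₂)

  module _ {p} {P : Pred Chord p} (P? : Decidable P) where

    positions : (ℕ → ℕ) → List Chord → List ℕ
    positions f xs = map proj₁ (filter (P? ∘ proj₂) (zip (applyUpTo f (length xs)) xs))

    positions-accept : ∀ f {x} xs → P x → positions f (x ∷ xs) ≡ f 0 ∷ positions (f ∘ suc) xs
    positions-accept f xs p = cong (map proj₁) (filter-accept (P? ∘ proj₂) p)

    positions-reject : ∀ f {x} xs → ¬ P x → positions f (x ∷ xs) ≡ positions (f ∘ suc) xs
    positions-reject f xs ¬p = cong (map proj₁) (filter-reject (P? ∘ proj₂) ¬p)

    positions-++ : ∀ f xs ys → positions f (xs ++ ys) ≡ positions f xs ++ positions (f ∘ (length xs +_)) ys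
    positions-++ f []       ys = refl
    positions-++ f (x ∷ xs) ys with P? x
    ... | yes p = cong (f 0 ∷_) (positions-++ (f ∘ suc) xs ys)
    ... | no ¬p = positions-++ (f ∘ suc) xs ys

    positions-map : ∀ {f g} h xs → (∀ n → g n ≡ h (f n)) → positions g xs ≡ map h (positions f xs)
    positions-map h []       eq = refl
    positions-map h (x ∷ xs) eq with P? x
    ... | yes p = cong₂ _∷_ (eq 0) (positions-map h xs (eq ∘ suc))
    ... | no ¬p = positions-map h xs (eq ∘ suc)

  -- A chord of such an X is terminal in C if it is terminal in X. The labelling can thus descend to
  -- components while terminality keeps referring to the whole diagram.
  RightClosed : Diagram → Diagram → Set
  RightClosed X C = ∀ {c d} → c ∈ X → d ∈ C → c ⌒ d → d ∈ X

  labels : ℕ → Diagram → List Chord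
  labels k X = concatMap (label k) (components X)

  nest-labels : ∀ {F b ps X} → Nest F b ps X → Increasing ps → Sorted X → ∀ k → size F ≤ k →
                ∀ C → RightClosed X C → (∀ {c} → c ∈ X → c ∈ C) →
                positions (terminal? C) suc (labels k X) ≡ terminalsᶠ F × length (labels k X) ≡ size F
  tree-labels : ∀ {F a b ps X} → Nest F b ps X → Increasing (a ∷ ps) → Sorted ((a , b) ∷ X) → ∀ k → size F < k →
                ∀ C → RightClosed ((a , b) ∷ X) C → (∀ {c} → c ∈ (a , b) ∷ X → c ∈ C) →
                positions (terminal? C) suc (label k ((a , b) ∷ X)) ≡ terminals F ×
                length (label k ((a , b) ∷ X)) ≡ suc (size F)
  nest-labels nil inc s k _ C _ _ = refl , refl
  nest-labels (cons {F₁} {F₂} {a′} {b′} {X₁ = X₁} {X₂} {X} n₁ n₂ i) inc s k size≤ C closed X⊆C =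
    trans (cong (positions T? suc) split)
      (trans (positions-++ T? suc (label k D) (labels k X₂))
             (cong₂ _++_ (proj₁ tree) (trans (positions-map T? (suc (size F₁) +_) (labels k X₂)
                (λ n → trans (cong (λ m → suc (m + n)) (proj₂ tree)) (sym (ℕₚ.+-suc (suc (size F₁)) n))))
                (cong (map (suc (size F₁) +_)) (proj₁ rest))))) ,
    trans (cong length split) (trans (length-++ (label k D)) (cong₂ _+_ (proj₂ tree) (proj₂ rest)))
    where
    open Geometry n₁ n₂ inc
    D  = (a′ , b′) ∷ X₁
    T? = terminal? C
    split : labels k X ≡ label k D ++ labels k X₂
    split = cong (concatMap (label k)) (nest-components n₁ n₂ i inc s)
    tree = tree-labels n₁ us++vs-increasing (AllPairs-interleaveˡ i s) k (ℕₚ.≤-trans (ℕₚ.m≤m+n _ (size F₂)) size≤)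
             C closedD (X⊆C ∘ ∈-interleaveˡ i)
      where
      closedD : RightClosed D C
      closedD c∈ d∈ x with ∈-interleave⁻ i (closed (∈-interleaveˡ i c∈) d∈ x)
      ... | inj₁ d∈D = d∈D
      ... | inj₂ d∈E = contradiction (inj₁ x) (nonCrossing c∈ d∈E)
    rest = nest-labels n₂ ms-increasing (AllPairs-interleaveʳ i s) k (ℕₚ.≤-trans (ℕₚ.m≤n+m _ (suc (size F₁))) size≤)
             C closedE (X⊆C ∘ ∈-interleaveʳ i)
      where
      closedE : RightClosed X₂ C
      closedE c∈ d∈ x with ∈-interleave⁻ i (closed (∈-interleaveʳ i c∈) d∈ x)
      ... | inj₂ d∈E = d∈E
      ... | inj₁ d∈D = contradiction (inj₂ x) (nonCrossing d∈D c∈)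
  tree-labels {F} {a} {b} {X = X} n inc@(_ ∷ inc′) s@(a< ∷ s′) (suc k) (s≤s size≤) C closed C⊇ = go n , cong suc (proj₂ rest)
    where
    closedX : RightClosed X C
    closedX c∈ d∈ x with closed (there c∈) d∈ x
    ... | here refl = contradiction (proj₁ x) (ℕₚ.<-asym (All.lookup a< c∈))
    ... | there d∈X = d∈X
    rest = nest-labels n inc′ s′ k size≤ C closedX (C⊇ ∘ there)
    nonterminal : ∀ {y} → y ∈ X → ¬ Terminal C (a , b)
    nonterminal {y} y∈ t = let (z , z∈ , _ , z<b , b<z) = nest-linked n inc′ y∈ in
      All.lookup t (C⊇ (there z∈)) (All.lookup a< z∈ , z<b , b<z)
    go : Nest F b _ X → positions (terminal? C) suc ((a , b) ∷ labels k X) ≡ terminals F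
    go nil = trans (positions-accept (terminal? C) suc (labels k []) (All.tabulate terminal)) refl
      where
      terminal : ∀ {d} → d ∈ C → ¬ (a , b) ⌒ d
      terminal d∈ x with closed (here refl) d∈ x
      ... | here refl = ℕₚ.<-irrefl refl (proj₁ x)
    go (cons n₁ n₂ i) = trans (positions-reject (terminal? C) suc (labels k X) (nonterminal (∈-interleaveˡ i (here refl))))
      (trans (positions-map (terminal? C) suc (labels k X) (λ _ → refl)) (cong (map suc) (proj₁ rest)))

  module _ {F a b ps X} (n : Nest F b ps X) (inc : Increasing (a ∷ ps)) (s : Sorted ((a , b) ∷ X)) where

    terminalLabels≡ : terminalLabels ((a , b) ∷ X) ≡ terminals F
    terminalLabels≡ = trans (cong (λ m → map proj₁ (filter (terminal? C ∘ proj₂) (zip (applyUpTo suc m) (intersectionOrder C))))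
                                  (sym lengths)) (proj₁ labelled)
      where
      C = (a , b) ∷ X
      labelled = tree-labels n inc s (length C) (s≤s (ℕₚ.≤-reflexive (sym (nest-length n)))) C (λ _ d∈ _ → d∈) id
      lengths : length (intersectionOrder C) ≡ length C
      lengths = trans (proj₂ labelled) (cong suc (sym (nest-length n)))

  terminals-head : ∀ F → ∃ λ ts → terminals F ≡ firstLabel F ∷ ts
  terminals-head leaf = [] , refl
  terminals-head (fork F₁ g F₂) with terminals F₁ | terminals-head F₁
  ... | _ | ts , refl = _ , refl

  t₁≡firstLabel : ∀ F → fromMaybe 0 (head (terminals F)) ≡ firstLabel F
  t₁≡firstLabel F with terminals F | terminals-head F
  ... | _ | ts , refl = refl

  gapsFrom : ℕ → List ℕ → List ℕ
  gapsFrom p []       = []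
  gapsFrom p (t ∷ ts) = (t ∸ p) ∷ gapsFrom t ts

  zipWith-∸ : ∀ t ts → zipWith _∸_ ts (t ∷ ts) ≡ gapsFrom t ts
  zipWith-∸ t []        = refl
  zipWith-∸ t (t′ ∷ ts) = cong (t′ ∸ t ∷_) (zipWith-∸ t′ ts)

  lastFrom : ℕ → List ℕ → ℕ
  lastFrom p []       = p
  lastFrom p (t ∷ ts) = lastFrom t ts

  gapsFrom-++ : ∀ p xs ys → gapsFrom p (xs ++ ys) ≡ gapsFrom p xs ++ gapsFrom (lastFrom p xs) ys
  gapsFrom-++ p []       ys = refl
  gapsFrom-++ p (x ∷ xs) ys = cong (x ∸ p ∷_) (gapsFrom-++ x xs ys)

  gapsFrom-shift : ∀ k p xs → gapsFrom (k + p) (map (k +_) xs) ≡ gapsFrom p xs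
  gapsFrom-shift k p []       = refl
  gapsFrom-shift k p (x ∷ xs) = cong₂ _∷_ (ℕₚ.[m+n]∸[m+o]≡n∸o k x p) (gapsFrom-shift k x xs)

  lastFrom-++ : ∀ p xs ys → lastFrom p (xs ++ ys) ≡ lastFrom (lastFrom p xs) ys
  lastFrom-++ p []       ys = refl
  lastFrom-++ p (x ∷ xs) ys = lastFrom-++ x xs ys

  lastFrom-shift : ∀ k p xs → lastFrom (k + p) (map (k +_) xs) ≡ k + lastFrom p xs
  lastFrom-shift k p []       = refl
  lastFrom-shift k p (x ∷ xs) = lastFrom-shift k x xs

  -- The chord labelled last is the last one of the last component, and by induction terminal. So
  -- the difference of labels across two components depends only on the second.
  last-terminals  : ∀ F p → lastFrom p (terminals F) ≡ suc (size F)
  last-terminalsᶠ : ∀ F → lastFrom 0 (terminalsᶠ F) ≡ size F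
  last-terminals leaf           p = refl
  last-terminals F@(fork F₁ g F₂) p with terminals F | terminals-head F | last-suc
    where
    last-suc : lastFrom (suc 0) (terminals F) ≡ suc (size F)
    last-suc = trans (lastFrom-shift 1 0 (terminalsᶠ F)) (cong suc (last-terminalsᶠ F))
  ... | _ | ts , refl | eq = eq
  last-terminalsᶠ leaf           = refl
  last-terminalsᶠ (fork F₁ g F₂) = trans (lastFrom-++ 0 (terminals F₁) _)
    (trans (cong (λ p → lastFrom p (map (suc (size F₁) +_) (terminalsᶠ F₂))) (trans (last-terminals F₁ 0) (sym (ℕₚ.+-identityʳ _))))
      (trans (lastFrom-shift (suc (size F₁)) 0 (terminalsᶠ F₂)) (cong (suc (size F₁) +_) (last-terminalsᶠ F₂))))

  length-terminals  : ∀ F → length (terminals F) ≤ suc (size F)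
  length-terminalsᶠ : ∀ F → length (terminalsᶠ F) ≤ size F
  length-terminals leaf           = s≤s z≤n
  length-terminals F@(fork _ _ _) = ℕₚ.≤-trans (ℕₚ.≤-reflexive (length-map suc (terminalsᶠ F)))
    (ℕₚ.m≤n⇒m≤1+n (length-terminalsᶠ F))
  length-terminalsᶠ leaf           = z≤n
  length-terminalsᶠ (fork F₁ g F₂) = ℕₚ.≤-trans (ℕₚ.≤-reflexive (length-++ (terminals F₁)))
    (ℕₚ.+-mono-≤ (length-terminals F₁) (ℕₚ.≤-trans (ℕₚ.≤-reflexive (length-map _ (terminalsᶠ F₂))) (length-terminalsᶠ F₂)))

  -- Valencies

  module _ {a p q} {A : Set a} {P : Pred A p} {Q : Pred A q} (P? : Decidable P) (Q? : Decidable Q) where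

    count-≤ : ∀ xs → (∀ {x} → x ∈ xs → P x → Q x) → length (filter P? xs) ≤ length (filter Q? xs)
    count-≤ []       f = z≤n
    count-≤ (x ∷ xs) f with P? x | Q? x
    ... | yes _ | yes _ = s≤s (count-≤ xs (f ∘ there))
    ... | yes p | no ¬q = contradiction (f (here refl) p) ¬q
    ... | no _  | yes _ = ℕₚ.m≤n⇒m≤1+n (count-≤ xs (f ∘ there))
    ... | no _  | no _  = count-≤ xs (f ∘ there)

    count-< : ∀ xs → (∀ {x} → x ∈ xs → P x → Q x) → ∀ {x} → x ∈ xs → Q x → ¬ P x →
              length (filter P? xs) < length (filter Q? xs)
    count-< (x ∷ xs) f x∈ q ¬p with P? x | Q? x | x∈
    ... | yes p  | no ¬q  | _         = contradiction (f (here refl) p) ¬q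
    ... | yes p  | _      | here refl = contradiction p ¬p
    ... | _      | no ¬q  | here refl = contradiction q ¬q
    ... | no _   | yes _  | here refl = s≤s (count-≤ xs (f ∘ there))
    ... | yes _  | yes _  | there x∈′ = s≤s (count-< xs (f ∘ there) x∈′ q ¬p)
    ... | no _   | yes _  | there x∈′ = ℕₚ.m<n⇒m<1+n (count-< xs (f ∘ there) x∈′ q ¬p)
    ... | no _   | no _   | there x∈′ = count-< xs (f ∘ there) x∈′ q ¬p

    count-≤-suc : ∀ {y xs} → Unique xs → (∀ {x} → x ∈ xs → Q x → P x ⊎ x ≡ y) →
                  length (filter Q? xs) ≤ suc (length (filter P? xs))
    count-≤-suc {xs = []} _ f = z≤n
    count-≤-suc {xs = x ∷ xs} (x∉ ∷ u) f with P? x | Q? x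
    ... | yes _ | yes _ = s≤s (count-≤-suc u (f ∘ there))
    ... | yes _ | no _  = ℕₚ.m≤n⇒m≤1+n (count-≤-suc u (f ∘ there))
    ... | no _  | no _  = count-≤-suc u (f ∘ there)
    ... | no ¬p | yes q with f (here refl) q
    ...   | inj₁ p    = contradiction p ¬p
    ...   | inj₂ refl = s≤s (transfer xs x∉ (f ∘ there))
      where
      transfer : ∀ xs → All (x ≢_) xs → (∀ {z} → z ∈ xs → Q z → P z ⊎ z ≡ x) →
                 length (filter Q? xs) ≤ length (filter P? xs)
      transfer []       _          _ = z≤n
      transfer (z ∷ zs) (z≢ ∷ z∉) f with P? z | Q? z
      ... | yes _ | yes _ = s≤s (transfer zs z∉ (f ∘ there))
      ... | yes _ | no _  = ℕₚ.m≤n⇒m≤1+n (transfer zs z∉ (f ∘ there))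
      ... | no _  | no _  = transfer zs z∉ (f ∘ there)
      ... | no ¬p | yes q with f (here refl) q
      ...   | inj₁ p  = contradiction p ¬p
      ...   | inj₂ eq = contradiction (sym eq) z≢

  extremal : ∀ {a r} {A : Set a} {R : A → A → Set r} → (∀ x → R x x) → (∀ x y → R x y ⊎ R y x) →
             (∀ {x y z} → R x y → R y z → R x z) → ∀ xs → xs ≢ [] → ∃ λ x → x ∈ xs × (∀ {y} → y ∈ xs → R x y)
  extremal rf total tr []            ne = contradiction refl ne
  extremal rf total tr (x ∷ [])      ne = x , here refl , λ { (here refl) → rf x }
  extremal rf total tr (x ∷ y ∷ xs) ne with extremal rf total tr (y ∷ xs) (λ ())
  ... | z , z∈ , f with total x z
  ...   | inj₁ xz = x , here refl , λ { (here refl) → rf x ; (there w∈) → tr xz (f w∈) }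
  ...   | inj₂ zx = z , there z∈ , λ { (here refl) → zx ; (there w∈) → f w∈ }

  greatest-sink : ∀ E → E ≢ [] → ∃ λ e → e ∈ E × (∀ {d} → d ∈ E → sink d ≤ sink e)
  greatest-sink = extremal {R = λ c d → sink d ≤ sink c} (λ _ → ℕₚ.≤-refl) (λ c d → ℕₚ.≤-total (sink d) (sink c))
    (λ p q → ℕₚ.≤-trans q p)

  least-sink : ∀ E → E ≢ [] → ∃ λ e → e ∈ E × (∀ {d} → d ∈ E → sink e ≤ sink d)
  least-sink = extremal {R = λ c d → sink c ≤ sink d} (λ _ → ℕₚ.≤-refl) (λ c d → ℕₚ.≤-total (sink c) (sink d)) ℕₚ.≤-trans

  subdiagrams-⊆ : ∀ D {E} → E ∈ subdiagrams D → ∀ {x} → x ∈ E → x ∈ D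
  subdiagrams-⊆ []      (here refl) ()
  subdiagrams-⊆ (c ∷ D) E∈ x∈ with ∈-++⁻ (map (c ∷_) (subdiagrams D)) E∈
  ... | inj₂ E∈′ = there (subdiagrams-⊆ D E∈′ x∈)
  ... | inj₁ E∈′ with ∈-map⁻ (c ∷_) E∈′ | x∈
  ...   | E′ , E′∈ , refl | here refl = here refl
  ...   | E′ , E′∈ , refl | there x∈′ = there (subdiagrams-⊆ D E′∈ x∈′)

  subdiagrams-AllPairs : ∀ {r} {R : Chord → Chord → Set r} D {E} → E ∈ subdiagrams D → AllPairs R D → AllPairs R E
  subdiagrams-AllPairs []      (here refl) _        = []
  subdiagrams-AllPairs (c ∷ D) E∈          (p ∷ ps) with ∈-++⁻ (map (c ∷_) (subdiagrams D)) E∈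
  ... | inj₂ E∈′ = subdiagrams-AllPairs D E∈′ ps
  ... | inj₁ E∈′ with ∈-map⁻ (c ∷_) E∈′
  ...   | E′ , E′∈ , refl = All.tabulate (All.lookup p ∘ subdiagrams-⊆ D E′∈) ∷ subdiagrams-AllPairs D E′∈ ps

  ∈-subdiagrams : ∀ {r} {R : Chord → Chord → Set r} → (∀ {x y} → R x y → ¬ R y x) → ∀ D {E} →
                  AllPairs R D → AllPairs R E → (∀ {x} → x ∈ E → x ∈ D) → E ∈ subdiagrams D
  ∈-subdiagrams asym []      {[]}    _        _        _ = here refl
  ∈-subdiagrams asym []      {e ∷ E} _        _        f with () ← f (here refl)
  ∈-subdiagrams asym (c ∷ D) {[]}    (p ∷ ps) _        f =
    ∈-++⁺ʳ (map (c ∷_) (subdiagrams D)) (∈-subdiagrams asym D ps [] (λ ()))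
  ∈-subdiagrams asym (c ∷ D) {e ∷ E} (p ∷ ps) (q ∷ qs) f with f (here refl)
  ... | here refl = ∈-++⁺ˡ (∈-map⁺ (c ∷_) (∈-subdiagrams asym D ps qs λ x∈ → narrow x∈ (f (there x∈))))
    where
    narrow : ∀ {x} → x ∈ E → x ∈ c ∷ D → x ∈ D
    narrow x∈ (here refl) = contradiction (All.lookup q x∈) (asym (All.lookup q x∈))
    narrow x∈ (there x∈′) = x∈′
  ... | there e∈D = ∈-++⁺ʳ (map (c ∷_) (subdiagrams D)) (∈-subdiagrams asym D ps (q ∷ qs) λ x∈ → narrow x∈ (f x∈))
    where
    narrow : ∀ {x} → x ∈ e ∷ E → x ∈ c ∷ D → x ∈ D
    narrow _           (there x∈′) = x∈′
    narrow (here refl) (here refl) = e∈D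
    narrow (there x∈)  (here refl) = contradiction (All.lookup q x∈) (asym (All.lookup p e∈D))

  module MaxBlocks {D : Diagram} (sorted : Sorted D) (distinct : Distinct D) (proper : Proper D) where

    -- Good a e: the points after a up to the sink of e form a closed interval;
    -- the sinks of such e are the ends of the blocks after a.

    Closed : ℕ → ℕ → Chord → Set
    Closed a m x = (a < source x → source x ≤ m → sink x ≤ m) × (a < sink x → sink x ≤ m → a < source x)

    Good : ℕ → Chord → Set
    Good a e = a < source e × All (Closed a (sink e)) D

    good? : ∀ a → Decidable (Good a)
    good? a e = a ℕₚ.<? source e ×-dec all? (λ x →
      (a ℕₚ.<? source x →-dec source x ℕₚ.≤? sink e →-dec sink x ℕₚ.≤? sink e) ×-dec
      (a ℕₚ.<? sink x →-dec sink x ℕₚ.≤? sink e →-dec a ℕₚ.<? source x)) D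

    ends : ℕ → ℕ
    ends a = length (filter (good? a) D)

    closedAt : ∀ {a e} → Good a e → ∀ {x} → x ∈ D → Closed a (sink e) x
    closedAt (_ , g) = All.lookup g

    max-endpoint : ∀ {E e} → (∀ {x} → x ∈ E → x ∈ D) → e ∈ E → (∀ {d} → d ∈ E → sink d ≤ sink e) →
                   max 0 (endpoints E) ≡ sink e
    max-endpoint {E} {e} E⊆D e∈ f = ℕₚ.≤-antisym (max≤v⁺ z≤n (All.tabulate bound))
      (v≤max⁺ 0 (endpoints E) (inj₂ (lose (proj₂ (∈-endpoints e∈)) ℕₚ.≤-refl)))
      where
      bound : ∀ {p} → p ∈ endpoints E → p ≤ sink e
      bound p∈ with ∈-endpoints⁻ E p∈
      ... | d , d∈ , inj₁ refl = ℕₚ.≤-trans (ℕₚ.<⇒≤ (proper (E⊆D d∈))) (f d∈)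
      ... | d , d∈ , inj₂ refl = f d∈

    endpoint-owner : ∀ {E x} → (∀ {y} → y ∈ E → y ∈ D) → x ∈ D → source x ∈ endpoints E ⊎ sink x ∈ endpoints E → x ∈ E
    endpoint-owner {E} E⊆D x∈ (inj₁ s∈) with ∈-endpoints⁻ E s∈
    ... | d , d∈ , inj₁ eq = subst (_∈ E) (sym (sorted-injective sorted x∈ (E⊆D d∈) eq)) d∈
    ... | d , d∈ , inj₂ eq = contradiction eq (source≢sink distinct x∈ (E⊆D d∈))
    endpoint-owner {E} E⊆D x∈ (inj₂ t∈) with ∈-endpoints⁻ E t∈
    ... | d , d∈ , inj₁ eq = contradiction (sym eq) (source≢sink distinct (E⊆D d∈) x∈)
    ... | d , d∈ , inj₂ eq = subst (_∈ E) (sym (distinct-sink distinct x∈ (E⊆D d∈) eq)) d∈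

    -- The end of the first block is one of the ends after a, but not an end after itself; every end
    -- after it is also an end after a. So each block uses up one end.
    blocks⇒≤ : ∀ a j → Blocks D a j → j ≤ ends a
    blocks⇒≤ a zero    _  = z≤n
    blocks⇒≤ a (suc j) bs with find bs
    ... | E , E∈ , (ne , _) , (a<E , covers) , rest with greatest-sink E ne
    ...   | e , e∈ , top = ℕₚ.≤-trans (s≤s (blocks⇒≤ m j (subst (λ p → Blocks D p j) (max-endpoint E⊆D e∈ top) rest)))
                                      (count-< (good? m) (good? a) D widen (E⊆D e∈) good-e (λ (m<e , _) → ℕₚ.<-asym m<e (proper (E⊆D e∈))))
      where
      m = sink e
      E⊆D : ∀ {x} → x ∈ E → x ∈ D
      E⊆D = subdiagrams-⊆ D E∈
      inE : ∀ {p} → p ∈ endpoints D → a < p → p ≤ m → p ∈ endpoints E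
      inE p∈ a<p p≤m = All.lookup covers p∈ a<p (lose (proj₂ (∈-endpoints e∈)) p≤m)
      source-inE : ∀ {x} → x ∈ D → a < source x → source x ≤ m → x ∈ E
      source-inE x∈ p q = endpoint-owner E⊆D x∈ (inj₁ (inE (proj₁ (∈-endpoints x∈)) p q))
      sink-inE : ∀ {x} → x ∈ D → a < sink x → sink x ≤ m → x ∈ E
      sink-inE x∈ p q = endpoint-owner E⊆D x∈ (inj₂ (inE (proj₂ (∈-endpoints x∈)) p q))
      after-a : ∀ {x} → x ∈ E → a < source x
      after-a x∈ = All.lookup a<E (proj₁ (∈-endpoints x∈))
      good-e : Good a e
      good-e = after-a e∈ , All.tabulate λ x∈ → (λ p q → top (source-inE x∈ p q)) , (λ p q → after-a (sink-inE x∈ p q))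
      widen : ∀ {x} → x ∈ D → Good m x → Good a x
      widen {x} x∈ g@(m<x , _) = a<x , All.tabulate λ y∈ → from-source y∈ , from-sink y∈
        where
        a<m : a < m
        a<m = ℕₚ.<-trans (after-a e∈) (proper (E⊆D e∈))
        a<x : a < source x
        a<x = ℕₚ.<-trans a<m m<x
        m≤t : m ≤ sink x
        m≤t = ℕₚ.<⇒≤ (ℕₚ.<-trans m<x (proper x∈))
        from-source : ∀ {y} → y ∈ D → a < source y → source y ≤ sink x → sink y ≤ sink x
        from-source {y} y∈ p q with source y ℕₚ.≤? m
        ... | yes s≤m = ℕₚ.≤-trans (top (source-inE y∈ p s≤m)) m≤t
        ... | no s≰m  = proj₁ (closedAt g y∈) (ℕₚ.≰⇒> s≰m) q
        from-sink : ∀ {y} → y ∈ D → a < sink y → sink y ≤ sink x → a < source y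
        from-sink {y} y∈ p q with sink y ℕₚ.≤? m
        ... | yes t≤m = after-a (sink-inE y∈ p t≤m)
        ... | no t≰m  = ℕₚ.<-trans a<m (proj₂ (closedAt g y∈) (ℕₚ.≰⇒> t≰m) q)

    -- Cutting at the least end gives an indecomposable block by minimality, and all other ends
    -- remain ends behind it.
    ≤⇒blocks : ∀ a j → j ≤ ends a → Blocks D a j
    ≤⇒blocks a zero    _  = tt
    ≤⇒blocks a (suc j) j< with least-sink (filter (good? a) D) (λ eq → ℕₚ.<⇒≱ (ℕₚ.≤-trans (s≤s z≤n) j<) (ℕₚ.≤-reflexive (cong length eq)))
    ... | e , e∈filter , least = lose E∈ ((ne , indecomposable) , (after , covers) , subst (λ p → Blocks D p j) (sym max≡) (≤⇒blocks m j (ℕₚ.≤-pred (ℕₚ.≤-trans j< fewer))))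
      where
      e∈ : e ∈ D
      e∈ = proj₁ (∈-filter⁻ (good? a) e∈filter)
      good-e : Good a e
      good-e = proj₂ (∈-filter⁻ (good? a) {xs = D} e∈filter)
      m = sink e
      within? : ∀ x → Dec (a < source x × source x ≤ m)
      within? x = a ℕₚ.<? source x ×-dec source x ℕₚ.≤? m
      E = filter within? D
      E⊆D : ∀ {x} → x ∈ E → x ∈ D
      E⊆D x∈ = proj₁ (∈-filter⁻ within? x∈)
      E-within : ∀ {x} → x ∈ E → a < source x × source x ≤ m
      E-within x∈ = proj₂ (∈-filter⁻ within? {xs = D} x∈)
      sortedE : Sorted E
      sortedE = AllPairsₚ.filter⁺ within? sorted
      E∈ : E ∈ subdiagrams D
      E∈ = ∈-subdiagrams (λ {c} {d} → ℕₚ.<-asym {source c} {source d}) D sorted sortedE E⊆D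
      e∈E : e ∈ E
      e∈E = ∈-filter⁺ within? e∈ (proj₁ good-e , ℕₚ.<⇒≤ (proper e∈))
      ne : E ≢ []
      ne eq with () ← subst (e ∈_) eq e∈E
      top : ∀ {x} → x ∈ E → sink x ≤ m
      top x∈ = let (p , q) = E-within x∈ in proj₁ (closedAt good-e (E⊆D x∈)) p q
      max≡ : max 0 (endpoints E) ≡ m
      max≡ = max-endpoint E⊆D e∈E top
      after : All (a <_) (endpoints E)
      after = All.tabulate bound
        where
        bound : ∀ {p} → p ∈ endpoints E → a < p
        bound p∈ with ∈-endpoints⁻ E p∈
        ... | d , d∈ , inj₁ refl = proj₁ (E-within d∈)
        ... | d , d∈ , inj₂ refl = ℕₚ.<-trans (proj₁ (E-within d∈)) (proper (E⊆D d∈))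
      covers : All (λ p → a < p → Any (p ≤_) (endpoints E) → p ∈ endpoints E) (endpoints D)
      covers = All.tabulate λ p∈ a<p some → cover p∈ a<p (≤m some)
        where
        ≤m : ∀ {p} → Any (p ≤_) (endpoints E) → p ≤ m
        ≤m some = let (q , q∈ , p≤q) = find some in
          ℕₚ.≤-trans p≤q (subst (q ≤_) max≡ (All.lookup (xs≤max 0 (endpoints E)) q∈))
        cover : ∀ {p} → p ∈ endpoints D → a < p → p ≤ m → p ∈ endpoints E
        cover p∈ a<p p≤m with ∈-endpoints⁻ D p∈
        ... | d , d∈ , inj₁ refl = proj₁ (∈-endpoints (∈-filter⁺ within? d∈ (a<p , p≤m)))
        ... | d , d∈ , inj₂ refl = proj₂ (∈-endpoints (∈-filter⁺ within? d∈
                (proj₂ (closedAt good-e d∈) a<p p≤m , ℕₚ.≤-trans (ℕₚ.<⇒≤ (proper d∈)) p≤m)))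
      indecomposable : ∀ {i} → i < length E → 0 < i → ¬ Before (take i E) (drop i E)
      indecomposable {i} i< 0<i before = split (∈-++⁻ (take i E) (subst (e ∈_) (sym (take++drop≡id i E)) e∈E))
        where
        T = take i E
        U = drop i E
        T⊆E : ∀ {x} → x ∈ T → x ∈ E
        T⊆E x∈ = subst (_ ∈_) (take++drop≡id i E) (∈-++⁺ˡ x∈)
        U⊆E : ∀ {x} → x ∈ U → x ∈ E
        U⊆E x∈ = subst (_ ∈_) (take++drop≡id i E) (∈-++⁺ʳ T x∈)
        nonemptyU : ∀ i (xs : Diagram) → i < length xs → ∃ λ x → x ∈ drop i xs
        nonemptyU zero    (x ∷ xs) _        = x , here refl
        nonemptyU (suc i) (x ∷ xs) (s≤s i<) = nonemptyU i xs i<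
        nonemptyT : ∀ i (xs : Diagram) → 0 < i → 0 < length xs → take i xs ≢ []
        nonemptyT (suc i) (x ∷ xs) _ _ ()
        T<U : ∀ {t u} → t ∈ T → u ∈ U → sink t < source u × sink t < sink u
        T<U t∈ u∈ = let ps = All.lookup before (proj₂ (∈-endpoints t∈)) in
          All.lookup ps (proj₁ (∈-endpoints u∈)) , All.lookup ps (proj₂ (∈-endpoints u∈))
        split : e ∈ T ⊎ e ∈ U → ⊥
        split (inj₁ e∈T) = let (u , u∈) = nonemptyU i E i< in ℕₚ.<⇒≱ (proj₂ (T<U e∈T u∈)) (top (U⊆E u∈))
        -- If e is in the second part, the first part closes at a smaller end, against the choice of
        -- e.
        split (inj₂ e∈U) with greatest-sink T (nonemptyT i E 0<i (ℕₚ.≤-<-trans z≤n i<))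
        ... | t , t∈ , topT = ℕₚ.<⇒≱ t<e (least (∈-filter⁺ (good? a) (E⊆D (T⊆E t∈)) good-t))
          where
          t<e : sink t < m
          t<e = proj₂ (T<U t∈ e∈U)
          inT : ∀ {x} → x ∈ D → a < source x → source x ≤ sink t → x ∈ T
          inT x∈ p q with ∈-++⁻ T (subst (_ ∈_) (sym (take++drop≡id i E)) (∈-filter⁺ within? x∈ (p , ℕₚ.≤-trans q (ℕₚ.<⇒≤ t<e))))
          ... | inj₁ x∈T = x∈T
          ... | inj₂ x∈U = contradiction q (ℕₚ.<⇒≱ (proj₁ (T<U t∈ x∈U)))
          good-t : Good a t
          good-t = proj₁ (E-within (T⊆E t∈)) , All.tabulate λ x∈ →
            (λ p q → topT (inT x∈ p q)) , (λ p q → proj₂ (closedAt good-e x∈) p (ℕₚ.≤-trans q (ℕₚ.<⇒≤ t<e)))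
      fewer : ends a ≤ suc (ends m)
      fewer = count-≤-suc (good? m) (good? a) (AllPairs.map (λ { lt refl → ℕₚ.<-irrefl refl lt }) sorted) λ x∈ g → later x∈ g
        where
        later : ∀ {x} → x ∈ D → Good a x → Good m x ⊎ x ≡ e
        later {x} x∈ g with x ≟ᶜ e
        ... | yes eq = inj₂ eq
        ... | no x≢e = inj₁ (m<x , All.tabulate λ y∈ →
            (λ p q → proj₁ (closedAt g y∈) (ℕₚ.<-trans a<m p) q) , from-sink y∈)
          where
          a<m : a < m
          a<m = ℕₚ.<-trans (proj₁ good-e) (proper e∈)
          m<t : m < sink x
          m<t = ℕₚ.≤∧≢⇒< (least (∈-filter⁺ (good? a) x∈ g)) (λ eq → x≢e (sym (distinct-sink distinct e∈ x∈ eq)))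
          m<x : m < source x
          m<x = ℕₚ.≰⇒> λ s≤m → ℕₚ.<⇒≱ m<t (proj₁ (closedAt good-e x∈) (proj₁ g) s≤m)
          from-sink : ∀ {y} → y ∈ D → m < sink y → sink y ≤ sink x → m < source y
          from-sink {y} y∈ p q = ℕₚ.≰⇒> λ s≤m → ℕₚ.<⇒≱ p
            (proj₁ (closedAt good-e y∈) (proj₂ (closedAt g y∈) (ℕₚ.<-trans a<m p) q) s≤m)

    maxBlocks≡ends : ∀ a → maxBlocks D a ≡ ends a
    maxBlocks≡ends a = ℕₚ.≤-antisym
      (max≤v⁺ z≤n (All.tabulate λ {j} j∈ → blocks⇒≤ a j (proj₂ (∈-filter⁻ (blocks? D a) {xs = upTo (suc (length D))} j∈))))
      (v≤max⁺ 0 (filter (blocks? D a) (upTo (suc (length D)))) (inj₂ (lose (∈-filter⁺ (blocks? D a)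
        (∈-upTo⁺ (s≤s (length-filter (good? a) D))) (≤⇒blocks a (ends a) ℕₚ.≤-refl)) ℕₚ.≤-refl)))

  -- d is the last chord that is open just after the point p.

  Owned : Diagram → Chord → ℕ → Set
  Owned C d p = Open d p × All (λ x → source d < source x → ¬ Open x p) C

  owned? : ∀ C d p → Dec (Owned C d p)
  owned? C d p = (source d ℕₚ.≤? p ×-dec p ℕₚ.<? sink d)
    ×-dec all? (λ x → source d ℕₚ.<? source x →-dec ¬? (source x ℕₚ.≤? p ×-dec p ℕₚ.<? sink x)) C

  module _ {a p r} {A : Set a} {P : Pred A p} {R : Pred A r} (P? : Decidable P) (R? : Decidable R) where

    count-split : ∀ xs → length (filter P? xs) ≡
                  length (filter P? (filter R? xs)) + length (filter P? (filter (¬? ∘ R?) xs))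
    count-split []       = refl
    count-split (x ∷ xs) with P? x in eq | R? x
    ... | yes _ | yes _ rewrite eq = cong suc (count-split xs)
    ... | no _  | yes _ rewrite eq = count-split xs
    ... | yes _ | no _  rewrite eq = trans (cong suc (count-split xs)) (sym (ℕₚ.+-suc _ _))
    ... | no _  | no _  rewrite eq = count-split xs

  sink-count : ∀ {p} {P : Pred ℕ p} (P? : Decidable P) k e E →
               length (filter P? (endpoints E)) ≡ k + length (filter (P? ∘ sink) E) →
               length (filter P? (sink e ∷ endpoints E)) ≡ k + length (filter (P? ∘ sink) (e ∷ E))
  sink-count P? k e E eq with P? (sink e)
  ... | yes _ = trans (cong suc eq) (sym (ℕₚ.+-suc k _))
  ... | no _  = eq

  module _ {C} (sorted : Sorted C) (distinct : Distinct C) (proper : Proper C) {d} (d∈ : d ∈ C) where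

    private
      OwnedSink : Chord → Set
      OwnedSink e = Owned C d (sink e)

      ownedSink? : Decidable OwnedSink
      ownedSink? e = owned? C d (sink e)

      D : Diagram
      D = filter (λ e → ¬? (e ⌒? d)) C

      D⊆C : ∀ {x} → x ∈ D → x ∈ C
      D⊆C x∈ = proj₁ (∈-filter⁻ (λ e → ¬? (e ⌒? d)) x∈)

      ¬left : ∀ {x} → x ∈ D → ¬ x ⌒ d
      ¬left x∈ = proj₂ (∈-filter⁻ (λ e → ¬? (e ⌒? d)) {xs = C} x∈)

      ∈D : ∀ {x} → x ∈ C → ¬ x ⌒ d → x ∈ D
      ∈D x∈ nl = ∈-filter⁺ (λ e → ¬? (e ⌒? d)) x∈ nl

      d∈D : d ∈ D
      d∈D = ∈D d∈ (λ (lt , _) → ℕₚ.<-irrefl refl lt)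

      ≢→< : ∀ {m n} → m ≤ n → m ≢ n → m < n
      ≢→< = ℕₚ.≤∧≢⇒<

      distinctD : Distinct D
      distinctD = AllPairs-interleaveʳ (endpoints-interleaving (partition-interleave (_⌒? d) C)) distinct

      module M = MaxBlocks {D} (AllPairsₚ.filter⁺ (λ e → ¬? (e ⌒? d)) sorted) distinctD (proper ∘ D⊆C)

    -- A left neighbour e of d starts before d, so it crosses a chord after d exactly if that chord
    -- is open at the sink of e. P stands for the condition in `valency`, which is decided there by
    -- a local function.
    left-neighbours : ∀ {p} {P : Pred Chord p} (P? : Decidable P) →
                      (∀ e → P e → All (λ x → source d < source x → ¬ Cross e x) C) →
                      (∀ e → All (λ x → source d < source x → ¬ Cross e x) C → P e) →
                      length (filter P? (filter (_⌒? d) C)) ≡ length (filter ownedSink? (filter (_⌒? d) C))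
    left-neighbours P? to from = cong length (filter-cong P? ownedSink? (filter (_⌒? d) C) (λ e∈ p → forth e∈ (to _ p)) (λ e∈ q → from _ (back e∈ q)))
      where
      forth : ∀ {e} → e ∈ filter (_⌒? d) C → All (λ x → source d < source x → ¬ Cross e x) C → OwnedSink e
      forth {e} e∈ nc with ∈-filter⁻ (_⌒? d) {xs = C} e∈
      ... | e∈C , (e<d , d<t , t<u) = (ℕₚ.<⇒≤ d<t , t<u) , All.tabulate λ x∈ d<x (x≤t , t<v) →
        All.lookup nc x∈ d<x (inj₁ (ℕₚ.<-trans e<d d<x , ≢→< x≤t (source≢sink distinct x∈ e∈C) , t<v))
      back : ∀ {e} → e ∈ filter (_⌒? d) C → OwnedSink e → All (λ x → source d < source x → ¬ Cross e x) C
      back {e} e∈ (_ , later) with ∈-filter⁻ (_⌒? d) {xs = C} e∈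
      ... | e∈C , (e<d , d<t , t<u) = All.tabulate λ where
        x∈ d<x (inj₁ (_ , x<t , t<v)) → All.lookup later x∈ d<x (ℕₚ.<⇒≤ x<t , t<v)
        x∈ d<x (inj₂ (x<e , _))       → ℕₚ.<-asym x<e (ℕₚ.<-trans e<d d<x)

    -- Without its left neighbours, d is the first open chord that matters: a block after its source
    -- closes where d is open and no later chord is.
    blocks-after : maxBlocks D (source d) ≡ length (filter ownedSink? D)
    blocks-after = trans (M.maxBlocks≡ends (source d))
      (cong length (filter-cong (M.good? (source d)) ownedSink? D forth back))
      where
      forth : ∀ {e} → e ∈ D → M.Good (source d) e → OwnedSink e
      forth {e} e∈ g@(d<e , _) = (ℕₚ.<⇒≤ d<t , t<u) , All.tabulate later
        where
        d<t : source d < sink e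
        d<t = ℕₚ.<-trans d<e (proper (D⊆C e∈))
        t<u : sink e < sink d
        t<u = ℕₚ.≰⇒> λ u≤t → ℕₚ.<-irrefl refl (proj₂ (M.closedAt g d∈D) (proper d∈) u≤t)
        later : ∀ {x} → x ∈ C → source d < source x → ¬ Open x (sink e)
        later x∈ d<x (x≤t , t<v) = ℕₚ.<⇒≱ t<v
          (proj₁ (M.closedAt g (∈D x∈ (λ (x<d , _) → ℕₚ.<-asym x<d d<x))) d<x x≤t)
      back : ∀ {e} → e ∈ D → OwnedSink e → M.Good (source d) e
      back {e} e∈ ((d≤t , t<u) , later) = after (D⊆C e∈) (¬left e∈) d<t t<u , All.tabulate λ {x} x∈ →
          (λ d<x x≤t → ℕₚ.≮⇒≥ λ t<v → All.lookup later (D⊆C x∈) d<x (x≤t , t<v)) ,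
          (λ d<v v≤t → after (D⊆C x∈) (¬left x∈) d<v (ℕₚ.≤-<-trans v≤t t<u))
        where
        d<t : source d < sink e
        d<t = ≢→< d≤t (source≢sink distinct d∈ (D⊆C e∈))
        after : ∀ {x} → x ∈ C → ¬ x ⌒ d → source d < sink x → sink x < sink d → source d < source x
        after {x} x∈ nl d<v v<u = ≢→< (ℕₚ.≮⇒≥ λ x<d → nl (x<d , d<v , v<u)) λ eq →
          ℕₚ.<-irrefl (cong sink (sym (sorted-injective sorted d∈ x∈ eq))) v<u

    -- Both summands count sinks owned by d, the first those of left neighbours, the second all
    -- others.
    valency≡ : valency C d ≡ length (filter ownedSink? C)
    valency≡ = trans (cong₂ _+_ (left-neighbours _ (λ _ → id) (λ _ → id)) blocks-after)
                     (sym (count-split ownedSink? (_⌒? d) C))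

    -- Besides d itself, no source is owned by d.

    count-endpoints : ∀ E → (∀ {x} → x ∈ E → x ∈ C) → Sorted E →
                      (d ∈ E → length (filter (owned? C d) (endpoints E)) ≡ suc (length (filter ownedSink? E))) ×
                      (¬ d ∈ E → length (filter (owned? C d) (endpoints E)) ≡ length (filter ownedSink? E))
    count-endpoints []      E⊆C _        = (λ ()) , (λ _ → refl)
    count-endpoints (e ∷ E) E⊆C (p ∷ ps) with count-endpoints E (E⊆C ∘ there) ps
    ... | ih∈ , ih∉ = case-∈ , case-∉
      where
      source-other : e ≢ d → ¬ Owned C d (source e)
      source-other e≢d ((d≤e , _) , later) = All.lookup later (E⊆C (here refl))
        (≢→< d≤e (λ eq → e≢d (sym (sorted-injective sorted d∈ (E⊆C (here refl)) eq))))
        (ℕₚ.≤-refl , proper (E⊆C (here refl)))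
      source-own : Owned C d (source d)
      source-own = (ℕₚ.≤-refl , proper d∈) , All.tabulate λ x∈ d<x (x≤d , _) → ℕₚ.<⇒≱ d<x x≤d
      skip : e ≢ d → length (filter (owned? C d) (endpoints (e ∷ E))) ≡ length (filter (owned? C d) (sink e ∷ endpoints E))
      skip e≢d = cong length (filter-reject (owned? C d) (source-other e≢d))
        where open import Data.List.Properties using (filter-reject)
      case-∉ : ¬ d ∈ e ∷ E → length (filter (owned? C d) (endpoints (e ∷ E))) ≡ length (filter ownedSink? (e ∷ E))
      case-∉ d∉ = trans (skip (λ eq → d∉ (here (sym eq)))) (sink-count (owned? C d) 0 e E (ih∉ (d∉ ∘ there)))
      case-∈ : d ∈ e ∷ E → length (filter (owned? C d) (endpoints (e ∷ E))) ≡ suc (length (filter ownedSink? (e ∷ E)))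
      case-∈ (here refl) = trans (cong length (filter-accept (owned? C d) source-own))
        (cong suc (sink-count (owned? C d) 0 e E (ih∉ (λ d∈E → ℕₚ.<-irrefl refl (All.lookup p d∈E)))))
        where open import Data.List.Properties using (filter-accept)
      case-∈ (there d∈E) = trans (skip (λ { refl → ℕₚ.<-irrefl refl (All.lookup p d∈E) })) (sink-count (owned? C d) 1 e E (ih∈ d∈E))

    -- The additional gap is the one behind the source of d.
    suc-valency : suc (valency C d) ≡ length (filter (owned? C d) (endpoints C))
    suc-valency = trans (cong suc valency≡) (sym (proj₁ (count-endpoints C id sorted) d∈))

  -- Owners of gaps

  postorder : ∀ {F b ps X} → Nest F b ps X → List Chord
  postorder nil                            = []
  postorder (cons {a′ = a′} {b′} n₁ n₂ i) = (postorder n₁ ++ (a′ , b′) ∷ []) ++ postorder n₂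

  length-postorder : ∀ {F b ps X} (n : Nest F b ps X) → length (postorder n) ≡ size F
  length-root      : ∀ {F b ps X} (n : Nest F b ps X) {r} → length (postorder n ++ r ∷ []) ≡ suc (size F)
  length-postorder nil             = refl
  length-postorder (cons n₁ n₂ i) = trans (length-++ (postorder n₁ ++ _ ∷ []))
    (cong₂ _+_ (length-root n₁) (length-postorder n₂))
  length-root n = trans (length-++ (postorder n)) (trans (ℕₚ.+-comm _ 1) (cong suc (length-postorder n)))

  postorder-↭ : ∀ {F b ps X} (n : Nest F b ps X) → postorder n ↭ X
  postorder-root-↭ : ∀ {F b ps X} (n : Nest F b ps X) {r} → postorder n ++ r ∷ [] ↭ r ∷ X
  postorder-↭ nil             = ↭-refl
  postorder-↭ (cons n₁ n₂ i) = ↭-trans (↭ₚ.++⁺ (postorder-root-↭ n₁) (postorder-↭ n₂)) (↭-sym (toPermutation i))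
  postorder-root-↭ n {r} = ↭-trans (↭ₚ.++-comm (postorder n) (r ∷ [])) (↭-prep r (postorder-↭ n))

  chordAt : List Chord → ℕ → Chord
  chordAt = nth (0 , 0)

  nth-++ˡ : ∀ {a} {A : Set a} {d : A} xs {ys} {k} → k < length xs → nth d (xs ++ ys) k ≡ nth d xs k
  nth-++ˡ (x ∷ xs) {k = zero}  _        = refl
  nth-++ˡ (x ∷ xs) {k = suc k} (s≤s k<) = nth-++ˡ xs k<

  nth-++ʳ : ∀ {a} {A : Set a} {d : A} xs {ys} k → nth d (xs ++ ys) (length xs + k) ≡ nth d ys k
  nth-++ʳ []       k = refl
  nth-++ʳ (x ∷ xs) k = nth-++ʳ xs k

  -- The points before the last one, paired with the slots that follow them.

  data Track (R : ℕ → Slot → Set) : List ℕ → List Slot → ℕ → Set where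
    last : ∀ {p} → Track R (p ∷ []) [] p
    _∷_  : ∀ {p s ps ss e} → R p s → Track R ps ss e → Track R (p ∷ ps) (s ∷ ss) e

  module _ {R : ℕ → Slot → Set} where

    track-end : ∀ {ps ss e} → Track R ps ss e → e ∈ ps
    track-end last    = here refl
    track-end (_ ∷ t) = there (track-end t)

    track-≤end : ∀ {ps ss e} → Track R ps ss e → Increasing ps → ∀ {p} → p ∈ ps → p ≤ e
    track-≤end last    _         (here refl) = ℕₚ.≤-refl
    track-≤end (_ ∷ t) (p ∷ ps) (here refl) = ℕₚ.<⇒≤ (All.lookup p (track-end t))
    track-≤end (_ ∷ t) (p ∷ ps) (there p∈)  = track-≤end t ps p∈

    track-map : ∀ {R′ : ℕ → Slot → Set} {f ps ss e} → (∀ {p s} → p ∈ ps → R p s → R′ p (f s)) →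
                Track R ps ss e → Track R′ ps (map f ss) e
    track-map g last    = last
    track-map g (r ∷ t) = g (here refl) r ∷ track-map (g ∘ there) t

    track-weaken : ∀ {R′ : ℕ → Slot → Set} {ps ss e} → (∀ {p s} → p ∈ ps → R p s → R′ p s) →
                   Track R ps ss e → Track R′ ps ss e
    track-weaken g last    = last
    track-weaken g (r ∷ t) = g (here refl) r ∷ track-weaken (g ∘ there) t

    track-++ : ∀ {us ss e s ps ss′ e′} → Track R us ss e → R e s → Track R ps ss′ e′ →
               Track R (us ++ ps) (ss ++ s ∷ ss′) e′
    track-++ last    r t′ = r ∷ t′
    track-++ (q ∷ t) r t′ = q ∷ track-++ t r t′

    track-split : ∀ u us {v vs ss e} → Track R ((u ∷ us) ++ v ∷ vs) ss e →
                  ∃ λ ss₁ → ∃ λ s → ∃ λ ss₂ → ∃ λ e₁ → ss ≡ ss₁ ++ s ∷ ss₂ × length ss₁ ≡ length us ×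
                  Track R (u ∷ us) ss₁ e₁ × R e₁ s × Track R (v ∷ vs) ss₂ e
    track-split u []        (r ∷ t) = [] , _ , _ , u , refl , refl , last , r , t
    track-split u (u′ ∷ us) (r ∷ t) =
      let (ss₁ , s , ss₂ , e₁ , eq , l , t₁ , q , t₂) = track-split u′ us t
      in _ ∷ ss₁ , s , ss₂ , e₁ , cong (_ ∷_) eq , cong suc l , r ∷ t₁ , q , t₂

  -- Whether a root can be attached at p without creating a top cycle.

  Admits Refuses : Diagram → ℕ → Set
  Admits  C p = ∀ {d} → d ∈ C → Open d p → ∃ λ q → p ≤ q × Owned C d q
  Refuses C p = ∃ λ d → d ∈ C × Open d p ×
                (∀ q → p ≤ q → q < sink d → ∃ λ x → x ∈ C × source d < source x × Open x q)

  TreeFlag : Diagram → ℕ → Bool → Set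
  TreeFlag C p true  = Admits C p
  TreeFlag C p false = Refuses C p

  -- Anticipates the root with sink b, which is not in X: before b it will be open and covered by
  -- the components, so that these gaps refuse.
  NestFlag : Diagram → ℕ → ℕ → Bool → Set
  NestFlag X b p true  = b ≤ p × Admits X p
  NestFlag X b p false = p < b ⊎ Refuses X p

  -- The flag is interpreted for free trees only, as its inheritance relies on the admissibility of
  -- the gap used in D¹.
  TreeSlot : Diagram → List Chord → Forest → ℕ → Slot → Set
  TreeSlot C L F p (k , fl) = k < length L × chordAt L k ∈ C × Owned C (chordAt L k) p × (isFree F ≡ true → TreeFlag C p fl)

  NestSlot : Diagram → ℕ → List Chord → Forest → ℕ → Slot → Set
  NestSlot X b L F p (k , fl) = k < length L × chordAt L k ∈ X × Owned X (chordAt L k) p × (isFree F ≡ true → NestFlag X b p fl)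

  refuses-mono : ∀ {C C′ p} → (∀ {x} → x ∈ C → x ∈ C′) → Refuses C p → Refuses C′ p
  refuses-mono f (d , d∈ , o , g) = d , f d∈ , o , λ q p≤q q<t → let (x , x∈ , r) = g q p≤q q<t in x , f x∈ , r

  take-suc-split : ∀ {a} {A : Set a} (xs : List A) {x ys} → take (suc (length xs)) (xs ++ x ∷ ys) ≡ xs ++ x ∷ []
  take-suc-split []       = refl
  take-suc-split (z ∷ xs) = cong (z ∷_) (take-suc-split xs)

  drop-split : ∀ {a} {A : Set a} (xs : List A) {ys} → drop (length xs) (xs ++ ys) ≡ ys
  drop-split []       = refl
  drop-split (z ∷ xs) = drop-split xs

  nth-split : ∀ {a} {A : Set a} {d : A} xs {x ys} → nth d (xs ++ x ∷ ys) (length xs) ≡ x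
  nth-split []       = refl
  nth-split (z ∷ xs) = nth-split xs

  inner-covered : ∀ {F b ps X} → Nest F b ps X → Increasing ps → ∀ {p q} → p ∈ ps → p ≤ q → q < b →
                  ∃ λ y → y ∈ X × Open y q
  inner-covered nil _ (here refl) p≤q q<b = contradiction p≤q (ℕₚ.<⇒≱ q<b)
  inner-covered (cons {us = us} n₁ n₂ i) inc p∈ p≤q q<b =
    let (y , y∈ , o) = covered n₁ (AllPairs.tail us++vs-increasing) (ℕₚ.≤-trans (least p∈) p≤q)
                         (ℕₚ.<-trans q<b b<v) (∈-++⁺ʳ us (here refl))
    in y , ∈-interleaveˡ i y∈ , o
    where open Geometry n₁ n₂ inc

  -- e₁ is the last point of D before ms, and eₘ the last point of ms. No endpoint of D lies behind
  -- e₁ up to eₘ, so a chord of D open at e₁ or at a point of ms is open at all of them.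
  module GapLemmas {F₁ F₂ a′ b′ b us v vs ms X₁ X₂ X}
                   (n₁ : Nest F₁ b′ (us ++ v ∷ vs) X₁) (n₂ : Nest F₂ b ms X₂)
                   (i : Interleaving ((a′ , b′) ∷ X₁) X₂ X) (inc : Increasing ((a′ ∷ us) ++ ms ++ v ∷ vs))
                   {e₁ eₘ} (e₁∈ : e₁ ∈ a′ ∷ us) (us≤e₁ : ∀ {u} → u ∈ a′ ∷ us → u ≤ e₁)
                   (eₘ∈ : eₘ ∈ ms) (≤eₘ : ∀ {m} → m ∈ ms → m ≤ eₘ) where

    open Geometry n₁ n₂ inc

    D : Diagram
    D = (a′ , b′) ∷ X₁

    ∈ˡ : ∀ {x} → x ∈ D → x ∈ X
    ∈ˡ = ∈-interleaveˡ i

    ∈ʳ : ∀ {x} → x ∈ X₂ → x ∈ X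
    ∈ʳ = ∈-interleaveʳ i

    splitX : ∀ {q} {Q : Chord → Set q} → (∀ {x} → x ∈ D → Q x) → (∀ {x} → x ∈ X₂ → Q x) → All Q X
    splitX f g = All.tabulate λ x∈ → [ f , g ]′ (∈-interleave⁻ i x∈)

    closed-before : ∀ {x p} → x ∈ X₂ → (∀ {m} → m ∈ ms → p < m) → ¬ Open x p
    closed-before x∈ p< (x≤p , _) = ℕₚ.<⇒≱ (p< (proj₁ (nest-∈ n₂ x∈))) x≤p
    closed-after : ∀ {x p} → x ∈ X₂ → (∀ {m} → m ∈ ms → m ≤ p) → ¬ Open x p
    closed-after x∈ ≤p (_ , p<t) = ℕₚ.<⇒≱ p<t (≤p (proj₂ (nest-∈ n₂ x∈)))
    back : ∀ {x p q} → x ∈ D → p ∈ ms → e₁ ≤ q → q ≤ p → Open x p → Open x q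
    back x∈ p∈ e≤q q≤p (x≤p , p<t) with ∈-++⁻ (a′ ∷ us) (proj₁ (tree-∈ n₁ x∈))
    ... | inj₁ u∈ = ℕₚ.≤-trans (us≤e₁ u∈) e≤q , ℕₚ.≤-<-trans q≤p p<t
    ... | inj₂ v∈ = contradiction x≤p (ℕₚ.<⇒≱ (ms<vs p∈ v∈))
    forward : ∀ {x q p} → x ∈ D → e₁ ≤ q → p ∈ ms → q ≤ p → Open x q → Open x p
    forward x∈ e≤q p∈ q≤p (x≤q , q<t) with ∈-++⁻ (a′ ∷ us) (proj₂ (tree-∈ n₁ x∈))
    ... | inj₁ u∈ = contradiction (ℕₚ.≤-trans (us≤e₁ u∈) e≤q) (ℕₚ.<⇒≱ q<t)
    ... | inj₂ v∈ = ℕₚ.≤-trans x≤q q≤p , ms<vs p∈ v∈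
    e₁<ms : ∀ {m} → m ∈ ms → e₁ < m
    e₁<ms = us<ms e₁∈
    owned-end : ∀ {d} → d ∈ D → Owned D d e₁ → Owned X d eₘ
    owned-end d∈ (o , later) = forward d∈ ℕₚ.≤-refl eₘ∈ (ℕₚ.<⇒≤ (e₁<ms eₘ∈)) o ,
      splitX (λ x∈ lt op → All.lookup later x∈ lt (back x∈ eₘ∈ ℕₚ.≤-refl (ℕₚ.<⇒≤ (e₁<ms eₘ∈)) op))
             (λ x∈ _ → closed-after x∈ ≤eₘ)
    -- A slot of D at the gap of ms can be moved behind ms.
    admits-middle : Admits D e₁ → ∀ {d p} → d ∈ D → p ∈ ms → Open d p → ∃ λ q → p ≤ q × Owned X d q
    admits-middle adm {d} {p} d∈ p∈ op with adm d∈ (back d∈ p∈ ℕₚ.≤-refl (ℕₚ.<⇒≤ (e₁<ms p∈)) op)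
    ... | q , e≤q , o , later with q ℕₚ.≤? eₘ
    ...   | yes q≤e = eₘ , ≤eₘ p∈ , forward d∈ e≤q eₘ∈ q≤e o ,
              splitX (λ x∈ lt op′ → All.lookup later x∈ lt (back x∈ eₘ∈ e≤q q≤e op′)) (λ x∈ _ → closed-after x∈ ≤eₘ)
    ...   | no q≰e  = q , ℕₚ.≤-trans (≤eₘ p∈) (ℕₚ.<⇒≤ (ℕₚ.≰⇒> q≰e)) , o ,
              splitX (All.lookup later) (λ x∈ _ → closed-after x∈ (λ m∈ → ℕₚ.≤-trans (≤eₘ m∈) (ℕₚ.<⇒≤ (ℕₚ.≰⇒> q≰e))))
    owned-middle : ∀ {d q} → d ∈ X₂ → Owned X₂ d q → Owned X d q
    owned-middle {d} {q} d∈ (o@(d≤q , q<t) , later) = o , splitX outer (All.lookup later)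
      where
      outer : ∀ {x} → x ∈ D → source d < source x → ¬ Open x q
      outer x∈ d<x (x≤q , _) with outside (proj₁ (tree-∈ n₁ x∈))
      ... | inj₁ below = ℕₚ.<-asym d<x (below (proj₁ (nest-∈ n₂ d∈)))
      ... | inj₂ above = ℕₚ.<⇒≱ (ℕₚ.<-trans q<t (above (proj₂ (nest-∈ n₂ d∈)))) x≤q

    -- Ownership of the gap that ms splits is moved to its second half, behind eₘ, where no chord of
    -- X₂ is open any more.
    owned-later : ∀ {d q} → d ∈ D → Owned D d q → ∃ λ q′ → q ≤ q′ × Owned X d q′
    owned-later {d} {q} d∈ (o , later) with q ℕₚ.<? e₁ | q ℕₚ.≤? eₘ
    ... | yes q<e | _       = q , ℕₚ.≤-refl , o ,
            splitX (All.lookup later) (λ x∈ _ → closed-before x∈ (λ m∈ → ℕₚ.<-trans q<e (e₁<ms m∈)))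
    ... | no q≮e  | yes q≤e = eₘ , q≤e , forward d∈ (ℕₚ.≮⇒≥ q≮e) eₘ∈ q≤e o ,
            splitX (λ x∈ lt op → All.lookup later x∈ lt (back x∈ eₘ∈ (ℕₚ.≮⇒≥ q≮e) q≤e op)) (λ x∈ _ → closed-after x∈ ≤eₘ)
    ... | no _    | no q≰e  = q , ℕₚ.≤-refl , o ,
            splitX (All.lookup later) (λ x∈ _ → closed-after x∈ (λ m∈ → ℕₚ.≤-trans (≤eₘ m∈) (ℕₚ.<⇒≤ (ℕₚ.≰⇒> q≰e))))

  -- The points are treated in the groups that make up `slotsᶠ`: `atU` before ms, where all is
  -- blocked; `atM` within ms; `atEnd` at the last point of ms, where gap g of D continues; `atV`
  -- behind.
  nest-track : ∀ {F b ps X} (n : Nest F b ps X) → Increasing ps →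
               ∃ λ e → Track (NestSlot X b (postorder n) F) ps (slotsᶠ F) e
  tree-track : ∀ {F a b ps X} (n : Nest F b ps X) → Increasing (a ∷ ps) →
               ∃ λ e → Track (TreeSlot ((a , b) ∷ X) (postorder n ++ (a , b) ∷ []) F) (a ∷ ps) (slots F) e

  tree-track {F} {a} {b} {ps} {X} n inc@(a< ∷ inc′) =
    let (e , t) = nest-track n inc′ in e , root ∷ track-weaken convert t
    where
    L = postorder n
    C = (a , b) ∷ X
    source> : ∀ {x} → x ∈ X → a < source x
    source> x∈ = All.lookup a< (proj₁ (nest-∈ n x∈))
    owned-root : Owned C (a , b) a
    owned-root = (ℕₚ.≤-refl , All.lookup a< (nest-sink∈ n)) , All.tabulate λ _ a<x (x≤a , _) → ℕₚ.<⇒≱ a<x x≤a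
    root : TreeSlot C (L ++ (a , b) ∷ []) F a (size F , true)
    root = ℕₚ.≤-reflexive (sym (length-root n)) ,
           subst (_∈ C) (sym root≡) (here refl) ,
           subst (λ c → Owned C c a) (sym root≡) owned-root ,
           λ _ → admits
      where
      root≡ : chordAt (L ++ (a , b) ∷ []) (size F) ≡ (a , b)
      root≡ = trans (cong (chordAt (L ++ (a , b) ∷ [])) (sym (length-postorder n))) (nth-split L)
      admits : Admits C a
      admits (here refl) _         = a , ℕₚ.≤-refl , owned-root
      admits (there d∈)  (d≤a , _) = contradiction d≤a (ℕₚ.<⇒≱ (source> d∈))
    owned-weaken : ∀ {d p} → d ∈ X → Owned X d p → Owned C d p
    owned-weaken d∈ (o , later) = o , (λ d<a _ → ℕₚ.<-asym d<a (source> d∈)) ∷ later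
    convert : ∀ {p s} → p ∈ ps → NestSlot X b L F p s → TreeSlot C (L ++ (a , b) ∷ []) F p s
    convert {p} {k , fl} p∈ (k< , d∈ , o , flag) =
      subst (k <_) (sym (length-++ L)) (ℕₚ.<-≤-trans k< (ℕₚ.m≤m+n _ 1)) ,
      subst (_∈ C) (sym d≡) (there d∈) ,
      subst (λ c → Owned C c p) (sym d≡) (owned-weaken d∈ o) ,
      λ free → go fl (flag free)
      where
      d≡ : chordAt (L ++ (a , b) ∷ []) k ≡ chordAt L k
      d≡ = nth-++ˡ L k<
      go : ∀ fl → NestFlag X b p fl → TreeFlag C p fl
      go true (b≤p , adm) (here refl) (_ , p<b) = contradiction b≤p (ℕₚ.<⇒≱ p<b)
      go true (b≤p , adm) (there d∈)  op        = let (q , p≤q , o) = adm d∈ op in q , p≤q , owned-weaken d∈ o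
      go false (inj₂ ref) = refuses-mono there ref
      -- The refusing chord is the root: it is open at p, and the components cover it up to b.
      go false (inj₁ p<b) = (a , b) , here refl , (ℕₚ.<⇒≤ a<p , p<b) , λ q p≤q q<b →
        let (y , y∈ , y≤q , q<t) = inner q p≤q q<b in y , there y∈ , source> y∈ , y≤q , q<t
        where
        a<p : a < p
        a<p = ℕₚ.<-≤-trans (source> d∈) (proj₁ (proj₁ o))
        inner : ∀ q → p ≤ q → q < b → ∃ λ y → y ∈ X × Open y q
        inner q = inner-covered n inc′ p∈
  nest-track nil _ = _ , last
  nest-track (cons {F₁} {F₂} {a′} {b′} {b} {us} {v} {vs} {ms} {X₁} {X₂} {X} n₁ n₂ i) inc
    with tree-track n₁ (Geometry.us++vs-increasing n₁ n₂ inc) | nest-track n₂ (Geometry.ms-increasing n₁ n₂ inc)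
  ... | e , tD | eₘ , tM with track-split a′ us tD
  ... | ss₁ , s@(k₀ , fl₀) , ss₂ , e₁ , o≡ , l≡ , t₁ , r₁ , t₂ =
    e , subst (λ ss → Track R ps ss e) (sym slots≡)
          (track-++ (track-map atU t₁) (atU (track-end t₁) r₁)
            (track-++ (track-map atM tM) (atEnd r₁) (track-weaken atV t₂)))
    where
    open Geometry n₁ n₂ inc
    open GapLemmas n₁ n₂ i inc (track-end t₁) (track-≤end t₁ (proj₁ (AllPairs-++⁻ (a′ ∷ us) us++vs-increasing)))
                   (track-end tM) (track-≤end tM ms-increasing)
    F  = fork F₁ (length us) F₂
    ps = (a′ ∷ us) ++ ms ++ v ∷ vs
    eₘ∈ : eₘ ∈ ms
    eₘ∈ = track-end tM
    ≤eₘ : ∀ {m} → m ∈ ms → m ≤ eₘ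
    ≤eₘ = track-≤end tM ms-increasing
    LD = postorder n₁ ++ (a′ , b′) ∷ []
    LM = postorder n₂
    L  = LD ++ LM
    R  = NestSlot X b L F
    slots≡ : slotsᶠ F ≡ map block ss₁ ++ block s ∷ map (shift (suc (size F₁))) (slotsᶠ F₂) ++ s ∷ ss₂
    slots≡ = trans (cong₂ (λ g o → map block (take (suc g) o) ++ map (shift (suc (size F₁))) (slotsᶠ F₂) ++ drop g o) (sym l≡) o≡)
      (trans (cong₂ (λ x y → map block x ++ map (shift (suc (size F₁))) (slotsᶠ F₂) ++ y) (take-suc-split ss₁) (drop-split ss₁))
      (trans (cong (_++ map (shift (suc (size F₁))) (slotsᶠ F₂) ++ s ∷ ss₂) (map-++ block ss₁ (s ∷ [])))
             (++-assoc (map block ss₁) (block s ∷ []) _)))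
    slot≡ : slot F₁ (length us) ≡ s
    slot≡ = trans (cong₂ (λ o g → nth (0 , false) o g) o≡ (sym l≡)) (nth-split ss₁)
    free₁ : isFree F ≡ true → isFree F₁ ≡ true
    free₁ = ∧-projˡ
    free₂ : isFree F ≡ true → isFree F₂ ≡ true
    free₂ ok = ∧-projʳ {proj₂ (slot F₁ (length us))} (∧-projʳ {isFree F₁} ok)
    flag₀ : isFree F ≡ true → fl₀ ≡ true
    flag₀ ok = trans (sym (cong proj₂ slot≡)) (∧-projˡ (∧-projʳ {isFree F₁} ok))
    indexˡ : ∀ {k} → k < length LD → k < length L
    indexˡ k< = subst (_ <_) (sym (length-++ LD)) (ℕₚ.<-≤-trans k< (ℕₚ.m≤m+n _ (length LM)))
    atU : ∀ {p s} → p ∈ a′ ∷ us → TreeSlot D LD F₁ p s → R p (block s)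
    atU {p} {k , _} p∈ (k< , d∈ , (o , later) , _) = indexˡ k< ,
      subst (_∈ X) (sym (nth-++ˡ LD k<)) (∈ˡ d∈) ,
      subst (λ c → Owned X c p) (sym (nth-++ˡ LD k<)) (o , splitX (All.lookup later) (λ x∈ _ → closed-before x∈ (us<ms p∈))) ,
      λ _ → inj₁ (us<ms p∈ (nest-sink∈ n₂))
    atM : ∀ {p s} → p ∈ ms → NestSlot X₂ b LM F₂ p s → R p (shift (suc (size F₁)) s)
    atM {p} {k , fl} p∈ (k< , d∈ , o , flag) =
      subst₂ _<_ (cong (_+ k) (length-root n₁)) (sym (length-++ LD)) (ℕₚ.+-monoʳ-< (length LD) k<) ,
      subst (_∈ X) (sym d≡) (∈ʳ d∈) ,
      subst (λ c → Owned X c p) (sym d≡) (owned-middle d∈ o) ,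
      λ ok → go fl ok (flag (free₂ ok))
      where
      open import Relation.Binary.PropositionalEquality using (subst₂)
      d≡ : chordAt L (suc (size F₁) + k) ≡ chordAt LM k
      d≡ = trans (cong (λ m → chordAt L (m + k)) (sym (length-root n₁))) (nth-++ʳ LD k)
      go : ∀ fl → isFree F ≡ true → NestFlag X₂ b p fl → NestFlag X b p fl
      go false _  (inj₁ p<b) = inj₁ p<b
      go false _  (inj₂ ref) = inj₂ (refuses-mono ∈ʳ ref)
      go true  ok (b≤p , adm) = b≤p , λ x∈ op → [ (λ d∈D → admits-middle admD d∈D p∈ op)
                                                , (λ d∈X₂ → let (q , p≤q , o) = adm d∈X₂ op in q , p≤q , owned-middle d∈X₂ o) ]′
                                                (∈-interleave⁻ i x∈)
        where
        admD : Admits D e₁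
        admD = subst (TreeFlag D e₁) (flag₀ ok) (proj₂ (proj₂ (proj₂ r₁)) (free₁ ok))
    atEnd : TreeSlot D LD F₁ e₁ s → R eₘ s
    atEnd (k< , d∈ , o , flag) = indexˡ k< ,
      subst (_∈ X) (sym (nth-++ˡ LD k<)) (∈ˡ d∈) ,
      subst (λ c → Owned X c eₘ) (sym (nth-++ˡ LD k<)) (owned-end d∈ o) ,
      λ ok → subst (NestFlag X b eₘ) (sym (flag₀ ok)) (≤eₘ (nest-sink∈ n₂) ,
        λ x∈ op → [ (λ d∈D → admits-middle (subst (TreeFlag D e₁) (flag₀ ok) (flag (free₁ ok))) d∈D eₘ∈ op)
                  , (λ d∈X₂ → contradiction op (closed-after d∈X₂ ≤eₘ)) ]′ (∈-interleave⁻ i x∈))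
    atV : ∀ {p s} → p ∈ v ∷ vs → TreeSlot D LD F₁ p s → R p s
    atV {p} {k , fl} p∈ (k< , d∈ , o , flag) = indexˡ k< ,
      subst (_∈ X) (sym (nth-++ˡ LD k<)) (∈ˡ d∈) ,
      subst (λ c → Owned X c p) (sym (nth-++ˡ LD k<)) (owned-outer ℕₚ.≤-refl o) ,
      λ ok → go fl (flag (free₁ ok))
      where
      owned-outer : ∀ {d q} → p ≤ q → Owned D d q → Owned X d q
      owned-outer p≤q (o , later) = o , splitX (All.lookup later)
        (λ x∈ _ → closed-after x∈ (λ m∈ → ℕₚ.<⇒≤ (ℕₚ.<-≤-trans (ms<vs m∈ p∈) p≤q)))
      go : ∀ fl → TreeFlag D p fl → NestFlag X b p fl
      go false ref = inj₂ (refuses-mono ∈ˡ ref)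
      go true  adm = ℕₚ.<⇒≤ (ms<vs (nest-sink∈ n₂) p∈) , λ x∈ op →
        [ (λ d∈D → let (q , p≤q , o) = adm d∈D op in q , p≤q , owned-outer p≤q o)
        , (λ d∈X₂ → contradiction op (closed-after d∈X₂ (λ m∈ → ℕₚ.<⇒≤ (ms<vs m∈ p∈)))) ]′ (∈-interleave⁻ i x∈)

  open SlotSums ℕₚ.+-0-commutativeMonoid using (Σslot; Σstate; Σslots; ·-ε; Σstate-ε)
  open import Algebra.Properties.CommutativeMonoid.Mult ℕₚ.+-0-commutativeMonoid using () renaming (_×_ to _·_)

  -- Kronecker's delta. With it, `Σslots` in ℕ counts the gaps of a single chord.
  indicator : ℕ → ℕ → ℕ
  indicator zero    zero    = 1
  indicator zero    (suc _) = 0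
  indicator (suc _) zero    = 0
  indicator (suc k) (suc j) = indicator k j

  indicator-≡ : ∀ k → indicator k k ≡ 1
  indicator-≡ zero    = refl
  indicator-≡ (suc k) = indicator-≡ k

  indicator-≢ : ∀ {k j} → k ≢ j → indicator k j ≡ 0
  indicator-≢ {zero}  {zero}  ne = contradiction refl ne
  indicator-≢ {zero}  {suc j} ne = refl
  indicator-≢ {suc k} {zero}  ne = refl
  indicator-≢ {suc k} {suc j} ne = indicator-≢ (ne ∘ cong suc)

  ·-1 : ∀ n → n · 1 ≡ n
  ·-1 zero    = refl
  ·-1 (suc n) = cong suc (·-1 n)

  Σstate-indicator : ∀ σ k → k < length σ →
                     Σstate binomial (indicator k) σ ≡ suc (proj₁ (nth (0 , false) σ k))
  Σstate-indicator ((v , a) ∷ σ) zero    _        =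
    trans (cong₂ _+_ (·-1 (suc v)) (Σstate-ε binomial σ)) (ℕₚ.+-identityʳ (suc v))
  Σstate-indicator ((v , a) ∷ σ) (suc k) (s≤s k<) =
    trans (cong (_+ Σstate binomial (indicator k) σ) (·-ε (suc v))) (Σstate-indicator σ k k<)

  nth-injective : ∀ {a} {A : Set a} {d : A} {xs} → Unique xs → ∀ {j k} → j < length xs → k < length xs →
                  nth d xs j ≡ nth d xs k → j ≡ k
  nth-injective (p ∷ u) {zero}  {zero}  _        _        _  = refl
  nth-injective (p ∷ u) {zero}  {suc k} _        (s≤s k<) eq = contradiction eq (nth-All k k< p)
  nth-injective (p ∷ u) {suc j} {zero}  (s≤s j<) _        eq = contradiction (sym eq) (nth-All j j< p)
  nth-injective (p ∷ u) {suc j} {suc k} (s≤s j<) (s≤s k<) eq = cong suc (nth-injective u j< k< eq)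

  map-nth : ∀ {a b c} {A : Set a} {B : Set b} {C : Set c} {f : A → C} {g : B → C} {x y} xs ys → length xs ≡ length ys →
            (∀ k → k < length xs → f (nth x xs k) ≡ g (nth y ys k)) → map f xs ≡ map g ys
  map-nth []       []       _ eq = refl
  map-nth (x ∷ xs) (y ∷ ys) l eq = cong₂ _∷_ (eq 0 (s≤s z≤n))
    (map-nth xs ys (ℕₚ.suc-injective l) (λ k k< → eq (suc k) (s≤s k<)))

  module _ {C L : List Chord} (sorted : Sorted C) (unique : Unique L) {F : Forest} {k : ℕ} (k< : k < length L)
           (d∈ : chordAt L k ∈ C) where

    private
      d = chordAt L k

    owned-unique : ∀ {p d′} → d′ ∈ C → Owned C d p → Owned C d′ p → d ≡ d′
    owned-unique d′∈ (o , l) (o′ , l′) = sorted-injective sorted d∈ d′∈ (ℕₚ.≤-antisym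
      (ℕₚ.≮⇒≥ λ d′<d → All.lookup l′ d∈ d′<d o) (ℕₚ.≮⇒≥ λ d<d′ → All.lookup l d′∈ d<d′ o′))

    -- A gap has only one owner, so d owns it exactly if its slot carries the index k. At the last
    -- point no chord is open.
    count-slots : ∀ {ps ss e} → Track (TreeSlot C L F) ps ss e → (∀ {x} → x ∈ C → sink x ≤ e) →
                  length (filter (owned? C d) ps) ≡ Σslot binomial (indicator k) ss
    count-slots {e ∷ []} last sinks≤ =
      cong length (filter-reject (owned? C d) {xs = []} (λ ((_ , e<t) , _) → ℕₚ.<⇒≱ e<t (sinks≤ d∈)))
    count-slots {p ∷ ps} {(k′ , _) ∷ ss} ((k′< , d′∈ , o′ , _) ∷ t) sinks≤ with k ℕₚ.≟ k′
    ... | yes refl = trans (cong length (filter-accept (owned? C d) {xs = ps} o′))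
      (cong₂ _+_ (sym (trans (ℕₚ.+-identityʳ _) (indicator-≡ k))) (count-slots t sinks≤))
    ... | no k≢ = trans (cong length (filter-reject (owned? C d) {xs = ps}
        (λ o → k≢ (nth-injective unique k< k′< (owned-unique d′∈ o o′)))))
      (cong₂ _+_ (sym (trans (ℕₚ.+-identityʳ _) (indicator-≢ k≢))) (count-slots t sinks≤))

  module _ {F a b ps X} (n : Nest F b ps X) (inc : Increasing (a ∷ ps)) (sorted : Sorted ((a , b) ∷ X)) where

    private
      C = (a , b) ∷ X
      L = postorder n ++ (a , b) ∷ []

    tree-points : a ∷ ps ↭ endpoints C
    tree-points = ↭-prep a (nest-↭ n)

    tree-distinct : Distinct C
    tree-distinct = Unique-resp-↭ (↭⇒↭ₛ tree-points) (AllPairs.map ℕₚ.<⇒≢ inc)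
      where open ↭ₛ (≡.setoid ℕ) using (Unique-resp-↭)

    tree-proper : Proper C
    tree-proper (here refl) = All.lookup (AllPairs.head inc) (nest-sink∈ n)
    tree-proper (there c∈)  = nest-valid n (AllPairs.tail inc) c∈

    postorder-unique : Unique L
    postorder-unique = Unique-resp-↭ (↭⇒↭ₛ (↭-sym (postorder-root-↭ n)))
      (AllPairs.map (λ { lt refl → ℕₚ.<-irrefl refl lt }) sorted)
      where open ↭ₛ (≡.setoid Chord) using (Unique-resp-↭)

    -- The gaps owned by the k-th chord are counted twice: `suc-valency` counts them in the diagram,
    -- `Σslots` in the tree.
    valency-states : Valid F → map (valency C) L ≡ map proj₁ (states F)
    valency-states valid = map-nth L (states F) (trans (length-root n) (sym (length-states F))) each
      where
      nth-∈ : ∀ {A : Set} {d : A} xs k → k < length xs → nth d xs k ∈ xs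
      nth-∈ (x ∷ xs) zero    _        = here refl
      nth-∈ (x ∷ xs) (suc k) (s≤s k<) = there (nth-∈ xs k k<)
      each : ∀ k → k < length L → valency C (chordAt L k) ≡ proj₁ (nth (0 , false) (states F) k)
      each k k< = let (e , t) = tree-track n inc in ℕₚ.suc-injective (begin
        suc (valency C d)
          ≡⟨ suc-valency sorted tree-distinct tree-proper d∈ ⟩
        length (filter (owned? C d) (endpoints C))
          ≡⟨ ↭ₚ.↭-length (↭ₚ.filter-↭ (owned? C d) tree-points) ⟨
        length (filter (owned? C d) (a ∷ ps))
          ≡⟨ count-slots sorted postorder-unique {F} k< d∈ t
               (λ x∈ → track-≤end t inc (↭ₚ.∈-resp-↭ (↭-sym tree-points) (proj₂ (∈-endpoints x∈)))) ⟩
        Σslot binomial (indicator k) (slots F)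
          ≡⟨ Σslots binomial (indicator k) F valid refl ⟩
        Σstate binomial (indicator k) (states F)
          ≡⟨ Σstate-indicator (states F) k (subst (k <_) (trans (length-root n) (sym (length-states F))) k<) ⟩
        suc (proj₁ (nth (0 , false) (states F) k)) ∎)
        where
        open ≡.≡-Reasoning
        d = chordAt L k
        d∈ : d ∈ C
        d∈ = ↭ₚ.∈-resp-↭ (postorder-root-↭ n) (nth-∈ L k k<)

  -- Top cycles

  -- No chord d crossed by an earlier r is covered, from the sink of r to its own
  -- sink, by chords with later sources.

  Uncovered Covered : Diagram → Set
  Uncovered C = ∀ {r d} → r ∈ C → d ∈ C → r ⌒ d → ∃ λ q → sink r ≤ q × Owned C d q
  Covered   C = ∃ λ r → ∃ λ d → r ∈ C × d ∈ C × r ⌒ d ×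
                (∀ q → sink r ≤ q → q < sink d → ∃ λ x → x ∈ C × source d < source x × Open x q)

  covered-mono : ∀ {C C′} → (∀ {x} → x ∈ C → x ∈ C′) → Covered C → Covered C′
  covered-mono f (r , d , r∈ , d∈ , x , g) = r , d , f r∈ , f d∈ , x ,
    λ q p≤q q<t → let (y , y∈ , o) = g q p≤q q<t in y , f y∈ , o

  -- The second component prepares the step to the tree: the root crosses precisely the chords that
  -- are open at b.
  nest-uncovered : ∀ {F b ps X} → Nest F b ps X → Increasing ps → isFree F ≡ true → Uncovered X × Admits X b
  tree-uncovered : ∀ {F a b ps X} → Nest F b ps X → Increasing (a ∷ ps) → isFree F ≡ true → Uncovered ((a , b) ∷ X)
  tree-uncovered {F} {a} {b} {ps} {X} n (a< ∷ inc) free with nest-uncovered n inc free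
  ... | unc , adm = go
    where
    source> : ∀ {x} → x ∈ X → a < source x
    source> x∈ = All.lookup a< (proj₁ (nest-∈ n x∈))
    weaken : ∀ {d q} → d ∈ X → Owned X d q → Owned ((a , b) ∷ X) d q
    weaken d∈ (o , later) = o , (λ d<a _ → ℕₚ.<-asym d<a (source> d∈)) ∷ later
    go : Uncovered ((a , b) ∷ X)
    go (here refl) (here refl) x = contradiction (proj₁ x) (ℕₚ.<-irrefl refl)
    go (there r∈)  (here refl) x = contradiction (proj₁ x) (ℕₚ.<-asym (source> r∈))
    go (here refl) (there d∈) (_ , d<b , b<t) =
      let (q , b≤q , o) = adm d∈ (ℕₚ.<⇒≤ d<b , b<t) in q , b≤q , weaken d∈ o
    go (there r∈)  (there d∈) x = let (q , t≤q , o) = unc r∈ d∈ x in q , t≤q , weaken d∈ o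
  nest-uncovered nil _ _ = (λ ()) , (λ ())
  nest-uncovered (cons {F₁} {F₂} {a′} {b′} {b} {us} {v} {vs} {ms} {X₁} {X₂} {X} n₁ n₂ i) inc free
    with tree-track n₁ (Geometry.us++vs-increasing n₁ n₂ inc) | nest-track n₂ (Geometry.ms-increasing n₁ n₂ inc)
  ... | e , tD | eₘ , tM with track-split a′ us tD
  ... | ss₁ , s@(k₀ , fl₀) , ss₂ , e₁ , o≡ , l≡ , t₁ , r₁ , t₂ = unc , adm
    where
    open Geometry n₁ n₂ inc
    open GapLemmas n₁ n₂ i inc (track-end t₁) (track-≤end t₁ (proj₁ (AllPairs-++⁻ (a′ ∷ us) us++vs-increasing)))
                   (track-end tM) (track-≤end tM ms-increasing)
    flag₀ : fl₀ ≡ true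
    flag₀ = trans (sym (cong proj₂ (trans (cong₂ (λ o g → nth (0 , false) o g) o≡ (sym l≡)) (nth-split ss₁))))
                  (∧-projˡ (∧-projʳ {isFree F₁} free))
    free₁ : isFree F₁ ≡ true
    free₁ = ∧-projˡ free
    ihD = tree-uncovered n₁ us++vs-increasing free₁
    ihM = nest-uncovered n₂ ms-increasing (∧-projʳ {proj₂ (slot F₁ (length us))} (∧-projʳ {isFree F₁} free))
    adm : Admits X b
    adm x∈ op with ∈-interleave⁻ i x∈
    ... | inj₁ d∈ = admits-middle (subst (TreeFlag D e₁) flag₀ (proj₂ (proj₂ (proj₂ r₁)) free₁)) d∈ (nest-sink∈ n₂) op
    ... | inj₂ d∈ = let (q , b≤q , o) = proj₂ ihM d∈ op in q , b≤q , owned-middle d∈ o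
    unc : Uncovered X
    unc r∈ d∈ x with ∈-interleave⁻ i r∈ | ∈-interleave⁻ i d∈
    ... | inj₁ r∈D | inj₂ d∈E = contradiction (inj₁ x) (nonCrossing r∈D d∈E)
    ... | inj₂ r∈E | inj₁ d∈D = contradiction (inj₂ x) (nonCrossing d∈D r∈E)
    ... | inj₂ r∈E | inj₂ d∈E = let (q , t≤q , o) = proj₁ ihM r∈E d∈E x in q , t≤q , owned-middle d∈E o
    ... | inj₁ r∈D | inj₁ d∈D = let (q , t≤q , o) = ihD r∈D d∈D x
                                    (q′ , q≤q′ , o′) = owned-later d∈D o
                                in q′ , ℕₚ.≤-trans t≤q q≤q′ , o′

  ∧-false : ∀ {x y} → x ∧ y ≡ false → x ≡ false ⊎ (x ≡ true × y ≡ false)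
  ∧-false {false} _  = inj₁ refl
  ∧-false {true}  eq = inj₂ (refl , eq)

  -- The failure is inherited from D¹ or from the rest, or the gap used in D¹ refuses. In the last
  -- case a chord of D¹ is covered from that gap to its sink, and the root crosses it in that gap.
  tree-covered : ∀ {F a b ps X} → Nest F b ps X → Increasing (a ∷ ps) → isFree F ≡ false → Covered ((a , b) ∷ X)
  tree-covered {a = a} (cons {F₁} {F₂} {a′} {b′} {b} {us} {v} {vs} {ms} {X₁} {X₂} {X} n₁ n₂ i) (a< ∷ inc) bound
    with ∧-false {isFree F₁} bound
  ... | inj₁ bound₁ = covered-mono (there ∘ ∈-interleaveˡ i) (tree-covered n₁ (Geometry.us++vs-increasing n₁ n₂ inc) bound₁)
  ... | inj₂ (free₁ , bound′) with ∧-false {proj₂ (slot F₁ (length us))} bound′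
  ...   | inj₂ (_ , bound₂) = covered-mono inside
            (tree-covered n₂ (All.tabulate (λ m∈ → All.lookup a< (∈-++⁺ʳ (a′ ∷ us) (∈-++⁺ˡ m∈))) ∷ Geometry.ms-increasing n₁ n₂ inc) bound₂)
    where
    inside : ∀ {x} → x ∈ (a , b) ∷ X₂ → x ∈ (a , b) ∷ X
    inside (here refl) = here refl
    inside (there x∈)  = there (∈-interleaveʳ i x∈)
  ...   | inj₁ flag-false with tree-track n₁ (Geometry.us++vs-increasing n₁ n₂ inc)
  ...     | e , tD with track-split a′ us tD
  ...       | ss₁ , s@(k₀ , fl₀) , ss₂ , e₁ , o≡ , l≡ , t₁ , r₁ , t₂ = covering
                (subst (TreeFlag ((a′ , b′) ∷ X₁) e₁) fl₀≡ (proj₂ (proj₂ (proj₂ r₁)) free₁))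
    where
    open Geometry n₁ n₂ inc
    fl₀≡ : fl₀ ≡ false
    fl₀≡ = trans (sym (cong proj₂ (trans (cong₂ (λ o g → nth (0 , false) o g) o≡ (sym l≡)) (nth-split ss₁)))) flag-false
    us≤e₁ : ∀ {u} → u ∈ a′ ∷ us → u ≤ e₁
    us≤e₁ = track-≤end t₁ (proj₁ (AllPairs-++⁻ (a′ ∷ us) us++vs-increasing))
    covering : Refuses ((a′ , b′) ∷ X₁) e₁ → Covered ((a , b) ∷ X)
    covering (d , d∈ , (d≤e , e<t) , g) = (a , b) , d , here refl , there (∈-interleaveˡ i d∈) ,
      (All.lookup a< (proj₁ (nest-∈ (cons n₁ n₂ i) (∈-interleaveˡ i d∈))) , ℕₚ.≤-<-trans d≤e e₁<b , b<t) ,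
      λ q b≤q q<t → let (x , x∈ , r) = g q (ℕₚ.≤-trans (ℕₚ.<⇒≤ e₁<b) b≤q) q<t in x , there (∈-interleaveˡ i x∈) , r
      where
      e₁<b : e₁ < b
      e₁<b = us<ms (track-end t₁) (nest-sink∈ n₂)
      b<t : b < sink d
      b<t with ∈-++⁻ (a′ ∷ us) (proj₂ (tree-∈ n₁ d∈))
      ... | inj₁ u∈ = contradiction e<t (ℕₚ.≤⇒≯ (us≤e₁ u∈))
      ... | inj₂ v∈ = ms<vs (nest-sink∈ n₂) v∈

  applyUpTo-cong : ∀ {a} {A : Set a} {f g : ℕ → A} n → (∀ j → f j ≡ g j) → applyUpTo f n ≡ applyUpTo g n
  applyUpTo-cong zero    eq = refl
  applyUpTo-cong (suc n) eq = cong₂ _∷_ (eq 0) (applyUpTo-cong n (eq ∘ suc))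

  rank : Diagram → ℕ → ℕ
  rank D p = length (filter (ℕₚ._≤? p) (endpoints D))

  ranks : Diagram → Chord → Chord
  ranks D c = rank D (source c) , rank D (sink c)

  rank-mono : ∀ D {p q} → p ≤ q → rank D p ≤ rank D q
  rank-mono D p≤q = count-≤ (ℕₚ._≤? _) (ℕₚ._≤? _) (endpoints D) (λ _ x≤p → ℕₚ.≤-trans x≤p p≤q)

  rank-reflects : ∀ D {p q} → rank D p < rank D q → p < q
  rank-reflects D lt = ℕₚ.≰⇒> λ q≤p → ℕₚ.<⇒≱ lt (rank-mono D q≤p)

  -- In a top cycle the second chord crosses the first, and from the sink of the first on it is
  -- covered by the overlapping chords of the rest up to its own sink. No gap is left for it to own.
  uncovered⇒topCycleFree : ∀ {C} → Uncovered C → TopCycleFree C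
  uncovered⇒topCycleFree {C} unc = All.tabulate λ {D} D∈ m 3≤m eq → refute D (subdiagrams-⊆ C D∈) m 3≤m eq
    where
    -- Runs along the chords (2j + 3 , 2j + 6) until one is open at q. The next source, of rank 2j +
    -- 5, precedes the current sink, and the last sink lies one rank beyond t.
    chase : ∀ D es i k {q t} → map (ranks D) es ≡ applyUpTo (λ j → 2 * (i + j) + 3 , 2 * (i + j) + 6) (suc k) →
            (∀ {p} → rank D p ≡ 2 * i + 3 → p ≤ q) → q < t → rank D t ≡ 2 * (i + k) + 5 →
            ∃ λ x → x ∈ es × 3 ≤ rank D (source x) × Open x q
    chase D (e ∷ es) i k {q} {t} eq start q<t rt with ∷-injective eq
    ... | eqₑ , eqₛ with ,-injective eqₑ
    ...   | src , snk with q ℕₚ.<? sink e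
    ...     | yes q<e = e , here refl ,
                subst (3 ≤_) (sym src) (ℕₚ.m≤n+m 3 (2 * (i + 0))) , start (trans src (cong (λ n → 2 * n + 3) (ℕₚ.+-identityʳ i))) , q<e
    chase D (e ∷ es) i zero {q} {t} eq start q<t rt | eqₑ , eqₛ | src , snk | no q≮e =
      contradiction (ℕₚ.≤-trans (ℕₚ.<⇒≤ (rank-reflects D (subst₂ _<_ (sym rt) (sym snk) (ℕₚ.+-monoʳ-< (2 * (i + 0)) (ℕₚ.n<1+n 5))))) (ℕₚ.≮⇒≥ q≮e)) (ℕₚ.<⇒≱ q<t)
    chase D (e ∷ es) i (suc k) {q} {t} eq start q<t rt | eqₑ , eqₛ | src , snk | no q≮e =
      let (x , x∈ , r) = chase D es (suc i) k (trans eqₛ (applyUpTo-cong (suc k) λ j → cong (λ n → 2 * n + 3 , 2 * n + 6) (ℕₚ.+-suc i j)))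
                           (λ {p} rp → ℕₚ.≤-trans (ℕₚ.<⇒≤ (rank-reflects D (subst₂ _<_ (sym rp) (sym snk)
                             (subst₂ _<_ (sym (shape i)) (cong (λ n → 2 * n + 6) (sym (ℕₚ.+-identityʳ i))) (ℕₚ.+-monoʳ-< (2 * i) (ℕₚ.n<1+n 5)))))) (ℕₚ.≮⇒≥ q≮e))
                           q<t (trans rt (cong (λ n → 2 * n + 5) (ℕₚ.+-suc i k)))
      in x , there x∈ , r
      where
      shape : ∀ i → 2 * suc i + 3 ≡ 2 * i + 5
      shape i = trans (cong (_+ 3) (ℕₚ.*-suc 2 i)) (trans (cong (_+ 3) (ℕₚ.+-comm 2 (2 * i))) (ℕₚ.+-assoc (2 * i) 2 3))
    refute : ∀ D → (∀ {x} → x ∈ D → x ∈ C) → ∀ m → 3 ≤ m → relabel D ≢ topCycle m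
    refute (r ∷ d ∷ es) D⊆C (suc (suc (suc m))) _ eq with ∷-injective eq
    ... | eqᵣ , eq′ with ∷-injective eq′ | ,-injective eqᵣ
    ...   | eq_d , eqₛ | r₁ , r₂ with ,-injective eq_d
    ...     | d₁ , d₂ = let (q , t≤q , (d≤q , q<t) , later) = unc (D⊆C (here refl)) (D⊆C (there (here refl)))
                                  (below r₁ d₁ (s≤s (s≤s z≤n)) , below d₁ r₂ (s≤s (s≤s (s≤s z≤n))) , below r₂ sink-d (ℕₚ.m≤n+m 5 (2 * m)))
                            (x , x∈ , 3≤ , op) = chase D es 0 m eqₛ (λ rp → ℕₚ.≤-trans (ℕₚ.<⇒≤ (below rp r₂ (s≤s (s≤s (s≤s (s≤s z≤n)))))) t≤q) q<t sink-d
                        in All.lookup later (D⊆C (there (there x∈))) (rank-reflects D (subst (_< rank D (source x)) (sym d₁) 3≤)) op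
      where
      D = r ∷ d ∷ es
      below : ∀ {p q x y} → rank D p ≡ x → rank D q ≡ y → x < y → p < q
      below refl refl lt = rank-reflects D lt
      sink-d : rank D (sink d) ≡ 2 * m + 5
      sink-d = trans d₂ (trans (cong (_∸ 1) (trans (cong (2 *_) (ℕₚ.+-comm 3 m)) (ℕₚ.*-distribˡ-+ 2 m 3)))
        (cong (_∸ 1) (trans (sym (ℕₚ.+-assoc (2 * m) 1 5)) (trans (cong (_+ 5) (ℕₚ.+-comm (2 * m) 1)) refl))))
    refute []           _ (suc (suc (suc m))) _ ()
    refute (r ∷ [])     _ (suc (suc (suc m))) _ ()
    refute _ _ (suc zero)       (s≤s ()) _
    refute _ _ (suc (suc zero)) (s≤s (s≤s ())) _

  -- The chain e₁, e₂, … of a top cycle below its second chord d; p is the sink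
  -- of the chord preceding e.

  data Chain (C : Diagram) (d : Chord) : ℕ → Chord → List Chord → Set where
    end  : ∀ {p e} → e ∈ C → source d < source e → source e < p → p < sink d → sink d < sink e → Chain C d p e []
    next : ∀ {p e e′ es} → e ∈ C → source d < source e → source e < p → p < source e′ → source e′ < sink e →
           sink e < sink d → Chain C d (sink e) e′ es → Chain C d p e (e′ ∷ es)

  -- The points of the chain behind the preceding sink, from left to right; the source of e lies
  -- before that sink.
  chainPoints : Chord → Chord → List Chord → List ℕ
  chainPoints d e []        = sink d ∷ sink e ∷ []
  chainPoints d e (e′ ∷ es) = source e′ ∷ sink e ∷ chainPoints d e′ es

  module _ {C : Diagram} {d : Chord} where

    chain-∈ : ∀ {p e es} → Chain C d p e es → ∀ {x} → x ∈ e ∷ es → x ∈ C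
    chain-∈ (end e∈ _ _ _ _)           (here refl) = e∈
    chain-∈ (next e∈ _ _ _ _ _ ch)     (here refl) = e∈
    chain-∈ (next _ _ _ _ _ _ ch)      (there x∈)  = chain-∈ ch x∈

    chain-p : ∀ {p e es} → Chain C d p e es → source e < p
    chain-p (end _ _ e<p _ _)        = e<p
    chain-p (next _ _ e<p _ _ _ _)   = e<p

    chain-after : ∀ {p e es} → Chain C d p e es → All (p <_) (chainPoints d e es)
    chain-after (end _ _ _ p<d d<e)         = p<d ∷ ℕₚ.<-trans p<d d<e ∷ []
    chain-after (next _ _ _ p<e′ e′<e _ ch) =
      p<e′ ∷ ℕₚ.<-trans p<e′ e′<e ∷ All.map (ℕₚ.<-trans (ℕₚ.<-trans p<e′ e′<e)) (chain-after ch)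

    chain-increasing : ∀ {p e es} → Chain C d p e es → Increasing (chainPoints d e es)
    chain-increasing (end _ _ _ _ d<e)         = (d<e ∷ []) ∷ [] ∷ []
    chain-increasing (next _ _ _ _ e′<e _ ch) =
      (e′<e ∷ All.map (ℕₚ.<-trans e′<e) (chain-after ch)) ∷ chain-after ch ∷ chain-increasing ch

    chain-sources : ∀ {p e es} → Chain C d p e es → All (λ x → source e < source x) es × Sorted es
    chain-sources (end _ _ _ _ _) = [] , []
    chain-sources (next {p} {e} {e′} _ _ e<p p<e′ _ _ ch) =
      let (a , s) = chain-sources ch in
      ℕₚ.<-trans e<p p<e′ ∷ All.map (ℕₚ.<-trans (ℕₚ.<-trans e<p p<e′)) a , a ∷ s

  chain-↭ : ∀ d e es → source e ∷ chainPoints d e es ↭ sink d ∷ endpoints (e ∷ es)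
  chain-↭ d e []        = ↭-swap _ _ ↭-refl
  chain-↭ d e (e′ ∷ es) = begin
    source e ∷ source e′ ∷ sink e ∷ chainPoints d e′ es   ↭⟨ ↭-prep _ (↭-swap _ _ ↭-refl) ⟩
    source e ∷ sink e ∷ source e′ ∷ chainPoints d e′ es   ↭⟨ ↭-prep _ (↭-prep _ (chain-↭ d e′ es)) ⟩
    source e ∷ sink e ∷ sink d ∷ endpoints (e′ ∷ es)      ↭⟨ ↭-prep _ (↭-swap _ _ ↭-refl) ⟩
    source e ∷ sink d ∷ sink e ∷ endpoints (e′ ∷ es)      ↭⟨ ↭-swap _ _ ↭-refl ⟩
    sink d ∷ endpoints (e ∷ e′ ∷ es)                      ∎
    where open PermutationReasoning

  position : ∀ pre {p post} → Increasing (pre ++ p ∷ post) →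
             length (filter (ℕₚ._≤? p) (pre ++ p ∷ post)) ≡ suc (length pre)
  position pre {p} {post} inc with AllPairs-++⁻ pre inc
  ... | _ , (p< ∷ _) , pre< = trans (cong length (filter-++ (ℕₚ._≤? p) pre (p ∷ post)))
    (trans (cong₂ (λ x y → length (x ++ y)) (filter-all (ℕₚ._≤? p) (All.tabulate λ u∈ → ℕₚ.<⇒≤ (pre< u∈ (here refl))))
             (trans (filter-accept (ℕₚ._≤? p) ℕₚ.≤-refl) (cong (p ∷_) (filter-none (ℕₚ._≤? p) (All.map ℕₚ.<⇒≱ p<)))))
      (trans (length-++ pre) (ℕₚ.+-comm _ 1)))

  module _ {C : Diagram} {d : Chord} where

    -- `pre` holds the n + 1 points up to the preceding sink, and the source of e has rank n. The
    -- next two points therefore have the ranks n + 2 and n + 3, and each step of the chain raises n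
    -- by 2.
    chain-ranks : ∀ D {p e es} → Chain C d p e es → ∀ pre → Increasing (pre ++ chainPoints d e es) →
                  endpoints D ↭ pre ++ chainPoints d e es → ∀ n → length pre ≡ suc n → rank D (source e) ≡ n →
                  map (ranks D) (e ∷ es) ≡ applyUpTo (λ j → 2 * j + n , 2 * j + (n + 3)) (suc (length es)) ×
                  rank D (sink d) ≡ 2 * length es + (n + 2)
    chain-ranks D {e = e} {es} ch pre inc perm n len re = go ch inc perm
      where
      at : ∀ pre′ {p post} → Increasing (pre′ ++ p ∷ post) → endpoints D ↭ pre′ ++ p ∷ post → rank D p ≡ suc (length pre′)
      at pre′ {p} inc perm = trans (↭ₚ.↭-length (↭ₚ.filter-↭ (ℕₚ._≤? p) perm)) (position pre′ inc)
      at-second : ∀ {x p post} → Increasing (pre ++ x ∷ p ∷ post) → endpoints D ↭ pre ++ x ∷ p ∷ post → rank D p ≡ n + 3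
      at-second {x} {p} {post} inc perm = trans
        (at (pre ++ x ∷ []) (subst Increasing assoc inc) (subst (endpoints D ↭_) assoc perm))
        (trans (cong suc (trans (length-++ pre) (cong (_+ 1) len))) (trans (cong (λ m → suc (suc m)) (ℕₚ.+-comm n 1)) (ℕₚ.+-comm 3 n)))
        where
        assoc : pre ++ x ∷ p ∷ post ≡ (pre ++ x ∷ []) ++ p ∷ post
        assoc = sym (++-assoc pre (x ∷ []) (p ∷ post))
      at-first : ∀ {p post} → Increasing (pre ++ p ∷ post) → endpoints D ↭ pre ++ p ∷ post → rank D p ≡ n + 2
      at-first inc perm = trans (at pre inc perm) (trans (cong suc len) (ℕₚ.+-comm 2 n))
      go : ∀ {es} → Chain C d _ e es → Increasing (pre ++ chainPoints d e es) →
           endpoints D ↭ pre ++ chainPoints d e es →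
           map (ranks D) (e ∷ es) ≡ applyUpTo (λ j → 2 * j + n , 2 * j + (n + 3)) (suc (length es)) ×
           rank D (sink d) ≡ 2 * length es + (n + 2)
      go (end _ _ _ _ _) inc perm = cong (_∷ []) (cong₂ _,_ re (at-second inc perm)) , at-first inc perm
      go (next {e′ = e′} {es} _ _ _ _ _ _ ch) inc perm =
        cong₂ _∷_ (cong₂ _,_ re (at-second inc perm)) (trans (proj₁ ih) (applyUpTo-cong (suc (length es)) λ j → cong₂ _,_ (shape j n) (shape j (n + 3)))) ,
        trans (proj₂ ih) (shape (length es) (n + 2))
        where
        assoc : pre ++ source e′ ∷ sink e ∷ chainPoints d e′ es ≡ (pre ++ source e′ ∷ sink e ∷ []) ++ chainPoints d e′ es
        assoc = sym (++-assoc pre (source e′ ∷ sink e ∷ []) (chainPoints d e′ es))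
        ih : map (ranks D) (e′ ∷ es) ≡ applyUpTo (λ j → 2 * j + (2 + n) , 2 * j + (2 + n + 3)) (suc (length es)) ×
             rank D (sink d) ≡ 2 * length es + (2 + n + 2)
        ih = chain-ranks D ch (pre ++ source e′ ∷ sink e ∷ []) (subst Increasing assoc inc) (subst (endpoints D ↭_) assoc perm)
               (2 + n) (trans (length-++ pre) (trans (cong (_+ 2) len) (ℕₚ.+-comm (suc n) 2)))
               (trans (at-first inc perm) (ℕₚ.+-comm n 2))
        shape : ∀ j k → 2 * j + (2 + k) ≡ 2 * suc j + k
        shape j k = trans (sym (ℕₚ.+-assoc (2 * j) 2 k)) (cong (_+ k) (trans (ℕₚ.+-comm (2 * j) 2) (sym (ℕₚ.*-suc 2 j))))

  module _ {C} (sorted : Sorted C) (distinct : Distinct C) (proper : Proper C) where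

    chain⇒topCycle : ∀ {r d e es} → r ∈ C → d ∈ C → r ⌒ d → Chain C d (sink r) e es → ¬ TopCycleFree C
    chain⇒topCycle {r} {d} {e} {es} r∈ d∈ (r<d , d<t , t<u) ch free =
      All.lookup free D∈ (3 + length es) (s≤s (s≤s (s≤s z≤n))) relabelled
      where
      D : Diagram
      D = r ∷ d ∷ e ∷ es
      -- The points of ranks 1 to 4 in a top cycle.
      pre : List ℕ
      pre = source r ∷ source d ∷ source e ∷ sink r ∷ []
      d<e : Chain C d (sink r) e es → source d < source e
      d<e (end _ lt _ _ _)      = lt
      d<e (next _ lt _ _ _ _ _) = lt
      sortedD : Sorted D
      sortedD = let (a , s) = chain-sources ch
                    as = d<e ch ∷ All.map (ℕₚ.<-trans (d<e ch)) a
                in (r<d ∷ All.map (ℕₚ.<-trans r<d) as) ∷ as ∷ a ∷ s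
      D⊆C : ∀ {x} → x ∈ D → x ∈ C
      D⊆C (here refl)         = r∈
      D⊆C (there (here refl)) = d∈
      D⊆C (there (there x∈))  = chain-∈ ch x∈
      D∈ : D ∈ subdiagrams C
      D∈ = ∈-subdiagrams (λ {c} {d} → ℕₚ.<-asym {source c} {source d}) C sorted sortedD D⊆C
      increasing : Increasing (pre ++ chainPoints d e es)
      increasing = (r<d ∷ r<e ∷ ℕₚ.<-trans r<d d<t ∷ All.map (ℕₚ.<-trans (ℕₚ.<-trans r<d d<t)) after)
        ∷ (d<e ch ∷ d<t ∷ All.map (ℕₚ.<-trans d<t) after)
        ∷ (chain-p ch ∷ All.map (ℕₚ.<-trans (chain-p ch)) after) ∷ after ∷ chain-increasing ch
        where
        after = chain-after ch
        r<e = ℕₚ.<-trans r<d (d<e ch)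
      perm : endpoints D ↭ pre ++ chainPoints d e es
      perm = begin
        source r ∷ sink r ∷ source d ∷ sink d ∷ endpoints (e ∷ es)
          ↭⟨ ↭-prep _ (↭-swap _ _ ↭-refl) ⟩
        source r ∷ source d ∷ sink r ∷ sink d ∷ endpoints (e ∷ es)
          ↭⟨ ↭-prep _ (↭-prep _ (↭-prep _ (↭-sym (chain-↭ d e es)))) ⟩
        source r ∷ source d ∷ sink r ∷ source e ∷ chainPoints d e es
          ↭⟨ ↭-prep _ (↭-prep _ (↭-swap _ _ ↭-refl)) ⟩
        pre ++ chainPoints d e es ∎
        where open PermutationReasoning
      rank-at : ∀ pre′ {p post} → pre ++ chainPoints d e es ≡ pre′ ++ p ∷ post → rank D p ≡ suc (length pre′)
      rank-at pre′ {p} eq = trans (↭ₚ.↭-length (↭ₚ.filter-↭ (ℕₚ._≤? p) (subst (endpoints D ↭_) eq perm))) (position pre′ (subst Increasing eq increasing))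
      chained = chain-ranks D ch pre increasing perm 3 refl (rank-at (source r ∷ source d ∷ []) refl)
      relabelled : relabel D ≡ topCycle (3 + length es)
      relabelled = cong₂ _∷_ (cong₂ _,_ (rank-at [] refl) (rank-at (source r ∷ source d ∷ source e ∷ []) refl))
        (cong₂ _∷_ (cong₂ _,_ (rank-at (source r ∷ []) refl) (trans (proj₂ chained) (shape (length es)))) (proj₁ chained))
        where
        shape : ∀ m → 2 * m + 5 ≡ 2 * (3 + m) ∸ 1
        shape m = sym (trans (cong (_∸ 1) (ℕₚ.*-distribˡ-+ 2 3 m)) (ℕₚ.+-comm 5 (2 * m)))

    -- A greedy chain: at each sink, proceed with the chord later than d that is open there and has
    -- the greatest sink, until the sink of d is passed. By this choice, chords of the chain cross
    -- only their neighbours in it.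
    covered⇒¬topCycleFree : Covered C → ¬ TopCycleFree C
    covered⇒¬topCycleFree (r , d , r∈ , d∈ , r⌒d@(r<d , d<t , t<u) , cover) =
      let (e , g)   = greedy (sink r) ℕₚ.≤-refl t<u
          -- The sinks of the chain increase, so at most `sink d` steps are needed.
          (es , ch) = build (sink d) r∈ ℕₚ.≤-refl t<u g (ℕₚ.m≤m+n _ (sink e))
      in chain⇒topCycle r∈ d∈ r⌒d ch
      where
      Later : ℕ → Chord → Set
      Later q x = source d < source x × Open x q
      later? : ∀ q x → Dec (Later q x)
      later? q x = source d ℕₚ.<? source x ×-dec (source x ℕₚ.≤? q ×-dec q ℕₚ.<? sink x)
      Greedy : ℕ → Chord → Set
      Greedy q e = e ∈ C × Later q e × (∀ {x} → x ∈ C → Later q x → sink x ≤ sink e)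
      greedy : ∀ q → sink r ≤ q → q < sink d → ∃ (Greedy q)
      greedy q t≤q q<u with cover q t≤q q<u
      ... | x , x∈ , l with greatest-sink (filter (later? q) C) (λ eq → nonempty (subst (x ∈_) eq (∈-filter⁺ (later? q) x∈ l)))
        where
        nonempty : ∀ {y : Chord} → ¬ y ∈ []
        nonempty ()
      ...   | e , e∈ , top = e , proj₁ (∈-filter⁻ (later? q) e∈) , proj₂ (∈-filter⁻ (later? q) {xs = C} e∈) , λ x∈ l → top (∈-filter⁺ (later? q) x∈ l)
      build : ∀ k {c e} → c ∈ C → sink r ≤ sink c → sink c < sink d → Greedy (sink c) e → sink d ≤ k + sink e →
              ∃ λ es → Chain C d (sink c) e es
      build k {c} {e} c∈ t≤c c<u (e∈ , (d<e , e≤c , c<t) , top) fuel with ℕₚ.<-cmp (sink e) (sink d)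
      ... | tri> _ _ u<t = [] , end e∈ d<e (ℕₚ.≤∧≢⇒< e≤c (source≢sink distinct e∈ c∈)) c<u u<t
      ... | tri≈ _ eq _  = contradiction d<e (ℕₚ.<-irrefl (cong source (sym (distinct-sink distinct e∈ d∈ eq))))
      build zero    c∈ t≤c c<u _ fuel | tri< t<u _ _ = contradiction t<u (ℕₚ.≤⇒≯ fuel)
      build (suc k) {c} {e} c∈ t≤c c<u (e∈ , (d<e , e≤c , c<t) , top) fuel | tri< t<u _ _
        with greedy (sink e) (ℕₚ.≤-trans t≤c (ℕₚ.<⇒≤ c<t)) t<u
      ... | e′ , g′@(e′∈ , (d<e′ , e′≤t , t<t′) , _) =
        let (es , ch) = build k e∈ (ℕₚ.≤-trans t≤c (ℕₚ.<⇒≤ c<t)) t<u g′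
                          (ℕₚ.≤-trans fuel (ℕₚ.≤-trans (ℕₚ.≤-reflexive (sym (ℕₚ.+-suc k (sink e)))) (ℕₚ.+-monoʳ-≤ k t<t′)))
        in e′ ∷ es , next e∈ d<e (ℕₚ.≤∧≢⇒< e≤c (source≢sink distinct e∈ c∈))
             -- Otherwise e′ would be open at the sink of c already, with a greater sink than the
             -- greedy choice e.
             (ℕₚ.≰⇒> λ e′≤c → ℕₚ.<⇒≱ t<t′ (top e′∈ (d<e′ , e′≤c , ℕₚ.<-trans c<t t<t′)))
             (ℕₚ.≤∧≢⇒< e′≤t (source≢sink distinct e′∈ e∈)) t<u ch

  -- Enumeration of the connected chord diagrams

  -- `possibleChords` contains chords with equal sources, so its order is lexicographic; on a
  -- matching it is the order of sources.
  _<ₗ_ : Chord → Chord → Set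
  c <ₗ d = source c < source d ⊎ (source c ≡ source d × sink c < sink d)

  <ₗ-asym : ∀ {c d} → c <ₗ d → ¬ d <ₗ c
  <ₗ-asym (inj₁ p)        (inj₁ q)        = ℕₚ.<-asym p q
  <ₗ-asym (inj₁ p)        (inj₂ (eq , _)) = ℕₚ.<-irrefl (sym eq) p
  <ₗ-asym (inj₂ (eq , _)) (inj₁ q)        = ℕₚ.<-irrefl (sym eq) q
  <ₗ-asym (inj₂ (_ , p))  (inj₂ (_ , q))  = ℕₚ.<-asym p q

  cartesianProduct-sorted : ∀ xs ys → Increasing xs → Increasing ys → AllPairs _<ₗ_ (cartesianProduct xs ys)
  cartesianProduct-sorted []       ys _        _  = []
  cartesianProduct-sorted (x ∷ xs) ys (p ∷ ps) qs = AllPairs-++⁺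
    (AllPairsₚ.map⁺ (AllPairs.map (λ lt → inj₂ (refl , lt)) qs))
    (cartesianProduct-sorted xs ys ps qs)
    λ c∈ d∈ → step c∈ d∈
    where
    step : ∀ {c d} → c ∈ map (x ,_) ys → d ∈ cartesianProduct xs ys → c <ₗ d
    step c∈ d∈ with ∈-map⁻ (x ,_) c∈
    ... | y , y∈ , refl = inj₁ (All.lookup p (proj₁ (∈-cartesianProduct⁻ xs ys d∈)))

  points-increasing : ∀ n → Increasing (points n)
  points-increasing n = AllPairsₚ.applyUpTo⁺₁ suc (2 * n) (λ i<j _ → s≤s i<j)

  possibleChords-sorted : ∀ n → AllPairs _<ₗ_ (possibleChords n)
  possibleChords-sorted n = AllPairsₚ.filter⁺ _ (cartesianProduct-sorted (points n) (points n) (points-increasing n) (points-increasing n))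

  ∈-possibleChords⁻ : ∀ n {c} → c ∈ possibleChords n → source c ∈ points n × sink c ∈ points n × source c < sink c
  ∈-possibleChords⁻ n c∈ = let (p , lt) = ∈-filter⁻ (λ c → source c ℕₚ.<? sink c) {xs = cartesianProduct (points n) (points n)} c∈
                               (s , t)  = ∈-cartesianProduct⁻ (points n) (points n) p
                           in s , t , lt

  ∈-possibleChords⁺ : ∀ n {c} → source c ∈ points n → sink c ∈ points n → source c < sink c → c ∈ possibleChords n
  ∈-possibleChords⁺ n s t lt = ∈-filter⁺ (λ c → source c ℕₚ.<? sink c) (∈-cartesianProduct⁺ s t) lt

  count : ℕ → List ℕ → ℕ
  count p xs = length (filter (p ℕₚ.≟_) xs)

  count-here : ∀ x xs → count x (x ∷ xs) ≡ suc (count x xs)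
  count-here x xs = cong length (filter-accept (x ℕₚ.≟_) refl)

  count-there : ∀ {x y} xs → x ≢ y → count x (y ∷ xs) ≡ count x xs
  count-there xs ne = cong length (filter-reject (_ ℕₚ.≟_) ne)

  ∈⇒count : ∀ {x xs} → x ∈ xs → 0 < count x xs
  ∈⇒count {x} {x ∷ xs} (here refl) = subst (0 <_) (sym (count-here x xs)) (s≤s z≤n)
  ∈⇒count {x} {y ∷ xs} (there x∈)  = go (x ℕₚ.≟ y)
    where
    go : Dec (x ≡ y) → 0 < count x (y ∷ xs)
    go (yes refl) = subst (0 <_) (sym (count-here x xs)) (s≤s z≤n)
    go (no ne)    = subst (0 <_) (sym (count-there xs ne)) (∈⇒count x∈)

  count⇒∈ : ∀ {x} xs → 0 < count x xs → x ∈ xs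
  count⇒∈ {x} (y ∷ xs) lt = go (x ℕₚ.≟ y)
    where
    go : Dec (x ≡ y) → x ∈ y ∷ xs
    go (yes eq) = here eq
    go (no ne)  = there (count⇒∈ xs (subst (0 <_) (count-there xs ne) lt))

  counts⇒unique : ∀ xs → (∀ {x} → x ∈ xs → count x xs ≡ 1) → Unique xs
  counts⇒unique []       _  = []
  counts⇒unique (x ∷ xs) eq = All.tabulate fresh ∷ counts⇒unique xs λ {y} y∈ →
    trans (sym (count-there xs (fresh y∈ ∘ sym))) (eq (there y∈))
    where
    fresh : ∀ {y} → y ∈ xs → x ≢ y
    fresh y∈ refl = ℕₚ.<⇒≢ (∈⇒count y∈) (sym (ℕₚ.suc-injective (trans (sym (count-here x xs)) (eq (here refl)))))

  unique-count : ∀ {x xs} → Unique xs → x ∈ xs → count x xs ≡ 1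
  unique-count {x} {x ∷ xs} (p ∷ u) (here refl) = trans (count-here x xs) (cong suc (none p))
    where
    none : ∀ {xs} → All (x ≢_) xs → count x xs ≡ 0
    none p = cong length (filter-none (x ℕₚ.≟_) p)
  unique-count {x} {y ∷ xs} (p ∷ u) (there x∈) = trans (count-there xs (λ eq → All.lookup p x∈ (sym eq))) (unique-count u x∈)

  unique-↭ : ∀ {a} {A : Set a} {xs ys : List A} → Unique xs → Unique ys →
             (∀ {x} → x ∈ xs → x ∈ ys) → (∀ {x} → x ∈ ys → x ∈ xs) → xs ↭ ys
  unique-↭ {xs = []}     {[]}     _ _ _ _ = ↭-refl
  unique-↭ {xs = []}     {y ∷ ys} _ _ _ g with () ← g (here refl)
  unique-↭ {xs = x ∷ xs} {ys} (p ∷ u) u′ f g with ∈-∃++ (f (here refl))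
  ... | ys₁ , ys₂ , refl = ↭-trans (↭-prep x (unique-↭ u (proj₁ removed) f′ g′)) (↭-sym (↭ₚ.shift x ys₁ ys₂))
    where
    removed : Unique (ys₁ ++ ys₂) × (∀ {y} → y ∈ ys₁ ++ ys₂ → x ≢ y)
    removed with AllPairs-++⁻ ys₁ u′
    ... | q , (r ∷ s) , t = AllPairs-++⁺ q s (λ y∈ z∈ → t y∈ (there z∈)) ,
      λ y∈ → [ (λ y∈₁ eq → t y∈₁ (here refl) (sym eq)) , All.lookup r ]′ (∈-++⁻ ys₁ y∈)
    f′ : ∀ {y} → y ∈ xs → y ∈ ys₁ ++ ys₂
    f′ y∈ with ∈-++⁻ ys₁ (f (there y∈))
    ... | inj₁ q           = ∈-++⁺ˡ q
    ... | inj₂ (there q)   = ∈-++⁺ʳ ys₁ q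
    ... | inj₂ (here refl) = contradiction refl (All.lookup p y∈)
    g′ : ∀ {y} → y ∈ ys₁ ++ ys₂ → y ∈ xs
    g′ y∈ with g ([ ∈-++⁺ˡ , ∈-++⁺ʳ ys₁ ∘ there ]′ (∈-++⁻ ys₁ y∈))
    ... | there q    = q
    ... | here eq = contradiction (sym eq) (proj₂ removed y∈)

  record ChordDiagram (n : ℕ) (C : Diagram) : Set where
    field
      sorted  : Sorted C
      proper  : Proper C
      matched : endpoints C ↭ points n

    distinct : Distinct C
    distinct = counts⇒unique (endpoints C) λ p∈ →
      trans (↭ₚ.↭-length (↭ₚ.filter-↭ _ matched))
        (unique-count (AllPairs.map ℕₚ.<⇒≢ (points-increasing n)) (↭ₚ.∈-resp-↭ matched p∈))

  chordDiagrams-sound : ∀ n {C} → C ∈ chordDiagrams n → ChordDiagram n C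
  chordDiagrams-sound n {C} C∈ with ∈-filter⁻ (perfectMatching? n) {xs = subdiagrams (possibleChords n)} C∈
  ... | C∈sub , pm = record
    { sorted  = sorted (subdiagrams-AllPairs (possibleChords n) C∈sub (possibleChords-sorted n)) unique
    ; proper  = λ c∈ → proj₂ (proj₂ (possible c∈))
    ; matched = unique-↭ unique (AllPairs.map ℕₚ.<⇒≢ (points-increasing n)) endpoint-∈
                  (λ p∈ → count⇒∈ (endpoints C) (ℕₚ.≤-reflexive (sym (All.lookup pm p∈))))
    }
    where
    possible : ∀ {c} → c ∈ C → source c ∈ points n × sink c ∈ points n × source c < sink c
    possible c∈ = ∈-possibleChords⁻ n (subdiagrams-⊆ (possibleChords n) C∈sub c∈)
    endpoint-∈ : ∀ {p} → p ∈ endpoints C → p ∈ points n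
    endpoint-∈ p∈ with ∈-endpoints⁻ C p∈
    ... | c , c∈ , inj₁ refl = proj₁ (possible c∈)
    ... | c , c∈ , inj₂ refl = proj₁ (proj₂ (possible c∈))
    unique : Unique (endpoints C)
    unique = counts⇒unique (endpoints C) (All.lookup pm ∘ endpoint-∈)
    sorted : ∀ {C} → AllPairs _<ₗ_ C → Unique (endpoints C) → Sorted C
    sorted []       _               = []
    sorted (q ∷ qs) (p ∷ _ ∷ u) = All.tabulate strict ∷ sorted qs u
      where
      strict : ∀ {d} → d ∈ _ → _ < source d
      strict d∈ with All.lookup q d∈
      ... | inj₁ lt       = lt
      ... | inj₂ (eq , _) = contradiction eq (All.lookup p (there (proj₁ (∈-endpoints d∈))))

  chordDiagrams-complete : ∀ n {C} → ChordDiagram n C → C ∈ chordDiagrams n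
  chordDiagrams-complete n {C} cd = ∈-filter⁺ (perfectMatching? n)
    (∈-subdiagrams (λ {c} {d} → <ₗ-asym {c} {d}) (possibleChords n) (possibleChords-sorted n) (AllPairs.map inj₁ sorted)
      λ c∈ → ∈-possibleChords⁺ n (↭ₚ.∈-resp-↭ matched (proj₁ (∈-endpoints c∈)))
                                 (↭ₚ.∈-resp-↭ matched (proj₂ (∈-endpoints c∈))) (proper c∈))
    (All.tabulate λ p∈ → trans (↭ₚ.↭-length (↭ₚ.filter-↭ _ matched))
      (unique-count (AllPairs.map ℕₚ.<⇒≢ (points-increasing n)) p∈))
    where open ChordDiagram cd

  subdiagrams-unique : ∀ {D} → Unique D → Unique (subdiagrams D)
  subdiagrams-unique []                = [] ∷ []
  subdiagrams-unique {c ∷ D} (c∉ ∷ u) = Uniqueₚ.++⁺ (Uniqueₚ.map⁺ (proj₂ ∘ ∷-injective) (subdiagrams-unique u))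
    (subdiagrams-unique u) λ (p , q) → disjoint p q
    where
    disjoint : ∀ {E} → E ∈ map (c ∷_) (subdiagrams D) → E ∈ subdiagrams D → ⊥
    disjoint p q with ∈-map⁻ (c ∷_) p
    ... | E , E∈ , refl = All.lookup c∉ (subdiagrams-⊆ D q (here refl)) refl

  chordDiagrams-unique : ∀ n → Unique (chordDiagrams n)
  chordDiagrams-unique n = Uniqueₚ.filter⁺ (perfectMatching? n)
    (subdiagrams-unique (AllPairs.map (λ { {c} lt refl → <ₗ-asym {c} {c} lt lt }) (possibleChords-sorted n)))

  -- The length is written such that `points (suc m)` reduces to 1 ∷ `tailPoints m`.
  tailPoints : ℕ → List ℕ
  tailPoints m = applyUpTo (suc ∘ suc) (m + suc (m + 0))

  -- F is the tree of the connected chord diagram C of size m + 1.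

  data Represents (m : ℕ) (F : Forest) : Diagram → Set where
    represents : ∀ {b X} → Nest F b (tailPoints m) X → Sorted ((1 , b) ∷ X) → Represents m F ((1 , b) ∷ X)

  connectedDiagrams : ℕ → List Diagram
  connectedDiagrams n = filter connected? (chordDiagrams n)

  module _ (m : ℕ) where

    tailPoints-length : length (tailPoints m) ≡ suc (2 * m)
    tailPoints-length = trans (length-applyUpTo (suc ∘ suc) (m + suc (m + 0))) (ℕₚ.+-suc m (m + 0))

    tailPoints-increasing : Increasing (1 ∷ tailPoints m)
    tailPoints-increasing = points-increasing (suc m)

    represents-functional : ∀ {F C C′} → Represents m F C → Represents m F C′ → C ≡ C′
    represents-functional (represents n s) (represents n′ s′)
      with nest-functional n n′ refl refl (AllPairs.tail s) (AllPairs.tail s′)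
    ... | refl , refl = refl

    represents-injective : ∀ {F F′ C} → Represents m F C → Represents m F′ C → F ≡ F′
    represents-injective (represents n s) (represents n′ s′) =
      nest-injective n n′ (AllPairs.tail tailPoints-increasing) (AllPairs.tail tailPoints-increasing) (AllPairs.tail s)

    represents-diagram : ∀ {F} → F ∈ forests m → ∃ λ C → C ∈ connectedDiagrams (suc m) × Represents m F C
    represents-diagram {F} F∈ with nest-exists F (forests-valid m F∈) (tailPoints m) (AllPairs.tail tailPoints-increasing)
                                     (trans tailPoints-length (cong (λ k → suc (2 * k)) (sym (forests-size m F∈))))
    ... | b , X , n , s = (1 , b) ∷ X ,
      ∈-filter⁺ connected? (chordDiagrams-complete (suc m) diagram) (tree-connected n tailPoints-increasing) ,
      represents n sorted
      where
      1< : ∀ {p} → p ∈ tailPoints m → 1 < p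
      1< = All.lookup (AllPairs.head tailPoints-increasing)
      sorted : Sorted ((1 , b) ∷ X)
      sorted = All.tabulate (1< ∘ proj₁ ∘ nest-∈ n) ∷ s
      proper : Proper ((1 , b) ∷ X)
      proper (here refl) = 1< (nest-sink∈ n)
      proper (there c∈)  = nest-valid n (AllPairs.tail tailPoints-increasing) c∈
      diagram : ChordDiagram (suc m) ((1 , b) ∷ X)
      diagram = record { sorted = sorted ; proper = proper ; matched = ↭-prep 1 (↭-sym (nest-↭ n)) }

    represents-forest : ∀ {C} → C ∈ connectedDiagrams (suc m) → ∃ λ F → F ∈ forests m × Represents m F C
    represents-forest {C} C∈ with ∈-filter⁻ connected? {xs = chordDiagrams (suc m)} C∈
    ... | C∈cd , ne , conn = go C (chordDiagrams-sound (suc m) C∈cd) ne conn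
      where
      go : ∀ C → ChordDiagram (suc m) C → C ≢ [] → (∀ {c} → c ∈ C → ∀ {d} → d ∈ C → Path C c d) →
           ∃ λ F → F ∈ forests m × Represents m F C
      go []            _  ne _    = contradiction refl ne
      go ((a , b) ∷ X) cd _  conn with decompose (length X) X ℕₚ.≤-refl b (AllPairs.tail sorted) (AllPairs.tail distinct)
                                         (proper ∘ there) (root-linked sorted (conn (here refl) ∘ there))
        where open ChordDiagram cd
      ... | F , qs , n , inc , v with increasing-unique (All.tabulate (a< ∘ ↭ₚ.∈-resp-↭ (nest-↭ n)) ∷ inc) tailPoints-increasing
                                        (↭-trans (↭-prep a (nest-↭ n)) matched)
        where
        open ChordDiagram cd
        a< : ∀ {p} → p ∈ b ∷ endpoints X → a < p
        a< (here refl) = proper (here refl)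
        a< (there p∈) with ∈-endpoints⁻ X p∈
        ... | d , d∈ , inj₁ refl = All.lookup (AllPairs.head sorted) d∈
        ... | d , d∈ , inj₂ refl = ℕₚ.<-trans (All.lookup (AllPairs.head sorted) d∈) (proper (there d∈))
      ...   | refl = F , subst (λ k → F ∈ forests k) size≡ (forests-complete F v) , represents n (ChordDiagram.sorted cd)
        where
        size≡ : size F ≡ m
        size≡ = ℕₚ.*-cancelˡ-≡ (size F) m 2 (ℕₚ.suc-injective (trans (sym (nest-points n)) tailPoints-length))

module Expansions where

  open import Defs
  open import Algebra.Apartness.Bundles using (HeytingField; HeytingCommutativeRing)
  open import Algebra.Bundles using (CommutativeRing)
  open import Data.Bool.Base using (Bool; if_then_else_; true; false)
  open import Data.List.Base
    using (List; []; _∷_; length; map; zipWith; upTo; applyUpTo; _++_; filter; drop;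
           head)
  open import Data.List.Membership.Propositional using (_∈_)
  open import Data.List.Membership.Propositional.Properties
    using (∈-++⁺ˡ; ∈-++⁺ʳ; ∈-++⁻; ∈-∃++)
  open import Data.List.Properties using (upTo-∷ʳ; length-++; length-map; map-∘; map-++)
  open import Data.List.Relation.Binary.Permutation.Propositional as Perm
    using (_↭_; ↭-sym)
  import Data.List.Relation.Binary.Permutation.Propositional.Properties as ↭ₚ
  open import Data.List.Relation.Unary.All as All using (All; []; _∷_)
  open import Data.List.Relation.Unary.AllPairs using ([]; _∷_)
  open import Data.List.Relation.Unary.Any using (here; there)
  open import Data.List.Relation.Unary.Unique.Propositional using (Unique)
  import Data.List.Relation.Unary.Unique.Propositional.Properties as Uniqueₚ
  open import Data.Maybe.Base using (fromMaybe)
  open import Data.Nat.Base as ℕ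
    using (ℕ; zero; suc; _∸_; _≤_; z≤n; s≤s; NonZero; _!; _<_)
  open import Data.Nat.GeneralisedArithmetic using (iterate)
  import Data.Nat.Properties as ℕₚ
  open import Data.Product.Base using (_×_; proj₂; _,_; proj₁; ∃)
  open import Data.Sum.Base using (inj₁; inj₂; [_,_]′)
  open import Function.Base using (_∘_; id)
  open import Level using (Level)
  open import Relation.Binary.PropositionalEquality as ≡
    using (_≡_; cong; _≢_; subst; cong₂)
  import Relation.Binary.Reasoning.Setoid as SetoidReasoning
  open import Relation.Nullary.Decidable using (yes; no; does; dec-true; dec-false)
  open import Relation.Nullary.Negation using (contradiction)
  open import Relation.Unary using (Decidable; Pred)
  open Series
  open Forests
  open TreeSeries
  open Diagrams

  -- Coefficients of polynomials and of the cocycle operators.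

  module PolynomialCoefficients {c ℓ₁ ℓ₂ : Level} (K : HeytingField c ℓ₁ ℓ₂) (char0 : CharacteristicZero K) where

    R : CommutativeRing c ℓ₁
    R = HeytingCommutativeRing.commutativeRing (HeytingField.heytingCommutativeRing K)

    open CommutativeRing R
    open ChordExpansion K char0
    open PowerSeries R using (_⊛_; _≋_; mk≋; at; const; powerSeriesRing)
    private module PA = PowerSeries powerSeriesRing
    open ListSums R
    open import Algebra.Properties.Semiring.Mult semiring
      using (×-congʳ; ×-assoc-*; ×-comm-*; ×-assocˡ) renaming (_×_ to _·_)
    open SetoidReasoning setoid

    coeff-+ : ∀ p q n → coeff (p +ₚ q) n ≈ coeff p n + coeff q n
    coeff-+ []      q       n       = sym (+-identityˡ _)
    coeff-+ (a ∷ p) []      n       = sym (+-identityʳ _)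
    coeff-+ (a ∷ p) (b ∷ q) zero    = refl
    coeff-+ (a ∷ p) (b ∷ q) (suc n) = coeff-+ p q n

    coeff-• : ∀ a p n → coeff (a • p) n ≈ a * coeff p n
    coeff-• a []      n       = sym (zeroʳ a)
    coeff-• a (b ∷ p) zero    = refl
    coeff-• a (b ∷ p) (suc n) = coeff-• a p n

    coeff-* : ∀ p q n → coeff (p *ₚ q) n ≈ (coeff p ⊛ coeff q) n
    coeff-* []      q n    = sym (PowerSeries.⊛-zeroˡ R (coeff q) n)
    coeff-* (a ∷ p) q zero = trans (coeff-+ (a • q) (0# ∷ p *ₚ q) 0) (trans (+-identityʳ _) (coeff-• a q 0))
    coeff-* (a ∷ p) q (suc n) = trans (coeff-+ (a • q) (0# ∷ p *ₚ q) (suc n)) (+-cong (coeff-• a q (suc n)) (coeff-* p q n))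

    coeff-sum : ∀ {a} {A : Set a} (t : A → Poly) xs n → coeff (sumₚ (map t xs)) n ≈ Σ xs (λ x → coeff (t x) n)
    coeff-sum t []       n = refl
    coeff-sum t (x ∷ xs) n = trans (coeff-+ (t x) (sumₚ (map t xs)) n) (+-congˡ (coeff-sum t xs n))

    coeffs : Series → ℕ → ℕ → Carrier
    coeffs G n = coeff (G n)

    module _ {c′ ℓ′} (R′ : CommutativeRing c′ ℓ′) where

      private
        module R′ = CommutativeRing R′
        module P′ = PowerSeries R′
        module L′ = ListSums R′

      Σ-⊛ : ∀ a b n → L′.Σ (upTo (suc n)) (λ k → a k R′.* b (n ∸ k)) R′.≈ (a P′.⊛ b) n
      Σ-⊛ a b zero    = R′.+-identityʳ _
      Σ-⊛ a b (suc n) = R′.+-congˡ (R′.trans (R′.reflexive (L′.Σ-applyUpTo _ suc (suc n))) (Σ-⊛ (a ∘ suc) b n))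

    Σ-at : ∀ {a} {A : Set a} (xs : List A) h j → ListSums.Σ powerSeriesRing xs h j ≈ Σ xs (λ x → h x j)
    Σ-at []       h j = refl
    Σ-at (x ∷ xs) h j = +-congˡ (Σ-at xs h j)

    coeffs-* : ∀ G H → coeffs (G *ₛ H) PA.≋ coeffs G PA.⊛ coeffs H
    coeffs-* G H = PA.mk≋ λ n → mk≋ λ j → begin
      coeff (sumₚ (map (λ k → G k *ₚ H (n ∸ k)) (upTo (suc n)))) j
        ≈⟨ coeff-sum (λ k → G k *ₚ H (n ∸ k)) (upTo (suc n)) j ⟩
      Σ (upTo (suc n)) (λ k → coeff (G k *ₚ H (n ∸ k)) j)
        ≈⟨ Σ-cong (upTo (suc n)) (λ {k} _ → coeff-* (G k) (H (n ∸ k)) j) ⟩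
      Σ (upTo (suc n)) (λ k → (coeff (G k) ⊛ coeff (H (n ∸ k))) j)
        ≈⟨ Σ-at (upTo (suc n)) _ j ⟨
      ListSums.Σ powerSeriesRing (upTo (suc n)) (λ k → coeff (G k) ⊛ coeff (H (n ∸ k))) j
        ≈⟨ at (Σ-⊛ powerSeriesRing (coeffs G) (coeffs H) n) j ⟩
      (coeffs G PA.⊛ coeffs H) n j ∎

    open import Algebra.Properties.Semiring.Exp (CommutativeRing.semiring PA.powerSeriesRing)
      using () renaming (_^_ to _B^_)
    private module BX = CommutativeRing PA.powerSeriesRing

    coeffs-1 : coeffs 1ₛ PA.≋ BX.1#
    coeffs-1 = PA.mk≋ λ where
      zero    → mk≋ λ { zero → refl ; (suc _) → refl }
      (suc _) → mk≋ λ _ → refl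

    coeffs-^ : ∀ G k → coeffs (G ^ₛ k) PA.≋ coeffs G B^ k
    coeffs-^ G zero    = coeffs-1
    coeffs-^ G (suc k) = BX.trans (coeffs-* G (G ^ₛ k)) (BX.*-congˡ {coeffs G} (coeffs-^ G k))

    ·-* : ∀ n a → n · a ≈ (n · 1#) * a
    ·-* n a = trans (×-congʳ n (sym (*-identityˡ a))) (sym (×-assoc-* n 1# a))

    1/-inverse : ∀ n .{{_ : NonZero n}} a → n · ((1/ n) * a) ≈ a
    1/-inverse n a = begin
      n · ((1/ n) * a)           ≈⟨ ·-* n _ ⟩
      (n · 1#) * ((1/ n) * a)    ≈⟨ *-assoc _ _ _ ⟨
      -- Apartness from 0 provides an inverse of the difference with 0.
      (n · 1#) * (1/ n) * a      ≈⟨ *-congʳ (*-congʳ minus-0) ⟨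
      ((n · 1#) - 0#) * (1/ n) * a ≈⟨ *-congʳ (proj₂ (proj₂ (HeytingField.#⇒invertible K (char0 n)))) ⟩
      1# * a                     ≈⟨ *-identityˡ a ⟩
      a                          ∎
      where
      open import Algebra.Properties.Ring ring using (-0#≈0#)
      minus-0 : (n · 1#) - 0# ≈ n · 1#
      minus-0 = trans (+-congˡ -0#≈0#) (+-identityʳ _)

    ·-cancel : ∀ n .{{_ : NonZero n}} {a b} → n · a ≈ n · b → a ≈ b
    ·-cancel n {a} {b} eq = begin
      a                   ≈⟨ 1/-inverse n a ⟨
      n · ((1/ n) * a)    ≈⟨ ×-comm-* n _ _ ⟨
      (1/ n) * (n · a)    ≈⟨ *-congˡ eq ⟩
      (1/ n) * (n · b)    ≈⟨ ×-comm-* n _ _ ⟩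
      n · ((1/ n) * b)    ≈⟨ 1/-inverse n b ⟩
      b                   ∎

    multiplicity-cancel : ∀ κ m {a b} → multiplicity κ (suc m) · a ≈ multiplicity κ (suc m) · b → a ≈ b
    multiplicity-cancel binomial m eq = ·-cancel (suc m) eq
    multiplicity-cancel divided  m eq = trans (sym (+-identityʳ _)) (trans eq (+-identityʳ _))

    module _ (f : ℕ → Carrier) where

      derivative : Kind → Poly → Poly
      derivative binomial = d/dy
      derivative divided  = δ/δy

      cocycle : Kind → Poly → Poly
      cocycle binomial = Lbin f
      cocycle divided  = Ldiv f

      coeff-derivative : ∀ κ p → coeff (derivative κ p) ≋ ∂ R κ (coeff p)
      coeff-derivative divided  []      = mk≋ λ _ → sym (+-identityʳ 0#)
      coeff-derivative divided  (a ∷ p) = mk≋ λ _ → sym (+-identityʳ _)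
      coeff-derivative binomial []      = mk≋ λ n → sym (×-0 R (suc n))
      coeff-derivative binomial (a ∷ p) = mk≋ (go suc p)
        where
        go : ∀ (g : ℕ → ℕ) p n → coeff (zipWith _·_ (applyUpTo g (length p)) p) n ≈ g n · coeff p n
        go g []      n       = sym (×-0 R (g n))
        go g (b ∷ p) zero    = refl
        go g (b ∷ p) (suc n) = go (g ∘ suc) p n

      coeff-cocycle-0 : ∀ κ p → coeff (cocycle κ p) 0 ≈ 0#
      coeff-cocycle-0 binomial p = refl
      coeff-cocycle-0 divided  p = refl

      coeff-cocycle-suc : ∀ κ p j → multiplicity κ (suc j) · coeff (cocycle κ p) (suc j) ≈
                          coeff (applySeries f (derivative κ) p) j
      coeff-cocycle-suc divided  p j = +-identityʳ _
      coeff-cocycle-suc binomial p j = trans (×-congʳ (suc j) (go id (applySeries f d/dy p) j)) (1/-inverse (suc j) _)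
        where
        go : ∀ (g : ℕ → ℕ) q j → coeff (zipWith (λ i a → (1/ suc i) * a) (applyUpTo g (length q)) q) j ≈
             (1/ suc (g j)) * coeff q j
        go g []      j       = sym (zeroʳ _)
        go g (b ∷ q) zero    = refl
        go g (b ∷ q) (suc j) = go (g ∘ suc) q j

      -- F(∂) a, truncated after N terms.

      F∂ : Kind → ℕ → (ℕ → Carrier) → (ℕ → Carrier) → ℕ → Carrier
      F∂ κ zero    g a j = 0#
      F∂ κ (suc N) g a j = g 0 * a j + F∂ κ N (g ∘ suc) (∂ R κ a) j

      module ∂ₚ κ = TwistedDerivation (derivation R κ)

      F∂-cong : ∀ κ N g {a b} → a ≋ b → ∀ j → F∂ κ N g a j ≈ F∂ κ N g b j
      F∂-cong κ zero    g p j = refl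
      F∂-cong κ (suc N) g p j = +-cong (*-congˡ (at p j)) (F∂-cong κ N (g ∘ suc) (∂ₚ.D-cong κ p) j)

      F∂-vanish : ∀ κ N g {a} → (∀ n → a n ≈ 0#) → ∀ j → F∂ κ N g a j ≈ 0#
      F∂-vanish κ zero    g p j = refl
      F∂-vanish κ (suc N) g p j = trans (+-cong (trans (*-congˡ (p j)) (zeroʳ _))
        (F∂-vanish κ N (g ∘ suc) (λ n → trans (×-congʳ (multiplicity κ (suc n)) (p (suc n))) (×-0 R (multiplicity κ (suc n)))) j)) (+-identityˡ 0#)

      -- After d derivations nothing is left of a, so every truncation from d terms on gives the
      -- same result.
      F∂-stable : ∀ κ d M g {a} → (∀ n → d ≤ n → a n ≈ 0#) → ∀ j → F∂ κ (d ℕ.+ M) g a j ≈ F∂ κ d g a j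
      F∂-stable κ zero    M g p j = F∂-vanish κ M g (λ n → p n z≤n) j
      F∂-stable κ (suc d) M g p j = +-congˡ (F∂-stable κ d M (g ∘ suc)
        (λ n d≤n → trans (×-congʳ (multiplicity κ (suc n)) (p (suc n) (s≤s d≤n))) (×-0 R (multiplicity κ (suc n)))) j)

      coeff-beyond : ∀ p n → length p ≤ n → coeff p n ≈ 0#
      coeff-beyond []      n       _        = refl
      coeff-beyond (a ∷ p) (suc n) (s≤s le) = coeff-beyond p n le

      coeff-applySeries : ∀ κ p M j → coeff (applySeries f (derivative κ) p) j ≈ F∂ κ (length p ℕ.+ M) f (coeff p) j
      coeff-applySeries κ p M j = begin
        coeff (sumₚ (map (λ k → f k • iterate (derivative κ) p k) (upTo (length p)))) j
          ≈⟨ coeff-sum (λ k → f k • iterate (derivative κ) p k) (upTo (length p)) j ⟩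
        Σ (upTo (length p)) (λ k → coeff (f k • iterate (derivative κ) p k) j)
          ≈⟨ Σ-cong (upTo (length p)) (λ {k} _ → coeff-• (f k) (iterate (derivative κ) p k) j) ⟩
        Σ (upTo (length p)) (λ k → f k * coeff (iterate (derivative κ) p k) j)
          ≈⟨ go (length p) f p ⟩
        F∂ κ (length p) f (coeff p) j
          ≈⟨ F∂-stable κ (length p) M f (coeff-beyond p) j ⟨
        F∂ κ (length p ℕ.+ M) f (coeff p) j ∎
        where
        go : ∀ N g p → Σ (upTo N) (λ k → g k * coeff (iterate (derivative κ) p k) j) ≈ F∂ κ N g (coeff p) j
        go zero    g p = refl
        go (suc N) g p = +-congˡ (trans (reflexive (Σ-applyUpTo _ suc N))
          (trans (go N (g ∘ suc) (derivative κ p)) (F∂-cong κ N (g ∘ suc) (coeff-derivative κ p) j)))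

      -- Lists that agree up to trailing zeros may differ in length, and `applySeries` truncates by
      -- length. Both sums are extended to the sum of the lengths.
      cocycle-cong : ∀ κ {p q} → p ≈ₚ q → cocycle κ p ≈ₚ cocycle κ q
      cocycle-cong κ {p} {q} eq zero    = trans (coeff-cocycle-0 κ p) (sym (coeff-cocycle-0 κ q))
      cocycle-cong κ {p} {q} eq (suc j) = multiplicity-cancel κ j (begin
        multiplicity κ (suc j) · coeff (cocycle κ p) (suc j)   ≈⟨ coeff-cocycle-suc κ p j ⟩
        coeff (applySeries f (derivative κ) p) j               ≈⟨ coeff-applySeries κ p (length q) j ⟩
        F∂ κ (length p ℕ.+ length q) f (coeff p) j             ≈⟨ F∂-cong κ (length p ℕ.+ length q) f (mk≋ eq) j ⟩
        F∂ κ (length p ℕ.+ length q) f (coeff q) j             ≡⟨ cong (λ N → F∂ κ N f (coeff q) j) (ℕₚ.+-comm (length p) (length q)) ⟩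
        F∂ κ (length q ℕ.+ length p) f (coeff q) j             ≈⟨ coeff-applySeries κ q (length p) j ⟨
        coeff (applySeries f (derivative κ) q) j               ≈⟨ coeff-cocycle-suc κ q j ⟨
        multiplicity κ (suc j) · coeff (cocycle κ q) (suc j)   ∎)

      monomial : ℕ → Carrier → ℕ → Carrier
      monomial zero    a j       = const a j
      monomial (suc s) a zero    = 0#
      monomial (suc s) a (suc j) = monomial s a j

      monomial-scale : ∀ (u : ℕ → ℕ) s a j → u j · monomial s a j ≈ monomial s (u s · a) j
      monomial-scale u zero    a zero    = refl
      monomial-scale u zero    a (suc j) = ×-0 R (u (suc j))
      monomial-scale u (suc s) a zero    = ×-0 R (u 0)
      monomial-scale u (suc s) a (suc j) = monomial-scale (u ∘ suc) s a j

      monomial-* : ∀ r s a j → r * monomial s a j ≈ monomial s (r * a) j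
      monomial-* r zero    a zero    = refl
      monomial-* r zero    a (suc j) = zeroʳ r
      monomial-* r (suc s) a zero    = zeroʳ r
      monomial-* r (suc s) a (suc j) = monomial-* r s a j

      monomial-cong : ∀ s {a b} → a ≈ b → ∀ j → monomial s a j ≈ monomial s b j
      monomial-cong zero    p zero    = p
      monomial-cong zero    p (suc j) = refl
      monomial-cong (suc s) p zero    = refl
      monomial-cong (suc s) p (suc j) = monomial-cong s p j

      monomial-beyond : ∀ s a j → suc s ≤ j → monomial s a j ≈ 0#
      monomial-beyond zero    a (suc j) _        = refl
      monomial-beyond (suc s) a (suc j) (s≤s lt) = monomial-beyond s a j lt

      coeff-y^ : ∀ s → coeff (y^ s) ≋ monomial s 1#
      coeff-y^ s = mk≋ (go s)
        where
        go : ∀ s j → coeff (y^ s) j ≈ monomial s 1# j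
        go zero    zero    = refl
        go zero    (suc j) = refl
        go (suc s) zero    = refl
        go (suc s) (suc j) = go s j

      length-y^ : ∀ s → length (y^ s) ≡ suc s
      length-y^ zero    = ≡.refl
      length-y^ (suc s) = cong suc (length-y^ s)

      recipFactorial : ℕ → Carrier
      recipFactorial s = (1/ (s !)) {{s ℕₚ.!≢0}}

      -- Normalises the powers of y so that the derivation maps each one to its predecessor.
      scalar : Kind → ℕ → Carrier
      scalar binomial s = recipFactorial s
      scalar divided  s = 1#

      scalar-suc : ∀ κ s → multiplicity κ (suc s) · scalar κ (suc s) ≈ scalar κ s
      scalar-suc divided  s = +-identityʳ 1#
      scalar-suc binomial s = ·-cancel (s !) {{s ℕₚ.!≢0}} (begin
        (s !) · (suc s · recipFactorial (suc s))      ≈⟨ ×-assocˡ _ (s !) (suc s) ⟩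
        ((s !) ℕ.* suc s) · recipFactorial (suc s)    ≡⟨ cong (_· recipFactorial (suc s)) (ℕₚ.*-comm (s !) (suc s)) ⟩
        (suc s !) · recipFactorial (suc s)          ≈⟨ inverse (suc s) ⟩
        1#                               ≈⟨ inverse s ⟨
        (s !) · recipFactorial s                      ∎)
        where
        inverse : ∀ s → (s !) · recipFactorial s ≈ 1#
        inverse s = trans (×-congʳ (s !) (sym (*-identityʳ _))) (1/-inverse (s !) {{s ℕₚ.!≢0}} 1#)

      scalar-0 : ∀ κ → scalar κ 0 ≈ 1#
      scalar-0 divided  = refl
      scalar-0 binomial = trans (sym (trans (+-identityʳ _) (*-identityʳ _))) (1/-inverse 1 1#)

      -- yˢ / s! or yˢ.

      basis : Kind → ℕ → ℕ → Carrier
      basis κ s = monomial s (scalar κ s)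

      ∂-basis : ∀ κ s → ∂ R κ (basis κ (suc s)) ≋ basis κ s
      ∂-basis κ s = mk≋ λ j → trans (monomial-scale (multiplicity κ ∘ suc) s _ j) (monomial-cong s (scalar-suc κ s) j)

      F∂-basis : Kind → ℕ → ℕ → Carrier
      F∂-basis κ t = F∂ κ (suc t) f (basis κ t)

      module _ (κ : Kind) where

        -- Only the t-th derivative of the t-th basis polynomial has a constant term, and this is 1.
        F∂-basis-0 : ∀ t g → F∂ κ (suc t) g (basis κ t) 0 ≈ g t
        F∂-basis-0 zero    g = trans (+-identityʳ _) (trans (*-congˡ (scalar-0 κ)) (*-identityʳ _))
        F∂-basis-0 (suc t) g = trans (+-cong (zeroʳ _) (trans (F∂-cong κ (suc t) (g ∘ suc) (∂-basis κ t) 0) (F∂-basis-0 t (g ∘ suc))))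
          (+-identityˡ _)

        ∂-F∂-basis : ∀ t g j → multiplicity κ (suc j) · F∂ κ (suc (suc t)) g (basis κ (suc t)) (suc j) ≈ F∂ κ (suc t) g (basis κ t) j
        ∂-F∂-basis t g j = begin
          m · (g 0 * basis κ (suc t) (suc j) + F∂ κ (suc t) (g ∘ suc) (∂ R κ (basis κ (suc t))) (suc j))
            ≈⟨ ×-distrib-+ _ _ m ⟩
          m · (g 0 * basis κ (suc t) (suc j)) + m · F∂ κ (suc t) (g ∘ suc) (∂ R κ (basis κ (suc t))) (suc j)
            ≈⟨ +-cong (trans (sym (×-comm-* m (g 0) _)) (*-congˡ (at (∂-basis κ t) j)))
                      (×-congʳ m (F∂-cong κ (suc t) (g ∘ suc) (∂-basis κ t) (suc j))) ⟩
          g 0 * basis κ t j + m · F∂ κ (suc t) (g ∘ suc) (basis κ t) (suc j)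
            ≈⟨ +-congˡ (rest t) ⟩
          F∂ κ (suc t) g (basis κ t) j ∎
          where
          open import Algebra.Properties.CommutativeMonoid.Mult +-commutativeMonoid using (×-distrib-+)
          m = multiplicity κ (suc j)
          rest : ∀ t → m · F∂ κ (suc t) (g ∘ suc) (basis κ t) (suc j) ≈ F∂ κ t (g ∘ suc) (∂ R κ (basis κ t)) j
          rest zero    = trans (×-congʳ m (trans (+-identityʳ _) (zeroʳ _))) (×-0 R m)
          rest (suc t) = trans (∂-F∂-basis t (g ∘ suc) j) (sym (F∂-cong κ (suc t) (g ∘ suc) (∂-basis κ t) j))

        F∂-scale : ∀ N g r a j → F∂ κ N g (λ i → r * a i) j ≈ r * F∂ κ N g a j
        F∂-scale zero    g r a j = sym (zeroʳ r)
        F∂-scale (suc N) g r a j = trans (+-cong (x∙yz≈y∙xz _ _ _)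
            (trans (F∂-cong κ N (g ∘ suc) (mk≋ λ i → sym (×-comm-* (multiplicity κ (suc i)) r _)) j) (F∂-scale N (g ∘ suc) r (∂ R κ a) j)))
          (sym (distribˡ _ _ _))
          where open import Algebra.Properties.CommutativeSemigroup *-commutativeSemigroup using (x∙yz≈y∙xz)

        F∂-+ : ∀ N g a b j → F∂ κ N g (λ i → a i + b i) j ≈ F∂ κ N g a j + F∂ κ N g b j
        F∂-+ zero    g a b j = sym (+-identityˡ 0#)
        F∂-+ (suc N) g a b j = trans (+-cong (distribˡ _ _ _)
            (trans (F∂-cong κ N (g ∘ suc) (∂ₚ.D-+ κ a b) j) (F∂-+ N (g ∘ suc) _ _ j)))
          (interchange _ _ _ _)
          where open import Algebra.Properties.CommutativeSemigroup +-commutativeSemigroup using (interchange)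

        F∂-Σ : ∀ {a} {A : Set a} N g (xs : List A) (h : A → ℕ → Carrier) (r : A → Carrier) j →
               F∂ κ N g (λ i → Σ xs (λ x → h x i * r x)) j ≈ Σ xs (λ x → F∂ κ N g (h x) j * r x)
        F∂-Σ N g []       h r j = F∂-vanish κ N g (λ _ → refl) j
        F∂-Σ N g (x ∷ xs) h r j = trans (F∂-+ N g _ _ j) (+-cong
          (trans (F∂-cong κ N g (mk≋ λ i → *-comm _ _) j) (trans (F∂-scale N g (r x) (h x) j) (*-comm _ _)))
          (F∂-Σ N g xs h r j))

        -- The index is t₁ and the exponent t₁ - 1.
        kernel-l kernel-h : ℕ → ℕ → Carrier
        kernel-l zero    j = 0#
        kernel-l (suc s) j = scalar κ s * coeff (cocycle κ (y^ s)) j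
        kernel-h zero    j = 0#
        kernel-h (suc s) j = basis κ s j

        F∂-kernel : ∀ t j → multiplicity κ (suc j) · kernel-l (suc t) (suc j) ≈ F∂-basis κ t j
        F∂-kernel t j = begin
          m · (scalar κ t * coeff (cocycle κ (y^ t)) (suc j))
            ≈⟨ ×-comm-* m _ _ ⟨
          scalar κ t * (m · coeff (cocycle κ (y^ t)) (suc j))
            ≈⟨ *-congˡ (coeff-cocycle-suc κ (y^ t) j) ⟩
          scalar κ t * coeff (applySeries f (derivative κ) (y^ t)) j
            ≈⟨ *-congˡ (coeff-applySeries κ (y^ t) 0 j) ⟩
          scalar κ t * F∂ κ (length (y^ t) ℕ.+ 0) f (coeff (y^ t)) j
            ≡⟨ cong (λ N → scalar κ t * F∂ κ N f (coeff (y^ t)) j) (≡.trans (ℕₚ.+-identityʳ _) (length-y^ t)) ⟩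
          scalar κ t * F∂ κ (suc t) f (coeff (y^ t)) j
            ≈⟨ *-congˡ (F∂-cong κ (suc t) f (coeff-y^ t) j) ⟩
          scalar κ t * F∂ κ (suc t) f (monomial t 1#) j
            ≈⟨ F∂-scale (suc t) f (scalar κ t) (monomial t 1#) j ⟨
          F∂ κ (suc t) f (λ i → scalar κ t * monomial t 1# i) j
            ≈⟨ F∂-cong κ (suc t) f (mk≋ λ i → trans (monomial-* _ t 1# i) (monomial-cong t (*-identityʳ _) i)) j ⟩
          F∂-basis κ t j ∎
          where m = multiplicity κ (suc j)

        kernel-l-y⁰ : ∀ t → kernel-l t 0 ≈ 0#
        kernel-l-y⁰ zero    = refl
        kernel-l-y⁰ (suc t) = trans (*-congˡ (coeff-cocycle-0 κ (y^ t))) (zeroʳ _)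

        -- F(∂) applied to the t-th basis polynomial has constant term f_t. Its remaining
        -- coefficients are those of the cocycle of the preceding one, because both have the same
        -- derivative.
        kernel-l-suc : ∀ t j → multiplicity κ (suc j) · kernel-l (suc t) (suc j) ≈ kernel-l t j + const (f t) j
        kernel-l-suc t j = trans (F∂-kernel t j) (split t j)
          where
          split : ∀ t j → F∂-basis κ t j ≈ kernel-l t j + const (f t) j
          split t       zero    = trans (F∂-basis-0 t f) (sym (trans (+-congʳ (kernel-l-y⁰ t)) (+-identityˡ _)))
          split zero    (suc j) = trans (+-identityʳ _) (trans (zeroʳ _) (sym (+-identityʳ 0#)))
          split (suc t) (suc j) = trans (multiplicity-cancel κ j (trans (∂-F∂-basis t f j) (sym (F∂-kernel t j)))) (sym (+-identityʳ _))

        module _ (φ : ℕ → Carrier) where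

          open ExpansionEquation R κ φ f using (Kernels)

          kernels : Kernels
          kernels = record
            { l      = kernel-l
            ; h      = kernel-h
            ; l-0    = λ _ → refl
            ; l-y⁰   = kernel-l-y⁰
            ; l-suc  = kernel-l-suc
            ; h-0    = λ _ → refl
            ; h-1-y⁰ = scalar-0 κ
            ; h-y⁰   = λ _ → refl
            ; h-suc  = λ { zero j → ×-0 R (multiplicity κ (suc j)) ; (suc t) j → at (∂-basis κ t) j }
            ; cancel = multiplicity-cancel κ
            }

  -- Sums along bijections.

  module ListSumProperties {c ℓ : Level} (R : CommutativeRing c ℓ) where

    open CommutativeRing R
    open ListSums R

    guardBy : Bool → Carrier → Carrier
    guardBy b a = if b then a else 0#

    Σ-filter : ∀ {a p} {A : Set a} {P : Pred A p} (P? : Decidable P) xs h →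
               Σ (filter P? xs) h ≈ Σ xs (λ x → guardBy (does (P? x)) (h x))
    Σ-filter P? []       h = refl
    Σ-filter P? (x ∷ xs) h with P? x
    ... | yes _ = +-congˡ (Σ-filter P? xs h)
    ... | no _  = trans (Σ-filter P? xs h) (sym (+-identityˡ _))

    Σ-↭ : ∀ {a} {A : Set a} {xs ys : List A} (h : A → Carrier) → xs ↭ ys → Σ xs h ≈ Σ ys h
    Σ-↭ h Perm.refl         = refl
    Σ-↭ h (Perm.prep x p)   = +-congˡ (Σ-↭ h p)
    Σ-↭ h (Perm.swap x y p) = trans (x∙yz≈y∙xz _ _ _) (+-congˡ (+-congˡ (Σ-↭ h p)))
      where open import Algebra.Properties.CommutativeSemigroup +-commutativeSemigroup using (x∙yz≈y∙xz)
    Σ-↭ h (Perm.trans p q)  = trans (Σ-↭ h p) (Σ-↭ h q)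

    module _ {a b r} {A : Set a} {B : Set b} (_~_ : A → B → Set r)
             (functional : ∀ {x y y′} → x ~ y → x ~ y′ → y ≡ y′) (injective : ∀ {x x′ y} → x ~ y → x′ ~ y → x ≡ x′) where

      Σ-bijection : ∀ {xs ys h k} → Unique xs → Unique ys →
                    (∀ {x} → x ∈ xs → ∃ λ y → y ∈ ys × x ~ y) → (∀ {y} → y ∈ ys → ∃ λ x → x ∈ xs × x ~ y) →
                    (∀ {x y} → x ∈ xs → x ~ y → h x ≈ k y) → Σ xs h ≈ Σ ys k
      Σ-bijection {[]}     {[]}     _ _ _ _ _ = refl
      Σ-bijection {[]}     {y ∷ ys} _ _ _ g _ with () ← proj₁ (proj₂ (g (here ≡.refl)))
      Σ-bijection {x ∷ xs} {ys} {h} {k} (p ∷ u) u′ f g eq with f (here ≡.refl)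
      ... | y , y∈ , x~y with ∈-∃++ y∈
      ... | ys₁ , ys₂ , ≡.refl = trans (+-cong (eq (here ≡.refl) x~y)
          (Σ-bijection u removed f′ g′ (eq ∘ there)))
        (sym (Σ-↭ k (↭ₚ.shift y ys₁ ys₂)))
        where
        removed : Unique (ys₁ ++ ys₂)
        removed with AllPairs-++⁻ ys₁ u′
        ... | q , (_ ∷ s) , t = AllPairs-++⁺ q s (λ y∈ z∈ → t y∈ (there z∈))
        fresh : ∀ {z} → z ∈ ys₁ ++ ys₂ → z ≢ y
        fresh z∈ with AllPairs-++⁻ ys₁ u′
        ... | q , (r ∷ s) , t = [ (λ z∈₁ → t z∈₁ (here ≡.refl)) , (λ z∈₂ eq → All.lookup r z∈₂ (≡.sym eq)) ]′ (∈-++⁻ ys₁ z∈)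
        f′ : ∀ {x′} → x′ ∈ xs → ∃ λ z → z ∈ ys₁ ++ ys₂ × x′ ~ z
        f′ x′∈ with f (there x′∈)
        ... | z , z∈ , x′~z with ∈-++⁻ ys₁ z∈
        ...   | inj₁ z∈₁             = z , ∈-++⁺ˡ z∈₁ , x′~z
        ...   | inj₂ (there z∈₂)     = z , ∈-++⁺ʳ ys₁ z∈₂ , x′~z
        ...   | inj₂ (here ≡.refl)   = contradiction (injective x~y x′~z) (All.lookup p x′∈)
        g′ : ∀ {z} → z ∈ ys₁ ++ ys₂ → ∃ λ x′ → x′ ∈ xs × x′ ~ z
        g′ {z} z∈ with g ([ ∈-++⁺ˡ , ∈-++⁺ʳ ys₁ ∘ there ]′ (∈-++⁻ ys₁ z∈))
        ... | x′ , there x′∈ , x′~z     = x′ , x′∈ , x′~z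
        ... | x′ , here ≡.refl , x~z = contradiction (functional x~z x~y) (fresh z∈)

  firstLabel-≤ : ∀ F → firstLabel F ≤ suc (size F)
  firstLabel-≤ leaf           = s≤s z≤n
  firstLabel-≤ (fork F₁ g F₂) = s≤s (ℕₚ.≤-trans (firstLabel-≤ F₁) (ℕₚ.m≤m+n _ (size F₂)))

  -- The functional equation for the sum over trees.

  module TreeExpansion {c ℓ₁ ℓ₂ : Level} (K : HeytingField c ℓ₁ ℓ₂) (char0 : CharacteristicZero K)
                       (κ : Kind) (φ f : ℕ → HeytingField.Carrier K) where

    open PolynomialCoefficients K char0
    open CommutativeRing R
    open ChordExpansion K char0
    open PowerSeries R using (_⊛_; _≋_; mk≋; at; const; powerSeriesRing; const-⊛)
    private module PA = PowerSeries powerSeriesRing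
    open ListSums R
    open ExpansionEquation R κ φ f using (module Solve; A; Z; coefficients)
    open Solve (kernels f κ φ)
    open TreeWeights A Z coefficients
    open import Algebra.Properties.Semiring.Mult semiring using (×-congʳ; ×-assoc-*) renaming (_×_ to _·_)
    open import Algebra.Properties.Semiring.Exp (CommutativeRing.semiring PA.powerSeriesRing)
      using () renaming (_^_ to _B^_)
    open SetoidReasoning setoid
    private module BX = CommutativeRing PA.powerSeriesRing

    L : Poly → Poly
    L = cocycle f κ

    treeCoeff : Forest → Carrier
    treeCoeff F = treeWeight F 0

    ev-series : ∀ b m j → ev (series b) (suc m) j ≈ Σ (forests m) (λ F → b (firstLabel F) j * treeCoeff F)
    ev-series b m j = Σ-at (forests m) _ 0

    composition-Σ : ∀ g N n j → composition g N n j ≈ Σ (upTo (suc N)) (λ k → φ k * (g B^ k) n j)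
    composition-Σ g zero    n j = trans (scaled 0 BX.1# n j) (sym (+-identityʳ _))
      where
      scaled : ∀ k (a : BX.Carrier) n j → (PA.const (const (φ k)) PA.⊛ a) n j ≈ φ k * a n j
      scaled k a n j = trans (at (PA.const-⊛ (const (φ k)) a n) j) (const-⊛ (φ k) (a n) j)
    composition-Σ g (suc N) n j = begin
      composition g N n j + (PA.const (const (φ (suc N))) PA.⊛ (g B^ suc N)) n j
        ≈⟨ +-cong (composition-Σ g N n j) (trans (at (PA.const-⊛ (const (φ (suc N))) (g B^ suc N) n) j) (const-⊛ (φ (suc N)) _ j)) ⟩
      Σ (upTo (suc N)) t + t (suc N)
        ≈⟨ +-congˡ (+-identityʳ _) ⟨
      Σ (upTo (suc N)) t + Σ (suc N ∷ []) t
        ≈⟨ Σ-++ (upTo (suc N)) (suc N ∷ []) t ⟨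
      Σ (upTo (suc N) ++ suc N ∷ []) t
        ≡⟨ cong (λ xs → Σ xs t) (upTo-∷ʳ (suc N)) ⟩
      Σ (upTo (suc (suc N))) t ∎
      where
      t : ℕ → Carrier
      t k = φ k * (g B^ k) n j

    coeffs-compose : ∀ G n j → coeff ((φ ⟨ G ⟩) n) j ≈ composition (coeffs G) n n j
    coeffs-compose G n j = begin
      coeff (sumₚ (map (λ k → φ k • (G ^ₛ k) n) (upTo (suc n)))) j
        ≈⟨ coeff-sum (λ k → φ k • (G ^ₛ k) n) (upTo (suc n)) j ⟩
      Σ (upTo (suc n)) (λ k → coeff (φ k • (G ^ₛ k) n) j)
        ≈⟨ Σ-cong (upTo (suc n)) (λ {k} _ → trans (coeff-• (φ k) ((G ^ₛ k) n) j) (*-congˡ (at (PA.at (coeffs-^ G k) n) j))) ⟩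
      Σ (upTo (suc n)) (λ k → φ k * (coeffs G B^ k) n j)
        ≈⟨ composition-Σ (coeffs G) n n j ⟨
      composition (coeffs G) n n j ∎

    power-cong-≤ : ∀ {g g′ : ℕ → ℕ → Carrier} n k → (∀ m → m ≤ n → g m ≋ g′ m) → ∀ m → m ≤ n → (g B^ k) m ≋ (g′ B^ k) m
    power-cong-≤ n zero    eq m m≤n = CommutativeRing.refl powerSeriesRing
    power-cong-≤ n (suc k) eq m m≤n = PA.⊛-cong-≤ m (λ i i≤m → eq i (ℕₚ.≤-trans i≤m m≤n))
      (λ i i≤m → power-cong-≤ n k eq i (ℕₚ.≤-trans i≤m m≤n))

    compose-cong-≤ : ∀ G H n → (∀ m → m ≤ n → G m ≈ₚ H m) → (φ ⟨ G ⟩) n ≈ₚ (φ ⟨ H ⟩) n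
    compose-cong-≤ G H n eq j = begin
      coeff ((φ ⟨ G ⟩) n) j                                   ≈⟨ trans (coeffs-compose G n j) (composition-Σ (coeffs G) n n j) ⟩
      Σ (upTo (suc n)) (λ k → φ k * (coeffs G B^ k) n j)
        ≈⟨ Σ-cong (upTo (suc n)) (λ {k} _ → *-congˡ (at (power-cong-≤ n k (λ m m≤n → mk≋ (eq m m≤n)) n ℕₚ.≤-refl) j)) ⟩
      Σ (upTo (suc n)) (λ k → φ k * (coeffs H B^ k) n j)      ≈⟨ trans (coeffs-compose H n j) (composition-Σ (coeffs H) n n j) ⟨
      coeff ((φ ⟨ H ⟩) n) j ∎

    -- Because of the factor x, the coefficient of degree m + 1 is determined by those up to m.
    solutions-agree : ∀ G H → Solves L φ G → Solves L φ H → H ≈ₛ G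
    solutions-agree G H (G₀ , G-eq) (H₀ , H-eq) n = below (suc n) n ℕₚ.≤-refl
      where
      below : ∀ k m → m < k → H m ≈ₚ G m
      below (suc k) zero    _         j = trans (H₀ j) (sym (G₀ j))
      below (suc k) (suc m) (s≤s m<k) j = begin
        coeff (H (suc m)) j          ≈⟨ H-eq (suc m) j ⟩
        coeff (L ((φ ⟨ H ⟩) m)) j    ≈⟨ cocycle-cong f κ {(φ ⟨ H ⟩) m} {(φ ⟨ G ⟩) m} (compose-cong-≤ H G m (λ i i≤m → below k i (ℕₚ.≤-<-trans i≤m m<k))) j ⟩
        coeff (L ((φ ⟨ G ⟩) m)) j    ≈⟨ G-eq (suc m) j ⟨
        coeff (G (suc m)) j ∎

    module _ (S : Series) (S-0 : ∀ j → coeff (S 0) j ≈ 0#)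
             (S-suc : ∀ m j → coeff (S (suc m)) j ≈ Σ (forests m) (λ F → kernel-l f κ (firstLabel F) j * treeCoeff F)) where

      coeffs-S : coeffs S PA.≋ ev G
      coeffs-S = PA.mk≋ λ where
        zero    → mk≋ S-0
        (suc m) → mk≋ λ j → trans (S-suc m j) (sym (ev-series (kernel-l f κ) m j))

      -- The identity H = x φ(z + G) at z = 0, where G becomes S.
      compose-S : ∀ m j → coeff ((φ ⟨ S ⟩) m) j ≈ Σ (forests m) (λ F → kernel-h f κ (firstLabel F) j * treeCoeff F)
      compose-S m j = begin
        coeff ((φ ⟨ S ⟩) m) j                                ≈⟨ trans (coeffs-compose S m j) (composition-Σ (coeffs S) m m j) ⟩
        Σ (upTo (suc m)) (λ k → φ k * (coeffs S B^ k) m j)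
          ≈⟨ Σ-cong (upTo (suc m)) (λ {k} _ → *-congˡ (at (power-cong-≤ m k (λ i _ → PA.at coeffs-S i) m ℕₚ.≤-refl) j)) ⟩
        Σ (upTo (suc m)) (λ k → φ k * (ev G B^ k) m j)       ≈⟨ composition-Σ (ev G) m m j ⟨
        composition (ev G) m m j                             ≈⟨ at (expansion m) j ⟨
        ev H (suc m) j                                       ≈⟨ ev-series (kernel-h f κ) m j ⟩
        Σ (forests m) (λ F → kernel-h f κ (firstLabel F) j * treeCoeff F) ∎

      F∂-kernel-h : ∀ F N → firstLabel F ≤ N → ∀ j →
                    F∂ f κ N f (kernel-h f κ (firstLabel F)) j ≈ multiplicity κ (suc j) · kernel-l f κ (firstLabel F) (suc j)
      F∂-kernel-h F N t≤N j = go (firstLabel F) (positive F) t≤N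
        where
        positive : ∀ F → 0 < firstLabel F
        positive leaf         = s≤s z≤n
        positive (fork _ _ _) = s≤s z≤n
        go : ∀ t → 0 < t → t ≤ N → F∂ f κ N f (kernel-h f κ t) j ≈ multiplicity κ (suc j) · kernel-l f κ t (suc j)
        go (suc s) _ t≤N with ℕₚ.m≤n⇒∃[o]m+o≡n t≤N
        ... | M , ≡.refl = trans (F∂-stable f κ (suc s) M f (λ n → monomial-beyond f s (scalar f κ s) n) j) (sym (F∂-kernel f κ s j))

      -- By `compose-S`, φ(S) is a combination of the polynomials `kernel-h`. The cocycle is linear
      -- and sends these to `kernel-l`, which gives S back.
      S-solves : Solves L φ S
      S-solves = S-0 , λ where
          zero    → S-0
          (suc m) → recursion m
        where
        recursion : ∀ m → S (suc m) ≈ₚ L ((φ ⟨ S ⟩) m)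
        recursion m zero = begin
          coeff (S (suc m)) 0                    ≈⟨ S-suc m 0 ⟩
          Σ (forests m) (λ F → kernel-l f κ (firstLabel F) 0 * treeCoeff F)
            ≈⟨ Σ-0 (forests m) (λ {F} _ → trans (*-congʳ (kernel-l-y⁰ f κ (firstLabel F))) (zeroˡ _)) ⟩
          0#                                     ≈⟨ coeff-cocycle-0 f κ ((φ ⟨ S ⟩) m) ⟨
          coeff (L ((φ ⟨ S ⟩) m)) 0 ∎
        recursion m (suc j) = multiplicity-cancel κ j (begin
          μ · coeff (S (suc m)) (suc j)
            ≈⟨ ×-congʳ μ (S-suc m (suc j)) ⟩
          μ · Σ (forests m) (λ F → kernel-l f κ (firstLabel F) (suc j) * treeCoeff F)
            ≈⟨ ·-Σ (forests m) ⟩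
          Σ (forests m) (λ F → (μ · kernel-l f κ (firstLabel F) (suc j)) * treeCoeff F)
            ≈⟨ Σ-cong (forests m) (λ {F} F∈ → *-congʳ (F∂-kernel-h F N (label≤ F∈) j)) ⟨
          Σ (forests m) (λ F → F∂ f κ N f (kernel-h f κ (firstLabel F)) j * treeCoeff F)
            ≈⟨ F∂-Σ f κ N f (forests m) (λ F → kernel-h f κ (firstLabel F)) treeCoeff j ⟨
          F∂ f κ N f (λ i → Σ (forests m) (λ F → kernel-h f κ (firstLabel F) i * treeCoeff F)) j
            ≈⟨ F∂-cong f κ N f (mk≋ (compose-S m)) j ⟨
          F∂ f κ N f (coeff p) j
            ≈⟨ coeff-applySeries f κ p (suc m) j ⟨
          coeff (applySeries f (derivative f κ) p) j
            ≈⟨ coeff-cocycle-suc f κ p j ⟨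
          μ · coeff (L p) (suc j) ∎)
          where
          p = (φ ⟨ S ⟩) m
          -- Large enough for p and for every label t₁ ≤ m + 1, so that one truncation of F serves
          -- all summands.
          N = length p ℕ.+ suc m
          μ = multiplicity κ (suc j)
          label≤ : ∀ {F} → F ∈ forests m → firstLabel F ≤ N
          label≤ {F} F∈ = ℕₚ.≤-trans (subst (λ k → firstLabel F ≤ suc k) (forests-size m F∈) (firstLabel-≤ F)) (ℕₚ.m≤n+m (suc m) (length p))
          ·-Σ : ∀ xs {h : Forest → Carrier} {k : Forest → Carrier} → μ · Σ xs (λ F → h F * k F) ≈ Σ xs (λ F → (μ · h F) * k F)
          ·-Σ []       = ×-0 R μ
          ·-Σ (x ∷ xs) = trans (×-distrib-+ _ _ μ) (+-cong (sym (×-assoc-* μ _ _)) (·-Σ xs))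
            where open import Algebra.Properties.CommutativeMonoid.Mult +-commutativeMonoid using (×-distrib-+)

      S-unique : UniqueSolution L φ S
      S-unique = S-solves , λ H → solutions-agree S H S-solves

  represented-free : ∀ {m F C} → Represents m F C → does (topCycleFree? C) ≡ isFree F
  represented-free {m} {F} (represents {b} {X} n s) = go (isFree F) ≡.refl
    where
    inc = tailPoints-increasing m
    C = (1 , b) ∷ X
    go : ∀ b → isFree F ≡ b → does (topCycleFree? C) ≡ b
    go true  eq = dec-true (topCycleFree? C) (uncovered⇒topCycleFree (tree-uncovered n inc eq))
    go false eq = dec-false (topCycleFree? C) (covered⇒¬topCycleFree s (tree-distinct n inc s) (tree-proper n inc s)
                                              (tree-covered n inc eq))

  allowed : Kind → Diagram → Bool
  allowed binomial _ = true
  allowed divided  C = does (topCycleFree? C)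

  represented-admissible : ∀ κ {m F C} → Represents m F C → allowed κ C ≡ admissible κ F
  represented-admissible binomial rep = ≡.refl
  represented-admissible divided  rep = represented-free rep

  represented-firstLabel : ∀ {m F C} → Represents m F C → t₁ C ≡ firstLabel F
  represented-firstLabel {m} {F} (represents n s) =
    ≡.trans (cong (fromMaybe 0 ∘ head) (terminalLabels≡ n (tailPoints-increasing m) s)) (t₁≡firstLabel F)

  ∸-+ : ∀ {a b c d} → b ≤ a → d ≤ c → (a ℕ.+ c) ∸ (b ℕ.+ d) ≡ (a ∸ b) ℕ.+ (c ∸ d)
  ∸-+ {a} {b} {c} {d} b≤a d≤c = ≡.trans (≡.sym (ℕₚ.∸-+-assoc (a ℕ.+ c) b d))
    (≡.trans (cong (_∸ d) (ℕₚ.+-∸-comm c b≤a)) (ℕₚ.+-∸-assoc (a ∸ b) d≤c))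

  -- Weights of diagrams and weights of their trees.

  module DiagramExpansion {c ℓ₁ ℓ₂ : Level} (K : HeytingField c ℓ₁ ℓ₂) (char0 : CharacteristicZero K)
                          (κ : Kind) (φ f : ℕ → HeytingField.Carrier K) where

    open PolynomialCoefficients K char0
    open CommutativeRing R
    open ChordExpansion K char0
    open ListSums R
    open ListSumProperties R
    open ExpansionEquation R κ φ f using (A; Z; coefficients; shifted; shifted-0)
    open TreeWeights A Z coefficients
    open TreeExpansion K char0 κ φ f
    open import Algebra.Properties.Semiring.Exp semiring using (_^_; ^-homo-*)
    open import Algebra.Properties.CommutativeSemigroup *-commutativeSemigroup using (interchange; x∙yz≈y∙xz)
    open SetoidReasoning setoid

    product-++ : ∀ xs ys → product (xs ++ ys) ≈ product xs * product ys
    product-++ []       ys = sym (*-identityˡ _)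
    product-++ (x ∷ xs) ys = trans (*-congˡ (product-++ xs ys)) (sym (*-assoc _ _ _))

    product-↭ : ∀ {xs ys} → xs ↭ ys → product xs ≈ product ys
    product-↭ Perm.refl         = refl
    product-↭ (Perm.prep x p)   = *-congˡ (product-↭ p)
    product-↭ (Perm.swap x y p) = trans (x∙yz≈y∙xz _ _ _) (*-congˡ (*-congˡ (product-↭ p)))
    product-↭ (Perm.trans p q)  = trans (product-↭ p) (product-↭ q)

    weight-at-0 : ∀ σ → weight σ 0 ≈ product (map φ (map proj₁ σ))
    weight-at-0 []      = refl
    weight-at-0 (s ∷ σ) = *-cong (go κ s) (weight-at-0 σ)
      where
      constant : ∀ κ a → constantTerm R κ a 0 ≡ a 0
      constant binomial a = ≡.refl
      constant divided  a = ≡.refl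
      go : ∀ κ s → factorOf κ s 0 ≈ φ (proj₁ s)
      go binomial (v , _)     = shifted-0 v
      go divided  (v , true)  = shifted-0 v
      go divided  (v , false) = trans (reflexive (constant κ (shifted κ v))) (shifted-0 v)

    -- f₀ to the number of nonterminal chords, times f over the differences ts.

    labelWeight : ℕ → ℕ → List ℕ → Carrier
    labelWeight n k ts = f 0 ^ (n ∸ k) * product (map f ts)

    labelWeight-++ : ∀ {m n j k} ss ts → j ≤ m → k ≤ n →
                     labelWeight (m ℕ.+ n) (j ℕ.+ k) (ss ++ ts) ≈ labelWeight m j ss * labelWeight n k ts
    labelWeight-++ {m} {n} {j} {k} ss ts j≤m k≤n = begin
      f 0 ^ (m ℕ.+ n ∸ (j ℕ.+ k)) * product (map f (ss ++ ts))
        ≈⟨ *-cong (trans (reflexive (cong (f 0 ^_) (∸-+ j≤m k≤n))) (^-homo-* (f 0) (m ∸ j) (n ∸ k)))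
                  (trans (reflexive (cong product (map-++ f ss ts))) (product-++ (map f ss) (map f ts))) ⟩
      (f 0 ^ (m ∸ j) * f 0 ^ (n ∸ k)) * (product (map f ss) * product (map f ts))
        ≈⟨ interchange _ _ _ _ ⟩
      labelWeight m j ss * labelWeight n k ts ∎

    -- `gapsFrom 0` begins with t₁ itself, which does not enter f_C.
    differences : Forest → List ℕ
    differences F = drop 1 (gapsFrom 0 (terminals F))

    gapsFrom-terminals : ∀ F → gapsFrom 0 (terminals F) ≡ firstLabel F ∷ differences F
    gapsFrom-terminals F with terminals F | terminals-head F
    ... | _ | ts , ≡.refl = ≡.refl

    gapsFrom-fork : ∀ F₁ g F₂ → gapsFrom 0 (terminalsᶠ (fork F₁ g F₂)) ≡
                    (firstLabel F₁ ∷ differences F₁) ++ gapsFrom 0 (terminalsᶠ F₂)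
    gapsFrom-fork F₁ g F₂ = ≡.trans (gapsFrom-++ 0 (terminals F₁) _) (cong₂ _++_ (gapsFrom-terminals F₁)
      (≡.trans (cong (λ p → gapsFrom p (map (suc (size F₁) ℕ.+_) (terminalsᶠ F₂))) (≡.trans (last-terminals F₁ 0) (≡.sym (ℕₚ.+-identityʳ _))))
               (gapsFrom-shift (suc (size F₁)) 0 (terminalsᶠ F₂))))

    length-terminalsᶠ-fork : ∀ F₁ g F₂ → length (terminalsᶠ (fork F₁ g F₂)) ≡ length (terminals F₁) ℕ.+ length (terminalsᶠ F₂)
    length-terminalsᶠ-fork F₁ g F₂ = ≡.trans (length-++ (terminals F₁)) (cong (length (terminals F₁) ℕ.+_) (length-map _ (terminalsᶠ F₂)))

    -- Over the components, the number of nonterminal chords adds up and the lists of differences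
    -- are concatenated. The root adds one nonterminal chord, and t₁ of D¹ drops out.
    treeLabelWeight   : ∀ F → labelWeight (suc (size F)) (length (terminals F)) (differences F) ≈ treeFactor F 0
    forestLabelWeight : ∀ F → labelWeight (size F) (length (terminalsᶠ F)) (gapsFrom 0 (terminalsᶠ F)) ≈ forestFactor F 0
    treeLabelWeight leaf = *-identityˡ 1#
    treeLabelWeight F@(fork F₁ g F₂) = begin
      f 0 ^ (suc (size F) ∸ length (terminals F)) * product (map f (differences F))
        ≡⟨ cong₂ (λ k ts → f 0 ^ k * product (map f ts)) exponent differences-fork ⟩
      (f 0 * f 0 ^ (size F ∸ length (terminalsᶠ F))) * product (map f (differences F₁ ++ gapsFrom 0 (terminalsᶠ F₂)))
        ≈⟨ *-assoc _ _ _ ⟩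
      f 0 * labelWeight (size F) (length (terminalsᶠ F)) (differences F₁ ++ gapsFrom 0 (terminalsᶠ F₂))
        ≡⟨ cong (λ k → f 0 * labelWeight (size F) k (differences F₁ ++ gapsFrom 0 (terminalsᶠ F₂))) (length-terminalsᶠ-fork F₁ g F₂) ⟩
      f 0 * labelWeight (size F) (length (terminals F₁) ℕ.+ length (terminalsᶠ F₂)) (differences F₁ ++ gapsFrom 0 (terminalsᶠ F₂))
        ≈⟨ *-congˡ (labelWeight-++ (differences F₁) _ (length-terminals F₁) (length-terminalsᶠ F₂)) ⟩
      f 0 * (labelWeight (suc (size F₁)) (length (terminals F₁)) (differences F₁)
             * labelWeight (size F₂) (length (terminalsᶠ F₂)) (gapsFrom 0 (terminalsᶠ F₂)))
        ≈⟨ *-congˡ (*-cong (treeLabelWeight F₁) (forestLabelWeight F₂)) ⟩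
      treeFactor F 0 ∎
      where
      exponent : suc (size F) ∸ length (terminals F) ≡ suc (size F ∸ length (terminalsᶠ F))
      exponent = ≡.trans (cong (suc (size F) ∸_) (length-map suc (terminalsᶠ F))) (ℕₚ.+-∸-assoc 1 (length-terminalsᶠ F))
      differences-fork : differences F ≡ differences F₁ ++ gapsFrom 0 (terminalsᶠ F₂)
      differences-fork = ≡.trans (shifted-differences (terminalsᶠ F)) (cong (drop 1) (gapsFrom-fork F₁ g F₂))
        where
        shifted-differences : ∀ ts → drop 1 (gapsFrom 0 (map suc ts)) ≡ drop 1 (gapsFrom 0 ts)
        shifted-differences []       = ≡.refl
        shifted-differences (t ∷ ts) = gapsFrom-shift 1 t ts
    forestLabelWeight leaf = *-identityˡ 1#
    forestLabelWeight F@(fork F₁ g F₂) = begin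
      labelWeight (size F) (length (terminalsᶠ F)) (gapsFrom 0 (terminalsᶠ F))
        ≡⟨ cong₂ (labelWeight (size F)) (length-terminalsᶠ-fork F₁ g F₂) (gapsFrom-fork F₁ g F₂) ⟩
      labelWeight (size F) (length (terminals F₁) ℕ.+ length (terminalsᶠ F₂)) ((firstLabel F₁ ∷ differences F₁) ++ gapsFrom 0 (terminalsᶠ F₂))
        ≈⟨ labelWeight-++ (firstLabel F₁ ∷ differences F₁) _ (length-terminals F₁) (length-terminalsᶠ F₂) ⟩
      labelWeight (suc (size F₁)) (length (terminals F₁)) (firstLabel F₁ ∷ differences F₁)
        * labelWeight (size F₂) (length (terminalsᶠ F₂)) (gapsFrom 0 (terminalsᶠ F₂))
        ≈⟨ *-cong (trans (x∙yz≈y∙xz _ _ _) (*-congˡ (treeLabelWeight F₁))) (forestLabelWeight F₂) ⟩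
      (f (firstLabel F₁) * treeFactor F₁ 0) * forestFactor F₂ 0
        ≈⟨ *-assoc _ _ _ ⟩
      forestFactor F 0 ∎

    f-weight≈ : ∀ {m F C} → Represents m F C → f-weight f C ≈ treeFactor F 0
    f-weight≈ {m} {F} (represents n s) = begin
      _ ≡⟨ cong₂ (λ k ts → f 0 ^ (suc k ∸ length ts) * product (map f (zipWith _∸_ (drop 1 ts) ts)))
             (nest-length n) (terminalLabels≡ n (tailPoints-increasing m) s) ⟩
      labelWeight (suc (size F)) (length (terminals F)) (zipWith _∸_ (drop 1 (terminals F)) (terminals F))
        ≡⟨ cong (labelWeight (suc (size F)) (length (terminals F))) zipped ⟩
      labelWeight (suc (size F)) (length (terminals F)) (differences F)
        ≈⟨ treeLabelWeight F ⟩
      treeFactor F 0 ∎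
      where
      zipped : zipWith _∸_ (drop 1 (terminals F)) (terminals F) ≡ differences F
      zipped with terminals F | terminals-head F
      ... | _ | ts , ≡.refl = zipWith-∸ _ ts

    φ-weight≈ : ∀ {m F C} → F ∈ forests m → Represents m F C → φ-weight φ C ≈ weight (states F) 0
    φ-weight≈ {m} {F} F∈ (represents {b} {X} n s) = begin
      product (map (λ d → φ (valency C d)) C)
        ≈⟨ product-↭ (↭ₚ.map⁺ (λ d → φ (valency C d)) (↭-sym (postorder-root-↭ n))) ⟩
      product (map (λ d → φ (valency C d)) ds)
        ≡⟨ cong product (map-∘ ds) ⟩
      product (map φ (map (valency C) ds))
        ≡⟨ cong (product ∘ map φ) (valency-states n (tailPoints-increasing m) s (forests-valid m F∈)) ⟩
      product (map φ (map proj₁ (states F)))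
        ≈⟨ weight-at-0 (states F) ⟨
      weight (states F) 0 ∎
      where
      C : Diagram
      C = (1 , b) ∷ X
      ds : List Chord
      ds = postorder n ++ (1 , b) ∷ []

    kernel-at-firstLabel : ∀ {m F C} → Represents m F C → ∀ j →
      kernel-l f κ (firstLabel F) j ≡ scalar f κ (t₁ C ∸ 1) * coeff (L (y^ (t₁ C ∸ 1))) j
    kernel-at-firstLabel {F = F} rep j = ≡.trans (go F) (cong (λ t → scalar f κ (t ∸ 1) * coeff (L (y^ (t ∸ 1))) j) (≡.sym (represented-firstLabel rep)))
      where
      go : ∀ F → kernel-l f κ (firstLabel F) j ≡ scalar f κ (firstLabel F ∸ 1) * coeff (L (y^ (firstLabel F ∸ 1))) j
      go leaf         = ≡.refl
      go (fork _ _ _) = ≡.refl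

    contribution : Diagram → ℕ → Carrier
    contribution C j = (f-weight f C * φ-weight φ C) * (scalar f κ (t₁ C ∸ 1) * coeff (L (y^ (t₁ C ∸ 1))) j)

    contributions : ∀ m j → Σ (connectedDiagrams (suc m)) (λ C → guardBy (allowed κ C) (contribution C j)) ≈
                    Σ (forests m) (λ F → kernel-l f κ (firstLabel F) j * treeCoeff F)
    contributions m j = Σ-bijection (λ C F → Represents m F C) (represents-injective m) (represents-functional m)
      (Uniqueₚ.filter⁺ connected? (chordDiagrams-unique (suc m))) (forestsUpTo-unique m m)
      (represents-forest m) (represents-diagram m) (λ C∈ rep → each C∈ rep)
      where
      guard-at-0 : ∀ b F → guard b (CommutativeRing._*_ A (treeFactor F) (weight (states F))) 0 ≈
                   guardBy b (treeFactor F 0 * weight (states F) 0)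
      guard-at-0 true  F = refl
      guard-at-0 false F = refl
      guardBy-* : ∀ b {x y z} → x ≈ z → guardBy b (x * y) ≈ y * guardBy b z
      guardBy-* true  eq = trans (*-congʳ eq) (*-comm _ _)
      guardBy-* false eq = sym (zeroʳ _)
      each : ∀ {C F} → C ∈ connectedDiagrams (suc m) → Represents m F C →
             guardBy (allowed κ C) (contribution C j) ≈ kernel-l f κ (firstLabel F) j * treeCoeff F
      each {C} {F} C∈ rep = begin
        guardBy (allowed κ C) (contribution C j)
          ≡⟨ cong₂ (λ b x → guardBy b ((f-weight f C * φ-weight φ C) * x)) (represented-admissible κ rep) (≡.sym (kernel-at-firstLabel rep j)) ⟩
        guardBy (admissible κ F) ((f-weight f C * φ-weight φ C) * kernel-l f κ (firstLabel F) j)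
          ≈⟨ guardBy-* (admissible κ F) (*-cong (f-weight≈ rep) (φ-weight≈ F∈ rep)) ⟩
        kernel-l f κ (firstLabel F) j * guardBy (admissible κ F) (treeFactor F 0 * weight (states F) 0)
          ≈⟨ *-congˡ (guard-at-0 (admissible κ F) F) ⟨
        kernel-l f κ (firstLabel F) j * treeCoeff F ∎
        where
        F∈ : F ∈ forests m
        F∈ with represents-forest m C∈
        ... | F′ , F′∈ , rep′ = subst (_∈ forests m) (represents-injective m rep′ rep) F′∈

-- Both expansions as instances of the tree expansion.

open import Defs
open import Algebra.Apartness.Bundles using (HeytingField)
open import Algebra.Bundles using (CommutativeRing)
open import Data.List.Base using (filter)
open import Data.Nat.Base as ℕ using (ℕ; suc; _∸_)
open import Data.Product.Base using (_×_; _,_)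
open Series
open Forests
open TreeSeries
open Diagrams
open Expansions

theorem5p1 : ∀ {c ℓ₁ ℓ₂} (K : HeytingField c ℓ₁ ℓ₂) (char0 : CharacteristicZero K) →
  let open HeytingField K
      open ChordExpansion K char0
  in (φ f : ℕ → Carrier) → φ 0 ≈ 1# →
     UniqueSolution (Lbin f) φ (Gbin f φ) × UniqueSolution (Ldiv f) φ (Gdiv f φ)
theorem5p1 K char0 φ f _ =
  TreeExpansion.S-unique K char0 binomial φ f (Gbin f φ) bin-0 bin-suc ,
  TreeExpansion.S-unique K char0 divided φ f (Gdiv f φ) div-0 div-suc
  where
  open PolynomialCoefficients K char0
  open CommutativeRing R
  open ChordExpansion K char0
  open ListSums R
  open ListSumProperties R
  module Bin = DiagramExpansion K char0 binomial φ f
  module Div = DiagramExpansion K char0 divided φ f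

  bin-0 : ∀ j → coeff (Gbin f φ 0) j ≈ 0#
  -- The only diagram of size 0 is empty and hence not connected, so the sum reduces to the empty
  -- one.
  bin-0 j = refl

  bin-suc : ∀ m j → coeff (Gbin f φ (suc m)) j ≈
            Σ (forests m) (λ F → kernel-l f binomial (firstLabel F) j * TreeExpansion.treeCoeff K char0 binomial φ f F)
  bin-suc m j = trans (coeff-sum _ (connectedDiagrams (suc m)) j)
    (trans (Σ-cong (connectedDiagrams (suc m)) (λ {C} _ →
              trans (coeff-• (f-weight f C * φ-weight φ C) (recipFactorial f (t₁ C ∸ 1) • Lbin f (y^ (t₁ C ∸ 1))) j)
                    (*-congˡ (coeff-• (recipFactorial f (t₁ C ∸ 1)) (Lbin f (y^ (t₁ C ∸ 1))) j))))
           (Bin.contributions m j))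

  div-0 : ∀ j → coeff (Gdiv f φ 0) j ≈ 0#
  div-0 j = refl

  div-suc : ∀ m j → coeff (Gdiv f φ (suc m)) j ≈
            Σ (forests m) (λ F → kernel-l f divided (firstLabel F) j * TreeExpansion.treeCoeff K char0 divided φ f F)
  div-suc m j = trans (coeff-sum _ (filter topCycleFree? (connectedDiagrams (suc m))) j)
    (trans (Σ-cong (filter topCycleFree? (connectedDiagrams (suc m))) (λ {C} _ →
              trans (coeff-• (f-weight f C * φ-weight φ C) (Ldiv f (y^ (t₁ C ∸ 1))) j)
                    -- The factor inserted is `scalar`, which is 1 in the divided power case.
                    (*-congˡ (sym (*-identityˡ _)))))
    (trans (Σ-filter topCycleFree? (connectedDiagrams (suc m)) (λ C → Div.contribution C j))
           (Div.contributions m j)))
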